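{- Assume that the following conjecture (the WHLE Conjecture) is true: there are constants $\delta>0$ and $x_0$ such that for every real $x\ge x_0$ and every positive integer $q\le x/4$, the inequality $g(n)\ge \delta\,\frac{n}{\log^2 n}$ holds for all even multiples $n$ of $q$ with $x/2<n\le x$, with at most $\frac{x}{8q}$ exceptions. Then there exist an effective constant $c>0$ and a threshold $q_0$ such that the following holds. Let $q\ge q_0$ be an integer such that exactly one positive divisor $t$ of $q$ belongs to the set $\{4\}\cup\{p : p \text{ prime},\ p\equiv 3 \pmod 4\}$. If there is an exceptional zero $\beta$ for a character mod $q$, then $$1-\beta\ \ge\ \frac{c\,\varphi(q)}{q\log^2 q}.$$
   Context: $g(n)=\sum_{n=p_1+p_2}1$ is the number of representations of $n$ as an ordered sum of two primes $p_1,p_2$. $\varphi$ is Euler's totient function and $L(s,\chi)$ is the Dirichlet $L$-function of $\chi$. Exceptional zeros: by the Landau--Page theorem there is an absolute constant $c_0>0$ such that for any $Q,T\ge 2$ the product $\prod_{q\le Q}\prod^{\star}_{\chi \bmod q}L(s,\chi)$, where $^\star$ means that $\chi$ runs over the primitive real characters mod $q$, has at most one zero $s=\sigma+it$ in the region $|t|\le T$, $1-\sigma\le \frac{c_0}{\log(QT)}$; if such a zero exists, it is real and belongs to a unique quadratic character. Fix such a $c_0$. An exceptional zero for a character $\chi$ mod $q$ is such a zero of $L(s,\chi)$, with $\chi$ real (quadratic) and primitive mod $q$, with respect to this region with $Q=T=q$; that is, a real $\beta<1$ with $L(\beta,\chi)=0$ and $1-\beta\le \frac{c_0}{\log(q^2)}$.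 The constants $c$ and $q_0$ do not depend on $q$, the character or $\beta$ (they may depend on the constants in the WHLE Conjecture); "effective" means effectively computable. -}

module Defs where

open import Data.Integer as ℤ using (ℤ; +_; +[1+_]; -[1+_]; 0ℤ; -1ℤ)
open import Data.List using (List; length; filter; upTo; applyUpTo)
open import Data.List.Relation.Unary.All using (All)
open import Data.List.Relation.Unary.Unique.Propositional using (Unique)
open import Data.Nat as ℕ using (ℕ; zero; suc; _∸_)
open import Data.Nat.Base using (_!)
open import Data.Nat.Coprimality using (Coprime; coprime?)
open import Data.Nat.Divisibility using (_∣_)
open import Data.Nat.DivMod using (_%_)
open import Data.Nat.Primality using (Prime; prime?)
open import Data.Product using (∃; _×_)
open import Data.Rational as ℚ using (ℚ; mkℚ; 0ℚ; 1ℚ; 1/_)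
open import Data.Sum using (_⊎_)
open import Function using (_∘_)
open import Function.Bundles using (_⇔_)
open import Relation.Binary.PropositionalEquality using (_≡_; _≢_)
open import Relation.Nullary using (¬_)
open import Relation.Nullary.Decidable using (_×-dec_)

infix  4 _≤ᴿ_ _<ᴿ_ _≈ᴿ_ _⟶_
infixl 6 _+ᴿ_ _-ᴿ_ _+ᶜ_ _-ᶜ_
infixl 7 _*ᴿ_ _/ᴿ_ _*ᶜ_
infixr 8 _^ᴿ_ _^ᶜ_
infix  5 _+i_

-- Real numbers are Cauchy sequences of rationals.  The operations below act
-- on arbitrary rational sequences and are total; on Cauchy sequences within
-- the usual domain (nonzero divisor, positive argument of log) they are the
-- usual operations on the limits.  Equality is _≈ᴿ_, never _≡_.

Seq : Set
Seq = ℕ → ℚ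

Cauchy : Seq → Set
Cauchy x = ∀ ε → 0ℚ ℚ.< ε → ∃ λ N → ∀ i j → N ℕ.≤ i → N ℕ.≤ j →
           ℚ.∣ x i ℚ.- x j ∣ ℚ.≤ ε

record ℝ : Set where
  field
    seq    : Seq
    cauchy : Cauchy seq

open ℝ public

_≤ᴿ_ : Seq → Seq → Set
x ≤ᴿ y = ∀ ε → 0ℚ ℚ.< ε → ∃ λ N → ∀ i → N ℕ.≤ i → x i ℚ.≤ y i ℚ.+ ε

_<ᴿ_ : Seq → Seq → Set
x <ᴿ y = ∃ λ ε → 0ℚ ℚ.< ε × ∃ λ N → ∀ i → N ℕ.≤ i → x i ℚ.+ ε ℚ.≤ y i

_≈ᴿ_ : Seq → Seq → Set
x ≈ᴿ y = x ≤ᴿ y × y ≤ᴿ x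

constᴿ : ℚ → Seq
constᴿ p _ = p

fromℤ : ℤ → Seq
fromℤ a = constᴿ (a ℚ./ 1)

fromℕ : ℕ → Seq
fromℕ n = fromℤ (+ n)

_+ᴿ_ _-ᴿ_ _*ᴿ_ _/ᴿ_ : Seq → Seq → Seq
(x +ᴿ y) i = x i ℚ.+ y i
(x -ᴿ y) i = x i ℚ.- y i
(x *ᴿ y) i = x i ℚ.* y i
(x /ᴿ y) i = x i ℚ.* inv (y i)
  where
  inv : ℚ → ℚ
  inv (mkℚ (+ 0) _ _)      = 0ℚ
  inv p@(mkℚ +[1+ _ ] _ _) = 1/ p
  inv p@(mkℚ -[1+ _ ] _ _) = 1/ p

∣_∣ᴿ : Seq → Seq
∣ x ∣ᴿ i = ℚ.∣ x i ∣

_^ᴿ_ : Seq → ℕ → Seq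
x ^ᴿ zero  = fromℕ 1
x ^ᴿ suc k = x *ᴿ x ^ᴿ k

-- ∑< N f = f 0 + ⋯ + f (N - 1)
∑< : ℕ → (ℕ → Seq) → Seq
∑< zero    f = fromℕ 0
∑< (suc N) f = ∑< N f +ᴿ f N

-- The limit of u N as N → ∞, provided that the convergence is locally
-- uniform in the rational arguments from which the u N are computed.
diagonal : (ℕ → Seq) → Seq
diagonal u i = u i i

-- log x = 2 artanh y = 2 ∑ y^(2k+1)/(2k+1), with y = (x - 1)/(x + 1);
-- this converges locally uniformly on x > 0.
log : Seq → Seq
log x = diagonal λ N → fromℕ 2 *ᴿ ∑< N λ k → y ^ᴿ suc (2 ℕ.* k) /ᴿ fromℕ (suc (2 ℕ.* k))
  where
  y : Seq
  y = (x -ᴿ fromℕ 1) /ᴿ (x +ᴿ fromℕ 1)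

_⟶_ : (ℕ → Seq) → Seq → Set
u ⟶ ℓ = ∀ ε → 0ℚ ℚ.< ε → ∃ λ N₀ → ∀ N → N₀ ℕ.≤ N → ∣ u N -ᴿ ℓ ∣ᴿ ≤ᴿ constᴿ ε

record ℂ : Set where
  constructor _+i_
  field
    re im : Seq

open ℂ public

fromᴿ : Seq → ℂ
fromᴿ x = x +i fromℕ 0

0ᶜ 1ᶜ : ℂ
0ᶜ = fromᴿ (fromℕ 0)
1ᶜ = fromᴿ (fromℕ 1)

_≈ᶜ_ : ℂ → ℂ → Set
z ≈ᶜ w = re z ≈ᴿ re w × im z ≈ᴿ im w

_+ᶜ_ _-ᶜ_ _*ᶜ_ _/ᶜ_ : ℂ → ℂ → ℂ
z +ᶜ w = (re z +ᴿ re w) +i (im z +ᴿ im w)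
z -ᶜ w = (re z -ᴿ re w) +i (im z -ᴿ im w)
z *ᶜ w = (re z *ᴿ re w -ᴿ im z *ᴿ im w) +i (re z *ᴿ im w +ᴿ im z *ᴿ re w)
z /ᶜ w = z *ᶜ ((re w /ᴿ ∣w∣²) +i ((fromℕ 0 -ᴿ im w) /ᴿ ∣w∣²))
  where
  ∣w∣² : Seq
  ∣w∣² = re w ^ᴿ 2 +ᴿ im w ^ᴿ 2

_^ᶜ_ : ℂ → ℕ → ℂ
z ^ᶜ zero  = 1ᶜ
z ^ᶜ suc k = z *ᶜ z ^ᶜ k

∑<ᶜ : ℕ → (ℕ → ℂ) → ℂ
∑<ᶜ N f = ∑< N (re ∘ f) +i ∑< N (im ∘ f)

exp : ℂ → ℂ
exp z = diagonal (re ∘ partial) +i diagonal (im ∘ partial)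
  where
  partial : ℕ → ℂ
  partial N = ∑<ᶜ N λ k → z ^ᶜ k *ᶜ fromᴿ (fromℕ 1 /ᴿ fromℕ (k !))

-- n to the power s, for n ≥ 1
power : ℕ → ℂ → ℂ
power n s = exp (s *ᶜ fromᴿ (log (fromℕ n)))

-- A real Dirichlet character mod q, restricted to ℕ.  Its values lie in
-- {-1, 0, 1}: the value at a unit is an integer and a root of unity.
record RealCharacter (q : ℕ) : Set where
  field
    χ              : ℕ → ℤ
    periodic       : ∀ n → χ (n ℕ.+ q) ≡ χ n
    multiplicative : ∀ m n → χ (m ℕ.* n) ≡ χ m ℤ.* χ n
    nonzero        : ∀ n → χ n ≢ 0ℤ ⇔ Coprime n q

open RealCharacter public

InducedBy : ∀ {q d} → RealCharacter q → RealCharacter d → Set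
InducedBy {q} X Y = ∀ n → Coprime n q → χ X n ≡ χ Y n

Primitive : ∀ {q} → RealCharacter q → Set
Primitive {q} X = ∀ d → d ∣ q → d ℕ.< q → (Y : RealCharacter d) → ¬ InducedBy X Y

Quadratic : ∀ {q} → RealCharacter q → Set
Quadratic X = ∃ λ n → χ X n ≡ -1ℤ

mean : ∀ {q} → RealCharacter q → Seq
mean {q} X = ∑< q (λ a → fromℤ (χ X (suc a))) /ᴿ fromℕ q

-- L(s, χ) = ℓ, for Re s > 0 and s ≠ 1.  With M the mean value of χ over a
-- period, summation by parts shows that the analytic continuation of L(s, χ)
-- to this region is the limit of ∑_{n ≤ N} χ(n) n⁻ˢ - M N¹⁻ˢ / (1 - s).
-- Here M = 0 unless χ is principal, so that s = 1 is then no exception and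
-- L(s, χ) is simply the sum of its Dirichlet series.
LPartial : ∀ {q} → RealCharacter q → ℂ → ℕ → ℂ
LPartial X s N =
  ∑<ᶜ N (λ k → fromᴿ (fromℤ (χ X (suc k))) *ᶜ power (suc k) (0ᶜ -ᶜ s))
  -ᶜ fromᴿ (mean X) *ᶜ (power N (1ᶜ -ᶜ s) /ᶜ (1ᶜ -ᶜ s))

record LValue {q : ℕ} (X : RealCharacter q) (s ℓ : ℂ) : Set where
  field
    domain : fromℕ 0 <ᴿ re s
    finite : mean X ≈ᴿ fromℕ 0 ⊎ ¬ (s ≈ᶜ 1ᶜ)
    real   : (re ∘ LPartial X s) ⟶ re ℓ
    imag   : (im ∘ LPartial X s) ⟶ im ℓ

LZero : ∀ {q} → RealCharacter q → ℂ → Set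
LZero X s = LValue X s 0ᶜ

-- A zero σ + it in the region |t| ≤ T, 1 - σ ≤ c₀ / log (QT) of the product of
-- the L(s, χ) over primitive real characters χ mod q with q ≤ Q.
record RegionZero (c₀ Q T : ℝ) : Set where
  field
    q           : ℕ
    q≥1         : 1 ℕ.≤ q
    q≤Q         : fromℕ q ≤ᴿ seq Q
    character   : RealCharacter q
    isPrimitive : Primitive character
    σ t         : ℝ
    isZero      : LZero character (seq σ +i seq t)
    height      : ∣ seq t ∣ᴿ ≤ᴿ seq T
    width       : fromℕ 1 -ᴿ seq σ ≤ᴿ seq c₀ /ᴿ log (seq Q *ᴿ seq T)

record SameZero {c₀ Q T : ℝ} (z w : RegionZero c₀ Q T) : Set where
  module Z = RegionZero z
  module W = RegionZero w
  field
    modulus   : Z.q ≡ W.q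
    character : ∀ n → χ Z.character n ≡ χ W.character n
    realPart  : seq Z.σ ≈ᴿ seq W.σ
    imagPart  : seq Z.t ≈ᴿ seq W.t

-- The property of c₀ asserted by the Landau–Page theorem.
LandauPage : ℝ → Set
LandauPage c₀ = ∀ (Q T : ℝ) → fromℕ 2 ≤ᴿ seq Q → fromℕ 2 ≤ᴿ seq T →
  (∀ (z w : RegionZero c₀ Q T) → SameZero z w) ×
  (∀ (z : RegionZero c₀ Q T) → let open RegionZero z in
     seq t ≈ᴿ fromℕ 0 × Quadratic character)

record ExceptionalZero (c₀ : ℝ) {q : ℕ} (X : RealCharacter q) (β : ℝ) : Set where
  field
    isPrimitive : Primitive X
    quadratic   : Quadratic X
    β<1         : seq β <ᴿ fromℕ 1
    isZero      : LZero X (fromᴿ (seq β))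
    width       : fromℕ 1 -ᴿ seq β ≤ᴿ seq c₀ /ᴿ log (fromℕ (q ℕ.^ 2))

φ : ℕ → ℕ
φ q = length (filter (λ a → coprime? a q) (applyUpTo suc q))

g : ℕ → ℕ
g n = length (filter (λ p → prime? p ×-dec prime? (n ∸ p)) (upTo (suc n)))

record WHLEException (δ x : ℝ) (q n : ℕ) : Set where
  field
    even     : 2 ∣ n
    multiple : q ∣ n
    lower    : seq x /ᴿ fromℕ 2 <ᴿ fromℕ n
    upper    : fromℕ n ≤ᴿ seq x
    fails    : ¬ (seq δ *ᴿ (fromℕ n /ᴿ log (fromℕ n) ^ᴿ 2) ≤ᴿ fromℕ (g n))

WHLE : ℝ → ℝ → Set
WHLE δ x₀ = ∀ (x : ℝ) (q : ℕ) → seq x₀ ≤ᴿ seq x → 1 ℕ.≤ q → fromℕ q ≤ᴿ seq x /ᴿ fromℕ 4 →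
  ∀ (exceptions : List ℕ) → Unique exceptions → All (WHLEException δ x q) exceptions →
  fromℕ (length exceptions) ≤ᴿ seq x /ᴿ fromℕ (8 ℕ.* q)

4OrPrime≡3mod4 : ℕ → Set
4OrPrime≡3mod4 t = t ≡ 4 ⊎ (Prime t × t % 4 ≡ 3)

{-# OPTIONS --safe #-}

-- Let ε = 1 - β, v n = n ^ ε, w n = v n / n and r = 1 * χ ≥ 0.  Since L(β, χ) = 0, the hyperbola
-- method gives ε ∑_{n ≤ Z} r n w n ≈ v Z ∑_d χ d / d - const.  So ∑_{n ≤ Z} r n w n grows at most
-- by a factor 1 + O(ε log q) between Z = Y and Z = X, where X and Y are powers of q.  As r (p m) ≥ r m
-- for primes p > Y ≥ m with χ p = 1, the sum of 1 / p over the primes Y < p ≤ X / Y with χ p = 1 is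
-- O(ε log q) up to a power of 1 / q.
-- Conversely, for every s the conjecture provides some n ≈ 2 ^ s with g n ≫ n / log² n and n ≡ 0
-- modulo q (if χ is odd) or n ≡ q / 2 modulo q (if 4 ∣ q and χ is even).  The hypothesis on the
-- divisors of q makes p₁ + p₂ = n force χ p₁ χ p₂ = - 1, so that there are ≫ 2 ^ s / s² primes
-- p ≤ 2 ^ s with χ p = 1.  Summing over ≍ log q values of s, the sum of 1 / p is ≫ 1 / log q.
-- Hence ε ≫ 1 / log² q.
module Submission where

open import Axiom.ExcludedMiddle using (ExcludedMiddle)
open import Data.Empty using (⊥; ⊥-elim)
open import Data.Integer as ℤ using (+[1+_]; -[1+_]; ℤ)
import Data.Integer.Properties as ℤ
open import Data.List using (List; []; _∷_; applyUpTo; filter; length)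
import Data.List.Properties as List
open import Data.List.Relation.Unary.All as All using (All)
import Data.List.Relation.Unary.All.Properties as All
open import Data.List.Relation.Unary.Unique.Propositional using (Unique)
import Data.List.Relation.Unary.Unique.Propositional.Properties as Unique
open import Data.Maybe using (just; nothing)
open import Data.Nat as ℕ using (suc; s≤s; zero; z≤n; ℕ)
open import Data.Nat.Base using (_!)
open import Data.Nat.Coprimality as Coprimality using (Coprime; coprime-Bézout; coprime-divisor; coprime?; prime⇒coprime)
open import Data.Nat.DivMod as ℕ using ([m+kn]%n≡m%n; _%_; m%n<n; m<n⇒m%n≡m; m≡m%n+[m/n]*n)
open import Data.Nat.Divisibility using (*-cancelˡ-∣; *-monoʳ-∣; *-monoˡ-∣; _∣?_; _∣_; divides; m∣m*n; n∣m*n; ∣-refl; ∣-trans; ∣1⇒≡1; ∣m+n∣m⇒∣n; ∣m∣n⇒∣m+n; ∣⇒≤)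
open import Data.Nat.GCD using (module Bézout)
open import Data.Nat.Induction using (<-rec)
open import Data.Nat.Primality using (Prime; euclidsLemma; prime?; prime[2]; prime⇒irreducible; prime⇒nonTrivial; prime⇒nonZero)
open import Data.Nat.Primality.Factorisation using (PrimeFactorisation; factorise)
import Data.Nat.Properties as ℕ
open import Data.Nat.Tactic.RingSolver using () renaming (solve-∀ to solveℕ-∀)
open import Data.Product using (_,_; _×_; proj₁; proj₂; ∃; ∃!; ∃₂)
open import Data.Rational as ℚ using (*≤*; -_; 0ℚ; 1ℚ; _*_; _+_; _/_; _<_; mkℚ; ½; ℚ; ∣_∣)
import Data.Rational.Properties as ℚ
import Data.Rational.Unnormalised as ℚᵘ
import Data.Rational.Unnormalised.Properties as ℚᵘ
open import Data.Sum using ([_,_]′; _⊎_; inj₁; inj₂; map₂; reduce)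
open import Defs
open import Function.Bundles using (Equivalence; mk⇔)
open import Level using (0ℓ)
open import Relation.Binary.PropositionalEquality using (_≡_; _≢_; cong; cong₂; module ≡-Reasoning; refl; subst; subst₂; sym; trans)
open import Relation.Nullary using (Dec; no; yes; ¬_)
open import Relation.Nullary.Decidable using (_×-dec_; _⊎-dec_; ¬?)
open import Tactic.RingSolver using (solve; solve-∀)
open import Tactic.RingSolver.Core.AlmostCommutativeRing using (AlmostCommutativeRing; fromCommutativeRing)

module Rationals where

  open import Data.Rational using (_≤_)

  ring : AlmostCommutativeRing 0ℓ 0ℓ
  ring = fromCommutativeRing ℚ.+-*-commutativeRing
    λ { (mkℚ (ℤ.+ 0) 0 _) → just refl ; _ → nothing }

  open AlmostCommutativeRing ring public using () renaming (_-_ to infixl 6 _-_)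

  ≤-by : ∀ {A B a b} → A ≤ B → A + b ≡ B + a → a ≤ b
  ≤-by {A} {B} {a} {b} A≤B e = subst₂ _≤_ (lem₁ A a) (trans (cong (_+ (- A)) (sym e)) (lem₂ A b))
    (ℚ.+-monoˡ-≤ (- A) (ℚ.+-monoˡ-≤ a A≤B))
    where
    lem₁ : ∀ A a → A + a + (- A) ≡ a
    lem₁ = solve-∀ ring
    lem₂ : ∀ A b → A + b + (- A) ≡ b
    lem₂ = solve-∀ ring

  <-by : ∀ {A B a b} → A < B → A + b ≡ B + a → a < b
  <-by {A} {B} {a} {b} A<B e = subst₂ _<_ (lem₁ A a) (trans (cong (_+ (- A)) (sym e)) (lem₂ A b))
    (ℚ.+-monoˡ-< (- A) (ℚ.+-monoˡ-< a A<B))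
    where
    lem₁ : ∀ A a → A + a + (- A) ≡ a
    lem₁ = solve-∀ ring
    lem₂ : ∀ A b → A + b + (- A) ≡ b
    lem₂ = solve-∀ ring

  infixr 5 _⊕_
  _⊕_ : ∀ {a b c d} → a ≤ b → c ≤ d → a + c ≤ b + d
  _⊕_ = ℚ.+-mono-≤

  infixr 6 _⊛_
  _⊛_ : ∀ {c a b} → 0ℚ ≤ c → a ≤ b → c * a ≤ c * b
  _⊛_ {c} 0≤c = ℚ.*-monoˡ-≤-nonNeg c {{ℚ.nonNegative 0≤c}}

  *-nonNeg : ∀ {a b} → 0ℚ ≤ a → 0ℚ ≤ b → 0ℚ ≤ a * b
  *-nonNeg {a} {b} 0≤a 0≤b = subst (_≤ a * b) (ℚ.*-zeroʳ a) (0≤a ⊛ 0≤b)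

  +-nonNeg : ∀ {a b} → 0ℚ ≤ a → 0ℚ ≤ b → 0ℚ ≤ a + b
  +-nonNeg {a} {b} p q = ≤-by (p ⊕ q) (solve (a ∷ b ∷ []) ring)

  *-pos : ∀ {a b} → 0ℚ < a → 0ℚ < b → 0ℚ < a * b
  *-pos {a} {b} 0<a 0<b = subst (_< a * b) (ℚ.*-zeroʳ a) (ℚ.*-monoʳ-<-pos a {{ℚ.positive 0<a}} 0<b)

  *-mono-≤ : ∀ {a b c d} → 0ℚ ≤ a → 0ℚ ≤ c → a ≤ b → c ≤ d → a * c ≤ b * d
  *-mono-≤ {a} {b} {c} {d} 0≤a 0≤c a≤b c≤d =
    ≤-by ((0≤c ⊛ a≤b) ⊕ (ℚ.≤-trans 0≤a a≤b ⊛ c≤d)) (solve (a ∷ b ∷ c ∷ d ∷ []) ring)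

  *-cancelˡ-≤ : ∀ {c a b} → 0ℚ < c → c * a ≤ c * b → a ≤ b
  *-cancelˡ-≤ {c} 0<c = ℚ.*-cancelˡ-≤-pos c {{ℚ.positive 0<c}}

  0≤1 : 0ℚ ≤ 1ℚ
  0≤1 = *≤* (ℤ.+≤+ z≤n)

  0<1 : 0ℚ < 1ℚ
  0<1 = ℚ.positive⁻¹ 1ℚ

  ≤⇒0≤ : ∀ {a b} → a ≤ b → 0ℚ ≤ b - a
  ≤⇒0≤ {a} {b} h = ≤-by h (solve (a ∷ b ∷ []) ring)

  square-nonNeg : ∀ a → 0ℚ ≤ a * a
  square-nonNeg a with ℚ.≤-total 0ℚ a
  ... | inj₁ p = *-nonNeg p p
  ... | inj₂ p = subst (0ℚ ≤_) (lem a) (*-nonNeg q q)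
    where
    q : 0ℚ ≤ - a
    q = ≤-by p (solve (a ∷ []) ring)
    lem : ∀ a → (- a) * (- a) ≡ a * a
    lem = solve-∀ ring

  ∣∣-upper : ∀ x → x ≤ ∣ x ∣
  ∣∣-upper x with ℚ.≤-total 0ℚ x
  ... | inj₁ p = ℚ.≤-reflexive (sym (ℚ.0≤p⇒∣p∣≡p p))
  ... | inj₂ p = ℚ.≤-trans p (ℚ.0≤∣p∣ x)

  ∣∣-lower : ∀ x → - x ≤ ∣ x ∣
  ∣∣-lower x = subst (- x ≤_) (ℚ.∣-p∣≡∣p∣ x) (∣∣-upper (- x))

  ∣∣-least : ∀ {x B} → x ≤ B → - x ≤ B → ∣ x ∣ ≤ B
  ∣∣-least {x} p q with ℚ.∣p∣≡p∨∣p∣≡-p x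
  ... | inj₁ e = subst (_≤ _) (sym e) p
  ... | inj₂ e = subst (_≤ _) (sym e) q

  ∣∣≤⇒≤ : ∀ {x B} → ∣ x ∣ ≤ B → x ≤ B
  ∣∣≤⇒≤ = ℚ.≤-trans (∣∣-upper _)

  ∣∣≤⇒-≤ : ∀ {x B} → ∣ x ∣ ≤ B → - x ≤ B
  ∣∣≤⇒-≤ = ℚ.≤-trans (∣∣-lower _)

  ∣∣-*-≤ : ∀ {x y A B} → ∣ x ∣ ≤ A → ∣ y ∣ ≤ B → ∣ x * y ∣ ≤ A * B
  ∣∣-*-≤ {x} {y} p q = subst (_≤ _) (sym (ℚ.∣p*q∣≡∣p∣*∣q∣ x y)) (*-mono-≤ (ℚ.0≤∣p∣ x) (ℚ.0≤∣p∣ y) p q)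

  ∣∣-+-≤ : ∀ {x y A B} → ∣ x ∣ ≤ A → ∣ y ∣ ≤ B → ∣ x + y ∣ ≤ A + B
  ∣∣-+-≤ {x} {y} p q = ℚ.≤-trans (ℚ.∣p+q∣≤∣p∣+∣q∣ x y) (p ⊕ q)

  opaque
    ιℤ : ℤ → ℚ
    ιℤ z = z / 1

    toℚᵘ-ιℤ : ∀ z → ℚ.toℚᵘ (ιℤ z) ℚᵘ.≃ ℚᵘ.mkℚᵘ z 0
    toℚᵘ-ιℤ z = ℚ.toℚᵘ-fromℚᵘ (ℚᵘ.mkℚᵘ z 0)

  opaque
    ι : ℕ → ℚ
    ι n = ιℤ (ℤ.+ n)

  ιℤ-+ : ∀ a b → ιℤ (a ℤ.+ b) ≡ ιℤ a + ιℤ b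
  ιℤ-+ a b = ℚ.toℚᵘ-injective (ℚᵘ.≃-trans (toℚᵘ-ιℤ (a ℤ.+ b)) (ℚᵘ.≃-trans
    (ℚᵘ.*≡* (cong (ℤ._* ℤ.+ 1) (sym (cong₂ ℤ._+_ (ℤ.*-identityʳ a) (ℤ.*-identityʳ b)))))
    (ℚᵘ.≃-sym (ℚᵘ.≃-trans (ℚ.toℚᵘ-homo-+ (ιℤ a) (ιℤ b)) (ℚᵘ.+-cong (toℚᵘ-ιℤ a) (toℚᵘ-ιℤ b))))))

  ιℤ-* : ∀ a b → ιℤ (a ℤ.* b) ≡ ιℤ a * ιℤ b
  ιℤ-* a b = ℚ.toℚᵘ-injective (ℚᵘ.≃-trans (toℚᵘ-ιℤ (a ℤ.* b))
    (ℚᵘ.≃-sym (ℚᵘ.≃-trans (ℚ.toℚᵘ-homo-* (ιℤ a) (ιℤ b)) (ℚᵘ.*-cong (toℚᵘ-ιℤ a) (toℚᵘ-ιℤ b)))))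

  opaque
    unfolding ι ιℤ

    ι-+ : ∀ a b → ι (a ℕ.+ b) ≡ ι a + ι b
    ι-+ a b = trans (cong ιℤ (ℤ.pos-+ a b)) (ιℤ-+ (ℤ.+ a) (ℤ.+ b))

    ι-* : ∀ a b → ι (a ℕ.* b) ≡ ι a * ι b
    ι-* a b = trans (cong ιℤ (ℤ.pos-* a b)) (ιℤ-* (ℤ.+ a) (ℤ.+ b))

    ι0 : ι 0 ≡ 0ℚ
    ι0 = refl

    ι1 : ι 1 ≡ 1ℚ
    ι1 = refl

    toℚᵘ-ι : ∀ n → ℚ.toℚᵘ (ι n) ℚᵘ.≃ ℚᵘ.mkℚᵘ (ℤ.+ n) 0
    toℚᵘ-ι n = toℚᵘ-ιℤ (ℤ.+ n)

  -- Unlike (+ n) / 1, a numeral in canonical form costs the ring solver no gcd.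
  #_ : ℕ → ℚ
  # n = mkℚ (ℤ.+ n) 0 (Coprimality.sym (Coprimality.1-coprimeTo n))

  ι-# : ∀ n → ι n ≡ # n
  ι-# n = ℚ.toℚᵘ-injective (toℚᵘ-ι n)

  ι-suc : ∀ n → ι (suc n) ≡ 1ℚ + ι n
  ι-suc n = trans (ι-+ 1 n) (cong₂ _+_ ι1 refl)

  ι-nonNeg : ∀ n → 0ℚ ≤ ι n
  ι-nonNeg zero    = ℚ.≤-reflexive (sym ι0)
  ι-nonNeg (suc n) = subst (0ℚ ≤_) (sym (ι-suc n)) (+-nonNeg 0≤1 (ι-nonNeg n))

  #-nonNeg : ∀ n → 0ℚ ≤ # n
  #-nonNeg n = subst (0ℚ ≤_) (ι-# n) (ι-nonNeg n)

  ι-mono : ∀ {m n} → m ℕ.≤ n → ι m ≤ ι n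
  ι-mono {m} {n} m≤n with k , refl ← ℕ.m≤n⇒∃[o]m+o≡n m≤n =
    subst (ι m ≤_) (sym (ι-+ m k)) (lem (ι m) (ι k) (ι-nonNeg k))
    where
    lem : ∀ a b → 0ℚ ≤ b → a ≤ a + b
    lem a b h = ≤-by h (solve (a ∷ b ∷ []) ring)

  ι-pos : ∀ {n} → 1 ℕ.≤ n → 0ℚ < ι n
  ι-pos {n} h = ℚ.<-≤-trans 0<1 (subst (_≤ ι n) ι1 (ι-mono h))

  ι-mono-< : ∀ {m n} → m ℕ.< n → ι m < ι n
  ι-mono-< {m} m<n = ℚ.<-≤-trans (subst (ι m <_) (sym (ι-suc m)) (<-by {0ℚ} {1ℚ} 0<1 (lem (ι m)))) (ι-mono m<n)
    where
    lem : ∀ a → 0ℚ + (1ℚ + a) ≡ 1ℚ + a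
    lem = solve-∀ ring

  ι-cancel-≤ : ∀ {m n} → ι m ≤ ι n → m ℕ.≤ n
  ι-cancel-≤ {m} {n} h with m ℕ.≤? n
  ... | yes p = p
  ... | no ¬p = ⊥-elim (ℚ.<-irrefl refl (ℚ.<-≤-trans (ι-mono-< (ℕ.≰⇒> ¬p)) h))

  archimedean : ∀ p → ∃ λ n → p ≤ ι n
  archimedean p@(mkℚ (ℤ.+ a) d c) = a , ℚ.toℚᵘ-cancel-≤
    (ℚᵘ.≤-respʳ-≃ {ℚᵘ.mkℚᵘ (ℤ.+ a) d} (ℚᵘ.≃-sym (toℚᵘ-ι a))
      (ℚᵘ.*≤* (ℤ.*-monoˡ-≤-nonNeg (ℤ.+ a) {ℤ.+ 1} {ℤ.+ suc d} (ℤ.+≤+ (s≤s z≤n)))))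
  archimedean p@(mkℚ -[1+ a ] d c) = 0 , ℚ.≤-trans (*≤* ℤ.-≤+) (ι-nonNeg 0)

  div-cancel : ∀ (x y : Seq) i → y i ≢ 0ℚ → (x /ᴿ y) i * y i ≡ x i
  div-cancel x y i y≢0 with y i
  ... | p@(mkℚ (ℤ.+ 0) _ _) = ⊥-elim (y≢0 (ℚ.↥p≡0⇒p≡0 p refl))
  ... | p@(mkℚ +[1+ _ ] _ _) = trans (ℚ.*-assoc (x i) (ℚ.1/ p) p)
          (trans (cong (x i *_) (ℚ.*-inverseˡ p)) (ℚ.*-identityʳ (x i)))
  ... | p@(mkℚ -[1+ _ ] _ _) = trans (ℚ.*-assoc (x i) (ℚ.1/ p) p)
          (trans (cong (x i *_) (ℚ.*-inverseˡ p)) (ℚ.*-identityʳ (x i)))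

  >⇒≢0 : ∀ {x} → 0ℚ < x → x ≢ 0ℚ
  >⇒≢0 0<x refl = ℚ.<-irrefl refl 0<x

  opaque
    recip : ℚ → ℚ
    recip p = (constᴿ 1ℚ /ᴿ constᴿ p) 0

    recip-0 : recip 0ℚ ≡ 0ℚ
    recip-0 = refl

    recip-inv : ∀ {p} → 0ℚ < p → recip p * p ≡ 1ℚ
    recip-inv {p} h = div-cancel (constᴿ 1ℚ) (constᴿ p) 0 (>⇒≢0 h)

  recip-pos : ∀ {p} → 0ℚ < p → 0ℚ < recip p
  recip-pos {p} h with ℚ._<?_ 0ℚ (recip p)
  ... | yes q = q
  ... | no ¬q = ⊥-elim (ℚ.<-irrefl refl (ℚ.<-≤-trans 0<1 (subst (_≤ 0ℚ) (recip-inv h)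
          (lem (recip p) p (ℚ.≮⇒≥ ¬q) (ℚ.<⇒≤ h)))))
    where
    lem : ∀ a b → a ≤ 0ℚ → 0ℚ ≤ b → a * b ≤ 0ℚ
    lem a b ha hb = ≤-by (hb ⊛ ha) (solve (a ∷ b ∷ []) ring)

  rcp : ℕ → ℚ
  rcp n = recip (ι n)

  rcp-inv : ∀ {n} → 1 ℕ.≤ n → rcp n * ι n ≡ 1ℚ
  rcp-inv h = recip-inv (ι-pos h)

  rcp-pos : ∀ {n} → 1 ℕ.≤ n → 0ℚ < rcp n
  rcp-pos h = recip-pos (ι-pos h)

  rcp-nonNeg : ∀ n → 0ℚ ≤ rcp n
  rcp-nonNeg zero = ℚ.≤-reflexive (sym (trans (cong recip ι0) recip-0))
  rcp-nonNeg (suc n) = ℚ.<⇒≤ (rcp-pos (s≤s z≤n))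

  recip-unique : ∀ {x y p} → x * p ≡ 1ℚ → y * p ≡ 1ℚ → x ≡ y
  recip-unique {x} {y} {p} a b =
    trans (trans (sym (ℚ.*-identityʳ x)) (cong (x *_) (sym b))) (trans (lem x y p) (trans (cong (y *_) a) (ℚ.*-identityʳ y)))
    where
    lem : ∀ x y p → x * (y * p) ≡ y * (x * p)
    lem = solve-∀ ring

  recip-antitone : ∀ {p q} → 0ℚ < p → p ≤ q → recip q ≤ recip p
  recip-antitone {p} {q} hp pq = subst₂ _≤_
      (trans (lem₁ (recip p) (recip q) p) (trans (cong (_* recip q) (recip-inv hp)) (ℚ.*-identityˡ _)))
      (trans (lem₂ (recip p) (recip q) q) (trans (cong (recip p *_) (recip-inv hq)) (ℚ.*-identityʳ _)))
      (*-nonNeg (ℚ.<⇒≤ (recip-pos hp)) (ℚ.<⇒≤ (recip-pos hq)) ⊛ pq)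
    where
    hq = ℚ.<-≤-trans hp pq
    lem₁ : ∀ a b p → a * b * p ≡ a * p * b
    lem₁ = solve-∀ ring
    lem₂ : ∀ a b q → a * b * q ≡ a * (b * q)
    lem₂ = solve-∀ ring

  rcp-antitone : ∀ {m n} → 1 ℕ.≤ m → m ℕ.≤ n → rcp n ≤ rcp m
  rcp-antitone h m≤n = recip-antitone (ι-pos h) (ι-mono m≤n)

  rcp-* : ∀ {m n} → 1 ℕ.≤ m → 1 ℕ.≤ n → rcp (m ℕ.* n) ≡ rcp m * rcp n
  rcp-* {m} {n} hm hn = recip-unique (rcp-inv (ℕ.*-mono-≤ hm hn))
    (trans (cong (rcp m * rcp n *_) (ι-* m n)) (trans (lem (rcp m) (rcp n) (ι m) (ι n))
     (trans (cong₂ _*_ (rcp-inv hm) (rcp-inv hn)) refl)))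
    where
    lem : ∀ a b c d → a * b * (c * d) ≡ a * c * (b * d)
    lem = solve-∀ ring

  rcp-archimedean : ∀ ε → 0ℚ < ε → ∃ λ n → 1 ℕ.≤ n × rcp n ≤ ε
  rcp-archimedean ε 0<ε with n , h ← archimedean (recip ε) = suc n , s≤s z≤n ,
    subst (rcp (suc n) ≤_) (recip-unique (recip-inv (recip-pos 0<ε)) (trans (ℚ.*-comm ε (recip ε)) (recip-inv 0<ε)))
      (recip-antitone (recip-pos 0<ε) (ℚ.≤-trans h (ι-mono (ℕ.n≤1+n n))))

  ∑ : ℕ → (ℕ → ℚ) → ℚ
  ∑ zero    f = 0ℚ
  ∑ (suc N) f = ∑ N f + f (suc N)

  ∑-cong : ∀ N {f h} → (∀ k → 1 ℕ.≤ k → k ℕ.≤ N → f k ≡ h k) → ∑ N f ≡ ∑ N h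
  ∑-cong zero    e = refl
  ∑-cong (suc N) e = cong₂ _+_ (∑-cong N (λ k a b → e k a (ℕ.m≤n⇒m≤1+n b))) (e (suc N) (s≤s z≤n) ℕ.≤-refl)

  ∑-mono : ∀ N {f h} → (∀ k → 1 ℕ.≤ k → k ℕ.≤ N → f k ≤ h k) → ∑ N f ≤ ∑ N h
  ∑-mono zero    e = ℚ.≤-refl
  ∑-mono (suc N) e = ∑-mono N (λ k a b → e k a (ℕ.m≤n⇒m≤1+n b)) ⊕ e (suc N) (s≤s z≤n) ℕ.≤-refl

  ∑-0 : ∀ N → ∑ N (λ _ → 0ℚ) ≡ 0ℚ
  ∑-0 zero    = refl
  ∑-0 (suc N) = trans (ℚ.+-identityʳ _) (∑-0 N)

  ∑-zero : ∀ N {f} → (∀ k → 1 ℕ.≤ k → k ℕ.≤ N → f k ≡ 0ℚ) → ∑ N f ≡ 0ℚ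
  ∑-zero N e = trans (∑-cong N e) (∑-0 N)

  ∑-nonNeg : ∀ N {f} → (∀ k → 1 ℕ.≤ k → k ℕ.≤ N → 0ℚ ≤ f k) → 0ℚ ≤ ∑ N f
  ∑-nonNeg N {f} e = subst (_≤ ∑ N f) (∑-0 N) (∑-mono N e)

  ∑-+ : ∀ N f h → ∑ N (λ k → f k + h k) ≡ ∑ N f + ∑ N h
  ∑-+ zero    f h = refl
  ∑-+ (suc N) f h = trans (cong₂ _+_ (∑-+ N f h) refl) (lem (∑ N f) (∑ N h) _ _)
    where
    lem : ∀ a b c d → a + b + (c + d) ≡ a + c + (b + d)
    lem = solve-∀ ring

  ∑-* : ∀ N c f → ∑ N (λ k → c * f k) ≡ c * ∑ N f
  ∑-* zero    c f = sym (ℚ.*-zeroʳ c)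
  ∑-* (suc N) c f = trans (cong₂ _+_ (∑-* N c f) refl) (sym (ℚ.*-distribˡ-+ c (∑ N f) _))

  ∑-*ʳ : ∀ N c f → ∑ N (λ k → f k * c) ≡ ∑ N f * c
  ∑-*ʳ N c f = trans (∑-cong N (λ k _ _ → ℚ.*-comm (f k) c)) (trans (∑-* N c f) (ℚ.*-comm c _))

  ∑-neg : ∀ N f → ∑ N (λ k → - f k) ≡ - ∑ N f
  ∑-neg zero    f = refl
  ∑-neg (suc N) f = trans (cong₂ _+_ (∑-neg N f) refl) (lem (∑ N f) _)
    where
    lem : ∀ a b → (- a) + (- b) ≡ - (a + b)
    lem = solve-∀ ring

  ∑-- : ∀ N f h → ∑ N (λ k → f k - h k) ≡ ∑ N f - ∑ N h
  ∑-- N f h = trans (∑-+ N f (λ k → - h k)) (cong (∑ N f +_) (∑-neg N h))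

  ∑-const : ∀ N c → ∑ N (λ _ → c) ≡ ι N * c
  ∑-const zero    c = sym (trans (cong (_* c) ι0) (ℚ.*-zeroˡ c))
  ∑-const (suc N) c = trans (cong (_+ c) (∑-const N c)) (trans (lem (ι N) c) (cong (_* c) (sym (ι-suc N))))
    where
    lem : ∀ a c → a * c + c ≡ (1ℚ + a) * c
    lem = solve-∀ ring

  ∑-swap : ∀ M N (f : ℕ → ℕ → ℚ) → ∑ M (λ a → ∑ N (f a)) ≡ ∑ N (λ b → ∑ M (λ a → f a b))
  ∑-swap zero    N f = sym (∑-0 N)
  ∑-swap (suc M) N f = trans (cong₂ _+_ (∑-swap M N f) refl) (sym (∑-+ N _ _))

  ∑-abs : ∀ N f → ∣ ∑ N f ∣ ≤ ∑ N (λ k → ∣ f k ∣)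
  ∑-abs zero    f = ℚ.≤-refl
  ∑-abs (suc N) f = ∣∣-+-≤ (∑-abs N f) ℚ.≤-refl

  ∑-split : ∀ M K f → ∑ (M ℕ.+ K) f ≡ ∑ M f + ∑ K (λ k → f (M ℕ.+ k))
  ∑-split M zero    f = trans (cong (λ n → ∑ n f) (ℕ.+-identityʳ M)) (sym (ℚ.+-identityʳ _))
  ∑-split M (suc K) f = trans (cong (λ n → ∑ n f) (ℕ.+-suc M K))
    (trans (cong₂ _+_ (∑-split M K f) (cong f (sym (ℕ.+-suc M K)))) (ℚ.+-assoc (∑ M f) _ _))

  ∑-prefix-mono : ∀ {M N f} → M ℕ.≤ N → (∀ k → 0ℚ ≤ f k) → ∑ M f ≤ ∑ N f
  ∑-prefix-mono {M} {N} {f} M≤N h with K , refl ← ℕ.m≤n⇒∃[o]m+o≡n M≤N =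
    subst (∑ M f ≤_) (sym (∑-split M K f)) (lem _ _ (∑-nonNeg K (λ k _ _ → h (M ℕ.+ k))))
    where
    lem : ∀ a b → 0ℚ ≤ b → a ≤ a + b
    lem a b h = ≤-by h (solve (a ∷ b ∷ []) ring)

  ∑-at-most-one : ∀ N f B → 0ℚ ≤ B → (∀ k → 1 ℕ.≤ k → k ℕ.≤ N → f k ≤ B) →
    (∀ j k → 1 ℕ.≤ j → j ℕ.< k → k ℕ.≤ N → f j ≡ 0ℚ ⊎ f k ≡ 0ℚ) → ∑ N f ≤ B
  ∑-at-most-one zero    f B 0≤B h₁ h₂ = 0≤B
  ∑-at-most-one (suc N) f B 0≤B h₁ h₂ with f (suc N) ℚ.≟ 0ℚ
  ... | yes e = subst (_≤ B) (sym (trans (cong (∑ N f +_) e) (ℚ.+-identityʳ _)))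
         (∑-at-most-one N f B 0≤B (λ k a b → h₁ k a (ℕ.m≤n⇒m≤1+n b)) (λ j k a b c → h₂ j k a b (ℕ.m≤n⇒m≤1+n c)))
  ... | no ¬e = subst (_≤ B) (sym (trans (cong (_+ f (suc N)) (∑-zero N z)) (ℚ.+-identityˡ _)))
         (h₁ (suc N) (s≤s z≤n) ℕ.≤-refl)
    where
    z : ∀ k → 1 ℕ.≤ k → k ℕ.≤ N → f k ≡ 0ℚ
    z k a b with h₂ k (suc N) a (s≤s b) ℕ.≤-refl
    ... | inj₁ e = e
    ... | inj₂ e = ⊥-elim (¬e e)

  𝟙 : ∀ {P : Set} → Dec P → ℚ
  𝟙 (yes _) = 1ℚ
  𝟙 (no _) = 0ℚ

  𝟙-yes : ∀ {P : Set} (d : Dec P) → P → 𝟙 d ≡ 1ℚ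
  𝟙-yes (yes _) _ = refl
  𝟙-yes (no ¬p) p = ⊥-elim (¬p p)

  𝟙-no : ∀ {P : Set} (d : Dec P) → ¬ P → 𝟙 d ≡ 0ℚ
  𝟙-no (yes p) ¬p = ⊥-elim (¬p p)
  𝟙-no (no _)  _  = refl

  𝟙-nonNeg : ∀ {P : Set} (d : Dec P) → 0ℚ ≤ 𝟙 d
  𝟙-nonNeg (yes _) = 0≤1
  𝟙-nonNeg (no _)  = ℚ.≤-refl

  𝟙-cong : ∀ {P R : Set} (d : Dec P) (e : Dec R) → (P → R) → (R → P) → 𝟙 d ≡ 𝟙 e
  𝟙-cong (yes p) e f g = sym (𝟙-yes e (f p))
  𝟙-cong (no ¬p) e f g = sym (𝟙-no e (λ r → ¬p (g r)))

  ∑-single : ∀ N m c → 1 ℕ.≤ m → m ℕ.≤ N → ∑ N (λ k → 𝟙 (k ℕ.≟ m) * c) ≡ c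
  ∑-single zero    m c 1≤m m≤N = ⊥-elim (ℕ.<⇒≱ (ℕ.≤-trans 1≤m m≤N) z≤n)
  ∑-single (suc N) m c 1≤m m≤N with suc N ℕ.≟ m
  ... | yes refl = trans (cong₂ _+_ (∑-zero N (λ k _ b → trans (cong (_* c) (𝟙-no (k ℕ.≟ suc N) (λ e → ℕ.<⇒≢ (s≤s b) e))) (ℚ.*-zeroˡ c))) (ℚ.*-identityˡ c)) (ℚ.+-identityˡ c)
  ... | no ne = trans (cong₂ _+_ (∑-single N m c 1≤m (ℕ.≤-pred (ℕ.≤∧≢⇒< m≤N (λ e → ne (sym e))))) (ℚ.*-zeroˡ c)) (ℚ.+-identityʳ c)

module Limits where

  open import Data.Rational using (_≤_)
  open Rationals

  Ev : (ℕ → Set) → Set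
  Ev P = ∃ λ N → ∀ i → N ℕ.≤ i → P i

  ev-now : ∀ {P : ℕ → Set} → (∀ i → P i) → Ev P
  ev-now h = 0 , λ i _ → h i

  ev-from : ∀ {P : ℕ → Set} N → (∀ i → N ℕ.≤ i → P i) → Ev P
  ev-from N h = N , h

  ev-map : ∀ {P R : ℕ → Set} → (∀ i → P i → R i) → Ev P → Ev R
  ev-map f (N , h) = N , λ i N≤i → f i (h i N≤i)

  ev-zip : ∀ {P R S : ℕ → Set} → (∀ i → P i → R i → S i) → Ev P → Ev R → Ev S
  ev-zip f (M , g) (N , h) = M ℕ.+ N , λ i le →
    f i (g i (ℕ.≤-trans (ℕ.m≤m+n M N) le)) (h i (ℕ.≤-trans (ℕ.m≤n+m N M) le))

  ev-× : ∀ {P R : ℕ → Set} → Ev P → Ev R → Ev (λ i → P i × R i)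
  ev-× = ev-zip (λ _ → _,_)

  ev-bounded : ∀ {P : ℕ → ℕ → Set} N → (∀ n → n ℕ.≤ N → Ev (P n)) → Ev (λ i → ∀ n → n ℕ.≤ N → P n i)
  ev-bounded zero    h = ev-map (λ { i p zero z≤n → p }) (h 0 z≤n)
  ev-bounded {P} (suc N) h = ev-zip step (ev-bounded N (λ n le → h n (ℕ.m≤n⇒m≤1+n le))) (h (suc N) ℕ.≤-refl)
    where
    step : ∀ i → (∀ n → n ℕ.≤ N → P n i) → P (suc N) i → ∀ n → n ℕ.≤ suc N → P n i
    step i f p n le with ℕ.m≤n⇒m<n∨m≡n le
    ... | inj₁ lt = f n (ℕ.≤-pred lt)
    ... | inj₂ refl = p

  -- lim inf z ≥ 0
  record Nn (z : Seq) : Set where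
    field nn : ∀ ε → 0ℚ < ε → Ev (λ i → - ε ≤ z i)

  record Bd (x : Seq) : Set where
    constructor _,_
    field
      bound     : ℕ
      isBounded : Ev (λ i → ∣ x i ∣ ≤ ι bound)

  open Nn public
  open Bd public

  half-pos : ∀ {ε} → 0ℚ < ε → 0ℚ < ½ * ε
  half-pos = *-pos (ℚ.positive⁻¹ ½)

  Nn-≥ : ∀ {z} → (∀ i → 0ℚ ≤ z i) → Nn z
  Nn-≥ {z} h .nn ε 0<ε = ev-now λ i → lem (z i) (h i)
    where
    lem : ∀ a → 0ℚ ≤ a → - ε ≤ a
    lem a p = ≤-by (p ⊕ ℚ.<⇒≤ 0<ε) (solve (a ∷ ε ∷ []) ring)

  Nn-ev : ∀ {z} → Ev (λ i → 0ℚ ≤ z i) → Nn z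
  Nn-ev {z} h .nn ε 0<ε = ev-map (λ i → lem (z i)) h
    where
    lem : ∀ a → 0ℚ ≤ a → - ε ≤ a
    lem a p = ≤-by (p ⊕ ℚ.<⇒≤ 0<ε) (solve (a ∷ ε ∷ []) ring)

  Nn-by : ∀ {z z′} → Nn z → (∀ i → z i ≡ z′ i) → Nn z′
  Nn-by h e .nn ε 0<ε = ev-map (λ i → subst (- ε ≤_) (e i)) (h .nn ε 0<ε)

  Nn-+ : ∀ {x y} → Nn x → Nn y → Nn (λ i → x i + y i)
  Nn-+ {x} {y} hx hy .nn ε 0<ε = ev-zip (λ i p q → lem (x i) (y i) (p ⊕ q)) (hx .nn (½ * ε) (half-pos 0<ε)) (hy .nn (½ * ε) (half-pos 0<ε))
    where
    lem : ∀ a b → (- (½ * ε)) + (- (½ * ε)) ≤ a + b → - ε ≤ a + b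
    lem a b h = ≤-by h (solve (a ∷ b ∷ ε ∷ []) ring)

  Nn-* : ∀ {x y} → Bd x → Bd y → Nn x → Nn y → Nn (λ i → x i * y i)
  Nn-* {x} {y} (C , bx) (D , by) hx hy .nn ε 0<ε =
    ev-zip (λ { i (p , q) (r , s) → lem (x i) (y i) p q (∣∣≤⇒≤ r) (∣∣≤⇒≤ s) })
      (ev-× (hx .nn δ 0<δ) (hy .nn δ 0<δ)) (ev-× bx by)
    where
    K = ι C + ι D + 1ℚ + ε
    0≤CD1 : 0ℚ ≤ ι C + ι D + 1ℚ
    0≤CD1 = +-nonNeg (+-nonNeg (ι-nonNeg C) (ι-nonNeg D)) 0≤1
    0<K : 0ℚ < K
    0<K = ℚ.<-≤-trans 0<ε (≤-by 0≤CD1 (lem′ (ι C + ι D + 1ℚ)))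
      where
      lem′ : ∀ a → 0ℚ + (a + ε) ≡ a + ε
      lem′ a = solve (a ∷ ε ∷ []) ring
    δ = ε * recip K
    0<δ : 0ℚ < δ
    0<δ = *-pos 0<ε (recip-pos 0<K)
    0≤δ = ℚ.<⇒≤ 0<δ
    δK : δ * K ≡ ε
    δK = trans (ℚ.*-assoc ε (recip K) K) (trans (cong (ε *_) (recip-inv 0<K)) (ℚ.*-identityʳ ε))
    δ≤1 : δ ≤ 1ℚ
    δ≤1 = subst (δ ≤_) (trans (ℚ.*-comm K (recip K)) (recip-inv 0<K)) (lem′ (ι C + ι D + 1ℚ) (recip K) 0≤CD1 (ℚ.<⇒≤ (recip-pos 0<K)))
      where
      lem′ : ∀ a r → 0ℚ ≤ a → 0ℚ ≤ r → ε * r ≤ (a + ε) * r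
      lem′ a r p q = ≤-by (*-nonNeg p q) (solve (a ∷ r ∷ ε ∷ []) ring)
    core : ∀ a b c d δ ε → 0ℚ ≤ δ → δ ≤ 1ℚ → 0ℚ ≤ ε → δ * (c + d + 1ℚ + ε) ≡ ε →
      - δ ≤ a → - δ ≤ b → a ≤ c → b ≤ d → - ε ≤ a * b
    core a b c d δ ε 0≤δ δ≤1 0≤ε e p q r s = subst (λ t → - t ≤ a * b) e
      (≤-by (*-nonNeg (≤⇒0≤ p) (≤⇒0≤ q) ⊕ (0≤δ ⊛ r) ⊕ (0≤δ ⊛ s) ⊕ (0≤δ ⊛ δ≤1) ⊕ *-nonNeg 0≤δ 0≤ε)
        (solve (a ∷ b ∷ c ∷ d ∷ δ ∷ ε ∷ []) ring))
    lem : ∀ a b → - δ ≤ a → - δ ≤ b → a ≤ ι C → b ≤ ι D → - ε ≤ a * b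
    lem a b = core a b (ι C) (ι D) δ ε 0≤δ δ≤1 (ℚ.<⇒≤ 0<ε) δK

  Bd-const : ∀ c → Bd (λ _ → c)
  Bd-const c = proj₁ (archimedean ∣ c ∣) , ev-now λ _ → proj₂ (archimedean ∣ c ∣)

  Bd-+ : ∀ {x y} → Bd x → Bd y → Bd (λ i → x i + y i)
  Bd-+ {x} {y} (C , p) (D , q) = C ℕ.+ D , ev-zip (λ i a b → subst (∣ x i + y i ∣ ≤_) (sym (ι-+ C D)) (∣∣-+-≤ a b)) p q

  Bd-* : ∀ {x y} → Bd x → Bd y → Bd (λ i → x i * y i)
  Bd-* {x} {y} (C , p) (D , q) = C ℕ.* D , ev-zip (λ i a b → subst (∣ x i * y i ∣ ≤_) (sym (ι-* C D)) (∣∣-*-≤ a b)) p q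

  Bd-neg : ∀ {x} → Bd x → Bd (λ i → - x i)
  Bd-neg {x} (C , p) = C , ev-map (λ i a → subst (_≤ ι C) (sym (ℚ.∣-p∣≡∣p∣ (x i))) a) p

  Nn-scale : ∀ {c x} → 0ℚ ≤ c → Bd x → Nn x → Nn (λ i → c * x i)
  Nn-scale {c} 0≤c b h = Nn-* (Bd-const c) b (Nn-≥ (λ _ → 0≤c)) h

  Nn-lim : ∀ {z} c → 0ℚ ≤ c → (∀ N → 1 ℕ.≤ N → Nn (λ i → z i + c * rcp N)) → Nn z
  Nn-lim {z} c 0≤c h .nn ε 0<ε = ev-map (λ i → lem (z i) (c * rcp N) bnd) (h N 1≤N .nn (½ * ε) (half-pos 0<ε))
    where
    0<c1 : 0ℚ < c + 1ℚ
    0<c1 = ℚ.<-≤-trans 0<1 (≤-by 0≤c (lem c))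
      where
      lem : ∀ c → 0ℚ + (c + 1ℚ) ≡ c + 1ℚ
      lem = solve-∀ ring
    r = recip (c + 1ℚ)
    small = rcp-archimedean (½ * ε * r) (*-pos (half-pos 0<ε) (recip-pos 0<c1))
    N = proj₁ small
    1≤N = proj₁ (proj₂ small)
    lem₂ : ∀ c r e → 0ℚ ≤ e → 0ℚ ≤ r → r * (c + 1ℚ) ≡ 1ℚ → c * (½ * e * r) ≤ ½ * e
    lem₂ c r e 0≤e 0≤r eq = subst (c * (½ * e * r) ≤_) (trans (cong (½ * e *_) eq) (ℚ.*-identityʳ (½ * e)))
      (≤-by (*-nonNeg 0≤r (*-nonNeg (ℚ.<⇒≤ (ℚ.positive⁻¹ ½)) 0≤e)) (solve (c ∷ r ∷ e ∷ []) ring))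
    bnd : c * rcp N ≤ ½ * ε
    bnd = ℚ.≤-trans (0≤c ⊛ proj₂ (proj₂ small)) (lem₂ c r ε (ℚ.<⇒≤ 0<ε) (ℚ.<⇒≤ (recip-pos 0<c1)) (recip-inv 0<c1))
    lem : ∀ a b → b ≤ ½ * ε → - (½ * ε) ≤ a + b → - ε ≤ a
    lem a b p q = ≤-by (p ⊕ q) (solve (a ∷ b ∷ ε ∷ []) ring)

module ExponentialSeries where

  open import Data.Rational using (_≤_)
  open Rationals
  open Limits

  ∑₀ : ℕ → (ℕ → ℚ) → ℚ
  ∑₀ zero    f = 0ℚ
  ∑₀ (suc n) f = ∑₀ n f + f n

  ∑₀-head : ∀ n f → ∑₀ (suc n) f ≡ f 0 + ∑₀ n (λ k → f (suc k))
  ∑₀-head zero    f = ℚ.+-comm 0ℚ (f 0)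
  ∑₀-head (suc n) f = trans (cong₂ _+_ (∑₀-head n f) refl) (ℚ.+-assoc (f 0) _ _)

  ∑₀-mono : ∀ n {f h} → (∀ k → f k ≤ h k) → ∑₀ n f ≤ ∑₀ n h
  ∑₀-mono zero    e = ℚ.≤-refl
  ∑₀-mono (suc n) e = ∑₀-mono n e ⊕ e n

  ∑₀-cong : ∀ n {f h} → (∀ k → f k ≡ h k) → ∑₀ n f ≡ ∑₀ n h
  ∑₀-cong zero    e = refl
  ∑₀-cong (suc n) e = cong₂ _+_ (∑₀-cong n e) (e n)

  ∑₀-nonNeg : ∀ n {f} → (∀ k → 0ℚ ≤ f k) → 0ℚ ≤ ∑₀ n f
  ∑₀-nonNeg zero    e = ℚ.≤-refl
  ∑₀-nonNeg (suc n) e = +-nonNeg (∑₀-nonNeg n e) (e n)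

  ∑₀-abs : ∀ n f → ∣ ∑₀ n f ∣ ≤ ∑₀ n (λ k → ∣ f k ∣)
  ∑₀-abs zero    f = ℚ.≤-refl
  ∑₀-abs (suc n) f = ∣∣-+-≤ (∑₀-abs n f) ℚ.≤-refl

  ≤-+ʳ : ∀ {a b} → 0ℚ ≤ b → a ≤ a + b
  ≤-+ʳ {a} {b} h = ≤-by h (solve (a ∷ b ∷ []) ring)

  ∑₀-grow : ∀ {m n f} → (∀ k → 0ℚ ≤ f k) → m ℕ.≤ n → ∑₀ m f ≤ ∑₀ n f
  ∑₀-grow {m} {n} {f} h m≤n with k , refl ← ℕ.m≤n⇒∃[o]m+o≡n m≤n = go k
    where
    go : ∀ k → ∑₀ m f ≤ ∑₀ (m ℕ.+ k) f
    go zero    = ℚ.≤-reflexive (cong (λ t → ∑₀ t f) (sym (ℕ.+-identityʳ m)))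
    go (suc k) = subst (λ t → ∑₀ m f ≤ ∑₀ t f) (sym (ℕ.+-suc m k)) (ℚ.≤-trans (go k) (≤-+ʳ (h (m ℕ.+ k))))

  ∑₀-diff-abs : ∀ {m n f} → m ℕ.≤ n → ∣ ∑₀ n f - ∑₀ m f ∣ ≤ ∑₀ n (λ k → ∣ f k ∣) - ∑₀ m (λ k → ∣ f k ∣)
  ∑₀-diff-abs {m} {n} {f} m≤n with k , refl ← ℕ.m≤n⇒∃[o]m+o≡n m≤n = go k
    where
    F = λ k → ∣ f k ∣
    z : ∀ a → a - a ≡ 0ℚ
    z = solve-∀ ring
    lem : ∀ a b c → a + c - b ≡ a - b + c
    lem = solve-∀ ring
    go : ∀ k → ∣ ∑₀ (m ℕ.+ k) f - ∑₀ m f ∣ ≤ ∑₀ (m ℕ.+ k) F - ∑₀ m F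
    go zero    = subst (λ t → ∣ ∑₀ t f - ∑₀ m f ∣ ≤ ∑₀ t F - ∑₀ m F) (sym (ℕ.+-identityʳ m))
      (ℚ.≤-reflexive (trans (cong ∣_∣ (z (∑₀ m f))) (sym (z (∑₀ m F)))))
    go (suc k) = subst (λ t → ∣ ∑₀ t f - ∑₀ m f ∣ ≤ ∑₀ t F - ∑₀ m F) (sym (ℕ.+-suc m k))
      (subst₂ _≤_ (cong ∣_∣ (sym (lem (∑₀ (m ℕ.+ k) f) (∑₀ m f) (f (m ℕ.+ k)))))
        (sym (lem (∑₀ (m ℕ.+ k) F) (∑₀ m F) (F (m ℕ.+ k)))) (∣∣-+-≤ (go k) ℚ.≤-refl))

  conv : (ℕ → ℚ) → (ℕ → ℚ) → ℕ → ℚ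
  conv f g zero    = f 0 * g 0
  conv f g (suc m) = f 0 * g (suc m) + conv (λ j → f (suc j)) g m

  -- triangle f g n = ∑_{j + l < n} f j * g l
  triangle : (ℕ → ℚ) → (ℕ → ℚ) → ℕ → ℚ
  triangle f g zero    = 0ℚ
  triangle f g (suc n) = f 0 * ∑₀ (suc n) g + triangle (λ j → f (suc j)) g n

  triangle-suc : ∀ f g n → triangle f g (suc n) ≡ triangle f g n + conv f g n
  triangle-suc f g zero    = lem (f 0) (g 0)
    where
    lem : ∀ a b → a * (0ℚ + b) + 0ℚ ≡ 0ℚ + a * b
    lem = solve-∀ ring
  triangle-suc f g (suc n) = trans (cong (f 0 * ∑₀ (2 ℕ.+ n) g +_) (triangle-suc (λ j → f (suc j)) g n))
    (lem (f 0) (∑₀ (suc n) g) (g (suc n)) (triangle (λ j → f (suc j)) g n) (conv (λ j → f (suc j)) g n))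
    where
    lem : ∀ a s b t c → a * (s + b) + (t + c) ≡ a * s + t + (a * b + c)
    lem = solve-∀ ring

  triangle-∑₀ : ∀ f g n → triangle f g n ≡ ∑₀ n (conv f g)
  triangle-∑₀ f g zero    = refl
  triangle-∑₀ f g (suc n) = trans (triangle-suc f g n) (cong₂ _+_ (triangle-∑₀ f g n) refl)

  square-triangle : ∀ f g n K → n ℕ.≤ K →
    ∣ ∑₀ n f * ∑₀ K g - triangle f g n ∣
      ≤ ∑₀ n (λ k → ∣ f k ∣) * ∑₀ K (λ k → ∣ g k ∣) - triangle (λ k → ∣ f k ∣) (λ k → ∣ g k ∣) n
  square-triangle f g zero    K le = ℚ.≤-reflexive (trans (cong ∣_∣ (lem (∑₀ K g))) (sym (lem (∑₀ K (λ k → ∣ g k ∣)))))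
    where
    lem : ∀ a → 0ℚ * a - 0ℚ ≡ 0ℚ
    lem = solve-∀ ring
  square-triangle f g (suc n) K le = subst₂ _≤_
    (cong ∣_∣ (trans (lem (f 0) (∑₀ K g) (∑₀ (suc n) g) (∑₀ n f′) (triangle f′ g n)) (cong (λ t → t * ∑₀ K g - triangle f g (suc n)) (sym (∑₀-head n f)))))
    (trans (lem (F 0) (∑₀ K G) (∑₀ (suc n) G) (∑₀ n F′) (triangle F′ G n)) (cong (λ t → t * ∑₀ K G - triangle F G (suc n)) (sym (∑₀-head n F))))
    (∣∣-+-≤ (∣∣-*-≤ {f 0} ℚ.≤-refl (∑₀-diff-abs le)) (square-triangle f′ g n K (ℕ.≤-trans (ℕ.n≤1+n n) le)))
    where
    f′ = λ j → f (suc j)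
    F = λ k → ∣ f k ∣
    F′ = λ k → ∣ f′ k ∣
    G = λ k → ∣ g k ∣
    lem : ∀ a K N s t → a * (K - N) + (s * K - t) ≡ (a + s) * K - (a * N + t)
    lem = solve-∀ ring

  square≤triangle : ∀ f g n K → (∀ k → 0ℚ ≤ f k) → (∀ k → 0ℚ ≤ g k) →
    ∑₀ n f * ∑₀ K g ≤ triangle f g (n ℕ.+ K)
  square≤triangle f g zero    K hf hg = subst₂ _≤_ (sym (ℚ.*-zeroˡ (∑₀ K g))) (sym (triangle-∑₀ f g K)) (∑₀-nonNeg K (conv-nonNeg f g hf hg))
    where
    conv-nonNeg : ∀ f g → (∀ k → 0ℚ ≤ f k) → (∀ k → 0ℚ ≤ g k) → ∀ m → 0ℚ ≤ conv f g m
    conv-nonNeg f g hf hg zero    = *-nonNeg (hf 0) (hg 0)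
    conv-nonNeg f g hf hg (suc m) = +-nonNeg (*-nonNeg (hf 0) (hg (suc m))) (conv-nonNeg _ g (λ k → hf (suc k)) hg m)
  square≤triangle f g (suc n) K hf hg = subst (_≤ triangle f g (suc n ℕ.+ K))
    (trans (sym (ℚ.*-distribʳ-+ (∑₀ K g) (f 0) (∑₀ n f′))) (cong (_* ∑₀ K g) (sym (∑₀-head n f))))
    ((hf 0 ⊛ ∑₀-grow hg (ℕ.m≤n⇒m≤1+n (ℕ.m≤n+m K n))) ⊕ square≤triangle f′ g n K (λ k → hf (suc k)) hg)
    where f′ = λ j → f (suc j)

  weighted : ℕ → (ℕ → ℚ) → ℕ → ℚ
  weighted s f j = ι (s ℕ.+ j) * f j

  conv-congˡ : ∀ {f f′} g m → (∀ j → f j ≡ f′ j) → conv f g m ≡ conv f′ g m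
  conv-congˡ g zero    e = cong (_* g 0) (e 0)
  conv-congˡ g (suc m) e = cong₂ _+_ (cong (_* g (suc m)) (e 0)) (conv-congˡ g m (λ j → e (suc j)))

  conv-congʳ : ∀ f {g g′} m → (∀ j → g j ≡ g′ j) → conv f g m ≡ conv f g′ m
  conv-congʳ f zero    e = cong (f 0 *_) (e 0)
  conv-congʳ f (suc m) e = cong₂ _+_ (cong (f 0 *_) (e (suc m))) (conv-congʳ (λ j → f (suc j)) m e)

  conv-*ˡ : ∀ a f g m → conv (λ j → a * f j) g m ≡ a * conv f g m
  conv-*ˡ a f g zero    = ℚ.*-assoc a (f 0) (g 0)
  conv-*ˡ a f g (suc m) = trans (cong₂ _+_ (ℚ.*-assoc a (f 0) (g (suc m))) (conv-*ˡ a _ g m)) (sym (ℚ.*-distribˡ-+ a _ _))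

  conv-*ʳ : ∀ a f g m → conv f (λ j → a * g j) m ≡ a * conv f g m
  conv-*ʳ a f g zero    = lem (f 0) a (g 0)
    where
    lem : ∀ x y z → x * (y * z) ≡ y * (x * z)
    lem = solve-∀ ring
  conv-*ʳ a f g (suc m) = trans (cong₂ _+_ (lem (f 0) a (g (suc m))) (conv-*ʳ a _ g m)) (sym (ℚ.*-distribˡ-+ a _ _))
    where
    lem : ∀ x y z → x * (y * z) ≡ y * (x * z)
    lem = solve-∀ ring

  conv-shiftʳ : ∀ f h m → h 0 ≡ 0ℚ → conv f h (suc m) ≡ conv f (λ j → h (suc j)) m
  conv-shiftʳ f h zero    e = trans (cong (λ t → f 0 * h 1 + f 1 * t) e) (lem (f 0 * h 1) (f 1))
    where
    lem : ∀ x y → x + y * 0ℚ ≡ x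
    lem = solve-∀ ring
  conv-shiftʳ f h (suc m) e = cong (f 0 * h (2 ℕ.+ m) +_) (conv-shiftʳ (λ j → f (suc j)) h m e)

  -- the Leibniz rule for the Euler operator t d/dt on power series
  leibniz : ∀ s f g m → ι (s ℕ.+ m) * conv f g m ≡ conv (weighted s f) g m + conv f (weighted 0 g) m
  leibniz s f g zero    = trans (cong (λ t → ι t * (f 0 * g 0)) (ℕ.+-identityʳ s))
    (trans (lem (ι s) (f 0) (g 0)) (cong₂ (λ a b → a * f 0 * g 0 + f 0 * (b * g 0)) (cong ι (sym (ℕ.+-identityʳ s))) (sym ι0)))
    where
    lem : ∀ s a b → s * (a * b) ≡ s * a * b + a * (0ℚ * b)
    lem = solve-∀ ring
  leibniz s f g (suc m) =
    trans (ℚ.*-distribˡ-+ (ι (s ℕ.+ suc m)) (f 0 * g (suc m)) (conv f′ g m))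
    (trans (cong₂ _+_ (trans (cong (_* (f 0 * g (suc m))) (trans (ι-+ s (suc m)) (cong (λ t → ι t + ι (suc m)) (sym (ℕ.+-identityʳ s))))) refl)
       (trans (cong (λ t → ι t * conv f′ g m) (ℕ.+-suc s m)) (trans (leibniz (suc s) f′ g m)
         (cong (_+ conv f′ (weighted 0 g) m) (conv-congˡ g m (λ j → cong (λ t → ι t * f′ j) (sym (ℕ.+-suc s j))))))))
    (lem (ι (s ℕ.+ 0)) (ι (suc m)) (f 0) (g (suc m)) _ _))
    where
    f′ = λ j → f (suc j)
    lem : ∀ s m a b x y → (s + m) * (a * b) + (x + y) ≡ s * a * b + x + (a * (m * b) + y)
    lem = solve-∀ ring

  term : ℚ → ℕ → ℚ
  term a zero    = 1ℚ
  term a (suc k) = a * term a k * rcp (suc k)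

  term-suc : ∀ a k → ι (suc k) * term a (suc k) ≡ a * term a k
  term-suc a k = trans (lem (ι (suc k)) (a * term a k) (rcp (suc k))) (trans (cong (a * term a k *_) (rcp-inv (s≤s z≤n))) (ℚ.*-identityʳ _))
    where
    lem : ∀ x y z → x * (y * z) ≡ y * (z * x)
    lem = solve-∀ ring

  *-cancelˡ : ∀ {c a b} → 0ℚ < c → c * a ≡ c * b → a ≡ b
  *-cancelˡ h e = ℚ.≤-antisym (*-cancelˡ-≤ h (ℚ.≤-reflexive e)) (*-cancelˡ-≤ h (ℚ.≤-reflexive (sym e)))

  conv-term : ∀ a b m → conv (term a) (term b) m ≡ term (a + b) m
  conv-term a b zero    = ℚ.*-identityˡ 1ℚ
  conv-term a b (suc m) = *-cancelˡ {ι (suc m)} (ι-pos (s≤s z≤n))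
    (trans (leibniz 0 (term a) (term b) (suc m))
    (trans (cong₂ _+_
      (trans (cong₂ _+_ (trans (cong (λ t → t * 1ℚ * term b (suc m)) ι0) (lem₀ (term b (suc m))))
         (trans (conv-congˡ (term b) m (term-suc a)) (conv-*ˡ a (term a) (term b) m))) refl)
      (trans (conv-shiftʳ (term a) (weighted 0 (term b)) m (trans (cong (_* 1ℚ) ι0) (ℚ.*-zeroˡ 1ℚ)))
        (trans (conv-congʳ (term a) m (term-suc b)) (conv-*ʳ b (term a) (term b) m))))
    (trans (lem a b (conv (term a) (term b) m)) (trans (cong ((a + b) *_) (conv-term a b m)) (sym (term-suc (a + b) m))))))
    where
    lem₀ : ∀ x → 0ℚ * 1ℚ * x ≡ 0ℚ
    lem₀ = solve-∀ ring
    lem : ∀ a b c → 0ℚ + a * c + b * c ≡ (a + b) * c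
    lem = solve-∀ ring

  Ex : ℕ → ℚ → ℚ
  Ex i a = ∑₀ i (term a)

  triangle-Ex : ∀ a b n → triangle (term a) (term b) n ≡ Ex n (a + b)
  triangle-Ex a b n = trans (triangle-∑₀ (term a) (term b) n) (∑₀-cong n (conv-term a b))

  term-abs : ∀ a k → ∣ term a k ∣ ≡ term ∣ a ∣ k
  term-abs a zero    = refl
  term-abs a (suc k) = trans (ℚ.∣p*q∣≡∣p∣*∣q∣ (a * term a k) (rcp (suc k)))
    (cong₂ _*_ (trans (ℚ.∣p*q∣≡∣p∣*∣q∣ a (term a k)) (cong (∣ a ∣ *_) (term-abs a k))) (ℚ.0≤p⇒∣p∣≡p (rcp-nonNeg (suc k))))

  term-nonNeg : ∀ {a} → 0ℚ ≤ a → ∀ k → 0ℚ ≤ term a k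
  term-nonNeg h zero    = 0≤1
  term-nonNeg h (suc k) = *-nonNeg (*-nonNeg h (term-nonNeg h k)) (rcp-nonNeg (suc k))

  term-mono : ∀ {a b} → 0ℚ ≤ a → a ≤ b → ∀ k → term a k ≤ term b k
  term-mono h le zero    = ℚ.≤-refl
  term-mono h le (suc k) = *-mono-≤ (*-nonNeg h (term-nonNeg h k)) (rcp-nonNeg (suc k))
    (*-mono-≤ h (term-nonNeg h k) le (term-mono h le k)) ℚ.≤-refl

  Ex-abs : ∀ i a → ∣ Ex i a ∣ ≤ Ex i ∣ a ∣
  Ex-abs i a = subst (∣ Ex i a ∣ ≤_) (∑₀-cong i (term-abs a)) (∑₀-abs i (term a))

  Ex-mono : ∀ i {a b} → 0ℚ ≤ a → a ≤ b → Ex i a ≤ Ex i b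
  Ex-mono i h le = ∑₀-mono i (term-mono h le)

  Ex-product-error : ∀ n a b → ∣ Ex n a * Ex n b - Ex n (a + b) ∣ ≤ Ex (n ℕ.+ n) (∣ a ∣ + ∣ b ∣) - Ex n (∣ a ∣ + ∣ b ∣)
  Ex-product-error n a b = ℚ.≤-trans
    (subst₂ _≤_ (cong (λ t → ∣ Ex n a * Ex n b - t ∣) (triangle-Ex a b n)) e (square-triangle (term a) (term b) n n ℕ.≤-refl))
    (lem _ _ (Ex n (∣ a ∣ + ∣ b ∣)) (subst (Ex n ∣ a ∣ * Ex n ∣ b ∣ ≤_) (triangle-Ex ∣ a ∣ ∣ b ∣ (n ℕ.+ n))
       (square≤triangle (term ∣ a ∣) (term ∣ b ∣) n n (term-nonNeg (ℚ.0≤∣p∣ a)) (term-nonNeg (ℚ.0≤∣p∣ b)))))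
    where
    lem : ∀ x y z → x ≤ y → x - z ≤ y - z
    lem x y z h = ≤-by h (solve (x ∷ y ∷ z ∷ []) ring)
    tri-cong : ∀ n {f f′ g g′ : ℕ → ℚ} → (∀ k → f k ≡ f′ k) → (∀ k → g k ≡ g′ k) → triangle f g n ≡ triangle f′ g′ n
    tri-cong zero    p q = refl
    tri-cong (suc n) p q = cong₂ _+_ (cong₂ _*_ (p 0) (∑₀-cong (suc n) q)) (tri-cong n (λ k → p (suc k)) q)
    e : ∑₀ n (λ k → ∣ term a k ∣) * ∑₀ n (λ k → ∣ term b k ∣) - triangle (λ k → ∣ term a k ∣) (λ k → ∣ term b k ∣) n
      ≡ Ex n ∣ a ∣ * Ex n ∣ b ∣ - Ex n (∣ a ∣ + ∣ b ∣)
    e = cong₂ _-_ (cong₂ _*_ (∑₀-cong n (term-abs a)) (∑₀-cong n (term-abs b)))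
          (trans (tri-cong n (term-abs a) (term-abs b)) (triangle-Ex ∣ a ∣ ∣ b ∣ n))

  term-step : ∀ C k → 2 ℕ.* C ℕ.≤ k → term (ι C) (suc k) + term (ι C) (suc k) ≤ term (ι C) k
  term-step C k le = *-cancelˡ-≤ (ι-pos {suc k} (s≤s z≤n))
    (ℚ.≤-trans (ℚ.≤-reflexive (trans (lem (ι (suc k)) (term (ι C) (suc k))) (cong (λ t → t + t) (term-suc (ι C) k))))
      (≤-by ((term-nonNeg (ι-nonNeg C) k ⊛ le′) ⊕ term-nonNeg (ι-nonNeg C) k) (lem₂ (ι C) (term (ι C) k) (ι k) (ι (suc k)) (ι-suc k))))
    where
    le′ : ι C + ι C ≤ ι k
    le′ = ℚ.≤-trans (ℚ.≤-reflexive (trans (sym (ι-+ C C)) (cong (λ t → ι (C ℕ.+ t)) (sym (ℕ.+-identityʳ C))))) (ι-mono le)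
    lem : ∀ a b → a * (b + b) ≡ a * b + a * b
    lem = solve-∀ ring
    lem₃ : ∀ c t k → t * (c + c) + 0ℚ + (1ℚ + k) * t ≡ t * k + t + (c * t + c * t)
    lem₃ = solve-∀ ring
    lem₂ : ∀ c t k s → s ≡ 1ℚ + k → t * (c + c) + 0ℚ + s * t ≡ t * k + t + (c * t + c * t)
    lem₂ c t k s refl = lem₃ c t k

  Ex-tail : ∀ C {m n} → 2 ℕ.* C ℕ.≤ m → m ℕ.≤ n → Ex n (ι C) - Ex m (ι C) ≤ term (ι C) m + term (ι C) m
  Ex-tail C {m} le m≤n with k , refl ← ℕ.m≤n⇒∃[o]m+o≡n m≤n = lem₀ (Ex (m ℕ.+ k) c) (Ex m c) (T (m ℕ.+ k)) (T m) (tn (m ℕ.+ k)) (go k)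
    where
    c = ι C
    T = term c
    tn = term-nonNeg (ι-nonNeg C)
    lem₀ : ∀ a b s t → 0ℚ ≤ s → a + s + s ≤ b + t + t → a - b ≤ t + t
    lem₀ a b s t p h = ≤-by (h ⊕ p ⊕ p) (solve (a ∷ b ∷ s ∷ t ∷ []) ring)
    lem₁ : ∀ a t u b → u + u ≤ t → a + t + t ≤ b → a + t + u + u ≤ b
    lem₁ a t u b p q = ≤-by (p ⊕ q) (solve (a ∷ t ∷ u ∷ b ∷ []) ring)
    go : ∀ k → Ex (m ℕ.+ k) c + T (m ℕ.+ k) + T (m ℕ.+ k) ≤ Ex m c + T m + T m
    go zero    = ℚ.≤-reflexive (cong (λ t → Ex t c + T t + T t) (ℕ.+-identityʳ m))
    go (suc k) = subst (λ t → Ex t c + T t + T t ≤ Ex m c + T m + T m) (sym (ℕ.+-suc m k))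
      (lem₁ (Ex (m ℕ.+ k) c) (T (m ℕ.+ k)) (T (suc (m ℕ.+ k))) _ (term-step C (m ℕ.+ k) (ℕ.≤-trans le (ℕ.m≤m+n m k))) (go k))

  term-decay : ∀ C → ∃ λ B → ∀ k → 2 ℕ.* C ℕ.≤ k → term (ι C) k + term (ι C) k ≤ ι B * rcp (suc k)
  term-decay C = proj₁ arch , λ k le → ℚ.≤-trans (bnd k le) (subst₂ _≤_ (ℚ.*-comm (rcp (suc k)) K) (ℚ.*-comm (rcp (suc k)) (ι (proj₁ arch)))
      (rcp-nonNeg (suc k) ⊛ proj₂ arch))
    where
    c = ι C
    T = term c
    k₀ = 2 ℕ.* C
    tn = term-nonNeg (ι-nonNeg C)
    K = (ι (suc k₀) + c) * (T k₀ + T k₀)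
    arch = archimedean K
    anti : ∀ j → T (k₀ ℕ.+ j) ≤ T k₀
    anti zero    = ℚ.≤-reflexive (cong T (ℕ.+-identityʳ k₀))
    anti (suc j) = subst (λ t → T t ≤ T k₀) (sym (ℕ.+-suc k₀ j)) (ℚ.≤-trans
       (lem₀ (T (suc (k₀ ℕ.+ j))) (T (k₀ ℕ.+ j)) (tn (suc (k₀ ℕ.+ j))) (term-step C (k₀ ℕ.+ j) (ℕ.m≤m+n k₀ j))) (anti j))
      where
      lem₀ : ∀ u t → 0ℚ ≤ u → u + u ≤ t → u ≤ t
      lem₀ u t p q = ≤-by (p ⊕ q) (solve (u ∷ t ∷ []) ring)
    scaled : ∀ j → ι (suc (k₀ ℕ.+ j)) * T (k₀ ℕ.+ j) ≤ (ι (suc k₀) + c) * T k₀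
    scaled zero    = subst (λ t → ι (suc t) * T t ≤ (ι (suc k₀) + c) * T k₀) (sym (ℕ.+-identityʳ k₀))
      (lem₀ (ι (suc k₀)) c (T k₀) (*-nonNeg (ι-nonNeg C) (tn k₀)))
      where
      lem₀ : ∀ a c t → 0ℚ ≤ c * t → a * t ≤ (a + c) * t
      lem₀ a c t h = ≤-by h (solve (a ∷ c ∷ t ∷ []) ring)
    scaled (suc j) = subst (λ t → ι (suc t) * T t ≤ (ι (suc k₀) + c) * T k₀) (sym (ℕ.+-suc k₀ j))
      (ℚ.≤-trans (ℚ.≤-reflexive (trans (cong (_* T (suc n)) (ι-suc (suc n))) (trans (ℚ.*-distribʳ-+ (T (suc n)) 1ℚ (ι (suc n))) (cong₂ _+_ (ℚ.*-identityˡ (T (suc n))) (term-suc c n)))))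
        (lem₀ (T (suc n)) (T k₀) (T n) (ι (suc k₀)) (subst (λ t → T t ≤ T k₀) (ℕ.+-suc k₀ j) (anti (suc j))) (anti j) (tn k₀) one≤))
      where
      n = k₀ ℕ.+ j
      one≤ : 1ℚ ≤ ι (suc k₀)
      one≤ = subst (_≤ ι (suc k₀)) ι1 (ι-mono (s≤s z≤n))
      lem₀ : ∀ u t s a → u ≤ t → s ≤ t → 0ℚ ≤ t → 1ℚ ≤ a → u + c * s ≤ (a + c) * t
      lem₀ u t s a p q r o = ≤-by (p ⊕ (ι-nonNeg C ⊛ q) ⊕ (r ⊛ o)) (lem₁ u t s a c)
        where
        lem₁ : ∀ u t s a c → u + (c * s + t * 1ℚ) + (a + c) * t ≡ t + (c * t + t * a) + (u + c * s)
        lem₁ = solve-∀ ring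
    bnd : ∀ k → k₀ ℕ.≤ k → T k + T k ≤ K * rcp (suc k)
    bnd k le with j , refl ← ℕ.m≤n⇒∃[o]m+o≡n le =
      *-cancelˡ-≤ {ι (suc (k₀ ℕ.+ j))} (ι-pos {suc (k₀ ℕ.+ j)} (s≤s z≤n))
        (lem₀ _ (T (k₀ ℕ.+ j)) (ι (suc k₀) + c) (T k₀) (rcp (suc (k₀ ℕ.+ j))) (rcp-inv {suc (k₀ ℕ.+ j)} (s≤s z≤n)) (scaled j))
      where
      lem₀ : ∀ a t b s r → r * a ≡ 1ℚ → a * t ≤ b * s → a * (t + t) ≤ a * (b * (s + s) * r)
      lem₀ a t b s r e h = subst (a * (t + t) ≤_) (sym (trans (lem₁ a b s r) (trans (cong (_* (b * (s + s))) e) (ℚ.*-identityˡ (b * (s + s))))))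
        (≤-by (h ⊕ h) (solve (a ∷ t ∷ b ∷ s ∷ []) ring))
        where
        lem₁ : ∀ a b s r → a * (b * (s + s) * r) ≡ r * a * (b * (s + s))
        lem₁ = solve-∀ ring

  rcp-eventually-small : ∀ B ε → 0ℚ < ε → Ev (λ i → ι B * rcp (suc i) ≤ ε)
  rcp-eventually-small B ε 0<ε = ev-from N λ i le → ℚ.≤-trans (ι-nonNeg B ⊛ rcp-antitone 1≤N (ℕ.m≤n⇒m≤1+n le)) bnd
    where
    0<B1 = ι-pos {suc B} (s≤s z≤n)
    small = rcp-archimedean (ε * recip (ι (suc B))) (*-pos 0<ε (recip-pos 0<B1))
    N = proj₁ small
    1≤N = proj₁ (proj₂ small)
    lem : ∀ e r B → B * (e * r) ≡ e * (r * B)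
    lem = solve-∀ ring
    bnd : ι B * rcp N ≤ ε
    bnd = ℚ.≤-trans (ι-nonNeg B ⊛ proj₂ (proj₂ small))
      (ℚ.≤-trans (subst₂ _≤_ (ℚ.*-comm _ (ι B)) (ℚ.*-comm _ (ι (suc B))) (*-nonNeg (ℚ.<⇒≤ 0<ε) (ℚ.<⇒≤ (recip-pos 0<B1)) ⊛ ι-mono (ℕ.n≤1+n B)))
      (ℚ.≤-reflexive (trans (lem ε (rcp (suc B)) (ι (suc B))) (trans (cong (ε *_) (recip-inv 0<B1)) (ℚ.*-identityʳ ε)))))

  Ex-additive : ∀ C ε → 0ℚ < ε → Ev (λ i → ∀ a b → ∣ a ∣ ≤ ι C → ∣ b ∣ ≤ ι C → ∣ Ex i a * Ex i b - Ex i (a + b) ∣ ≤ ε)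
  Ex-additive C ε 0<ε = ev-zip (λ i le h a b p q → ℚ.≤-trans (Ex-product-error i a b)
        (ℚ.≤-trans (diff-mono i (i ℕ.+ i) (ℕ.m≤m+n i i) (+-nonNeg (ℚ.0≤∣p∣ a) (ℚ.0≤∣p∣ b)) (subst (∣ a ∣ + ∣ b ∣ ≤_) (sym (ι-+ C C)) (p ⊕ q)))
        (ℚ.≤-trans (Ex-tail D le (ℕ.m≤m+n i i)) (ℚ.≤-trans (proj₂ (term-decay D) i le) h))))
      (ev-from (2 ℕ.* D) λ _ le → le) (rcp-eventually-small (proj₁ (term-decay D)) ε 0<ε)
    where
    D = C ℕ.+ C
    diff-mono : ∀ m n {a b} → m ℕ.≤ n → 0ℚ ≤ a → a ≤ b → Ex n a - Ex m a ≤ Ex n b - Ex m b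
    diff-mono m n {a} {b} m≤n h le with k , refl ← ℕ.m≤n⇒∃[o]m+o≡n m≤n = go k
      where
      z : ∀ a → a - a ≡ 0ℚ
      z = solve-∀ ring
      lem : ∀ x y t u v w → x - y ≤ u - v → t ≤ w → x + t - y ≤ u + w - v
      lem x y t u v w p q = ≤-by (p ⊕ q) (solve (x ∷ y ∷ t ∷ u ∷ v ∷ w ∷ []) ring)
      go : ∀ k → Ex (m ℕ.+ k) a - Ex m a ≤ Ex (m ℕ.+ k) b - Ex m b
      go zero    = subst (λ t → Ex t a - Ex m a ≤ Ex t b - Ex m b) (sym (ℕ.+-identityʳ m)) (ℚ.≤-reflexive (trans (z (Ex m a)) (sym (z (Ex m b)))))
      go (suc k) = subst (λ t → Ex t a - Ex m a ≤ Ex t b - Ex m b) (sym (ℕ.+-suc m k))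
        (lem (Ex (m ℕ.+ k) a) _ (term a (m ℕ.+ k)) (Ex (m ℕ.+ k) b) _ (term b (m ℕ.+ k)) (go k) (term-mono h le (m ℕ.+ k)))

  Ex-bounded : ∀ C → ∃ λ B → ∀ i a → ∣ a ∣ ≤ ι C → ∣ Ex i a ∣ ≤ ι B
  Ex-bounded C = proj₁ arch , λ i a h → ℚ.≤-trans (Ex-abs i a) (ℚ.≤-trans (Ex-mono i (ℚ.0≤∣p∣ a) h) (ℚ.≤-trans (bnd i) (proj₂ arch)))
    where
    k₀ = 2 ℕ.* C
    T = term (ι C)
    tn = term-nonNeg (ι-nonNeg C)
    arch = archimedean (Ex k₀ (ι C) + (T k₀ + T k₀))
    lem : ∀ a b c → a - b ≤ c → a ≤ b + c
    lem a b c h = ≤-by h (solve (a ∷ b ∷ c ∷ []) ring)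
    bnd : ∀ i → Ex i (ι C) ≤ Ex k₀ (ι C) + (T k₀ + T k₀)
    bnd i with ℕ.≤-total i k₀
    ... | inj₁ le = ℚ.≤-trans (∑₀-grow tn le) (≤-+ʳ (+-nonNeg (tn k₀) (tn k₀)))
    ... | inj₂ le = lem _ _ _ (Ex-tail C ℕ.≤-refl le)

  Ex-0 : ∀ i → 1 ℕ.≤ i → Ex i 0ℚ ≡ 1ℚ
  Ex-0 (suc i) _ = trans (∑₀-head i (term 0ℚ)) (trans (cong (1ℚ +_) (z i)) (ℚ.+-identityʳ 1ℚ))
    where
    t0 : ∀ k → term 0ℚ (suc k) ≡ 0ℚ
    t0 k = trans (cong (_* rcp (suc k)) (ℚ.*-zeroˡ (term 0ℚ k))) (ℚ.*-zeroˡ (rcp (suc k)))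
    z : ∀ i → ∑₀ i (λ k → term 0ℚ (suc k)) ≡ 0ℚ
    z zero    = refl
    z (suc i) = trans (cong₂ _+_ (z i) (t0 i)) (ℚ.+-identityˡ 0ℚ)

  Ex-≥1+ : ∀ i {a} → 2 ℕ.≤ i → 0ℚ ≤ a → 1ℚ + a ≤ Ex i a
  Ex-≥1+ i {a} 2≤i h = ℚ.≤-trans (ℚ.≤-reflexive (trans (lem a) (cong (λ t → 0ℚ + 1ℚ + a * 1ℚ * t) (sym r1)))) (∑₀-grow (term-nonNeg h) 2≤i)
    where
    lem : ∀ a → 1ℚ + a ≡ 0ℚ + 1ℚ + a * 1ℚ * 1ℚ
    lem = solve-∀ ring
    r1 : rcp 1 ≡ 1ℚ
    r1 = trans (sym (ℚ.*-identityʳ (rcp 1))) (trans (cong (rcp 1 *_) (sym ι1)) (rcp-inv {1} ℕ.≤-refl))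

  Ex-upper : ∀ i {s} → 0ℚ ≤ s → Ex i s - s * Ex i s ≤ 1ℚ
  Ex-upper i {s} h = lem₀ (Ex i s) (term s i) (term-nonNeg h i) (go i)
    where
    lem₀ : ∀ e t → 0ℚ ≤ t → e - s * e + t ≤ 1ℚ → e - s * e ≤ 1ℚ
    lem₀ e t p q = ≤-by (p ⊕ q) (solve (e ∷ t ∷ s ∷ []) ring)
    rcp≤1 : ∀ k → rcp (suc k) ≤ 1ℚ
    rcp≤1 k = subst (rcp (suc k) ≤_) (trans (sym (ℚ.*-identityʳ (rcp 1))) (trans (cong (rcp 1 *_) (sym ι1)) (rcp-inv {1} ℕ.≤-refl))) (rcp-antitone {1} ℕ.≤-refl (s≤s z≤n))
    lem : ∀ e t r → 0ℚ ≤ s * t → r ≤ 1ℚ → e - s * e + t ≤ 1ℚ → e + t - s * (e + t) + s * t * r ≤ 1ℚ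
    lem e t r p q k = ≤-by ((p ⊛ q) ⊕ k) (solve (e ∷ t ∷ r ∷ s ∷ []) ring)
    base : ∀ s → 0ℚ - s * 0ℚ + 1ℚ ≡ 1ℚ
    base = solve-∀ ring
    go : ∀ i → Ex i s - s * Ex i s + term s i ≤ 1ℚ
    go zero    = ℚ.≤-reflexive (base s)
    go (suc i) = lem (Ex i s) (term s i) (rcp (suc i)) (*-nonNeg h (term-nonNeg h i)) (rcp≤1 i) (go i)

  Ex-tangent₀ : ∀ C ε → 0ℚ < ε → Ev (λ i → ∀ a → ∣ a ∣ ≤ ι C → - ε ≤ Ex i a - (1ℚ + a))
  Ex-tangent₀ C ε 0<ε = ev-zip step (ev-from 2 λ _ le → le) (Ex-additive C ε 0<ε)
    where
    step : ∀ i → 2 ℕ.≤ i → (∀ a b → ∣ a ∣ ≤ ι C → ∣ b ∣ ≤ ι C → ∣ Ex i a * Ex i b - Ex i (a + b) ∣ ≤ ε) →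
      ∀ a → ∣ a ∣ ≤ ι C → - ε ≤ Ex i a - (1ℚ + a)
    step i 2≤i add a h with ℚ.≤-total 0ℚ a
    ... | inj₁ 0≤a = lem₁ (Ex i a) (1ℚ + a) (Ex-≥1+ i 2≤i 0≤a)
      where
      lem₁ : ∀ e b → b ≤ e → - ε ≤ e - b
      lem₁ e b p = ≤-by (p ⊕ ℚ.<⇒≤ 0<ε) (solve (e ∷ b ∷ ε ∷ []) ring)
    ... | inj₂ a≤0 with ℚ.≤-total 0ℚ (Ex i a - (1ℚ + a))
    ...   | inj₁ p = lem₁ (Ex i a - (1ℚ + a)) p
      where
      lem₁ : ∀ e → 0ℚ ≤ e → - ε ≤ e
      lem₁ e p = ≤-by (p ⊕ ℚ.<⇒≤ 0<ε) (solve (e ∷ ε ∷ []) ring)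
    ...   | inj₂ p = lem₂ (Ex i a) (Ex i (- a)) prod p (ℚ.≤-trans (≤-+ʳ 0≤-a) (Ex-≥1+ i 2≤i 0≤-a)) (Ex-upper i 0≤-a)
      where
      0≤-a : 0ℚ ≤ - a
      0≤-a = ≤-by a≤0 (solve (a ∷ []) ring)
      inv₀ : ∀ a → a + (- a) ≡ 0ℚ
      inv₀ = solve-∀ ring
      prod : 1ℚ - ε ≤ Ex i a * Ex i (- a)
      prod = lem₀ (Ex i a * Ex i (- a)) (∣∣≤⇒-≤ (subst (λ t → ∣ Ex i a * Ex i (- a) - t ∣ ≤ ε)
          (trans (cong (Ex i) (inv₀ a)) (Ex-0 i (ℕ.≤-trans (s≤s z≤n) 2≤i))) (add a (- a) h (subst (_≤ ι C) (sym (ℚ.∣-p∣≡∣p∣ a)) h))))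
        where
        lem₀ : ∀ x → - (x - 1ℚ) ≤ ε → 1ℚ - ε ≤ x
        lem₀ x q = ≤-by q (solve (x ∷ ε ∷ []) ring)
      lem₂ : ∀ x y → 1ℚ - ε ≤ x * y → x - (1ℚ + a) ≤ 0ℚ → 1ℚ ≤ y → y - (- a) * y ≤ 1ℚ → - ε ≤ x - (1ℚ + a)
      lem₂ x y p q r s = ≤-by (p ⊕ s ⊕ *-nonNeg (≤⇒0≤ q) (≤⇒0≤ r)) (solve (x ∷ y ∷ a ∷ ε ∷ []) ring)

module Logarithm where

  open import Data.Rational using (_≤_)
  open Rationals
  open Limits
  open ExponentialSeries

  Exp : Seq → Seq
  Exp x i = Ex i (x i)

  Bd-Exp : ∀ {x} → Bd x → Bd (Exp x)
  Bd-Exp {x} (C , b) = proj₁ (Ex-bounded C) , ev-map (λ i → proj₂ (Ex-bounded C) i (x i)) b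

  Bd-⊔ : ∀ {x y} → Bd x → Bd y → ∃ λ C → Ev (λ i → ∣ x i ∣ ≤ ι C × ∣ y i ∣ ≤ ι C)
  Bd-⊔ (C , p) (D , q) = C ℕ.+ D , ev-zip (λ i a b → ℚ.≤-trans a (ι-mono (ℕ.m≤m+n C D)) , ℚ.≤-trans b (ι-mono (ℕ.m≤n+m D C))) p q

  Exp-+-≤ : ∀ {x y} → Bd x → Bd y → Nn (λ i → Exp x i * Exp y i - Exp (λ i → x i + y i) i)
  Exp-+-≤ {x} {y} bx by .nn ε 0<ε = ev-zip (λ { i (p , q) h → lem _ (∣∣≤⇒-≤ (h (x i) (y i) p q)) }) (proj₂ (Bd-⊔ bx by)) (Ex-additive (proj₁ (Bd-⊔ bx by)) ε 0<ε)
    where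
    lem : ∀ a → - a ≤ ε → - ε ≤ a
    lem a h = ≤-by h (solve (a ∷ ε ∷ []) ring)

  Exp-+-≥ : ∀ {x y} → Bd x → Bd y → Nn (λ i → Exp (λ i → x i + y i) i - Exp x i * Exp y i)
  Exp-+-≥ {x} {y} bx by .nn ε 0<ε = ev-zip (λ { i (p , q) h → lem (Exp x i * Exp y i) _ (∣∣≤⇒≤ (h (x i) (y i) p q)) }) (proj₂ (Bd-⊔ bx by)) (Ex-additive (proj₁ (Bd-⊔ bx by)) ε 0<ε)
    where
    lem : ∀ a b → a - b ≤ ε → - ε ≤ b - a
    lem a b h = ≤-by h (solve (a ∷ b ∷ ε ∷ []) ring)

  Exp-tangent₀ : ∀ {x} → Bd x → Nn (λ i → Exp x i - (1ℚ + x i))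
  Exp-tangent₀ {x} (C , b) .nn ε 0<ε = ev-zip (λ i p h → h (x i) p) b (Ex-tangent₀ C ε 0<ε)

  Exp-nonNeg : ∀ {x} → Bd x → Nn (Exp x)
  Exp-nonNeg {x} b = Nn-by (Nn-+ (Exp-+-≥ bh bh) (Nn-≥ (λ i → square-nonNeg (Exp h i))))
      (λ i → trans (lem (Exp (λ i → h i + h i) i) (Exp h i * Exp h i)) (cong (Ex i) (lem₂ (x i))))
    where
    h : Seq
    h i = ½ * x i
    bh = Bd-* (Bd-const ½) b
    lem : ∀ a b → a - b + b ≡ a
    lem = solve-∀ ring
    lem₂ : ∀ a → ½ * a + ½ * a ≡ a
    lem₂ = solve-∀ ring

  Bd-- : ∀ {x y} → Bd x → Bd y → Bd (λ i → x i - y i)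
  Bd-- p q = Bd-+ p (Bd-neg q)

  Exp-tangent : ∀ {s t} → Bd s → Bd t → Nn (λ i → Exp s i - Exp t i * (1ℚ + (s i - t i)))
  Exp-tangent {s} {t} bs bt = Nn-by
    (Nn-+ (Exp-+-≥ bt bd) (Nn-* (Bd-Exp bt) (Bd-- (Bd-Exp bd) (Bd-+ (Bd-const 1ℚ) bd)) (Exp-nonNeg bt) (Exp-tangent₀ bd)))
    (λ i → trans (lem (Exp (λ i → t i + d i) i) (Exp t i) (Exp d i) (1ℚ + d i))
       (cong (λ u → Ex i u - Exp t i * (1ℚ + d i)) (lem₂ (s i) (t i))))
    where
    d : Seq
    d i = s i - t i
    bd = Bd-- bs bt
    lem : ∀ a b c e → a - b * c + b * (c - e) ≡ a - b * e
    lem = solve-∀ ring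
    lem₂ : ∀ s t → t + (s - t) ≡ s
    lem₂ = solve-∀ ring

  Exp-mono : ∀ {s t} → Bd s → Bd t → Nn (λ i → s i - t i) → Nn (λ i → Exp s i - Exp t i)
  Exp-mono {s} {t} bs bt h = Nn-by (Nn-+ (Exp-tangent bs bt) (Nn-* (Bd-Exp bt) (Bd-- bs bt) (Exp-nonNeg bt) h))
    (λ i → lem (Exp s i) (Exp t i) (s i - t i))
    where
    lem : ∀ a b d → a - b * (1ℚ + d) + b * d ≡ a - b
    lem = solve-∀ ring

  Exp-0 : ∀ {x} → (∀ i → x i ≡ 0ℚ) → Nn (λ i → Exp x i - 1ℚ) × Nn (λ i → 1ℚ - Exp x i)
  Exp-0 {x} e = Nn-ev (ev-from 1 λ i le → ℚ.≤-reflexive (sym (trans (cong (λ t → t - 1ℚ) (one i le)) (ℚ.+-inverseʳ 1ℚ)))) ,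
                Nn-ev (ev-from 1 λ i le → ℚ.≤-reflexive (sym (trans (cong (λ t → 1ℚ - t) (one i le)) (ℚ.+-inverseʳ 1ℚ))))
    where
    one : ∀ i → 1 ℕ.≤ i → Exp x i ≡ 1ℚ
    one i le = trans (cong (Ex i) (e i)) (Ex-0 i le)

  Exp-reflect : ∀ {s t} → Bd s → Bd t → Nn (λ i → Exp t i - Exp s i) → Nn (λ i → t i - s i)
  Exp-reflect {s} {t} bs bt h = Nn-by
    (Nn-+ (Nn-+ (Nn-* (Bd-Exp bn) bET (Exp-nonNeg bn) step) (Nn-* (Bd-- (Bd-const 1ℚ) bEE) (Bd-+ (Bd-const (ι C)) bd) one≥ d≥))
      (Nn-* (Bd-- bEE (Bd-const 1ℚ)) (Bd-const (ι C)) one≤ (Nn-≥ λ _ → ι-nonNeg C)))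
    (λ i → lem (Exp n i) (Exp t i) (t i - s i) (ι C))
    where
    n : Seq
    n i = - t i
    bn = Bd-neg bt
    bd = Bd-- bt bs
    C = bound bd
    bET = Bd-* (Bd-Exp bt) bd
    bEE = Bd-* (Bd-Exp bn) (Bd-Exp bt)
    z0 : ∀ a → (- a) + a ≡ 0ℚ
    z0 = solve-∀ ring
    e0 = Exp-0 {λ i → n i + t i} (λ i → z0 (t i))
    lem₄ : ∀ a b → a - b + (b - 1ℚ) ≡ a - 1ℚ
    lem₄ = solve-∀ ring
    lem₅ : ∀ a b → (1ℚ - b) + (b - a) ≡ 1ℚ - a
    lem₅ = solve-∀ ring
    one≤ : Nn (λ i → Exp n i * Exp t i - 1ℚ)
    one≤ = Nn-by (Nn-+ (Exp-+-≤ bn bt) (proj₁ e0)) (λ i → lem₄ (Exp n i * Exp t i) (Exp (λ i → n i + t i) i))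
    one≥ : Nn (λ i → 1ℚ - Exp n i * Exp t i)
    one≥ = Nn-by (Nn-+ (proj₂ e0) (Exp-+-≥ bn bt)) (λ i → lem₅ (Exp n i * Exp t i) (Exp (λ i → n i + t i) i))
    d≥ : Nn (λ i → ι C + (t i - s i))
    d≥ = Nn-ev (ev-map (λ i p → lem₆ (t i - s i) (ι C) (∣∣≤⇒-≤ p)) (isBounded bd))
      where
      lem₆ : ∀ a c → - a ≤ c → 0ℚ ≤ c + a
      lem₆ a c p = ≤-by p (solve (a ∷ c ∷ []) ring)
    step : Nn (λ i → Exp t i * (t i - s i))
    step = Nn-by (Nn-+ (Exp-tangent bs bt) h) (λ i → lem₇ (Exp s i) (Exp t i) (s i) (t i))
      where
      lem₇ : ∀ a b s t → a - b * (1ℚ + (s - t)) + (b - a) ≡ b * (t - s)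
      lem₇ = solve-∀ ring
    lem : ∀ n t d c → n * (t * d) + (1ℚ - n * t) * (c + d) + (n * t - 1ℚ) * c ≡ d
    lem = solve-∀ ring

  pow : ℚ → ℕ → ℚ
  pow y zero    = 1ℚ
  pow y (suc m) = y * pow y m

  pow-nonNeg : ∀ {y} → 0ℚ ≤ y → ∀ m → 0ℚ ≤ pow y m
  pow-nonNeg h zero    = 0≤1
  pow-nonNeg h (suc m) = *-nonNeg h (pow-nonNeg h m)

  pow-diff-upper : ∀ {y z} → 0ℚ ≤ y → y ≤ z → ∀ m → pow z (suc m) - pow y (suc m) ≤ ι (suc m) * ((z - y) * pow z m)
  pow-diff-upper {y} {z} 0≤y y≤z zero    = ℚ.≤-reflexive (trans (lem y z) (cong (_* ((z - y) * 1ℚ)) (sym ι1)))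
    where
    lem : ∀ y z → z * 1ℚ - y * 1ℚ ≡ 1ℚ * ((z - y) * 1ℚ)
    lem = solve-∀ ring
  pow-diff-upper {y} {z} 0≤y y≤z (suc m) = subst (λ t → pow z (2 ℕ.+ m) - pow y (2 ℕ.+ m) ≤ t * ((z - y) * pow z (suc m))) (sym (ι-suc (suc m)))
    (lem (pow z m) (pow y (suc m)) (ι (suc m)) (pow-diff-upper 0≤y y≤z m) (pow-mono (suc m)))
    where
    pow-mono : ∀ m → pow y m ≤ pow z m
    pow-mono zero    = ℚ.≤-refl
    pow-mono (suc m) = *-mono-≤ 0≤y (pow-nonNeg 0≤y m) y≤z (pow-mono m)
    lem : ∀ a b n → z * a - b ≤ n * ((z - y) * a) → b ≤ z * a → z * (z * a) - y * b ≤ (1ℚ + n) * ((z - y) * (z * a))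
    lem a b n p q = ≤-by ((ℚ.≤-trans 0≤y y≤z ⊛ p) ⊕ (≤⇒0≤ y≤z ⊛ q)) (solve (a ∷ b ∷ n ∷ y ∷ z ∷ []) ring)

  pow-diff-lower : ∀ {y z} → 0ℚ ≤ y → y ≤ z → ∀ m → ι (suc m) * ((z - y) * pow y m) ≤ pow z (suc m) - pow y (suc m)
  pow-diff-lower {y} {z} 0≤y y≤z zero    = ℚ.≤-reflexive (sym (trans (lem y z) (cong (_* ((z - y) * 1ℚ)) (sym ι1))))
    where
    lem : ∀ y z → z * 1ℚ - y * 1ℚ ≡ 1ℚ * ((z - y) * 1ℚ)
    lem = solve-∀ ring
  pow-diff-lower {y} {z} 0≤y y≤z (suc m) = subst (λ t → t * ((z - y) * pow y (suc m)) ≤ pow z (2 ℕ.+ m) - pow y (2 ℕ.+ m)) (sym (ι-suc (suc m)))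
    (lem (pow y m) (pow z (suc m)) (ι (suc m)) (pow-diff-lower 0≤y y≤z m) (pow-mono (suc m)))
    where
    pow-mono : ∀ m → pow y m ≤ pow z m
    pow-mono zero    = ℚ.≤-refl
    pow-mono (suc m) = *-mono-≤ 0≤y (pow-nonNeg 0≤y m) y≤z (pow-mono m)
    lem : ∀ a b n → n * ((z - y) * a) ≤ b - y * a → y * a ≤ b → (1ℚ + n) * ((z - y) * (y * a)) ≤ z * b - y * (y * a)
    lem a b n p q = ≤-by ((0≤y ⊛ p) ⊕ (≤⇒0≤ y≤z ⊛ q)) (solve (a ∷ b ∷ n ∷ y ∷ z ∷ []) ring)

  Artanh : ℕ → ℚ → ℚ
  Artanh i z = ∑₀ i (λ k → pow z (suc (2 ℕ.* k)) * rcp (suc (2 ℕ.* k)))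

  Geom : ℕ → ℚ → ℚ
  Geom i z = ∑₀ i (λ k → pow z (2 ℕ.* k))

  2*-suc : ∀ k → 2 ℕ.* suc k ≡ suc (suc (2 ℕ.* k))
  2*-suc k = cong suc (ℕ.+-suc k (k ℕ.+ 0))

  Geom-sum : ∀ i z → (1ℚ - z * z) * Geom i z ≡ 1ℚ - pow z (2 ℕ.* i)
  Geom-sum zero    z = lem z
    where
    lem : ∀ z → (1ℚ - z * z) * 0ℚ ≡ 1ℚ - 1ℚ
    lem = solve-∀ ring
  Geom-sum (suc i) z = trans (ℚ.*-distribˡ-+ (1ℚ - z * z) (Geom i z) (pow z (2 ℕ.* i))) (trans (cong (_+ (1ℚ - z * z) * pow z (2 ℕ.* i)) (Geom-sum i z))
    (trans (lem z (pow z (2 ℕ.* i))) (cong (λ t → 1ℚ - pow z t) (sym (2*-suc i)))))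
    where
    lem : ∀ z a → 1ℚ - a + (1ℚ - z * z) * a ≡ 1ℚ - z * (z * a)
    lem = solve-∀ ring

  Artanh-diff-upper : ∀ i {y z} → 0ℚ ≤ y → y ≤ z → Artanh i z - Artanh i y ≤ (z - y) * Geom i z
  Artanh-diff-upper zero    {y} {z} 0≤y y≤z = ℚ.≤-reflexive (lem (z - y))
    where
    lem : ∀ d → 0ℚ - 0ℚ ≡ d * 0ℚ
    lem = solve-∀ ring
  Artanh-diff-upper (suc i) {y} {z} 0≤y y≤z = lem (Artanh i z) (Artanh i y) (Geom i z) (pow z (suc m)) (pow y (suc m)) (pow z m) (rcp (suc m)) (ι (suc m))
      (rcp-inv (s≤s z≤n)) (Artanh-diff-upper i 0≤y y≤z) (rcp-nonNeg (suc m) ⊛ pow-diff-upper 0≤y y≤z m)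
    where
    m = 2 ℕ.* i
    lem : ∀ U V G a b c r n → r * n ≡ 1ℚ → U - V ≤ (z - y) * G → r * (a - b) ≤ r * (n * ((z - y) * c)) → U + a * r - (V + b * r) ≤ (z - y) * (G + c)
    lem U V G a b c r n e p q = ≤-by (p ⊕ subst (r * (a - b) ≤_) (trans (sym (ℚ.*-assoc r n ((z - y) * c))) (cong (_* ((z - y) * c)) e)) q) (solve (U ∷ V ∷ G ∷ a ∷ b ∷ c ∷ r ∷ y ∷ z ∷ []) ring)

  Artanh-diff-lower : ∀ i {y z} → 0ℚ ≤ y → y ≤ z → (z - y) * Geom i y ≤ Artanh i z - Artanh i y
  Artanh-diff-lower zero    {y} {z} 0≤y y≤z = ℚ.≤-reflexive (sym (lem (z - y)))
    where
    lem : ∀ d → 0ℚ - 0ℚ ≡ d * 0ℚ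
    lem = solve-∀ ring
  Artanh-diff-lower (suc i) {y} {z} 0≤y y≤z = lem (Artanh i z) (Artanh i y) (Geom i y) (pow z (suc m)) (pow y (suc m)) (pow y m) (rcp (suc m)) (ι (suc m))
      (rcp-inv (s≤s z≤n)) (Artanh-diff-lower i 0≤y y≤z) (rcp-nonNeg (suc m) ⊛ pow-diff-lower 0≤y y≤z m)
    where
    m = 2 ℕ.* i
    lem : ∀ U V G a b c r n → r * n ≡ 1ℚ → (z - y) * G ≤ U - V → r * (n * ((z - y) * c)) ≤ r * (a - b) → (z - y) * (G + c) ≤ U + a * r - (V + b * r)
    lem U V G a b c r n e p q = ≤-by (p ⊕ subst (_≤ r * (a - b)) (trans (sym (ℚ.*-assoc r n ((z - y) * c))) (cong (_* ((z - y) * c)) e)) q) (solve (U ∷ V ∷ G ∷ a ∷ b ∷ c ∷ r ∷ y ∷ z ∷ []) ring)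

  cayley : ℚ → ℚ
  cayley x = (x - 1ℚ) * recip (x + 1ℚ)

  Lg : ℕ → ℚ → ℚ
  Lg i x = ι 2 * Artanh i (cayley x)

  module _ {x : ℚ} (1≤x : 1ℚ ≤ x) where
    x+1-pos : 0ℚ < x + 1ℚ
    x+1-pos = ℚ.<-≤-trans 0<1 (≤-by (0≤1 ⊕ 1≤x) (solve (x ∷ []) ring))

    cayley-* : cayley x * (x + 1ℚ) ≡ x - 1ℚ
    cayley-* = trans (ℚ.*-assoc (x - 1ℚ) (recip (x + 1ℚ)) (x + 1ℚ)) (trans (cong ((x - 1ℚ) *_) (recip-inv x+1-pos)) (ℚ.*-identityʳ (x - 1ℚ)))

    cayley-nonNeg : 0ℚ ≤ cayley x
    cayley-nonNeg = *-nonNeg (≤⇒0≤ 1≤x) (ℚ.<⇒≤ (recip-pos x+1-pos))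

    1-cayley-pos : 0ℚ < 1ℚ - cayley x
    1-cayley-pos = subst (0ℚ <_) (trans (lem x (recip (x + 1ℚ))) (cong (λ t → t - cayley x) (recip-inv x+1-pos)))
       (*-pos (ℚ.positive⁻¹ (1ℚ + 1ℚ)) (recip-pos x+1-pos))
      where
      lem : ∀ x r → (1ℚ + 1ℚ) * r ≡ r * (x + 1ℚ) - (x - 1ℚ) * r
      lem = solve-∀ ring

    cayley-square : 0ℚ ≤ 1ℚ - cayley x * cayley x
    cayley-square = lem (cayley x) cayley-nonNeg (ℚ.<⇒≤ 1-cayley-pos)
      where
      lem : ∀ y → 0ℚ ≤ y → 0ℚ ≤ 1ℚ - y → 0ℚ ≤ 1ℚ - y * y
      lem y p q = ≤-by (*-nonNeg p q ⊕ q) (solve (y ∷ []) ring)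

  module _ {x x′ : ℚ} (1≤x : 1ℚ ≤ x) (x≤x′ : x ≤ x′) where
    private
      1≤x′ = ℚ.≤-trans 1≤x x≤x′
      y = cayley x
      z = cayley x′
      0≤a : 0ℚ ≤ x + 1ℚ
      0≤a = ℚ.<⇒≤ (x+1-pos 1≤x)
      0≤b : 0ℚ ≤ x′ + 1ℚ
      0≤b = ℚ.<⇒≤ (x+1-pos 1≤x′)
      cross : (x′ + 1ℚ) * (x + 1ℚ) * (z - y) ≡ (1ℚ + 1ℚ) * (x′ - x)
      cross = trans (lem x x′ y z) (trans (cong₂ (λ s t → (x + 1ℚ) * s - (x′ + 1ℚ) * t) (cayley-* 1≤x′) (cayley-* 1≤x)) (lem₂ x x′))
        where
        lem : ∀ x x′ y z → (x′ + 1ℚ) * (x + 1ℚ) * (z - y) ≡ (x + 1ℚ) * (z * (x′ + 1ℚ)) - (x′ + 1ℚ) * (y * (x + 1ℚ))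
        lem = solve-∀ ring
        lem₂ : ∀ x x′ → (x + 1ℚ) * (x′ - 1ℚ) - (x′ + 1ℚ) * (x - 1ℚ) ≡ (1ℚ + 1ℚ) * (x′ - x)
        lem₂ = solve-∀ ring
      y≤z : y ≤ z
      y≤z = *-cancelˡ-≤ (*-pos (x+1-pos 1≤x′) (x+1-pos 1≤x)) (lem ((x′ + 1ℚ) * (x + 1ℚ)) y z (subst (0ℚ ≤_) (sym cross) (*-nonNeg (ℚ.<⇒≤ (ℚ.positive⁻¹ (1ℚ + 1ℚ))) (≤⇒0≤ x≤x′))))
        where
        lem : ∀ c y z → 0ℚ ≤ c * (z - y) → c * y ≤ c * z
        lem c y z h = ≤-by h (solve (c ∷ y ∷ z ∷ []) ring)
      0≤y = cayley-nonNeg 1≤x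
      ι2 : ι 2 ≡ 1ℚ + 1ℚ
      ι2 = trans (ι-suc 1) (cong (1ℚ +_) ι1)
      square : ∀ {t} (p : 1ℚ ≤ t) → (t + 1ℚ) * (t + 1ℚ) * (1ℚ - cayley t * cayley t) ≡ (1ℚ + 1ℚ) * (1ℚ + 1ℚ) * t
      square {t} p = trans (lem t (cayley t)) (trans (cong (λ s → (t + 1ℚ) * (t + 1ℚ) - s * s) (cayley-* p)) (lem₂ t))
        where
        lem : ∀ t c → (t + 1ℚ) * (t + 1ℚ) * (1ℚ - c * c) ≡ (t + 1ℚ) * (t + 1ℚ) - c * (t + 1ℚ) * (c * (t + 1ℚ))
        lem = solve-∀ ring
        lem₂ : ∀ t → (t + 1ℚ) * (t + 1ℚ) - (t - 1ℚ) * (t - 1ℚ) ≡ (1ℚ + 1ℚ) * (1ℚ + 1ℚ) * t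
        lem₂ = solve-∀ ring
      0<2 : 0ℚ < 1ℚ + 1ℚ
      0<2 = ℚ.positive⁻¹ (1ℚ + 1ℚ)

    Lg-diff-upper : ∀ i → x′ * (x + 1ℚ) * (Lg i x′ - Lg i x) ≤ (x′ - x) * (x′ + 1ℚ)
    Lg-diff-upper i = *-cancelˡ-≤ 0<2 (subst₂ _≤_
        (trans (lem₁ (x + 1ℚ) (x′ + 1ℚ) (1ℚ - z * z) D) (trans (cong (λ t → (x + 1ℚ) * t * D) (square 1≤x′))
           (trans (lem₂ (x + 1ℚ) x′ A₁ A₀) (cong (λ t → (1ℚ + 1ℚ) * (x′ * (x + 1ℚ) * (t * A₁ - t * A₀))) (sym ι2)))))
        (trans (lem₃ (x + 1ℚ) (x′ + 1ℚ) (z - y)) (trans (cong (_* (x′ + 1ℚ)) cross) (ℚ.*-assoc (1ℚ + 1ℚ) (x′ - x) (x′ + 1ℚ))))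
        (*-nonNeg 0≤a (*-nonNeg 0≤b 0≤b) ⊛ key))
      where
      A₁ = Artanh i z
      A₀ = Artanh i y
      D = A₁ - A₀
      key : (1ℚ - z * z) * D ≤ z - y
      key = ℚ.≤-trans (cayley-square 1≤x′ ⊛ Artanh-diff-upper i 0≤y y≤z)
        (lem (1ℚ - z * z) (z - y) (Geom i z) (pow z (2 ℕ.* i)) (Geom-sum i z) (≤⇒0≤ y≤z) (pow-nonNeg (cayley-nonNeg 1≤x′) (2 ℕ.* i)))
        where
        lem : ∀ s d G p → s * G ≡ 1ℚ - p → 0ℚ ≤ d → 0ℚ ≤ p → s * (d * G) ≤ d
        lem s d G p e h k = subst (_≤ d) (trans (cong (d *_) (sym e)) (lem′ s d G)) (≤-by (*-nonNeg h k) (solve (d ∷ p ∷ []) ring))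
          where
          lem′ : ∀ s d G → d * (s * G) ≡ s * (d * G)
          lem′ = solve-∀ ring
      lem₁ : ∀ a b s D → a * (b * b) * (s * D) ≡ a * (b * b * s) * D
      lem₁ = solve-∀ ring
      lem₂ : ∀ a x′ u v → a * ((1ℚ + 1ℚ) * (1ℚ + 1ℚ) * x′) * (u - v) ≡ (1ℚ + 1ℚ) * (x′ * a * ((1ℚ + 1ℚ) * u - (1ℚ + 1ℚ) * v))
      lem₂ = solve-∀ ring
      lem₃ : ∀ a b d → a * (b * b) * d ≡ b * a * d * b
      lem₃ = solve-∀ ring

    Lg-diff-lower : ∀ i → (x′ - x) * (x + 1ℚ) * (1ℚ - pow (cayley x) (2 ℕ.* i)) ≤ x * (x′ + 1ℚ) * (Lg i x′ - Lg i x)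
    Lg-diff-lower i = *-cancelˡ-≤ 0<2 (subst₂ _≤_
        (trans (lem₃ (x + 1ℚ) (x′ + 1ℚ) (z - y) P) (trans (cong (λ t → t * ((x + 1ℚ) * P)) cross) (lem₄ (x′ - x) (x + 1ℚ) P)))
        (trans (lem₁ (x + 1ℚ) (x′ + 1ℚ) (1ℚ - y * y) D) (trans (cong (λ t → (x′ + 1ℚ) * t * D) (square 1≤x))
           (trans (lem₂ (x′ + 1ℚ) x A₁ A₀) (cong (λ t → (1ℚ + 1ℚ) * (x * (x′ + 1ℚ) * (t * A₁ - t * A₀))) (sym ι2)))))
        (*-nonNeg 0≤b (*-nonNeg 0≤a 0≤a) ⊛ key))
      where
      A₁ = Artanh i z
      A₀ = Artanh i y
      D = A₁ - A₀
      P = 1ℚ - pow y (2 ℕ.* i)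
      key : (z - y) * P ≤ (1ℚ - y * y) * D
      key = ℚ.≤-trans (ℚ.≤-reflexive (trans (cong ((z - y) *_) (sym (Geom-sum i y))) (lem (1ℚ - y * y) (z - y) (Geom i y)))) (cayley-square 1≤x ⊛ Artanh-diff-lower i 0≤y y≤z)
        where
        lem : ∀ s d G → d * (s * G) ≡ s * (d * G)
        lem = solve-∀ ring
      lem₁ : ∀ a b s D → b * (a * a) * (s * D) ≡ b * (a * a * s) * D
      lem₁ = solve-∀ ring
      lem₂ : ∀ a x′ u v → a * ((1ℚ + 1ℚ) * (1ℚ + 1ℚ) * x′) * (u - v) ≡ (1ℚ + 1ℚ) * (x′ * a * ((1ℚ + 1ℚ) * u - (1ℚ + 1ℚ) * v))
      lem₂ = solve-∀ ring
      lem₃ : ∀ a b d P → b * (a * a) * (d * P) ≡ b * a * d * (a * P)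
      lem₃ = solve-∀ ring
      lem₄ : ∀ d a P → (1ℚ + 1ℚ) * d * (a * P) ≡ (1ℚ + 1ℚ) * (d * a * P)
      lem₄ = solve-∀ ring

    Lg-mono : ∀ i → Lg i x ≤ Lg i x′
    Lg-mono i = lem (ι 2) (Artanh i z) (Artanh i y) (ι-nonNeg 2) (ℚ.≤-trans (*-nonNeg (≤⇒0≤ y≤z) (∑₀-nonNeg i (λ k → pow-nonNeg 0≤y (2 ℕ.* k)))) (Artanh-diff-lower i 0≤y y≤z))
      where
      lem : ∀ c u v → 0ℚ ≤ c → 0ℚ ≤ u - v → c * v ≤ c * u
      lem c u v p q = ≤-by (*-nonNeg p q) (solve (c ∷ u ∷ v ∷ []) ring)

  pow-decay : ∀ {y} → 0ℚ ≤ y → 0ℚ ≤ 1ℚ - y → ∀ m → pow y m * (1ℚ + ι m * (1ℚ - y)) ≤ 1ℚ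
  pow-decay {y} p q zero    = ℚ.≤-reflexive (trans (cong (λ t → 1ℚ * (1ℚ + t * (1ℚ - y))) ι0) (lem y))
    where
    lem : ∀ y → 1ℚ * (1ℚ + 0ℚ * (1ℚ - y)) ≡ 1ℚ
    lem = solve-∀ ring
  pow-decay {y} p q (suc m) = ℚ.≤-trans (subst (λ t → y * pow y m * (1ℚ + t * (1ℚ - y)) ≤ pow y m * (1ℚ + ι m * (1ℚ - y))) (sym (ι-suc m))
      (lem (pow y m) (ι m) (*-nonNeg (pow-nonNeg p m) (*-nonNeg (+-nonNeg 0≤1 (ι-nonNeg m)) (*-nonNeg q q))))) (pow-decay p q m)
    where
    lem : ∀ a n → 0ℚ ≤ a * ((1ℚ + n) * ((1ℚ - y) * (1ℚ - y))) → y * a * (1ℚ + (1ℚ + n) * (1ℚ - y)) ≤ a * (1ℚ + n * (1ℚ - y))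
    lem a n h = ≤-by h (solve (a ∷ n ∷ y ∷ []) ring)

  pow-vanishes : ∀ {y} → 0ℚ ≤ y → 0ℚ < 1ℚ - y → Nn (λ i → - pow y (2 ℕ.* i))
  pow-vanishes {y} p q .nn ε 0<ε = ev-map (λ i h → ℚ.neg-antimono-≤ (ℚ.≤-trans (bnd i) h)) (rcp-eventually-small B ε 0<ε)
    where
    u = 1ℚ - y
    arch = archimedean (1ℚ + recip u)
    B = proj₁ arch
    bnd : ∀ i → pow y (2 ℕ.* i) ≤ ι B * rcp (suc i)
    bnd i = *-cancelˡ-≤ (*-pos q (ι-pos {suc i} (s≤s z≤n)))
      (lem (pow y m) u (ι i) (ι (suc i)) (ι m) (ι B) (rcp (suc i)) (recip u)
        (ι-suc i) (rcp-inv {suc i} (s≤s z≤n)) (recip-inv q) (pow-nonNeg p m) (ℚ.<⇒≤ q) u≤1 (ι-mono (ℕ.m≤m+n i (i ℕ.+ 0))) (proj₂ arch) (pow-decay p (ℚ.<⇒≤ q) m))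
      where
      m = 2 ℕ.* i
      u≤1 : 1ℚ - y ≤ 1ℚ
      u≤1 = ≤-by p (solve (y ∷ []) ring)
      lem : ∀ P u j s n b r v → s ≡ 1ℚ + j → r * s ≡ 1ℚ → v * u ≡ 1ℚ → 0ℚ ≤ P → 0ℚ ≤ u → u ≤ 1ℚ → j ≤ n → 1ℚ + v ≤ b → P * (1ℚ + n * u) ≤ 1ℚ → u * s * P ≤ u * s * (b * r)
      lem P u j s n b r v refl e f hP hu u1 jn vb dec = subst (u * (1ℚ + j) * P ≤_) (trans (cong (u * b *_) (sym e)) (lem″ u b r (1ℚ + j)))
        (ℚ.≤-trans s₁ (ℚ.≤-trans s₂ (subst (u * (1ℚ + v) ≤_) (sym (ℚ.*-identityʳ (u * b))) (hu ⊛ vb))))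
        where
        s₁ : u * (1ℚ + j) * P ≤ 1ℚ
        s₁ = ≤-by ((hP ⊛ u1) ⊕ (*-nonNeg hP hu ⊛ jn) ⊕ dec) (solve (P ∷ u ∷ j ∷ n ∷ []) ring)
        s₂ : 1ℚ ≤ u * (1ℚ + v)
        s₂ = ≤-by (hu ⊕ ℚ.≤-reflexive (sym f)) (solve (v ∷ u ∷ []) ring)
        lem″ : ∀ u b r s → u * b * (r * s) ≡ u * s * (b * r)
        lem″ = solve-∀ ring

module RealPowers where

  open import Data.Rational using (_≤_)
  open Rationals
  open Limits
  open ExponentialSeries
  open Logarithm

  1≤ι : ∀ {n} → 1 ℕ.≤ n → 1ℚ ≤ ι n
  1≤ι {n} h = subst (_≤ ι n) ι1 (ι-mono h)

  Lg-1 : ∀ i → Lg i 1ℚ ≡ 0ℚ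
  Lg-1 i = trans (cong (ι 2 *_) (trans (cong (Artanh i) (ℚ.*-zeroˡ (recip (1ℚ + 1ℚ)))) (z i))) (ℚ.*-zeroʳ (ι 2))
    where
    lem : ∀ a b → 0ℚ * a * b ≡ 0ℚ
    lem = solve-∀ ring
    z : ∀ i → Artanh i 0ℚ ≡ 0ℚ
    z zero    = refl
    z (suc i) = trans (cong₂ _+_ (z i) (lem (pow 0ℚ (2 ℕ.* i)) (rcp (suc (2 ℕ.* i))))) (ℚ.+-identityˡ 0ℚ)

  Lg-nonNeg : ∀ {x} → 1ℚ ≤ x → ∀ i → 0ℚ ≤ Lg i x
  Lg-nonNeg {x} h i = subst (_≤ Lg i x) (Lg-1 i) (Lg-mono ℚ.≤-refl h i)

  Lg-upper : ∀ {x} → 1ℚ ≤ x → ∀ i → Lg i x ≤ x * x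
  Lg-upper {x} h i = lem x (Lg i x) h (Lg-nonNeg h i) (subst (λ t → x * (1ℚ + 1ℚ) * (Lg i x - t) ≤ (x - 1ℚ) * (x + 1ℚ)) (Lg-1 i) (Lg-diff-upper ℚ.≤-refl h i))
    where
    lem : ∀ x l → 1ℚ ≤ x → 0ℚ ≤ l → x * (1ℚ + 1ℚ) * (l - 0ℚ) ≤ (x - 1ℚ) * (x + 1ℚ) → l ≤ x * x
    lem x l p q r = ≤-by (r ⊕ (q ⊛ p) ⊕ (q ⊛ p) ⊕ q ⊕ 0≤1) (solve (x ∷ l ∷ []) ring)

  LS : ℚ → Seq
  LS x i = Lg i x

  Bd-LS : ∀ {x} → 1ℚ ≤ x → Bd (LS x)
  Bd-LS {x} h = proj₁ (archimedean (x * x)) , ev-now λ i → ℚ.≤-trans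
    (∣∣-least (Lg-upper h i) (lem (Lg i x) (x * x) (Lg-nonNeg h i) (square-nonNeg x))) (proj₂ (archimedean (x * x)))
    where
    lem : ∀ a b → 0ℚ ≤ a → 0ℚ ≤ b → - a ≤ b
    lem a b p q = ≤-by (p ⊕ q) (solve (a ∷ b ∷ []) ring)

  pow-≤1 : ∀ {y} → 0ℚ ≤ y → y ≤ 1ℚ → ∀ m → pow y m ≤ 1ℚ
  pow-≤1 p q zero    = ℚ.≤-refl
  pow-≤1 p q (suc m) = *-mono-≤ p (pow-nonNeg p m) q (pow-≤1 p q m)

  -- The interval [1, m] is cut into steps of length 1 / N; on each of them the
  -- increment of log lies between 1 / (j + 1) and 1 / j, up to a vanishing error.
  module Mesh (M : ℕ) where
    N = suc M
    n = ι N
    r = rcp N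
    rn : r * n ≡ 1ℚ
    rn = rcp-inv (s≤s z≤n)

    point : ℕ → ℚ
    point j = ι j * r

    point-≥1 : ∀ {j} → N ℕ.≤ j → 1ℚ ≤ point j
    point-≥1 {j} h = subst₂ _≤_ rn (ℚ.*-comm r (ι j)) (rcp-nonNeg N ⊛ ι-mono h)

    point-step : ∀ j → point (suc j) ≡ (1ℚ + ι j) * r
    point-step j = cong (_* r) (ι-suc j)

    point-mono : ∀ j → point j ≤ point (suc j)
    point-mono j = subst₂ _≤_ (ℚ.*-comm r (ι j)) (ℚ.*-comm r (ι (suc j))) (rcp-nonNeg N ⊛ ι-mono (ℕ.n≤1+n j))

    Δ : ℕ → Seq
    Δ j i = Lg i (point (suc j)) - Lg i (point j)

    e : ℕ → Seq
    e j = Exp (LS (point j))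

    module _ (j : ℕ) (N≤j : N ℕ.≤ j) where
      private
        a = ι j
        1≤x = point-≥1 N≤j
        1≤x′ = point-≥1 (ℕ.m≤n⇒m≤1+n N≤j)
        bx = Bd-LS 1≤x
        bx′ = Bd-LS 1≤x′
        0≤Δ : ∀ i → 0ℚ ≤ Δ j i
        0≤Δ i = ≤⇒0≤ (Lg-mono 1≤x (point-mono j) i)
        p : Seq
        p i = pow (cayley (point j)) (2 ℕ.* i)
        bΔ = Bd-- bx′ bx
        scale : ∀ r n a → r * n ≡ 1ℚ → ∀ Δ → n * n * ((1ℚ + a) * r * (a * r + 1ℚ) * Δ) ≡ (1ℚ + a) * (a + n) * Δ
        scale r n a e Δ = trans (lem r n a Δ) (trans (cong (λ t → (1ℚ + a) * t * (a * t + n) * Δ) e) (lem₂ a n Δ))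
          where
          lem : ∀ r n a Δ → n * n * ((1ℚ + a) * r * (a * r + 1ℚ) * Δ) ≡ (1ℚ + a) * (r * n) * (a * (r * n) + n) * Δ
          lem = solve-∀ ring
          lem₂ : ∀ a n Δ → (1ℚ + a) * 1ℚ * (a * 1ℚ + n) * Δ ≡ (1ℚ + a) * (a + n) * Δ
          lem₂ = solve-∀ ring
        scale₂ : ∀ r n a b → r * n ≡ 1ℚ → ∀ Δ → n * n * (((1ℚ + a) * r - a * r) * (b * r + 1ℚ) * Δ) ≡ (b + n) * Δ
        scale₂ r n a b e Δ = trans (lem r n a b Δ) (trans (cong (λ t → t * (b * t + n) * Δ) e) (lem₂ b n Δ))
          where
          lem : ∀ r n a b Δ → n * n * (((1ℚ + a) * r - a * r) * (b * r + 1ℚ) * Δ) ≡ (r * n) * (b * (r * n) + n) * Δ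
          lem = solve-∀ ring
          lem₂ : ∀ a n Δ → 1ℚ * (a * 1ℚ + n) * Δ ≡ (a + n) * Δ
          lem₂ = solve-∀ ring
        scale₃ : ∀ r n a → r * n ≡ 1ℚ → ∀ Δ → n * n * (a * r * ((1ℚ + a) * r + 1ℚ) * Δ) ≡ a * (1ℚ + a + n) * Δ
        scale₃ r n a e Δ = trans (lem r n a Δ) (trans (cong (λ t → a * t * ((1ℚ + a) * t + n) * Δ) e) (lem₂ a n Δ))
          where
          lem : ∀ r n a Δ → n * n * (a * r * ((1ℚ + a) * r + 1ℚ) * Δ) ≡ a * (r * n) * ((1ℚ + a) * (r * n) + n) * Δ
          lem = solve-∀ ring
          lem₂ : ∀ a n Δ → a * 1ℚ * ((1ℚ + a) * 1ℚ + n) * Δ ≡ a * (1ℚ + a + n) * Δ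
          lem₂ = solve-∀ ring
        0≤nn : 0ℚ ≤ n * n
        0≤nn = square-nonNeg n
        0<an : ∀ b → 0ℚ ≤ b → 0ℚ < b + n
        0<an b h = ℚ.<-≤-trans (ι-pos {N} (s≤s z≤n)) (≤-by h (lem b n))
          where
          lem : ∀ b n → 0ℚ + (b + n) ≡ b + n
          lem = solve-∀ ring

        increment-upper : ∀ i → a * Δ j i ≤ 1ℚ
        increment-upper i = *-cancelˡ-≤ (0<an (1ℚ + a) (+-nonNeg 0≤1 (ι-nonNeg j))) (fin a n (Δ j i) (*-nonNeg (ι-nonNeg N) (0≤Δ i))
            (subst₂ _≤_ (scale r n a rn (Δ j i)) (trans (cong (n * n *_) (sym (ℚ.*-identityʳ _))) (scale₂ r n a (1ℚ + a) rn 1ℚ)) (0≤nn ⊛ h)))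
          where
          h : (1ℚ + a) * r * (a * r + 1ℚ) * Δ j i ≤ ((1ℚ + a) * r - a * r) * ((1ℚ + a) * r + 1ℚ)
          h = subst (λ t → t * (point j + 1ℚ) * Δ j i ≤ (t - point j) * (t + 1ℚ)) (point-step j) (Lg-diff-upper 1≤x (point-mono j) i)
          fin : ∀ a n D → 0ℚ ≤ n * D → (1ℚ + a) * (a + n) * D ≤ (1ℚ + a + n) * 1ℚ → (1ℚ + a + n) * (a * D) ≤ (1ℚ + a + n) * 1ℚ
          fin a n D q h = ≤-by (h ⊕ q) (solve (a ∷ n ∷ D ∷ []) ring)

        increment-lower : ∀ i → 1ℚ - p i ≤ (1ℚ + a) * Δ j i
        increment-lower i = *-cancelˡ-≤ (0<an a (ι-nonNeg j)) (fin a n (Δ j i) (1ℚ - p i) (*-nonNeg (ι-nonNeg N) (0≤Δ i))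
            (subst₂ _≤_ (scale₂ r n a a rn (1ℚ - p i)) (scale₃ r n a rn (Δ j i)) (0≤nn ⊛ h)))
          where
          h : ((1ℚ + a) * r - a * r) * (a * r + 1ℚ) * (1ℚ - p i) ≤ a * r * ((1ℚ + a) * r + 1ℚ) * Δ j i
          h = subst (λ t → (t - point j) * (point j + 1ℚ) * (1ℚ - p i) ≤ point j * (t + 1ℚ) * Δ j i) (point-step j) (Lg-diff-lower 1≤x (point-mono j) i)
          fin : ∀ a n D P → 0ℚ ≤ n * D → (a + n) * P ≤ a * (1ℚ + a + n) * D → (a + n) * P ≤ (a + n) * ((1ℚ + a) * D)
          fin a n D P q h = ≤-by (h ⊕ q) (solve (a ∷ n ∷ D ∷ P ∷ []) ring)

      step-lower : Nn (λ i → (1ℚ + ι j) * e (suc j) i - (1ℚ + (1ℚ + ι j)) * e j i)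
      step-lower = Nn-by (Nn-+ (Nn-+ (Nn-scale 0≤1a (Bd-- (Bd-Exp bx′) (Bd-* (Bd-Exp bx) (Bd-+ (Bd-const 1ℚ) bΔ))) (Exp-tangent bx′ bx))
          (Nn-* (Bd-Exp bx) bI (Exp-nonNeg bx) (Nn-≥ (λ i → ≤⇒0≤ (increment-lower i)))))
          (Nn-* (Bd-Exp bx) (Bd-neg bp) (Exp-nonNeg bx) (pow-vanishes (cayley-nonNeg 1≤x) (1-cayley-pos 1≤x))))
        (λ i → lem a (e (suc j) i) (e j i) (Δ j i) (p i))
        where
        0≤1a = +-nonNeg 0≤1 (ι-nonNeg j)
        y≤1 : cayley (point j) ≤ 1ℚ
        y≤1 = lem′ (cayley (point j)) (ℚ.<⇒≤ (1-cayley-pos 1≤x))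
          where
          lem′ : ∀ y → 0ℚ ≤ 1ℚ - y → y ≤ 1ℚ
          lem′ y h = ≤-by h (solve (y ∷ []) ring)
        bp : Bd p
        bp = 1 , ev-now λ i → subst (_≤ ι 1) (sym (ℚ.0≤p⇒∣p∣≡p (pow-nonNeg (cayley-nonNeg 1≤x) (2 ℕ.* i))))
               (subst (p i ≤_) (sym ι1) (pow-≤1 (cayley-nonNeg 1≤x) y≤1 (2 ℕ.* i)))
        bI : Bd (λ i → (1ℚ + a) * Δ j i - (1ℚ - p i))
        bI = Bd-- (Bd-* (Bd-const (1ℚ + a)) bΔ) (Bd-- (Bd-const 1ℚ) bp)
        lem : ∀ a e′ e Δ p → (1ℚ + a) * (e′ - e * (1ℚ + Δ)) + e * ((1ℚ + a) * Δ - (1ℚ - p)) + e * (- p) ≡ (1ℚ + a) * e′ - (1ℚ + (1ℚ + a)) * e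
        lem = solve-∀ ring

      step-upper : Nn (λ i → ι j * e j i - (ι j - 1ℚ) * e (suc j) i)
      step-upper = Nn-by (Nn-+ (Nn-scale (ι-nonNeg j) (Bd-- (Bd-Exp bx) (Bd-* (Bd-Exp bx′) (Bd-+ (Bd-const 1ℚ) (Bd-- bx bx′)))) (Exp-tangent bx bx′))
          (Nn-* (Bd-Exp bx′) (Bd-- (Bd-const 1ℚ) (Bd-* (Bd-const a) bΔ)) (Exp-nonNeg bx′) (Nn-≥ (λ i → ≤⇒0≤ (increment-upper i)))))
        (λ i → lem a (e (suc j) i) (e j i) (Lg i (point (suc j))) (Lg i (point j)))
        where
        lem : ∀ a e′ e x′ x → a * (e - e′ * (1ℚ + (x - x′))) + e′ * (1ℚ - a * (x′ - x)) ≡ a * e - (a - 1ℚ) * e′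
        lem = solve-∀ ring

    Bd-e : ∀ {j} → N ℕ.≤ j → Bd (e j)
    Bd-e h = Bd-Exp (Bd-LS (point-≥1 h))

    e-base : Nn (λ i → e N i - 1ℚ) × Nn (λ i → 1ℚ - e N i)
    e-base = Exp-0 (λ i → trans (cong (Lg i) (trans (ℚ.*-comm n r) rn)) (Lg-1 i))

    lower : ∀ t → Nn (λ i → (n + 1ℚ) * e (N ℕ.+ t) i - (ι (N ℕ.+ t) + 1ℚ))
    lower zero    = subst (λ j → Nn (λ i → (n + 1ℚ) * e j i - (ι j + 1ℚ))) (sym (ℕ.+-identityʳ N))
      (Nn-by (Nn-scale {n + 1ℚ} (+-nonNeg (ι-nonNeg N) 0≤1) (Bd-- (Bd-e ℕ.≤-refl) (Bd-const 1ℚ)) (proj₁ e-base)) (λ i → lem n (e N i)))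
      where
      lem : ∀ n e → (n + 1ℚ) * (e - 1ℚ) ≡ (n + 1ℚ) * e - (n + 1ℚ)
      lem = solve-∀ ring
    lower (suc t) = subst (λ j → Nn (λ i → (n + 1ℚ) * e j i - (ι j + 1ℚ))) (sym (ℕ.+-suc N t))
      (Nn-by (Nn-scale (rcp-nonNeg (suc j)) (Bd-+ (Bd-* (Bd-const (n + 1ℚ)) bS) (Bd-* (Bd-const (1ℚ + (1ℚ + ι j))) bH))
         (Nn-+ (Nn-scale (+-nonNeg (ι-nonNeg N) 0≤1) bS (step-lower j N≤j)) (Nn-scale (+-nonNeg 0≤1 (+-nonNeg 0≤1 (ι-nonNeg j))) bH (lower t))))
        (λ i → lem (rcp (suc j)) n (ι j) (ι (suc j)) (e (suc j) i) (e j i) (ι-suc j) (rcp-inv {suc j} (s≤s z≤n))))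
      where
      j = N ℕ.+ t
      N≤j = ℕ.m≤m+n N t
      bS = Bd-- (Bd-* (Bd-const (1ℚ + ι j)) (Bd-e (ℕ.m≤n⇒m≤1+n N≤j))) (Bd-* (Bd-const (1ℚ + (1ℚ + ι j))) (Bd-e N≤j))
      bH = Bd-- (Bd-* (Bd-const (n + 1ℚ)) (Bd-e N≤j)) (Bd-const (ι j + 1ℚ))
      lem : ∀ r n a s e′ e → s ≡ 1ℚ + a → r * s ≡ 1ℚ →
        r * ((n + 1ℚ) * ((1ℚ + a) * e′ - (1ℚ + (1ℚ + a)) * e) + (1ℚ + (1ℚ + a)) * ((n + 1ℚ) * e - (a + 1ℚ))) ≡ (n + 1ℚ) * e′ - (s + 1ℚ)
      lem r n a s e′ e refl q = trans (lem′ r n a e′ e) (trans (cong (λ t → (n + 1ℚ) * e′ * t - (1ℚ + (1ℚ + a)) * t) q) (lem″ n a e′))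
        where
        lem′ : ∀ r n a e′ e → r * ((n + 1ℚ) * ((1ℚ + a) * e′ - (1ℚ + (1ℚ + a)) * e) + (1ℚ + (1ℚ + a)) * ((n + 1ℚ) * e - (a + 1ℚ))) ≡ (n + 1ℚ) * e′ * (r * (1ℚ + a)) - (1ℚ + (1ℚ + a)) * (r * (1ℚ + a))
        lem′ = solve-∀ ring
        lem″ : ∀ n a e′ → (n + 1ℚ) * e′ * 1ℚ - (1ℚ + (1ℚ + a)) * 1ℚ ≡ (n + 1ℚ) * e′ - (1ℚ + a + 1ℚ)
        lem″ = solve-∀ ring

    upper : 1 ℕ.≤ M → ∀ t → Nn (λ i → ι (M ℕ.+ t) - ι M * e (N ℕ.+ t) i)
    upper 1≤M zero    = subst (λ j → Nn (λ i → ι j - ι M * e (suc j) i)) (sym (ℕ.+-identityʳ M))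
      (Nn-by (Nn-scale (ι-nonNeg M) (Bd-- (Bd-const 1ℚ) (Bd-e ℕ.≤-refl)) (proj₂ e-base)) (λ i → lem (ι M) (e N i)))
      where
      lem : ∀ n e → n * (1ℚ - e) ≡ n - n * e
      lem = solve-∀ ring
    upper 1≤M (suc t) = subst (λ j → Nn (λ i → ι j - ι M * e (suc j) i)) (sym (ℕ.+-suc M t))
      (Nn-by (Nn-scale (rcp-nonNeg k) (Bd-+ (Bd-* (Bd-const (ι (suc k))) bH) (Bd-* (Bd-const (ι M)) bS))
         (Nn-+ (Nn-scale (ι-nonNeg (suc k)) bH (upper 1≤M t)) (Nn-scale (ι-nonNeg M) bS (step-upper (suc k) N≤j))))
        (λ i → lem (rcp k) (ι M) (ι k) (ι (suc k)) (e (2 ℕ.+ k) i) (e (suc k) i) (ι-suc k) (rcp-inv (ℕ.≤-trans 1≤M (ℕ.m≤m+n M t)))))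
      where
      k = M ℕ.+ t
      N≤j = s≤s (ℕ.m≤m+n M t)
      bS = Bd-- (Bd-* (Bd-const (ι (suc k))) (Bd-e N≤j)) (Bd-* (Bd-const (ι (suc k) - 1ℚ)) (Bd-e (ℕ.m≤n⇒m≤1+n N≤j)))
      bH = Bd-- (Bd-const (ι k)) (Bd-* (Bd-const (ι M)) (Bd-e N≤j))
      lem : ∀ r m a s e′ e → s ≡ 1ℚ + a → r * a ≡ 1ℚ →
        r * (s * (a - m * e) + m * (s * e - (s - 1ℚ) * e′)) ≡ s - m * e′
      lem r m a s e′ e refl q = trans (lem′ r m a e′ e) (trans (cong (λ t → (1ℚ + a) * t - m * t * e′) q) (lem″ m a e′))
        where
        lem′ : ∀ r m a e′ e → r * ((1ℚ + a) * (a - m * e) + m * ((1ℚ + a) * e - (1ℚ + a - 1ℚ) * e′)) ≡ (1ℚ + a) * (r * a) - m * (r * a) * e′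
        lem′ = solve-∀ ring
        lem″ : ∀ m a e′ → (1ℚ + a) * 1ℚ - m * 1ℚ * e′ ≡ 1ℚ + a - m * e′
        lem″ = solve-∀ ring

  module _ (m′ : ℕ) where
    private
      m = suc m′
      E = Exp (LS (ι m))
      module _ (K : ℕ) (1≤K : 1 ℕ.≤ K) where
        open Mesh K
        t = m′ ℕ.* N
        end : point (N ℕ.+ t) ≡ ι m
        end = trans (cong (_* r) (ι-* m N)) (trans (ℚ.*-assoc (ι m) n r) (trans (cong (ι m *_) (trans (ℚ.*-comm n r) rn)) (ℚ.*-identityʳ (ι m))))
        bE = Bd-Exp (Bd-LS (1≤ι {m} (s≤s z≤n)))
        low : Nn (λ i → (E i - ι m) + ι m′ * rcp K)
        low = Nn-by (Nn-+ (Nn-scale (rcp-nonNeg (suc N)) (Bd-- (Bd-* (Bd-const (n + 1ℚ)) bE) (Bd-const (ι m * n + 1ℚ)))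
                (subst₂ (λ x s → Nn (λ i → (n + 1ℚ) * Exp (LS x) i - (s + 1ℚ))) end (ι-* m N) (lower t)))
                (Nn-≥ (λ i → ≤⇒0≤ (ι-nonNeg m′ ⊛ rcp-antitone 1≤K (ℕ.m≤n⇒m≤1+n (ℕ.n≤1+n K))))))
              (λ i → lem (rcp (suc N)) n (ι (suc N)) (ι m) (ι m′) (E i) (rcp K) (ι-suc N) (ι-suc m′) (rcp-inv {suc N} (s≤s z≤n)))
          where
          lem : ∀ r n s m m′ e k → s ≡ 1ℚ + n → m ≡ 1ℚ + m′ → r * s ≡ 1ℚ → r * ((n + 1ℚ) * e - (m * n + 1ℚ)) + (m′ * k - m′ * r) ≡ e - m + m′ * k
          lem r n s m m′ e k refl refl q = trans (lem′ r n m′ e k) (trans (cong (λ t → t * e - (1ℚ + m′) * t + m′ * k) q) (lem″ m′ e k))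
            where
            lem′ : ∀ r n m′ e k → r * ((n + 1ℚ) * e - ((1ℚ + m′) * n + 1ℚ)) + (m′ * k - m′ * r) ≡ r * (1ℚ + n) * e - (1ℚ + m′) * (r * (1ℚ + n)) + m′ * k
            lem′ = solve-∀ ring
            lem″ : ∀ m′ e k → 1ℚ * e - (1ℚ + m′) * 1ℚ + m′ * k ≡ e - (1ℚ + m′) + m′ * k
            lem″ = solve-∀ ring
        upp : Nn (λ i → (ι m - E i) + ι m′ * rcp K)
        upp = Nn-by (Nn-scale (rcp-nonNeg K) (Bd-- (Bd-const (ι (K ℕ.+ t))) (Bd-* (Bd-const (ι K)) bE))
                (subst (λ x → Nn (λ i → ι (K ℕ.+ t) - ι K * Exp (LS x) i)) end (upper 1≤K t)))
              (λ i → lem (rcp K) (ι K) (ι m) (ι m′) (E i) (ι (K ℕ.+ t)) (ι-suc m′) (trans (ι-+ K t) (cong (ι K +_) (trans (ι-* m′ N) (cong (ι m′ *_) (ι-suc K))))) (rcp-inv 1≤K))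
          where
          lem : ∀ r k m m′ e s → m ≡ 1ℚ + m′ → s ≡ k + m′ * (1ℚ + k) → r * k ≡ 1ℚ → r * (s - k * e) ≡ m - e + m′ * r
          lem r k m m′ e s refl refl q = trans (lem′ r k m′ e) (trans (cong (λ t → (1ℚ + m′) * t - t * e + m′ * r) q) (lem″ m′ e r))
            where
            lem′ : ∀ r k m′ e → r * (k + m′ * (1ℚ + k) - k * e) ≡ (1ℚ + m′) * (r * k) - r * k * e + m′ * r
            lem′ = solve-∀ ring
            lem″ : ∀ m′ e r → (1ℚ + m′) * 1ℚ - 1ℚ * e + m′ * r ≡ 1ℚ + m′ - e + m′ * r
            lem″ = solve-∀ ring

    Exp-log-≥ : Nn (λ i → E i - ι m)
    Exp-log-≥ = Nn-lim (ι m′) (ι-nonNeg m′) low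

    Exp-log-≤ : Nn (λ i → ι m - E i)
    Exp-log-≤ = Nn-lim (ι m′) (ι-nonNeg m′) upp

  exp-log-≥ : ∀ k → 1 ℕ.≤ k → Nn (λ i → Exp (LS (ι k)) i - ι k)
  exp-log-≥ (suc k′) _ = Exp-log-≥ k′

  exp-log-≤ : ∀ k → 1 ℕ.≤ k → Nn (λ i → ι k - Exp (LS (ι k)) i)
  exp-log-≤ (suc k′) _ = Exp-log-≤ k′

  module Log (k : ℕ) (1≤k : 1 ℕ.≤ k) where
    λᵏ : Seq
    λᵏ = LS (ι k)
    Bd-λ : Bd λᵏ
    Bd-λ = Bd-LS (1≤ι 1≤k)
    exp-≥ : Nn (λ i → Exp λᵏ i - ι k)
    exp-≥ = exp-log-≥ k 1≤k
    exp-≤ : Nn (λ i → ι k - Exp λᵏ i)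
    exp-≤ = exp-log-≤ k 1≤k

  module _ (m n : ℕ) (1≤m : 1 ℕ.≤ m) (1≤n : 1 ℕ.≤ n) where
    private
      module M = Log m 1≤m
      module N = Log n 1≤n
      module MN = Log (m ℕ.* n) (ℕ.*-mono-≤ 1≤m 1≤n)
      s : Seq
      s i = Lg i (ι m) + Lg i (ι n)
      bs = Bd-+ M.Bd-λ N.Bd-λ
      bEM = Bd-Exp M.Bd-λ
      bEN = Bd-Exp N.Bd-λ

    log-*-≤ : Nn (λ i → (Lg i (ι m) + Lg i (ι n)) - Lg i (ι (m ℕ.* n)))
    log-*-≤ = Exp-reflect MN.Bd-λ bs (Nn-by
      (Nn-+ (Nn-+ (Exp-+-≥ M.Bd-λ N.Bd-λ) MN.exp-≤)
        (Nn-+ (Nn-* (Bd-- bEM (Bd-const (ι m))) bEN M.exp-≥ (Exp-nonNeg N.Bd-λ)) (Nn-scale (ι-nonNeg m) (Bd-- bEN (Bd-const (ι n))) N.exp-≥)))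
      (λ i → trans (cong (λ t → Exp s i - Exp M.λᵏ i * Exp N.λᵏ i + (t - Exp MN.λᵏ i) + ((Exp M.λᵏ i - ι m) * Exp N.λᵏ i + ι m * (Exp N.λᵏ i - ι n))) (ι-* m n))
         (lem (Exp s i) (Exp M.λᵏ i) (Exp N.λᵏ i) (Exp MN.λᵏ i) (ι m) (ι n))))
      where
      lem : ∀ s a b c m n → s - a * b + (m * n - c) + ((a - m) * b + m * (b - n)) ≡ s - c
      lem = solve-∀ ring

    log-*-≥ : Nn (λ i → Lg i (ι (m ℕ.* n)) - (Lg i (ι m) + Lg i (ι n)))
    log-*-≥ = Exp-reflect bs MN.Bd-λ (Nn-by
      (Nn-+ (Nn-+ (Exp-+-≤ M.Bd-λ N.Bd-λ) MN.exp-≥)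
        (Nn-+ (Nn-* (Bd-- (Bd-const (ι m)) bEM) bEN M.exp-≤ (Exp-nonNeg N.Bd-λ)) (Nn-scale (ι-nonNeg m) (Bd-- (Bd-const (ι n)) bEN) N.exp-≤)))
      (λ i → trans (cong (λ t → Exp M.λᵏ i * Exp N.λᵏ i - Exp s i + (Exp MN.λᵏ i - t) + ((ι m - Exp M.λᵏ i) * Exp N.λᵏ i + ι m * (ι n - Exp N.λᵏ i))) (ι-* m n))
         (lem (Exp s i) (Exp M.λᵏ i) (Exp N.λᵏ i) (Exp MN.λᵏ i) (ι m) (ι n))))
      where
      lem : ∀ s a b c m n → a * b - s + (c - m * n) + ((m - a) * b + m * (n - b)) ≡ c - s
      lem = solve-∀ ring

  -- n ^ (1 - β) as n * n ^ (- β)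
  module Powers (β : Seq) (bβ : Bd β) (0≤β : Nn β) (β≤1 : Nn (λ i → 1ℚ - β i)) where

    arg : ℕ → Seq
    arg n i = - (β i * Lg i (ι n))

    v : ℕ → Seq
    v n i = ι n * Ex i (arg n i)

    Bd-arg : ∀ {n} → 1 ℕ.≤ n → Bd (arg n)
    Bd-arg h = Bd-neg (Bd-* bβ (Log.Bd-λ _ h))

    v-1 : Nn (λ i → v 1 i - 1ℚ) × Nn (λ i → 1ℚ - v 1 i)
    v-1 = Nn-by (proj₁ z) (λ i → cong (λ t → t - 1ℚ) (one i)) , Nn-by (proj₂ z) (λ i → cong (λ t → 1ℚ - t) (one i))
      where
      lem : ∀ b → - (b * 0ℚ) ≡ 0ℚ
      lem = solve-∀ ring
      z = Exp-0 {arg 1} (λ i → trans (cong (λ t → - (β i * t)) (trans (cong (Lg i) ι1) (Lg-1 i))) (lem (β i)))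
      one : ∀ i → Ex i (arg 1 i) ≡ v 1 i
      one i = sym (trans (cong (_* Ex i (arg 1 i)) ι1) (ℚ.*-identityˡ (Ex i (arg 1 i))))

    module _ (m n : ℕ) (1≤m : 1 ℕ.≤ m) (1≤n : 1 ℕ.≤ n) where
      private
        1≤mn : 1 ℕ.≤ m ℕ.* n
        1≤mn = ℕ.*-mono-≤ 1≤m 1≤n
        bM = Log.Bd-λ m 1≤m
        bN = Log.Bd-λ n 1≤n
        bMN = Log.Bd-λ (m ℕ.* n) 1≤mn
        a+b : Seq
        a+b i = arg m i + arg n i
        bab = Bd-+ (Bd-arg 1≤m) (Bd-arg 1≤n)
        0≤mn = *-nonNeg (ι-nonNeg m) (ι-nonNeg n)

      v-*-≤ : Nn (λ i → v m i * v n i - v (m ℕ.* n) i)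
      v-*-≤ = Nn-by (Nn-scale 0≤mn (Bd-+ (Bd-- (Bd-* (Bd-Exp (Bd-arg 1≤m)) (Bd-Exp (Bd-arg 1≤n))) (Bd-Exp bab)) (Bd-- (Bd-Exp bab) (Bd-Exp (Bd-arg 1≤mn))))
          (Nn-+ (Exp-+-≤ (Bd-arg 1≤m) (Bd-arg 1≤n)) (Exp-mono bab (Bd-arg 1≤mn)
            (Nn-by (Nn-* bβ (Bd-- bMN (Bd-+ bM bN)) 0≤β (log-*-≥ m n 1≤m 1≤n)) (λ i → lem (β i) (Lg i (ι m)) (Lg i (ι n)) (Lg i (ι (m ℕ.* n))))))))
        (λ i → trans (lem₂ (ι m) (ι n) (Exp (arg m) i) (Exp (arg n) i) (Exp a+b i) (Exp (arg (m ℕ.* n)) i)) (cong (λ t → ι m * Exp (arg m) i * (ι n * Exp (arg n) i) - t * Exp (arg (m ℕ.* n)) i) (sym (ι-* m n))))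
        where
        lem : ∀ b x y z → b * (z - (x + y)) ≡ - (b * x) + - (b * y) - - (b * z)
        lem = solve-∀ ring
        lem₂ : ∀ m n a b c d → m * n * (a * b - c + (c - d)) ≡ m * a * (n * b) - m * n * d
        lem₂ = solve-∀ ring

      v-*-≥ : Nn (λ i → v (m ℕ.* n) i - v m i * v n i)
      v-*-≥ = Nn-by (Nn-scale 0≤mn (Bd-+ (Bd-- (Bd-Exp bab) (Bd-* (Bd-Exp (Bd-arg 1≤m)) (Bd-Exp (Bd-arg 1≤n)))) (Bd-- (Bd-Exp (Bd-arg 1≤mn)) (Bd-Exp bab)))
          (Nn-+ (Exp-+-≥ (Bd-arg 1≤m) (Bd-arg 1≤n)) (Exp-mono (Bd-arg 1≤mn) bab
            (Nn-by (Nn-* bβ (Bd-- (Bd-+ bM bN) bMN) 0≤β (log-*-≤ m n 1≤m 1≤n)) (λ i → lem (β i) (Lg i (ι m)) (Lg i (ι n)) (Lg i (ι (m ℕ.* n))))))))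
        (λ i → trans (lem₂ (ι m) (ι n) (Exp (arg m) i) (Exp (arg n) i) (Exp a+b i) (Exp (arg (m ℕ.* n)) i)) (cong (λ t → t * Exp (arg (m ℕ.* n)) i - ι m * Exp (arg m) i * (ι n * Exp (arg n) i)) (sym (ι-* m n))))
        where
        lem : ∀ b x y z → b * (x + y - z) ≡ - (b * z) - (- (b * x) + - (b * y))
        lem = solve-∀ ring
        lem₂ : ∀ m n a b c d → m * n * (c - a * b + (d - c)) ≡ m * n * d - m * a * (n * b)
        lem₂ = solve-∀ ring

    -- Bernoulli's inequality (b / a) ^ (1 - β) ≤ 1 + (1 - β) (b / a - 1)
    bernoulli : ∀ a b → 1 ℕ.≤ a → 1 ℕ.≤ b →
      Nn (λ i → (ι a + (1ℚ - β i) * (ι b - ι a)) * v a i - ι a * v b i)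
    bernoulli a b 1≤a 1≤b = Nn-by
      (Nn-scale (ι-nonNeg a) (Bd-+ (Bd-+ (Bd-* bβ bu) (Bd-* bβ (Bd-* (Bd-const (ι b)) bT₁))) (Bd-* bε (Bd-* (Bd-const (ι b)) bT₂)))
        (Nn-+ (Nn-+ (Nn-* bβ bu 0≤β ub) (Nn-* bβ (Bd-* (Bd-const (ι b)) bT₁) 0≤β (Nn-scale (ι-nonNeg b) bT₁ (Exp-tangent bs (Bd-arg 1≤b)))))
          (Nn-* bε (Bd-* (Bd-const (ι b)) bT₂) β≤1 (Nn-scale (ι-nonNeg b) bT₂ (Exp-tangent (Bd-arg 1≤a) (Bd-arg 1≤b))))))
      (λ i → lem (ι a) (ι b) (β i) (Exp (arg a) i) (Exp (arg b) i) (Exp s i) (Lg i (ι a)) (Lg i (ι b)))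
      where
      module A = Log a 1≤a
      module B = Log b 1≤b
      ε : Seq
      ε i = 1ℚ - β i
      bε : Bd ε
      bε = Bd-- (Bd-const 1ℚ) bβ
      s : Seq
      s i = (1ℚ - β i) * Lg i (ι a) - Lg i (ι b)
      bs : Bd s
      bs = Bd-- (Bd-* bε A.Bd-λ) B.Bd-λ
      bT₁ = Bd-- (Bd-Exp bs) (Bd-* (Bd-Exp (Bd-arg 1≤b)) (Bd-+ (Bd-const 1ℚ) (Bd-- bs (Bd-arg 1≤b))))
      bT₂ = Bd-- (Bd-Exp (Bd-arg 1≤a)) (Bd-* (Bd-Exp (Bd-arg 1≤b)) (Bd-+ (Bd-const 1ℚ) (Bd-- (Bd-arg 1≤a) (Bd-arg 1≤b))))
      bu : Bd (λ i → ι a * Exp (arg a) i - ι b * Exp s i)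
      bu = Bd-- (Bd-* (Bd-const (ι a)) (Bd-Exp (Bd-arg 1≤a))) (Bd-* (Bd-const (ι b)) (Bd-Exp bs))
      ub : Nn (λ i → ι a * Exp (arg a) i - ι b * Exp s i)
      ub = Nn-by (Nn-+ (Nn-+ (Nn-* (Bd-- (Bd-const (ι a)) (Bd-Exp A.Bd-λ)) (Bd-Exp (Bd-arg 1≤a)) A.exp-≤ (Exp-nonNeg (Bd-arg 1≤a)))
               (Exp-+-≤ A.Bd-λ (Bd-arg 1≤a)))
             (Nn-+ (Exp-+-≥ bs B.Bd-λ) (Nn-* (Bd-Exp bs) (Bd-- (Bd-Exp B.Bd-λ) (Bd-const (ι b))) (Exp-nonNeg bs) B.exp-≥)))
           (λ i → trans (cong (λ t → (ι a - Exp A.λᵏ i) * Exp (arg a) i + (Exp A.λᵏ i * Exp (arg a) i - Ex i t) + (Ex i (s i + Lg i (ι b)) - Exp s i * Exp B.λᵏ i + Exp s i * (Exp B.λᵏ i - ι b))) (lem₁ (β i) (Lg i (ι a)) (Lg i (ι b))))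
              (lem₂ (ι a) (ι b) (Exp A.λᵏ i) (Exp B.λᵏ i) (Exp (arg a) i) (Exp s i) (Ex i (s i + Lg i (ι b)))))
        where
        lem₁ : ∀ b x y → x + - (b * x) ≡ (1ℚ - b) * x - y + y
        lem₁ = solve-∀ ring
        lem₂ : ∀ a b ea eb A u t → (a - ea) * A + (ea * A - t) + (t - u * eb + u * (eb - b)) ≡ a * A - b * u
        lem₂ = solve-∀ ring
      lem : ∀ a b β A B u x y →
        a * (β * (a * A - b * u) + β * (b * (u - B * (1ℚ + ((1ℚ - β) * x - y - - (β * y))))) + (1ℚ - β) * (b * (A - B * (1ℚ + (- (β * x) - - (β * y))))))
        ≡ (a + (1ℚ - β) * (b - a)) * (a * A) - a * (b * B)
      lem = solve-∀ ring

module Summation where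

  open import Data.Rational using (_≤_)
  open Rationals

  abel : ∀ K (f a : ℕ → ℚ) B → 0ℚ ≤ B → 0ℚ ≤ a 1 → (∀ k → 1 ℕ.≤ k → k ℕ.≤ K → 0ℚ ≤ a k) →
    (∀ k → 1 ℕ.≤ k → k ℕ.< K → a (suc k) ≤ a k) → (∀ k → ∣ ∑ k f ∣ ≤ B) →
    ∣ ∑ K (λ k → f k * a k) ∣ ≤ B * a 1
  abel zero    f a B 0≤B 0≤a₁ a≥0 anti bnd = *-nonNeg 0≤B 0≤a₁
  abel (suc K) f a B 0≤B 0≤a₁ a≥0 anti bnd = lem (∑ (suc K) (λ k → f k * a k)) (∑ (suc K) f) (a (suc K)) (a 1)
      (go K ℕ.≤-refl) (∣∣-*-≤ (bnd (suc K)) (ℚ.≤-reflexive (ℚ.0≤p⇒∣p∣≡p (a≥0 (suc K) (s≤s z≤n) ℕ.≤-refl))))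
    where
    go : ∀ k → k ℕ.≤ K → ∣ ∑ (suc k) (λ k → f k * a k) - ∑ (suc k) f * a (suc k) ∣ ≤ B * (a 1 - a (suc k))
    go zero    _  = ℚ.≤-reflexive (trans (cong ∣_∣ (e₁ (f 1) (a 1))) (e₂ B (a 1)))
      where
      e₁ : ∀ f a → 0ℚ + f * a - (0ℚ + f) * a ≡ 0ℚ
      e₁ = solve-∀ ring
      e₂ : ∀ B a → 0ℚ ≡ B * (a - a)
      e₂ = solve-∀ ring
    go (suc k) le = subst₂ _≤_ (cong ∣_∣ (e₁ (∑ (suc k) (λ k → f k * a k)) (∑ (suc k) f) (a (suc k)) (a (2 ℕ.+ k)) (f (2 ℕ.+ k))))
        (e₂ B (a 1) (a (suc k)) (a (2 ℕ.+ k)))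
        (∣∣-+-≤ (go k (ℕ.≤-trans (ℕ.n≤1+n k) le)) (∣∣-*-≤ (bnd (suc k)) (ℚ.≤-reflexive (ℚ.0≤p⇒∣p∣≡p (≤⇒0≤ (anti (suc k) (s≤s z≤n) (s≤s le)))))))
      where
      e₁ : ∀ s t a b f → s - t * a + t * (a - b) ≡ s + f * b - (t + f) * b
      e₁ = solve-∀ ring
      e₂ : ∀ B x a b → B * (x - a) + B * (a - b) ≡ B * (x - b)
      e₂ = solve-∀ ring
    lem : ∀ s t a x → ∣ s - t * a ∣ ≤ B * (x - a) → ∣ t * a ∣ ≤ B * a → ∣ s ∣ ≤ B * x
    lem s t a x p q = subst₂ _≤_ (cong ∣_∣ (e₁ s (t * a))) (e₂ B x a) (∣∣-+-≤ p q)
      where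
      e₁ : ∀ s u → s - u + u ≡ s
      e₁ = solve-∀ ring
      e₂ : ∀ B x a → B * (x - a) + B * a ≡ B * x
      e₂ = solve-∀ ring

  ∑-extend : ∀ {N M} {f : ℕ → ℚ} → N ℕ.≤ M → (∀ k → N ℕ.< k → k ℕ.≤ M → f k ≡ 0ℚ) → ∑ M f ≡ ∑ N f
  ∑-extend {N} {M} {f} le z with K , refl ← ℕ.m≤n⇒∃[o]m+o≡n le =
    trans (∑-split N K f) (trans (cong (∑ N f +_) (∑-zero K (λ k 1≤k k≤K → z (N ℕ.+ k) (ℕ.m<m+n N 1≤k) (ℕ.+-monoʳ-≤ N k≤K)))) (ℚ.+-identityʳ _))

  ∑-pick : ∀ Z m (f : ℕ → ℚ) → 1 ℕ.≤ m → ∑ Z (λ n → 𝟙 (n ℕ.≟ m) * f n) ≡ 𝟙 (m ℕ.≤? Z) * f m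
  ∑-pick Z m f 1≤m = trans (∑-cong Z (λ n _ _ → same n)) pick
    where
    same : ∀ n → 𝟙 (n ℕ.≟ m) * f n ≡ 𝟙 (n ℕ.≟ m) * f m
    same n with n ℕ.≟ m
    ... | yes refl = refl
    ... | no _ = trans (ℚ.*-zeroˡ (f n)) (sym (ℚ.*-zeroˡ (f m)))
    pick : ∑ Z (λ n → 𝟙 (n ℕ.≟ m) * f m) ≡ 𝟙 (m ℕ.≤? Z) * f m
    pick with m ℕ.≤? Z
    ... | yes m≤Z = trans (∑-single Z m (f m) 1≤m m≤Z) (sym (ℚ.*-identityˡ (f m)))
    ... | no m≰Z = trans (∑-zero Z (λ n _ n≤Z → trans (cong (_* f m) (𝟙-no (n ℕ.≟ m) (λ { refl → m≰Z n≤Z }))) (ℚ.*-zeroˡ (f m)))) (sym (ℚ.*-zeroˡ (f m)))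

  ∑-multiples : ∀ Z d n → 1 ℕ.≤ d → 1 ℕ.≤ n → n ℕ.≤ d ℕ.* Z → ∑ Z (λ e → 𝟙 (n ℕ.≟ d ℕ.* e)) ≡ 𝟙 (d ∣? n)
  ∑-multiples Z d n 1≤d 1≤n n≤Z with d ∣? n
  ... | no ¬d = ∑-zero Z (λ e _ _ → 𝟙-no (n ℕ.≟ d ℕ.* e) (λ eq → ¬d (divides e (trans eq (ℕ.*-comm d e)))))
  ... | yes (divides zero refl) = ⊥-elim (ℕ.<-irrefl refl 1≤n)
  ... | yes (divides q@(suc _) refl) = trans (∑-cong Z (λ e _ _ → trans (𝟙-cong (q ℕ.* d ℕ.≟ d ℕ.* e) (e ℕ.≟ q)
          (λ eq → ℕ.*-cancelʳ-≡ e q d {{ℕ.>-nonZero 1≤d}} (trans (ℕ.*-comm e d) (sym eq))) (λ { refl → ℕ.*-comm q d })) (sym (ℚ.*-identityʳ _))))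
        (∑-single Z q 1ℚ (s≤s z≤n) (ℕ.*-cancelˡ-≤ d {{ℕ.>-nonZero 1≤d}} (subst (ℕ._≤ d ℕ.* Z) (ℕ.*-comm q d) n≤Z)))

  divisorSum : (ℕ → ℚ) → ℕ → ℚ
  divisorSum c n = ∑ n (λ d → 𝟙 (d ∣? n) * c d)

  module Hyperbola (c w : ℕ → ℚ) (Z : ℕ) where

    r = divisorSum c

    S : ℚ
    S = ∑ Z (λ n → r n * w n)

    W : ℕ → ℚ
    W n = 𝟙 (n ℕ.≤? Z) * w n

    S-double : S ≡ ∑ Z (λ d → ∑ Z (λ e → c d * W (d ℕ.* e)))
    S-double = sym (begin
      ∑ Z (λ d → ∑ Z (λ e → c d * W (d ℕ.* e)))
        ≡⟨ ∑-cong Z (λ d 1≤d _ → ∑-cong Z (λ e 1≤e _ → trans (cong (c d *_) (sym (∑-pick Z (d ℕ.* e) w (ℕ.*-mono-≤ 1≤d 1≤e)))) (sym (∑-* Z (c d) _)))) ⟩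
      ∑ Z (λ d → ∑ Z (λ e → ∑ Z (λ n → c d * (𝟙 (n ℕ.≟ d ℕ.* e) * w n))))
        ≡⟨ ∑-cong Z (λ d _ _ → ∑-swap Z Z _) ⟩
      ∑ Z (λ d → ∑ Z (λ n → ∑ Z (λ e → c d * (𝟙 (n ℕ.≟ d ℕ.* e) * w n))))
        ≡⟨ ∑-cong Z (λ d 1≤d _ → ∑-cong Z (λ n 1≤n n≤Z → inner d n 1≤d 1≤n n≤Z)) ⟩
      ∑ Z (λ d → ∑ Z (λ n → 𝟙 (d ∣? n) * c d * w n))
        ≡⟨ ∑-swap Z Z _ ⟩
      ∑ Z (λ n → ∑ Z (λ d → 𝟙 (d ∣? n) * c d * w n))
        ≡⟨ ∑-cong Z (λ n 1≤n n≤Z → trans (∑-*ʳ Z (w n) _) (cong (_* w n) (∑-extend n≤Z (λ d n<d _ →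
              trans (cong (_* c d) (𝟙-no (d ∣? n) (λ d∣n → ℕ.<⇒≱ n<d (∣⇒≤ {{ℕ.>-nonZero 1≤n}} d∣n)))) (ℚ.*-zeroˡ (c d)))))) ⟩
      S ∎)
      where
      open ≡-Reasoning
      lem : ∀ c i w → c * (i * w) ≡ i * (c * w)
      lem = solve-∀ ring
      inner : ∀ d n → 1 ℕ.≤ d → 1 ℕ.≤ n → n ℕ.≤ Z → ∑ Z (λ e → c d * (𝟙 (n ℕ.≟ d ℕ.* e) * w n)) ≡ 𝟙 (d ∣? n) * c d * w n
      inner d n 1≤d 1≤n n≤Z = trans (∑-cong Z (λ e _ _ → lem (c d) (𝟙 (n ℕ.≟ d ℕ.* e)) (w n)))
        (trans (∑-*ʳ Z (c d * w n) _) (trans (cong (_* (c d * w n)) (∑-multiples Z d n 1≤d 1≤n (ℕ.≤-trans n≤Z (ℕ.m≤n*m Z d {{ℕ.>-nonZero 1≤d}})))) (sym (ℚ.*-assoc (𝟙 (d ∣? n)) (c d) (w n)))))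

    head : ℕ → ℚ
    head D = ∑ D (λ d → c d * ∑ Z (λ e → W (d ℕ.* e)))

    tail : ℕ → ℕ → ℚ
    tail D K = ∑ Z (λ e → ∑ K (λ k → c (D ℕ.+ k) * W ((D ℕ.+ k) ℕ.* e)))

    S-split : ∀ D K → D ℕ.+ K ≡ Z → S ≡ head D + tail D K
    S-split D K refl = trans S-double (trans (∑-split D K _) (cong₂ _+_ (∑-cong D (λ d _ _ → ∑-* Z (c d) _)) (∑-swap K Z _)))

    module _ (Q : ℚ) (0≤Q : 0ℚ ≤ Q) (partial : ∀ N → ∣ ∑ N c ∣ ≤ Q)
             (0≤w : ∀ n → 1 ℕ.≤ n → n ℕ.≤ Z → 0ℚ ≤ w n) (anti : ∀ m n → 1 ℕ.≤ m → m ℕ.≤ n → n ℕ.≤ Z → w n ≤ w m) where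

      0≤W : ∀ n → 1 ℕ.≤ n → 0ℚ ≤ W n
      0≤W n 1≤n with n ℕ.≤? Z
      ... | yes n≤Z = subst (0ℚ ≤_) (sym (ℚ.*-identityˡ (w n))) (0≤w n 1≤n n≤Z)
      ... | no _ = ℚ.≤-reflexive (sym (ℚ.*-zeroˡ (w n)))

      W-anti : ∀ m n → 1 ℕ.≤ m → m ℕ.≤ n → W n ≤ W m
      W-anti m n 1≤m m≤n with n ℕ.≤? Z
      ... | no _ = subst (_≤ W m) (sym (ℚ.*-zeroˡ (w n))) (0≤W m 1≤m)
      ... | yes n≤Z = subst₂ _≤_ (sym (ℚ.*-identityˡ (w n))) (sym (trans (cong (_* w m) (𝟙-yes (m ℕ.≤? Z) (ℕ.≤-trans m≤n n≤Z))) (ℚ.*-identityˡ (w m)))) (anti m n 1≤m m≤n n≤Z)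

      partial-shift : ∀ D k → ∣ ∑ k (λ j → c (D ℕ.+ j)) ∣ ≤ Q + Q
      partial-shift D k = subst (λ t → ∣ t ∣ ≤ Q + Q) (trans (cong (_+ (- ∑ D c)) (∑-split D k c)) (lem (∑ D c) _)) (∣∣-+-≤ (partial (D ℕ.+ k)) (subst (_≤ Q) (sym (ℚ.∣-p∣≡∣p∣ (∑ D c))) (partial D)))
        where
        lem : ∀ a b → a + b + (- a) ≡ b
        lem = solve-∀ ring

      tail-bound : ∀ D K → ∣ tail D K ∣ ≤ (Q + Q) * ∑ Z (λ e → W (suc D ℕ.* e))
      tail-bound D K = ℚ.≤-trans (∑-abs Z _) (subst (∑ Z (λ e → ∣ ∑ K (λ k → c (D ℕ.+ k) * W ((D ℕ.+ k) ℕ.* e)) ∣) ≤_)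
        (trans (∑-cong Z (λ e _ _ → cong (λ t → (Q + Q) * W (t ℕ.* e)) (ℕ.+-comm D 1))) (∑-* Z (Q + Q) _))
        (∑-mono Z (λ e 1≤e _ → abel K (λ k → c (D ℕ.+ k)) (λ k → W ((D ℕ.+ k) ℕ.* e)) (Q + Q) (+-nonNeg 0≤Q 0≤Q)
           (0≤W ((D ℕ.+ 1) ℕ.* e) (ℕ.*-mono-≤ (ℕ.m≤n+m 1 D) 1≤e)) (λ k 1≤k _ → 0≤W ((D ℕ.+ k) ℕ.* e) (ℕ.*-mono-≤ (ℕ.≤-trans 1≤k (ℕ.m≤n+m k D)) 1≤e))
           (λ k 1≤k _ → W-anti ((D ℕ.+ k) ℕ.* e) ((D ℕ.+ suc k) ℕ.* e) (ℕ.*-mono-≤ (ℕ.≤-trans 1≤k (ℕ.m≤n+m k D)) 1≤e) (ℕ.*-monoˡ-≤ e (ℕ.+-monoʳ-≤ D (ℕ.n≤1+n k)))) (partial-shift D))))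

    -- for fixed d the cut-off leaves the range e ≤ Z / d
    row : ∀ d → .{{_ : ℕ.NonZero d}} → ∑ Z (λ e → W (d ℕ.* e)) ≡ ∑ (Z ℕ./ d) (λ e → w (d ℕ.* e))
    row d = trans (∑-extend (ℕ.m/n≤m Z d) (λ e y<e _ → trans (cong (_* w (d ℕ.* e)) (𝟙-no (d ℕ.* e ℕ.≤? Z) (λ le → ℕ.<⇒≱ y<e (quot le)))) (ℚ.*-zeroˡ (w (d ℕ.* e)))))
        (∑-cong (Z ℕ./ d) (λ e _ e≤y → trans (cong (_* w (d ℕ.* e)) (𝟙-yes (d ℕ.* e ℕ.≤? Z) (ℕ.≤-trans (ℕ.≤-reflexive (ℕ.*-comm d e)) (ℕ.≤-trans (ℕ.*-monoˡ-≤ d e≤y) (ℕ.m/n*n≤m Z d))))) (ℚ.*-identityˡ (w (d ℕ.* e)))))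
      where
      quot : ∀ {e} → d ℕ.* e ℕ.≤ Z → e ℕ.≤ Z ℕ./ d
      quot {e} le = subst (ℕ._≤ Z ℕ./ d) (ℕ.m*n/n≡m e d) (ℕ./-monoˡ-≤ d (subst (ℕ._≤ Z) (ℕ.*-comm d e) le))

module Growth where

  open import Data.Rational using (_≤_)
  open Rationals
  open Summation

  2ℚ 4ℚ 8ℚ : ℚ
  2ℚ = # 2
  4ℚ = # 4
  8ℚ = # 8

  harmonic : ℕ → ℚ
  harmonic Z = ∑ Z rcp

  ∣∣-neg : ∀ {a b} → ∣ a - b ∣ ≡ ∣ b - a ∣
  ∣∣-neg {a} {b} = trans (sym (ℚ.∣-p∣≡∣p∣ (a - b))) (cong ∣_∣ (lem a b))
    where
    lem : ∀ a b → - (a - b) ≡ b - a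
    lem = solve-∀ ring

  rcp≤1 : ∀ n → rcp n ≤ 1ℚ
  rcp≤1 zero    = ℚ.≤-trans (ℚ.≤-reflexive (trans (cong recip ι0) recip-0)) 0≤1
  rcp≤1 (suc n) = subst (rcp (suc n) ≤_) (trans (sym (ℚ.*-identityʳ (rcp 1))) (trans (cong (rcp 1 *_) (sym ι1)) (rcp-inv {1} ℕ.≤-refl))) (rcp-antitone {1} ℕ.≤-refl (s≤s z≤n))

  -- The hypotheses say that v n behaves like n ^ ε and w n like n ^ (ε - 1).
  record PowerLike (v : ℕ → ℚ) (ε τ : ℚ) (X M : ℕ) : Set where
    w : ℕ → ℚ
    w n = v n * rcp n
    field
      0<ε    : 0ℚ < ε
      ε≤1    : ε ≤ 1ℚ
      0≤τ    : 0ℚ ≤ τ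
      X≤M    : X ℕ.≤ M
      lower  : ∀ n → 1 ℕ.≤ n → n ℕ.≤ X → 1ℚ ≤ 2ℚ * v n
      upper  : ∀ n → 1 ℕ.≤ n → n ℕ.≤ X → v n ≤ 2ℚ
      w≥0    : ∀ n → 1 ℕ.≤ n → n ℕ.≤ M → 0ℚ ≤ w n
      w-anti : ∀ m n → 1 ℕ.≤ m → m ℕ.≤ n → n ℕ.≤ M → w n ≤ w m
      slope  : ∀ n → 1 ℕ.≤ n → suc n ℕ.≤ X → ∣ (v (suc n) - v n) - ε * w (suc n) ∣ ≤ 2ℚ * ε * (w n - w (suc n))
      mult   : ∀ d e → 1 ℕ.≤ d → 1 ℕ.≤ e → d ℕ.* e ℕ.≤ X → ∣ v (d ℕ.* e) - v d * v e ∣ ≤ ε * τ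
      near   : ∀ a b → 1 ℕ.≤ a → a ℕ.≤ b → b ℕ.≤ X → ∣ v b - v a ∣ ≤ 4ℚ * ε * ((ι b - ι a) * rcp a)

  module Core {v : ℕ → ℚ} {ε τ : ℚ} {X M : ℕ} (pl : PowerLike v ε τ X M)
    (c : ℕ → ℚ) (c≤1 : ∀ n → ∣ c n ∣ ≤ 1ℚ)
    (Q : ℚ) (0≤Q : 0ℚ ≤ Q) (partial : ∀ N → ∣ ∑ N c ∣ ≤ Q)
    (D : ℕ) (1≤D : 1 ℕ.≤ D) where

    open PowerLike pl
    0≤ε = ℚ.<⇒≤ 0<ε
    0≤2 : 0ℚ ≤ 2ℚ
    0≤2 = ℚ.<⇒≤ (ℚ.positive⁻¹ 2ℚ)
    0≤2ε : 0ℚ ≤ 2ℚ * ε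
    0≤2ε = *-nonNeg 0≤2 0≤ε

    w-upper : ∀ n → 1 ℕ.≤ n → n ℕ.≤ X → w n ≤ 2ℚ * rcp n
    w-upper n a b = subst₂ _≤_ (ℚ.*-comm (rcp n) (v n)) (ℚ.*-comm (rcp n) 2ℚ) (rcp-nonNeg n ⊛ upper n a b)

    0≤v : ∀ n → 1 ℕ.≤ n → n ℕ.≤ X → 0ℚ ≤ v n
    0≤v n a b = lem (v n) (lower n a b)
      where
      lem : ∀ v → 1ℚ ≤ 2ℚ * v → 0ℚ ≤ v
      lem v h = *-cancelˡ-≤ (ℚ.positive⁻¹ 2ℚ) (ℚ.≤-trans (ℚ.≤-reflexive (ℚ.*-zeroʳ 2ℚ)) (ℚ.≤-trans 0≤1 h))

    F : ℕ → ℚ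
    F y = v y - ε * ∑ y w

    κ : ℚ
    κ = F X

    F-diff : ∀ y t → 1 ℕ.≤ y → y ℕ.+ t ℕ.≤ X → ∣ F (y ℕ.+ t) - F y ∣ ≤ 2ℚ * ε * (w y - w (y ℕ.+ t))
    F-diff y zero    1≤y le = subst (λ s → ∣ F s - F y ∣ ≤ 2ℚ * ε * (w y - w s)) (sym (ℕ.+-identityʳ y))
      (ℚ.≤-reflexive (trans (cong ∣_∣ (z (F y))) (sym (z′ (2ℚ * ε) (w y)))))
      where
      z : ∀ a → a - a ≡ 0ℚ
      z = solve-∀ ring
      z′ : ∀ b a → b * (a - a) ≡ 0ℚ
      z′ = solve-∀ ring
    F-diff y (suc t) 1≤y le = subst (λ s → ∣ F s - F y ∣ ≤ 2ℚ * ε * (w y - w s)) (sym (ℕ.+-suc y t))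
      (subst₂ _≤_ (cong ∣_∣ (e₁ (F y) (v n) (v (suc n)) ε (∑ n w) (w (suc n)))) (e₂ (2ℚ * ε) (w y) (w n) (w (suc n)))
        (∣∣-+-≤ (F-diff y t 1≤y (ℕ.≤-trans (ℕ.n≤1+n n) le′)) (slope n (ℕ.≤-trans 1≤y (ℕ.m≤m+n y t)) le′)))
      where
      n = y ℕ.+ t
      le′ : suc n ℕ.≤ X
      le′ = subst (ℕ._≤ X) (ℕ.+-suc y t) le
      e₁ : ∀ f v v′ ε s w → v - ε * s - f + (v′ - v - ε * w) ≡ v′ - ε * (s + w) - f
      e₁ = solve-∀ ring
      e₂ : ∀ b x y z → b * (x - y) + b * (y - z) ≡ b * (x - z)
      e₂ = solve-∀ ring

    F-κ : ∀ y → 1 ℕ.≤ y → y ℕ.≤ X → ∣ F y - κ ∣ ≤ 2ℚ * ε * w y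
    F-κ y 1≤y y≤X with t , refl ← ℕ.m≤n⇒∃[o]m+o≡n y≤X =
      ℚ.≤-trans (ℚ.≤-reflexive (∣∣-neg {F y} {F (y ℕ.+ t)})) (ℚ.≤-trans (F-diff y t 1≤y ℕ.≤-refl)
        (0≤2ε ⊛ lem (w y) (w (y ℕ.+ t)) (w≥0 (y ℕ.+ t) (ℕ.≤-trans 1≤y y≤X) X≤M)))
      where
      lem : ∀ a b → 0ℚ ≤ b → a - b ≤ a
      lem a b h = ≤-by h (solve (a ∷ b ∷ []) ring)

    κ-bound : 1 ℕ.≤ X → ∣ κ ∣ ≤ 8ℚ
    κ-bound 1≤X = ℚ.≤-trans (ℚ.≤-reflexive (cong ∣_∣ (e₁ (F 1) κ))) (ℚ.≤-trans (∣∣-+-≤ (∣∣-+-≤ v₁ (ℚ.≤-trans (ℚ.≤-reflexive (ℚ.∣-p∣≡∣p∣ (ε * (0ℚ + w 1)))) w₁)) (ℚ.≤-trans (ℚ.≤-reflexive (∣∣-neg {κ} {F 1})) (F-κ 1 ℕ.≤-refl 1≤X)))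
        (lem ε (w 1) 0≤ε ε≤1 (ℚ.≤-trans (w-upper 1 ℕ.≤-refl 1≤X) (0≤2 ⊛ rcp≤1 1)) (w≥0 1 ℕ.≤-refl (ℕ.≤-trans 1≤X X≤M))))
      where
      e₁ : ∀ f k → k ≡ f + (k - f)
      e₁ = solve-∀ ring
      v₁ : ∣ v 1 ∣ ≤ 2ℚ
      v₁ = ℚ.≤-trans (ℚ.≤-reflexive (ℚ.0≤p⇒∣p∣≡p (0≤v 1 ℕ.≤-refl 1≤X))) (upper 1 ℕ.≤-refl 1≤X)
      w₁ : ∣ ε * (0ℚ + w 1) ∣ ≤ ε * w 1
      w₁ = ℚ.≤-reflexive (trans (cong (λ t → ∣ ε * t ∣) (ℚ.+-identityˡ (w 1))) (ℚ.0≤p⇒∣p∣≡p (*-nonNeg 0≤ε (w≥0 1 ℕ.≤-refl (ℕ.≤-trans 1≤X X≤M)))))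
      lem : ∀ e w → 0ℚ ≤ e → e ≤ 1ℚ → w ≤ 2ℚ * 1ℚ → 0ℚ ≤ w → 2ℚ + e * w + 2ℚ * e * w ≤ 8ℚ
      lem e w p q r s = ≤-by ((s ⊛ q) ⊕ (s ⊛ q) ⊕ (s ⊛ q) ⊕ r ⊕ r ⊕ r) (solve (e ∷ w ∷ []) ring)

    τ′ = τ * (1ℚ + ι X)

    row-error : ∀ Z d → Z ℕ.≤ X → 1 ℕ.≤ d → d ℕ.≤ Z → .{{_ : ℕ.NonZero d}} →
      ∣ rcp d * (v Z - κ * v d) - ε * ∑ (Z ℕ./ d) (λ e → w (d ℕ.* e)) ∣ ≤ ε * (8ℚ * (1ℚ + 2ℚ) * rcp Z + τ′)
    row-error Z d Z≤X 1≤d d≤Z = ℚ.≤-trans (ℚ.≤-reflexive (trans (cong ∣_∣ e₁) (trans (ℚ.∣p*q∣≡∣p∣*∣q∣ (rcp d) T) (cong (_* ∣ T ∣) (ℚ.0≤p⇒∣p∣≡p (rcp-nonNeg d))))))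
        (ℚ.≤-trans (rcp-nonNeg d ⊛ T-bound) final)
      where
      y = Z ℕ./ d
      1≤y : 1 ℕ.≤ y
      1≤y = ℕ.m≥n⇒m/n>0 d≤Z
      dy≤Z : d ℕ.* y ℕ.≤ Z
      dy≤Z = ℕ.≤-trans (ℕ.≤-reflexive (ℕ.*-comm d y)) (ℕ.m/n*n≤m Z d)
      Z<d+dy : Z ℕ.≤ d ℕ.+ d ℕ.* y
      Z<d+dy = ℕ.≤-trans (ℕ.≤-reflexive (ℕ.m≡m%n+[m/n]*n Z d)) (ℕ.+-mono-≤ (ℕ.<⇒≤ (ℕ.m%n<n Z d)) (ℕ.≤-reflexive (ℕ.*-comm y d)))
      y≤X : y ℕ.≤ X
      y≤X = ℕ.≤-trans (ℕ.m/n≤m Z d) Z≤X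
      1≤dy = ℕ.*-mono-≤ 1≤d 1≤y
      Gd = ∑ y (λ e → w (d ℕ.* e))
      Vd = ∑ y (λ e → v (d ℕ.* e) * rcp e)
      T = (v Z - κ * v d) - ε * Vd
      dw : ∀ e → 1 ℕ.≤ e → w (d ℕ.* e) ≡ rcp d * (v (d ℕ.* e) * rcp e)
      dw e 1≤e = trans (cong (v (d ℕ.* e) *_) (rcp-* 1≤d 1≤e)) (lem (v (d ℕ.* e)) (rcp d) (rcp e))
        where
        lem : ∀ v a b → v * (a * b) ≡ a * (v * b)
        lem = solve-∀ ring
      Gd≡ : Gd ≡ rcp d * Vd
      Gd≡ = trans (∑-cong y (λ e 1≤e _ → dw e 1≤e)) (∑-* y (rcp d) _)
      e₁ : rcp d * (v Z - κ * v d) - ε * Gd ≡ rcp d * T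
      e₁ = trans (cong (λ g → rcp d * (v Z - κ * v d) - ε * g) Gd≡) (lem (rcp d) (v Z - κ * v d) ε Vd)
        where
        lem : ∀ r a e V → r * a - e * (r * V) ≡ r * (a - e * V)
        lem = solve-∀ ring
      vy : ∀ e → 1 ℕ.≤ e → e ℕ.≤ y → d ℕ.* e ℕ.≤ X
      vy e _ e≤y = ℕ.≤-trans (ℕ.*-monoʳ-≤ d e≤y) (ℕ.≤-trans dy≤Z Z≤X)
      errSum = ∑ y (λ e → (v (d ℕ.* e) - v d * v e) * rcp e)
      errSum≡ : errSum ≡ Vd - v d * ∑ y w
      errSum≡ = trans (∑-cong y (λ e _ _ → lem (v (d ℕ.* e)) (v d) (v e) (rcp e))) (trans (∑-- y _ _) (cong (λ s → Vd - s) (∑-* y (v d) _)))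
        where
        lem : ∀ a b c r → (a - b * c) * r ≡ a * r - b * (c * r)
        lem = solve-∀ ring
      errSum-bound : ∣ errSum ∣ ≤ ι X * (ε * τ)
      errSum-bound = ℚ.≤-trans (∑-abs y _) (ℚ.≤-trans (∑-mono y (λ e 1≤e e≤y → subst (_ ≤_) (ℚ.*-identityʳ (ε * τ)) (∣∣-*-≤ (mult d e 1≤d 1≤e (vy e 1≤e e≤y)) (ℚ.≤-trans (ℚ.≤-reflexive (ℚ.0≤p⇒∣p∣≡p (rcp-nonNeg e))) (rcp≤1 e)))))
        (ℚ.≤-trans (ℚ.≤-reflexive (trans (∑-const y (ε * τ)) (ℚ.*-comm (ι y) (ε * τ)))) (ℚ.≤-trans (*-nonNeg 0≤ε 0≤τ ⊛ ι-mono y≤X) (ℚ.≤-reflexive (ℚ.*-comm (ε * τ) (ι X))))))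
      T≡ : T ≡ (v Z - v (d ℕ.* y)) + (v (d ℕ.* y) - v d * v y) + v d * (F y - κ) - ε * errSum
      T≡ = trans (lem (v Z) κ (v d) ε Vd (v (d ℕ.* y)) (v y) (∑ y w)) (cong (λ s → (v Z - v (d ℕ.* y)) + (v (d ℕ.* y) - v d * v y) + v d * (F y - κ) - ε * s) (sym errSum≡))
        where
        lem : ∀ z κ d ε V dy y s → z - κ * d - ε * V ≡ (z - dy) + (dy - d * y) + d * (y - ε * s - κ) - ε * (V - d * s)
        lem = solve-∀ ring
      gap : (ι Z - ι (d ℕ.* y)) * rcp (d ℕ.* y) ≤ rcp y
      gap = ℚ.≤-trans (subst₂ _≤_ (ℚ.*-comm (rcp (d ℕ.* y)) _) refl (rcp-nonNeg (d ℕ.* y) ⊛ diff))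
          (ℚ.≤-reflexive (trans (cong (_* ι d) (rcp-* 1≤d 1≤y)) (trans (lem (rcp d) (rcp y) (ι d)) (trans (cong (_* rcp y) (rcp-inv 1≤d)) (ℚ.*-identityˡ (rcp y))))))
        where
        diff : ι Z - ι (d ℕ.* y) ≤ ι d
        diff = lem (ι Z) (ι d) (ι (d ℕ.* y)) (subst (ι Z ≤_) (ι-+ d (d ℕ.* y)) (ι-mono Z<d+dy))
          where
          lem : ∀ a b c → a ≤ b + c → a - c ≤ b
          lem a b c h = ≤-by h (solve (a ∷ b ∷ c ∷ []) ring)
        lem : ∀ a b c → a * b * c ≡ a * c * b
        lem = solve-∀ ring
      t₁ : ∣ v Z - v (d ℕ.* y) ∣ ≤ 4ℚ * ε * rcp y
      t₁ = ℚ.≤-trans (near (d ℕ.* y) Z 1≤dy dy≤Z Z≤X) (*-nonNeg (ℚ.<⇒≤ (ℚ.positive⁻¹ 4ℚ)) 0≤ε ⊛ gap)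
      t₃ : ∣ v d * (F y - κ) ∣ ≤ 2ℚ * (2ℚ * ε * (2ℚ * rcp y))
      t₃ = ∣∣-*-≤ (ℚ.≤-trans (ℚ.≤-reflexive (ℚ.0≤p⇒∣p∣≡p (0≤v d 1≤d d≤X))) (upper d 1≤d d≤X)) (ℚ.≤-trans (F-κ y 1≤y y≤X) (0≤2ε ⊛ w-upper y 1≤y y≤X))
        where d≤X = ℕ.≤-trans d≤Z Z≤X
      T-bound : ∣ T ∣ ≤ ε * ((8ℚ + 4ℚ) * rcp y + τ′)
      T-bound = ℚ.≤-trans (ℚ.≤-reflexive (cong ∣_∣ T≡)) (ℚ.≤-trans
        (∣∣-+-≤ (∣∣-+-≤ (∣∣-+-≤ t₁ (mult d y 1≤d 1≤y (ℕ.≤-trans dy≤Z Z≤X))) t₃) (ℚ.≤-trans (ℚ.≤-reflexive (ℚ.∣-p∣≡∣p∣ (ε * errSum))) (∣∣-*-≤ {ε} (ℚ.≤-reflexive (ℚ.0≤p⇒∣p∣≡p 0≤ε)) errSum-bound)))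
        (lem ε τ (ι X) (rcp y) 0≤ε ε≤1 0≤τ (ι-nonNeg X)))
        where
        lem : ∀ e t x r → 0ℚ ≤ e → e ≤ 1ℚ → 0ℚ ≤ t → 0ℚ ≤ x → 4ℚ * e * r + e * t + 2ℚ * (2ℚ * e * (2ℚ * r)) + e * (x * (e * t)) ≤ e * ((8ℚ + 4ℚ) * r + t * (1ℚ + x))
        lem e t x r p q h k = ≤-by (*-nonNeg (*-nonNeg p h) k ⊛ q) (solve (e ∷ t ∷ x ∷ r ∷ []) ring)
      rdy : rcp d * rcp y ≤ 2ℚ * rcp Z
      rdy = *-cancelˡ-≤ (ι-pos 1≤Z) (lem (ι Z) (ι d) (ι y) (ι (d ℕ.* y)) (rcp d) (rcp y) (rcp Z) (ι-* d y) (rcp-inv 1≤d) (rcp-inv 1≤y) (rcp-inv 1≤Z)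
          (subst (ι Z ≤_) (ι-+ d (d ℕ.* y)) (ι-mono Z<d+dy)) (ι-mono (ℕ.m≤m*n d y {{ℕ.>-nonZero 1≤y}})) (*-nonNeg (rcp-nonNeg d) (rcp-nonNeg y)))
        where
        1≤Z = ℕ.≤-trans 1≤d d≤Z
        lem : ∀ z d y dy rd ry rz → dy ≡ d * y → rd * d ≡ 1ℚ → ry * y ≡ 1ℚ → rz * z ≡ 1ℚ → z ≤ d + dy → d ≤ dy → 0ℚ ≤ rd * ry → z * (rd * ry) ≤ z * (2ℚ * rz)
        lem z d y dy rd ry rz refl a b c p q r = subst (z * (rd * ry) ≤_) (trans (e₃ rd d ry y) (trans (cong₂ (λ s t → 2ℚ * (s * t)) a b) (trans (cong (2ℚ *_) (trans (ℚ.*-identityˡ 1ℚ) (sym c))) (e₄ z rz))))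
            (≤-by ((r ⊛ p) ⊕ (r ⊛ q)) (solve (z ∷ d ∷ y ∷ rd ∷ ry ∷ []) ring))
          where
          e₃ : ∀ rd d ry y → (d * y + d * y) * (rd * ry) ≡ 2ℚ * (rd * d * (ry * y))
          e₃ = solve-∀ ring
          e₄ : ∀ z rz → 2ℚ * (rz * z) ≡ z * (2ℚ * rz)
          e₄ = solve-∀ ring
      final : rcp d * (ε * ((8ℚ + 4ℚ) * rcp y + τ′)) ≤ ε * (8ℚ * (1ℚ + 2ℚ) * rcp Z + τ′)
      final = lem (rcp d) (rcp y) (rcp Z) τ′ ε 0≤ε (*-nonNeg 0≤τ (+-nonNeg 0≤1 (ι-nonNeg X))) rdy (rcp≤1 d)
        where
        lem : ∀ rd ry rz t e → 0ℚ ≤ e → 0ℚ ≤ t → rd * ry ≤ 2ℚ * rz → rd ≤ 1ℚ → rd * (e * ((8ℚ + 4ℚ) * ry + t)) ≤ e * (8ℚ * (1ℚ + 2ℚ) * rz + t)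
        lem rd ry rz t e p q h k = ≤-by ((*-nonNeg p (ℚ.<⇒≤ (ℚ.positive⁻¹ (8ℚ + 4ℚ))) ⊛ h) ⊕ (*-nonNeg p q ⊛ k)) (solve (rd ∷ ry ∷ rz ∷ t ∷ e ∷ []) ring)

    C : ℕ → ℚ
    C N = ∑ N (λ n → c n * w n)

    L : ℚ
    L = ∑ D (λ d → c d * rcp d)

    error : ℕ → ℚ
    error Z = ι D * (8ℚ * (1ℚ + 2ℚ) * rcp Z + τ′) + 4ℚ * Q * rcp (suc D) * harmonic Z

    module _ (Z : ℕ) (Z≤X : Z ℕ.≤ X) (D≤Z : D ℕ.≤ Z) where
      open Hyperbola c w Z

      private
        Z≤M = ℕ.≤-trans Z≤X X≤M

      head-error : ∣ ε * head D - (v Z * L - κ * C D) ∣ ≤ ι D * (ε * (8ℚ * (1ℚ + 2ℚ) * rcp Z + τ′))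
      head-error = ℚ.≤-trans (ℚ.≤-reflexive (cong ∣_∣ e₁)) (ℚ.≤-trans (∑-abs D _) (ℚ.≤-trans (∑-mono D bnd) (ℚ.≤-reflexive (∑-const D _))))
        where
        t : ℕ → ℚ
        t d = c d * (ε * ∑ Z (λ e → W (d ℕ.* e)) - rcp d * (v Z - κ * v d))
        e₁ : ε * head D - (v Z * L - κ * C D) ≡ ∑ D t
        e₁ = sym (trans (∑-cong D (λ d _ _ → lem (c d) ε (∑ Z (λ e → W (d ℕ.* e))) (rcp d) (v Z) κ (v d)))
            (trans (∑-- D _ _) (cong₂ (λ a b → a - b) (∑-* D ε _) (trans (∑-- D _ _) (cong₂ (λ a b → a - b) (∑-* D (v Z) _) (∑-* D κ _))))))
          where
          lem : ∀ c ε g r z k d → c * (ε * g - r * (z - k * d)) ≡ ε * (c * g) - (z * (c * r) - k * (c * (d * r)))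
          lem = solve-∀ ring
        bnd : ∀ d → 1 ℕ.≤ d → d ℕ.≤ D → ∣ t d ∣ ≤ ε * (8ℚ * (1ℚ + 2ℚ) * rcp Z + τ′)
        bnd d@(suc _) 1≤d d≤D = subst (∣ t d ∣ ≤_) (ℚ.*-identityˡ _) (∣∣-*-≤ (c≤1 d)
          (ℚ.≤-trans (ℚ.≤-reflexive (trans (∣∣-neg {ε * ∑ Z (λ e → W (d ℕ.* e))}) (cong (λ g → ∣ rcp d * (v Z - κ * v d) - ε * g ∣) (row d)))) (row-error Z d Z≤X 1≤d (ℕ.≤-trans d≤D D≤Z))))

      S-error : ∣ ε * S - (v Z * L - κ * C D) ∣ ≤ ε * error Z
      S-error = ℚ.≤-trans (ℚ.≤-reflexive (cong ∣_∣ (trans (cong (λ s → ε * s - (v Z * L - κ * C D)) (S-split D K DK)) (e₁ ε (head D) (tail D K) (v Z * L - κ * C D)))))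
        (ℚ.≤-trans (∣∣-+-≤ head-error (∣∣-*-≤ {ε} (ℚ.≤-reflexive (ℚ.0≤p⇒∣p∣≡p 0≤ε)) tail-error)) (ℚ.≤-reflexive (e₂ (ι D) ε (8ℚ * (1ℚ + 2ℚ) * rcp Z + τ′) (4ℚ * Q * rcp (suc D) * harmonic Z))))
        where
        K = proj₁ (ℕ.m≤n⇒∃[o]m+o≡n D≤Z)
        DK = proj₂ (ℕ.m≤n⇒∃[o]m+o≡n D≤Z)
        e₁ : ∀ ε h t x → ε * (h + t) - x ≡ ε * h - x + ε * t
        e₁ = solve-∀ ring
        e₂ : ∀ d ε x y → d * (ε * x) + ε * y ≡ ε * (d * x + y)
        e₂ = solve-∀ ring
        Wbound : ∀ e → 1 ℕ.≤ e → e ℕ.≤ Z → W (suc D ℕ.* e) ≤ 2ℚ * rcp (suc D) * rcp e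
        Wbound e 1≤e _ with suc D ℕ.* e ℕ.≤? Z
        ... | no _ = ℚ.≤-trans (ℚ.≤-reflexive (ℚ.*-zeroˡ (w (suc D ℕ.* e)))) (*-nonNeg (*-nonNeg 0≤2 (rcp-nonNeg (suc D))) (rcp-nonNeg e))
        ... | yes le = ℚ.≤-trans (ℚ.≤-reflexive (ℚ.*-identityˡ (w (suc D ℕ.* e)))) (ℚ.≤-trans (w-upper (suc D ℕ.* e) (ℕ.*-mono-≤ {1} {suc D} (s≤s z≤n) 1≤e) (ℕ.≤-trans le Z≤X))
            (ℚ.≤-reflexive (trans (cong (2ℚ *_) (rcp-* {suc D} {e} (s≤s z≤n) 1≤e)) (sym (ℚ.*-assoc 2ℚ (rcp (suc D)) (rcp e))))))
        tail-error : ∣ tail D K ∣ ≤ 4ℚ * Q * rcp (suc D) * harmonic Z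
        tail-error = ℚ.≤-trans (tail-bound Q 0≤Q partial (λ n a b → w≥0 n a (ℕ.≤-trans b Z≤M)) (λ m n a b h → w-anti m n a b (ℕ.≤-trans h Z≤M)) D K)
          (ℚ.≤-trans (+-nonNeg 0≤Q 0≤Q ⊛ ∑-mono Z Wbound) (ℚ.≤-reflexive (trans (cong ((Q + Q) *_) (∑-* Z (2ℚ * rcp (suc D)) rcp)) (e₃ Q (rcp (suc D)) (harmonic Z)))))
          where
          e₃ : ∀ Q r h → (Q + Q) * (2ℚ * r * h) ≡ 4ℚ * Q * r * h
          e₃ = solve-∀ ring

    C-bound : ∀ {τ₁} → suc D ℕ.≤ X → ∣ C M ∣ ≤ τ₁ → ∣ C D ∣ ≤ τ₁ + 4ℚ * Q * rcp (suc D)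
    C-bound {τ₁} D<X CM with K , DK ← ℕ.m≤n⇒∃[o]m+o≡n (ℕ.≤-trans (ℕ.≤-trans (ℕ.n≤1+n D) D<X) X≤M) =
      ℚ.≤-trans (ℚ.≤-reflexive (cong ∣_∣ (e₁ (C D) (C M) T split))) (∣∣-+-≤ CM (ℚ.≤-trans (ℚ.≤-reflexive (ℚ.∣-p∣≡∣p∣ T)) T-bound))
      where
      T = ∑ K (λ k → c (D ℕ.+ k) * w (D ℕ.+ k))
      split : C M ≡ C D + T
      split = trans (cong C (sym DK)) (∑-split D K _)
      e₁ : ∀ a b t → b ≡ a + t → a ≡ b + (- t)
      e₁ a b t refl = e a t
        where
        e : ∀ a t → a ≡ a + t + (- t)
        e = solve-∀ ring
      inM : ∀ {k} → k ℕ.≤ K → D ℕ.+ k ℕ.≤ M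
      inM le = subst (_ ℕ.≤_) DK (ℕ.+-monoʳ-≤ D le)
      D+1 : D ℕ.+ 1 ≡ suc D
      D+1 = ℕ.+-comm D 1
      T-bound : ∣ T ∣ ≤ 4ℚ * Q * rcp (suc D)
      T-bound = ℚ.≤-trans (abel K (λ k → c (D ℕ.+ k)) (λ k → w (D ℕ.+ k)) (Q + Q) (+-nonNeg 0≤Q 0≤Q)
          (subst (λ n → 0ℚ ≤ w n) (sym D+1) (w≥0 (suc D) (s≤s z≤n) (ℕ.≤-trans D<X X≤M)))
          (λ k 1≤k k≤K → w≥0 (D ℕ.+ k) (ℕ.≤-trans 1≤D (ℕ.m≤m+n D k)) (inM k≤K))
          (λ k 1≤k k<K → w-anti (D ℕ.+ k) (D ℕ.+ suc k) (ℕ.≤-trans 1≤D (ℕ.m≤m+n D k)) (ℕ.+-monoʳ-≤ D (ℕ.n≤1+n k)) (inM k<K))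
          (Hyperbola.partial-shift c w X Q 0≤Q partial (λ n a b → w≥0 n a (ℕ.≤-trans b X≤M)) (λ m n a b h → w-anti m n a b (ℕ.≤-trans h X≤M)) D))
        (subst (λ n → (Q + Q) * w n ≤ 4ℚ * Q * rcp (suc D)) (sym D+1)
          (ℚ.≤-trans (+-nonNeg 0≤Q 0≤Q ⊛ w-upper (suc D) (s≤s z≤n) D<X) (ℚ.≤-reflexive (e₃ Q (rcp (suc D))))))
        where
        e₃ : ∀ Q r → (Q + Q) * (2ℚ * r) ≡ 4ℚ * Q * r
        e₃ = solve-∀ ring

    -- Eliminating L between the asymptotic formulas at Y and at X.
    growth : ∀ Y g γ e → 1 ℕ.≤ Y → Y ℕ.≤ X → D ℕ.≤ Y → 0ℚ ≤ g → 0ℚ ≤ γ → 0ℚ ≤ v X - v Y → v X - v Y ≤ g * ε →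
      ∣ C D ∣ ≤ γ → error X ≤ e → error Y ≤ e →
      0ℚ ≤ Hyperbola.S c w X - Hyperbola.S c w Y → 0ℚ ≤ Hyperbola.S c w Y →
      Hyperbola.S c w X - Hyperbola.S c w Y ≤ 2ℚ * g * ε * Hyperbola.S c w Y + (8ℚ * 2ℚ * g * γ + 2ℚ * g * e + 8ℚ * e)
    growth Y g γ e 1≤Y Y≤X D≤Y 0≤g 0≤γ dv≥0 dv≤ hC eX eY dS S≥0 =
      *-cancelˡ-≤ 0<ε (lem (v X) (v Y) L SX SY (κ * C D) γ
        (ℚ.≤-trans (∣∣≤⇒≤ (S-error X ℕ.≤-refl (ℕ.≤-trans D≤Y Y≤X))) (0≤ε ⊛ eX))
        (ℚ.≤-trans (∣∣≤⇒-≤ (S-error Y Y≤X D≤Y)) (0≤ε ⊛ eY))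
        dv≥0 dv≤ (∣∣≤⇒≤ (∣∣-*-≤ (κ-bound (ℕ.≤-trans 1≤Y Y≤X)) hC)) (lower Y 1≤Y Y≤X) (upper Y 1≤Y Y≤X) dS S≥0 0≤γ 0≤e)
      where
      SX = Hyperbola.S c w X
      SY = Hyperbola.S c w Y
      0≤e : 0ℚ ≤ e
      0≤e = *-cancelˡ-≤ 0<ε (ℚ.≤-trans (ℚ.≤-reflexive (ℚ.*-zeroʳ ε)) (ℚ.≤-trans (ℚ.0≤∣p∣ _) (ℚ.≤-trans (S-error Y Y≤X D≤Y) (0≤ε ⊛ eY))))
      lem : ∀ vX vY L SX SY κC γ → ε * SX - (vX * L - κC) ≤ ε * e → - (ε * SY - (vY * L - κC)) ≤ ε * e →
        0ℚ ≤ vX - vY → vX - vY ≤ g * ε → κC ≤ 8ℚ * γ → 1ℚ ≤ 2ℚ * vY → vY ≤ 2ℚ → 0ℚ ≤ SX - SY → 0ℚ ≤ SY → 0ℚ ≤ γ → 0ℚ ≤ e →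
        ε * (SX - SY) ≤ ε * (2ℚ * g * ε * SY + (8ℚ * 2ℚ * g * γ + 2ℚ * g * e + 8ℚ * e))
      lem vX vY L SX SY κC γ hX hY dv≥0 dv≤ hκ lo up dS S≥0 0≤γ 0≤e =
        ≤-by ((*-nonNeg 0≤ε dS ⊛ lo) ⊕ (0≤2 ⊛ step₂)) (solve (vX ∷ vY ∷ SX ∷ SY ∷ γ ∷ g ∷ e ∷ ε ∷ []) ring)
        where
        step₀ : ε * (SX - SY) ≤ (vX - vY) * L + 2ℚ * ε * e
        step₀ = ≤-by (hX ⊕ hY) (solve (vX ∷ vY ∷ L ∷ SX ∷ SY ∷ κC ∷ e ∷ ε ∷ []) ring)
        step₁ : (vX - vY) * (vY * L) ≤ g * ε * (ε * SY + 8ℚ * γ + ε * e)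
        step₁ = ℚ.≤-trans (dv≥0 ⊛ vYL) (subst₂ _≤_ (ℚ.*-comm B (vX - vY)) (ℚ.*-comm B (g * ε)) (0≤B ⊛ dv≤))
          where
          B = ε * SY + 8ℚ * γ + ε * e
          0≤B : 0ℚ ≤ B
          0≤B = +-nonNeg (+-nonNeg (*-nonNeg 0≤ε S≥0) (*-nonNeg (ℚ.<⇒≤ (ℚ.positive⁻¹ 8ℚ)) 0≤γ)) (*-nonNeg 0≤ε 0≤e)
          vYL : vY * L ≤ ε * SY + 8ℚ * γ + ε * e
          vYL = ≤-by (hY ⊕ hκ) (solve (vY ∷ L ∷ SY ∷ κC ∷ γ ∷ e ∷ ε ∷ []) ring)
        step₂ : vY * (ε * (SX - SY)) ≤ g * ε * (ε * SY + 8ℚ * γ + e) + 4ℚ * ε * e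
        step₂ = ≤-by ((0≤vY ⊛ step₀) ⊕ step₁ ⊕ (*-nonNeg 0≤2ε 0≤e ⊛ up) ⊕ (*-nonNeg (*-nonNeg 0≤g 0≤ε) 0≤e ⊛ ε≤1)) (solve (vX ∷ vY ∷ L ∷ SX ∷ SY ∷ γ ∷ g ∷ e ∷ ε ∷ []) ring)
          where
          0≤vY : 0ℚ ≤ vY
          0≤vY = *-cancelˡ-≤ (ℚ.positive⁻¹ 2ℚ) (ℚ.≤-trans (ℚ.≤-reflexive (ℚ.*-zeroʳ 2ℚ)) (ℚ.≤-trans 0≤1 lo))

module DivisorSums where

  open import Data.Rational using (_≤_)
  open Rationals
  open Summation

  prime-pos : ∀ {p} → Prime p → 1 ℕ.≤ p
  prime-pos pr = ℕ.>-nonZero⁻¹ _ {{prime⇒nonZero pr}}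

  prime>1 : ∀ {p} → Prime p → 1 ℕ.< p
  prime>1 pr = ℕ.nonTrivial⇒n>1 _ {{prime⇒nonTrivial pr}}

  prime-divisor : ∀ n → 1 ℕ.< n → ∃ λ p → Prime p × p ∣ n
  prime-divisor n 1<n = go (PrimeFactorisation.factors f) (PrimeFactorisation.isFactorisation f) (PrimeFactorisation.factorsPrime f)
    where
    f = factorise n {{ℕ.>-nonZero (ℕ.<-trans (s≤s z≤n) 1<n)}}
    go : ∀ ps → n ≡ Data.List.foldr ℕ._*_ 1 ps → All Prime ps → ∃ λ p → Prime p × p ∣ n
    go [] refl _ = ⊥-elim (ℕ.<-irrefl refl 1<n)
    go (p ∷ ps) refl (pr All.∷ _) = p , pr , m∣m*n _

  prime∣prime : ∀ {p p′} → Prime p → Prime p′ → p ∣ p′ → p ≡ p′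
  prime∣prime pr pr′ p∣p′ with prime⇒irreducible pr′ p∣p′
  ... | inj₁ refl = ⊥-elim (ℕ.<-irrefl refl (prime>1 pr))
  ... | inj₂ e = e

  record Sign (c : ℕ → ℚ) : Set where
    field
      c-one  : c 1 ≡ 1ℚ
      c-*    : ∀ m n → c (m ℕ.* n) ≡ c m * c n
      c-cases : ∀ n → c n ≡ 0ℚ ⊎ c n ≡ 1ℚ ⊎ c n ≡ - 1ℚ

  away : ℕ → (ℕ → ℚ) → ℕ → ℚ
  away p c d = 𝟙 (¬? (p ∣? d)) * c d

  away-∤ : ∀ p c d → ¬ p ∣ d → away p c d ≡ c d
  away-∤ p c d ¬d = trans (cong (_* c d) (𝟙-yes (¬? (p ∣? d)) ¬d)) (ℚ.*-identityˡ (c d))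

  away-∣ : ∀ p c d → p ∣ d → away p c d ≡ 0ℚ
  away-∣ p c d pd = trans (cong (_* c d) (𝟙-no (¬? (p ∣? d)) (λ ¬d → ¬d pd))) (ℚ.*-zeroˡ (c d))

  away-sign : ∀ {p c} → Prime p → Sign c → Sign (away p c)
  away-sign {p} {c} pr s = record { c-one = one ; c-* = mul ; c-cases = cases }
    where
    open Sign s
    one : away p c 1 ≡ 1ℚ
    one = trans (away-∤ p c 1 (λ p∣1 → ℕ.<-irrefl (sym (∣1⇒≡1 p∣1)) (prime>1 pr))) c-one
    mul : ∀ m n → away p c (m ℕ.* n) ≡ away p c m * away p c n
    mul m n with p ∣? m | p ∣? n
    ... | yes pm | _ = trans (away-∣ p c (m ℕ.* n) (∣-trans pm (m∣m*n n))) (lem (c m) _)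
      where
      lem : ∀ a b → 0ℚ ≡ 0ℚ * a * b
      lem = solve-∀ ring
    ... | no _ | yes pn = trans (away-∣ p c (m ℕ.* n) (∣-trans pn (n∣m*n m))) (lem (c m) (c n))
      where
      lem : ∀ a b → 0ℚ ≡ 1ℚ * a * (0ℚ * b)
      lem = solve-∀ ring
    ... | no ¬pm | no ¬pn = trans (away-∤ p c (m ℕ.* n) ¬pmn) (trans (c-* m n) (sym (cong₂ _*_ (ℚ.*-identityˡ (c m)) (ℚ.*-identityˡ (c n)))))
      where
      ¬pmn : ¬ p ∣ m ℕ.* n
      ¬pmn h with euclidsLemma m n pr h
      ... | inj₁ x = ¬pm x
      ... | inj₂ x = ¬pn x
    cases : ∀ n → away p c n ≡ 0ℚ ⊎ away p c n ≡ 1ℚ ⊎ away p c n ≡ - 1ℚ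
    cases n with p ∣? n
    ... | yes _ = inj₁ (ℚ.*-zeroˡ (c n))
    ... | no _ = subst (λ t → t ≡ 0ℚ ⊎ t ≡ 1ℚ ⊎ t ≡ - 1ℚ) (sym (ℚ.*-identityˡ (c n))) (c-cases n)

  divisorSum-cong : ∀ n {c c′} → (∀ d → d ∣ n → c d ≡ c′ d) → divisorSum c n ≡ divisorSum c′ n
  divisorSum-cong n {c} {c′} e = ∑-cong n (λ d _ _ → same d)
    where
    same : ∀ d → 𝟙 (d ∣? n) * c d ≡ 𝟙 (d ∣? n) * c′ d
    same d with d ∣? n
    ... | yes dn = cong (1ℚ *_) (e d dn)
    ... | no _ = trans (ℚ.*-zeroˡ (c d)) (sym (ℚ.*-zeroˡ (c′ d)))

  -- splitting the divisors of p n into the multiples of p and the others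
  divisorSum-prime : ∀ {p c} n → Prime p → Sign c → 1 ℕ.≤ n →
    divisorSum c (p ℕ.* n) ≡ c p * divisorSum c n + divisorSum (away p c) n
  divisorSum-prime {p} {c} n pr s 1≤n = trans (trans (∑-cong (p ℕ.* n) (λ d _ _ → split d)) (∑-+ (p ℕ.* n) _ _)) (cong₂ _+_ multiples others)
    where
    open Sign s
    h : ℕ → ℚ
    h d = 𝟙 (d ∣? p ℕ.* n) * c d
    1≤p = prime-pos pr
    split : ∀ d → h d ≡ 𝟙 (p ∣? d) * h d + 𝟙 (d ∣? p ℕ.* n) * away p c d
    split d with p ∣? d
    ... | yes _ = lem (𝟙 (d ∣? p ℕ.* n)) (c d)
      where
      lem : ∀ a b → a * b ≡ 1ℚ * (a * b) + a * (0ℚ * b)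
      lem = solve-∀ ring
    ... | no _ = lem (𝟙 (d ∣? p ℕ.* n)) (c d)
      where
      lem : ∀ a b → a * b ≡ 0ℚ * (a * b) + a * (1ℚ * b)
      lem = solve-∀ ring
    multiples : ∑ (p ℕ.* n) (λ d → 𝟙 (p ∣? d) * h d) ≡ c p * divisorSum c n
    multiples = begin
      ∑ (p ℕ.* n) (λ d → 𝟙 (p ∣? d) * h d)
        ≡⟨ ∑-cong (p ℕ.* n) (λ d 1≤d d≤pn → trans (cong (_* h d) (sym (∑-multiples n p d 1≤p 1≤d d≤pn))) (sym (∑-*ʳ n (h d) _))) ⟩
      ∑ (p ℕ.* n) (λ d → ∑ n (λ e → 𝟙 (d ℕ.≟ p ℕ.* e) * h d))
        ≡⟨ ∑-swap (p ℕ.* n) n _ ⟩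
      ∑ n (λ e → ∑ (p ℕ.* n) (λ d → 𝟙 (d ℕ.≟ p ℕ.* e) * h d))
        ≡⟨ ∑-cong n (λ e 1≤e e≤n → trans (∑-pick (p ℕ.* n) (p ℕ.* e) h (ℕ.*-mono-≤ 1≤p 1≤e)) (term e (ℕ.*-monoʳ-≤ p e≤n))) ⟩
      ∑ n (λ e → c p * (𝟙 (e ∣? n) * c e))
        ≡⟨ ∑-* n (c p) _ ⟩
      c p * divisorSum c n ∎
      where
      open ≡-Reasoning
      lem : ∀ i a b → 1ℚ * (i * (a * b)) ≡ a * (i * b)
      lem = solve-∀ ring
      term : ∀ e → p ℕ.* e ℕ.≤ p ℕ.* n → 𝟙 (p ℕ.* e ℕ.≤? p ℕ.* n) * h (p ℕ.* e) ≡ c p * (𝟙 (e ∣? n) * c e)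
      term e le = trans (cong₂ (λ a b → a * (b * c (p ℕ.* e))) (𝟙-yes (p ℕ.* e ℕ.≤? p ℕ.* n) le)
          (𝟙-cong (p ℕ.* e ∣? p ℕ.* n) (e ∣? n) (*-cancelˡ-∣ p {{prime⇒nonZero pr}}) (*-monoʳ-∣ p)))
        (trans (cong (λ t → 1ℚ * (𝟙 (e ∣? n) * t)) (c-* p e)) (lem (𝟙 (e ∣? n)) (c p) (c e)))
    others : ∑ (p ℕ.* n) (λ d → 𝟙 (d ∣? p ℕ.* n) * away p c d) ≡ divisorSum (away p c) n
    others = trans (∑-cong (p ℕ.* n) (λ d _ _ → same d))
        (∑-extend (ℕ.m≤n*m n p {{prime⇒nonZero pr}}) (λ d n<d _ → trans (cong (_* away p c d) (𝟙-no (d ∣? n) (λ dn → ℕ.<⇒≱ n<d (∣⇒≤ {{ℕ.>-nonZero 1≤n}} dn)))) (ℚ.*-zeroˡ (away p c d))))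
      where
      coprimePart : ∀ d → ¬ p ∣ d → d ∣ p ℕ.* n → d ∣ n
      coprimePart d ¬pd (divides k eq) with euclidsLemma k d pr (subst (p ∣_) eq (m∣m*n n))
      ... | inj₂ pd = ⊥-elim (¬pd pd)
      ... | inj₁ (divides j refl) = divides j (ℕ.*-cancelˡ-≡ n (j ℕ.* d) p {{prime⇒nonZero pr}} (trans eq (trans (cong (ℕ._* d) (ℕ.*-comm j p)) (ℕ.*-assoc p j d))))
      same : ∀ d → 𝟙 (d ∣? p ℕ.* n) * away p c d ≡ 𝟙 (d ∣? n) * away p c d
      same d with p ∣? d
      ... | yes _ = lem (𝟙 (d ∣? p ℕ.* n)) (𝟙 (d ∣? n)) (c d)
        where
        lem : ∀ a b x → a * (0ℚ * x) ≡ b * (0ℚ * x)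
        lem = solve-∀ ring
      ... | no ¬pd = cong (_* (1ℚ * c d)) (𝟙-cong (d ∣? p ℕ.* n) (d ∣? n) (coprimePart d ¬pd) (λ dn → ∣-trans dn (n∣m*n p)))

  divisorSum-1 : ∀ {c} → Sign c → divisorSum c 1 ≡ 1ℚ
  divisorSum-1 {c} s = trans (cong₂ (λ a b → 0ℚ + a * b) (𝟙-yes (1 ∣? 1) ∣-refl) (Sign.c-one s)) refl

  divisorSum-nonNeg : ∀ n → 1 ℕ.≤ n → ∀ {c} → Sign c → 0ℚ ≤ divisorSum c n
  divisorSum-nonNeg = <-rec _ go
    where
    go : ∀ n → (∀ {m} → m ℕ.< n → 1 ℕ.≤ m → ∀ {c} → Sign c → 0ℚ ≤ divisorSum c m) →
      1 ℕ.≤ n → ∀ {c} → Sign c → 0ℚ ≤ divisorSum c n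
    go n rec 1≤n {c} s with ℕ.m≤n⇒m<n∨m≡n 1≤n
    ... | inj₂ refl = subst (0ℚ ≤_) (sym (divisorSum-1 s)) 0≤1
    ... | inj₁ 1<n with prime-divisor n 1<n
    ...   | p , pr , divides zero refl = ⊥-elim (ℕ.<⇒≱ 1≤n z≤n)
    ...   | p , pr , divides m@(suc _) refl = subst (λ t → 0ℚ ≤ divisorSum c t) (ℕ.*-comm p m)
              (subst (0ℚ ≤_) (sym (divisorSum-prime m pr s (s≤s z≤n))) (by-sign (c-cases p)))
      where
      open Sign s
      smaller : ∀ {j} → 1 ℕ.≤ j → j ℕ.< j ℕ.* p
      smaller {j@(suc _)} _ = ℕ.m<m*n j p (prime>1 pr)
      r = divisorSum c m
      r′ = divisorSum (away p c) m
      r≥0 : 0ℚ ≤ r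
      r≥0 = rec (smaller {m} (s≤s z≤n)) (s≤s z≤n) s
      r′≥0 : 0ℚ ≤ r′
      r′≥0 = rec (smaller {m} (s≤s z≤n)) (s≤s z≤n) (away-sign pr s)
      minus : c p ≡ - 1ℚ → Dec (p ∣ m) → 0ℚ ≤ c p * r + r′
      by-sign : c p ≡ 0ℚ ⊎ c p ≡ 1ℚ ⊎ c p ≡ - 1ℚ → 0ℚ ≤ c p * r + r′
      by-sign (inj₁ e) = subst (λ t → 0ℚ ≤ t * r + r′) (sym e) (+-nonNeg (*-nonNeg ℚ.≤-refl r≥0) r′≥0)
      by-sign (inj₂ (inj₁ e)) = subst (λ t → 0ℚ ≤ t * r + r′) (sym e) (+-nonNeg (*-nonNeg 0≤1 r≥0) r′≥0)
      by-sign (inj₂ (inj₂ e)) = minus e (p ∣? m)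
      minus e (no ¬pm) = ℚ.≤-reflexive (sym (trans (cong₂ (λ t u → t * r + u) e (divisorSum-cong m (λ d dm → away-∤ p c d (λ pd → ¬pm (∣-trans pd dm))))) (lem r)))
        where
        lem : ∀ r → (- 1ℚ) * r + r ≡ 0ℚ
        lem = solve-∀ ring
      minus e (yes (divides j eq)) = subst (0ℚ ≤_) (sym total) (rec j<n 1≤j s)
        where
        1≤j : 1 ℕ.≤ j
        1≤j = ℕ.n≢0⇒n>0 (λ { refl → ℕ.1+n≢0 eq })
        m≡ : m ≡ p ℕ.* j
        m≡ = trans eq (ℕ.*-comm j p)
        j<n : j ℕ.< m ℕ.* p
        j<n = ℕ.<-trans (subst (j ℕ.<_) (sym eq) (smaller 1≤j)) (smaller {m} (s≤s z≤n))
        c′ = away p c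
        r≡ : r ≡ c p * divisorSum c j + divisorSum c′ j
        r≡ = trans (cong (divisorSum c) m≡) (divisorSum-prime j pr s 1≤j)
        r′≡ : r′ ≡ 0ℚ * divisorSum c′ j + divisorSum c′ j
        r′≡ = trans (cong (divisorSum c′) m≡) (trans (divisorSum-prime j pr (away-sign pr s) 1≤j)
          (cong₂ (λ a b → a * divisorSum c′ j + b) (away-∣ p c p ∣-refl) (divisorSum-cong j (λ d _ → idem d))))
          where
          idem : ∀ d → away p (away p c) d ≡ away p c d
          idem d with p ∣? d
          ... | yes _ = lem (c d)
            where
            lem : ∀ x → 0ℚ * (0ℚ * x) ≡ 0ℚ * x
            lem = solve-∀ ring
          ... | no _ = lem (c d)
            where
            lem : ∀ x → 1ℚ * (1ℚ * x) ≡ 1ℚ * x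
            lem = solve-∀ ring
        lem : ∀ a b → (- 1ℚ) * ((- 1ℚ) * a + b) + (0ℚ * b + b) ≡ a
        lem = solve-∀ ring
        total : c p * r + r′ ≡ divisorSum c j
        total = trans (cong₂ (λ a b → c p * a + b) r≡ r′≡) (trans (cong (λ t → t * (t * divisorSum c j + divisorSum c′ j) + (0ℚ * divisorSum c′ j + divisorSum c′ j)) e) (lem (divisorSum c j) (divisorSum c′ j)))

  divisorSum-≥ : ∀ {p c} m → Prime p → Sign c → 1 ℕ.≤ m → c p ≡ 1ℚ → divisorSum c m ≤ divisorSum c (p ℕ.* m)
  divisorSum-≥ {p} {c} m pr s 1≤m e = subst (divisorSum c m ≤_) (sym (divisorSum-prime m pr s 1≤m))
    (lem (divisorSum c m) (divisorSum (away p c) m) (c p) e (divisorSum-nonNeg m 1≤m (away-sign pr s)))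
    where
    lem : ∀ r r′ t → t ≡ 1ℚ → 0ℚ ≤ r′ → r ≤ t * r + r′
    lem r r′ t refl h = ≤-by h (solve (r ∷ r′ ∷ []) ring)

  -- The map (p, m) ↦ p m is injective on primes p > Y and numbers 1 ≤ m ≤ Y.
  module PrimeSum (c : ℕ → ℚ) (s : Sign c) (Y : ℕ) where

    Large : ℕ → Set
    Large p = Y ℕ.< p × (Prime p × c p ≡ 1ℚ)

    large? : ∀ p → Dec (Large p)
    large? p = (Y ℕ.<? p) ×-dec (prime? p ×-dec (c p ℚ.≟ 1ℚ))

    r = divisorSum c

    S₁ : ℕ → ℚ
    S₁ Z = ∑ Z (λ n → r n * rcp n)

    P : ℕ → ℚ
    P Z = ∑ Z (λ p → 𝟙 (large? p) * rcp p)

    prime-sum : ∀ Z → Y ℕ.≤ Z ℕ.* Y → P Z * S₁ Y ≤ S₁ (Z ℕ.* Y) - S₁ Y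
    prime-sum Z Y≤X = ℚ.≤-trans (ℚ.≤-reflexive expand) (ℚ.≤-trans (∑-mono X (λ n 1≤n n≤X → rcp-nonNeg n ⊛ inner-bound n 1≤n)) (ℚ.≤-reflexive range))
      where
      X = Z ℕ.* Y
      inner : ℕ → ℕ → ℚ
      inner n p = ∑ Y (λ m → 𝟙 (large? p) * 𝟙 (n ℕ.≟ p ℕ.* m) * r m)
      expand : P Z * S₁ Y ≡ ∑ X (λ n → rcp n * ∑ Z (inner n))
      expand = begin
        P Z * S₁ Y
          ≡⟨ sym (∑-*ʳ Z (S₁ Y) _) ⟩
        ∑ Z (λ p → 𝟙 (large? p) * rcp p * S₁ Y)
          ≡⟨ ∑-cong Z (λ p 1≤p p≤Z → trans (sym (∑-* Y (𝟙 (large? p) * rcp p) _)) (∑-cong Y (λ m 1≤m m≤Y → point p m 1≤p 1≤m (ℕ.*-mono-≤ p≤Z m≤Y)))) ⟩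
        ∑ Z (λ p → ∑ Y (λ m → ∑ X (λ n → rcp n * (𝟙 (large? p) * 𝟙 (n ℕ.≟ p ℕ.* m) * r m))))
          ≡⟨ ∑-cong Z (λ p _ _ → ∑-swap Y X _) ⟩
        ∑ Z (λ p → ∑ X (λ n → ∑ Y (λ m → rcp n * (𝟙 (large? p) * 𝟙 (n ℕ.≟ p ℕ.* m) * r m))))
          ≡⟨ ∑-swap Z X _ ⟩
        ∑ X (λ n → ∑ Z (λ p → ∑ Y (λ m → rcp n * (𝟙 (large? p) * 𝟙 (n ℕ.≟ p ℕ.* m) * r m))))
          ≡⟨ ∑-cong X (λ n _ _ → trans (∑-cong Z (λ p _ _ → ∑-* Y (rcp n) _)) (∑-* Z (rcp n) _)) ⟩
        ∑ X (λ n → rcp n * ∑ Z (inner n)) ∎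
        where
        open ≡-Reasoning
        lem : ∀ l a b r → l * a * (r * b) ≡ l * r * (a * b)
        lem = solve-∀ ring
        lem₂ : ∀ i l r k → l * r * (i * k) ≡ k * (l * i * r)
        lem₂ = solve-∀ ring
        point : ∀ p m → 1 ℕ.≤ p → 1 ℕ.≤ m → p ℕ.* m ℕ.≤ X → 𝟙 (large? p) * rcp p * (r m * rcp m) ≡ ∑ X (λ n → rcp n * (𝟙 (large? p) * 𝟙 (n ℕ.≟ p ℕ.* m) * r m))
        point p m 1≤p 1≤m le = trans (lem (𝟙 (large? p)) (rcp p) (rcp m) (r m)) (trans (cong (𝟙 (large? p) * r m *_) (trans (sym (rcp-* 1≤p 1≤m))
            (trans (sym (ℚ.*-identityˡ _)) (trans (cong (_* rcp (p ℕ.* m)) (sym (𝟙-yes (p ℕ.* m ℕ.≤? X) le))) (sym (∑-pick X (p ℕ.* m) rcp (ℕ.*-mono-≤ 1≤p 1≤m)))))))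
          (trans (sym (∑-* X (𝟙 (large? p) * r m) _)) (∑-cong X (λ n _ _ → lem₂ (𝟙 (n ℕ.≟ p ℕ.* m)) (𝟙 (large? p)) (r m) (rcp n)))))
      range : ∑ X (λ n → rcp n * (𝟙 (Y ℕ.<? n) * r n)) ≡ S₁ X - S₁ Y
      range = trans (subst (λ t → ∑ t f ≡ ∑ t h - S₁ Y) YK (trans (∑-split Y K f) (trans (cong₂ _+_ (∑-zero Y zeros) (∑-cong K (λ k 1≤k _ → same (Y ℕ.+ k) (ℕ.m<m+n Y 1≤k)))) (trans (lem (∑ Y h) (∑ K (λ k → h (Y ℕ.+ k)))) (cong (λ t → t - S₁ Y) (sym (∑-split Y K h))))))) refl
        where
        f = λ n → rcp n * (𝟙 (Y ℕ.<? n) * r n)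
        h = λ n → r n * rcp n
        K = proj₁ (ℕ.m≤n⇒∃[o]m+o≡n Y≤X)
        YK = proj₂ (ℕ.m≤n⇒∃[o]m+o≡n Y≤X)
        lem : ∀ a b → 0ℚ + b ≡ a + b - a
        lem = solve-∀ ring
        lem₀ : ∀ a b → a * (0ℚ * b) ≡ 0ℚ
        lem₀ = solve-∀ ring
        lem₁ : ∀ a b → a * (1ℚ * b) ≡ b * a
        lem₁ = solve-∀ ring
        zeros : ∀ n → 1 ℕ.≤ n → n ℕ.≤ Y → f n ≡ 0ℚ
        zeros n _ n≤Y = trans (cong (λ t → rcp n * (t * r n)) (𝟙-no (Y ℕ.<? n) (λ lt → ℕ.<⇒≱ lt n≤Y))) (lem₀ (rcp n) (r n))
        same : ∀ n → Y ℕ.< n → f n ≡ h n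
        same n lt = trans (cong (λ t → rcp n * (t * r n)) (𝟙-yes (Y ℕ.<? n) lt)) (lem₁ (rcp n) (r n))
      Hit : ℕ → ℕ → Set
      Hit n p = Large p × (∃ λ m → n ≡ p ℕ.* m × (1 ℕ.≤ m × m ℕ.≤ Y))
      hit : ∀ n → 1 ℕ.≤ n → ∀ p → inner n p ≡ 0ℚ ⊎ (Hit n p × inner n p ≤ r n)
      hit n 1≤n p with large? p
      ... | no _ = inj₁ (∑-zero Y (λ m _ _ → lem₀ (𝟙 (n ℕ.≟ p ℕ.* m)) (r m)))
        where
        lem₀ : ∀ a b → 0ℚ * a * b ≡ 0ℚ
        lem₀ = solve-∀ ring
      ... | yes lp with p ∣? n
      ...   | no ¬pn = inj₁ (∑-zero Y (λ m _ _ → trans (cong (λ t → 1ℚ * t * r m) (𝟙-no (n ℕ.≟ p ℕ.* m) (λ e → ¬pn (divides m (trans e (ℕ.*-comm p m)))))) (lem₀ (r m))))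
        where
        lem₀ : ∀ b → 1ℚ * 0ℚ * b ≡ 0ℚ
        lem₀ = solve-∀ ring
      ...   | yes (divides zero e) = ⊥-elim (ℕ.<⇒≱ 1≤n (ℕ.≤-reflexive e))
      ...   | yes (divides m@(suc _) e) = result (m ℕ.≤? Y)
        where
        pr = proj₁ (proj₂ lp)
        value : ∑ Y (λ m′ → 1ℚ * 𝟙 (n ℕ.≟ p ℕ.* m′) * r m′) ≡ 𝟙 (m ℕ.≤? Y) * r m
        value = trans (∑-cong Y (λ m′ _ _ → cong (_* r m′) (trans (ℚ.*-identityˡ _) (𝟙-cong (n ℕ.≟ p ℕ.* m′) (m′ ℕ.≟ m)
            (λ q → ℕ.*-cancelˡ-≡ m′ m p {{prime⇒nonZero pr}} (trans (sym q) (trans e (ℕ.*-comm m p)))) (λ { refl → trans e (ℕ.*-comm m p) }))))) (∑-pick Y m r (s≤s z≤n))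
        result : Dec (m ℕ.≤ Y) → _ ⊎ (Hit n p × _)
        result (no m≰Y) = inj₁ (trans value (trans (cong (_* r m) (𝟙-no (m ℕ.≤? Y) m≰Y)) (ℚ.*-zeroˡ (r m))))
        result (yes m≤Y) = inj₂ ((lp , m , trans e (ℕ.*-comm m p) , s≤s z≤n , m≤Y) ,
          ℚ.≤-trans (ℚ.≤-reflexive (trans value (trans (cong (_* r m) (𝟙-yes (m ℕ.≤? Y) m≤Y)) (ℚ.*-identityˡ (r m)))))
            (subst (λ t → r m ≤ r t) (trans (ℕ.*-comm p m) (sym e)) (divisorSum-≥ m pr s (s≤s z≤n) (proj₂ (proj₂ lp)))))
      bound : ℕ → ℚ
      bound n = 𝟙 (Y ℕ.<? n) * r n
      bound≥0 : ∀ n → 1 ℕ.≤ n → 0ℚ ≤ bound n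
      bound≥0 n 1≤n = *-nonNeg (𝟙-nonNeg (Y ℕ.<? n)) (divisorSum-nonNeg n 1≤n s)
      inner-bound : ∀ n → 1 ℕ.≤ n → ∑ Z (inner n) ≤ bound n
      inner-bound n 1≤n = ∑-at-most-one Z (inner n) (bound n) (bound≥0 n 1≤n) each unique
        where
        each : ∀ p → 1 ℕ.≤ p → p ℕ.≤ Z → inner n p ≤ bound n
        each p _ _ with hit n 1≤n p
        ... | inj₁ e = ℚ.≤-trans (ℚ.≤-reflexive e) (bound≥0 n 1≤n)
        ... | inj₂ (((Y<p , _) , m , refl , 1≤m , _) , le) = ℚ.≤-trans le (ℚ.≤-reflexive (sym (trans (cong (_* r n) (𝟙-yes (Y ℕ.<? n) (ℕ.<-≤-trans Y<p (ℕ.m≤m*n p m {{ℕ.>-nonZero 1≤m}})))) (ℚ.*-identityˡ (r n)))))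
        unique : ∀ p p′ → 1 ℕ.≤ p → p ℕ.< p′ → p′ ℕ.≤ Z → inner n p ≡ 0ℚ ⊎ inner n p′ ≡ 0ℚ
        unique p p′ _ p<p′ _ with hit n 1≤n p | hit n 1≤n p′
        ... | inj₁ e | _ = inj₁ e
        ... | inj₂ _ | inj₁ e = inj₂ e
        ... | inj₂ (((Y<p , pr , _) , m , refl , _) , _) | inj₂ (((_ , pr′ , _) , m′ , e′ , 1≤m′ , m′≤Y) , _)
          with euclidsLemma p′ m′ pr (subst (p ∣_) e′ (m∣m*n m))
        ...   | inj₁ d = ⊥-elim (ℕ.<⇒≢ p<p′ (prime∣prime pr pr′ d))
        ...   | inj₂ d = ⊥-elim (ℕ.<⇒≱ Y<p (ℕ.≤-trans (∣⇒≤ {{ℕ.>-nonZero 1≤m′}} d) m′≤Y))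

module PowerApproximation where

  open import Data.Rational using (_≤_)
  open Rationals
  open RealPowers
  open Growth

  -- From approximate identities with a small error η to the exact inequalities of PowerLike.
  module Exact (v : ℕ → ℚ) (ε ε₀ β₀ τ η : ℚ) (J M : ℕ)
    (0<ε₀ : 0ℚ < ε₀) (0<β₀ : 0ℚ < β₀) (0<τ : 0ℚ < τ) (ε₀≤1 : ε₀ ≤ 1ℚ) (β₀≤1 : β₀ ≤ 1ℚ) (τ≤1 : τ ≤ 1ℚ)
    (ε₀≤ε : ε₀ ≤ ε) (β₀≤β : β₀ ≤ 1ℚ - ε) (1≤M : 1 ℕ.≤ M) (X≤M : 2 ℕ.^ J ℕ.≤ M)
    (η≡ : 4ℚ * η ≡ ε₀ * (β₀ * (τ * (rcp M * rcp M))))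
    (small : 4ℚ * ι J * ε ≤ 1ℚ)
    (one₁ : v 1 - 1ℚ ≤ η) (one₂ : 1ℚ - v 1 ≤ η)
    (mul : ∀ m n → 1 ℕ.≤ m → 1 ℕ.≤ n → m ℕ.* n ℕ.≤ M → ∣ v (m ℕ.* n) - v m * v n ∣ ≤ η)
    (bern : ∀ a b → 1 ℕ.≤ a → 1 ℕ.≤ b → a ℕ.≤ M → b ℕ.≤ M → ι a * v b ≤ (ι a + ε * (ι b - ι a)) * v a + η)
    where

    X = 2 ℕ.^ J

    1≤2^ : ∀ j → 1 ℕ.≤ 2 ℕ.^ j
    1≤2^ j = ℕ.m^n>0 2 j

    0≤ε₀ = ℚ.<⇒≤ 0<ε₀
    0≤β₀ = ℚ.<⇒≤ 0<β₀
    0≤τ = ℚ.<⇒≤ 0<τ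
    0<ε : 0ℚ < ε
    0<ε = ℚ.<-≤-trans 0<ε₀ ε₀≤ε
    0≤ε = ℚ.<⇒≤ 0<ε
    rM = rcp M
    0≤rr : 0ℚ ≤ rM * rM
    0≤rr = *-nonNeg (rcp-nonNeg M) (rcp-nonNeg M)

    ε≤1 : ε ≤ 1ℚ
    ε≤1 = ≤-by (β₀≤β ⊕ 0≤β₀) (solve (ε ∷ β₀ ∷ []) ring)

    product≤ : ∀ {a b} → 0ℚ ≤ a → b ≤ 1ℚ → a * b ≤ a
    product≤ {a} {b} p q = subst (a * b ≤_) (ℚ.*-identityʳ a) (p ⊛ q)

    product≤′ : ∀ {a b} → 0ℚ ≤ b → a ≤ 1ℚ → a * b ≤ b
    product≤′ {a} {b} p q = subst (_≤ b) (ℚ.*-comm b a) (product≤ p q)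

    0≤η : 0ℚ ≤ η
    0≤η = *-cancelˡ-≤ (ℚ.positive⁻¹ 4ℚ) (ℚ.≤-trans (ℚ.≤-reflexive (ℚ.*-zeroʳ 4ℚ)) (subst (0ℚ ≤_) (sym η≡) (*-nonNeg 0≤ε₀ (*-nonNeg 0≤β₀ (*-nonNeg 0≤τ 0≤rr)))))

    rr≤1 : rM * rM ≤ 1ℚ
    rr≤1 = ℚ.≤-trans (product≤ (rcp-nonNeg M) (rcp≤1 M)) (rcp≤1 M)
    τrr≤1 : τ * (rM * rM) ≤ 1ℚ
    τrr≤1 = ℚ.≤-trans (product≤ 0≤τ rr≤1) τ≤1
    βτrr≤1 : β₀ * (τ * (rM * rM)) ≤ 1ℚ
    βτrr≤1 = ℚ.≤-trans (product≤ 0≤β₀ τrr≤1) β₀≤1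

    4η≤ε : 4ℚ * η ≤ ε
    4η≤ε = ℚ.≤-trans (ℚ.≤-reflexive η≡) (ℚ.≤-trans (product≤ 0≤ε₀ βτrr≤1) ε₀≤ε)
    4η≤1 : 4ℚ * η ≤ 1ℚ
    4η≤1 = ℚ.≤-trans 4η≤ε ε≤1
    4η≤β : 4ℚ * η ≤ 1ℚ - ε
    4η≤β = ℚ.≤-trans (ℚ.≤-reflexive η≡) (ℚ.≤-trans (product≤′ (*-nonNeg 0≤β₀ (*-nonNeg 0≤τ 0≤rr)) ε₀≤1) (ℚ.≤-trans (product≤ 0≤β₀ τrr≤1) β₀≤β))
    η≤ετ : η ≤ ε * τ
    η≤ετ = ℚ.≤-trans (lem η 0≤η) (ℚ.≤-trans (ℚ.≤-reflexive η≡) (ℚ.≤-trans (0≤ε₀ ⊛ ℚ.≤-trans (product≤′ (*-nonNeg 0≤τ 0≤rr) β₀≤1) (product≤ 0≤τ rr≤1)) (*-mono-≤ 0≤ε₀ 0≤τ ε₀≤ε ℚ.≤-refl)))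
      where
      lem : ∀ η → 0ℚ ≤ η → η ≤ 4ℚ * η
      lem η h = ≤-by (h ⊕ h ⊕ h) (solve (η ∷ []) ring)
    4η≤εβ : 4ℚ * η ≤ ε * ((1ℚ - ε) * (rM * rM))
    4η≤εβ = ℚ.≤-trans (ℚ.≤-reflexive η≡) (*-mono-≤ 0≤ε₀ (*-nonNeg 0≤β₀ (*-nonNeg 0≤τ 0≤rr)) ε₀≤ε (*-mono-≤ 0≤β₀ (*-nonNeg 0≤τ 0≤rr) β₀≤β (product≤′ 0≤rr τ≤1)))

    0≤2 : 0ℚ ≤ 2ℚ
    0≤2 = ℚ.<⇒≤ (ℚ.positive⁻¹ 2ℚ)
    0≤4 : 0ℚ ≤ 4ℚ
    0≤4 = ℚ.<⇒≤ (ℚ.positive⁻¹ 4ℚ)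

    bern-1 : ∀ n → 1 ℕ.≤ n → n ℕ.≤ M → ι n * v 1 ≤ (ι n + ε * (1ℚ - ι n)) * v n + η
    bern-1 n 1≤n n≤M = subst (λ t → ι n * v 1 ≤ (ι n + ε * (t - ι n)) * v n + η) ι1 (bern n 1 1≤n ℕ.≤-refl n≤M 1≤M)

    v-lower : ∀ n → 1 ℕ.≤ n → n ℕ.≤ M → 1ℚ ≤ 2ℚ * v n
    v-lower n 1≤n n≤M with ℚ.≤-total 0ℚ (v n)
    ... | inj₁ p = lem (ι n) (v n) (v 1) (1≤ι 1≤n) p one₂ (bern-1 n 1≤n n≤M)
      where
      lem : ∀ n w o → 1ℚ ≤ n → 0ℚ ≤ w → 1ℚ - o ≤ η → n * o ≤ (n + ε * (1ℚ - n)) * w + η → 1ℚ ≤ 2ℚ * w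
      lem n w o p q s t = *-cancelˡ-≤ (ℚ.<-≤-trans 0<1 p) (≤-by ((0≤2 ⊛ t) ⊕ (0≤2 ⊛ (0≤n ⊛ s)) ⊕ (0≤2 ⊛ (*-nonNeg 0≤ε q ⊛ p)) ⊕ (0≤n ⊛ 4η≤1) ⊕ (0≤2 ⊛ (0≤η ⊛ p))) (solve (n ∷ w ∷ o ∷ ε ∷ η ∷ []) ring))
        where
        0≤n = ℚ.≤-trans 0≤1 p
    ... | inj₂ p = ⊥-elim (ℚ.<-irrefl refl (ℚ.<-≤-trans 0<1 (lem (ι n) (v n) (v 1) (1≤ι 1≤n) p one₂ (bern-1 n 1≤n n≤M))))
      where
      lem : ∀ n w o → 1ℚ ≤ n → w ≤ 0ℚ → 1ℚ - o ≤ η → n * o ≤ (n + ε * (1ℚ - n)) * w + η → 1ℚ ≤ 0ℚ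
      lem n w o p q s t = *-cancelˡ-≤ (ℚ.<-≤-trans 0<1 p) (≤-by ((0≤2 ⊛ t) ⊕ (0≤2 ⊛ (0≤n ⊛ s)) ⊕ (0≤2 ⊛ (K≥0 ⊛ q)) ⊕ (0≤n ⊛ 4η≤1) ⊕ (0≤2 ⊛ (0≤η ⊛ p))) (solve (n ∷ w ∷ o ∷ ε ∷ η ∷ []) ring))
        where
        0≤n = ℚ.≤-trans 0≤1 p
        K≥0 : 0ℚ ≤ n + ε * (1ℚ - n)
        K≥0 = ≤-by ((≤⇒0≤ p ⊛ ε≤1) ⊕ 0≤1) (solve (n ∷ ε ∷ []) ring)

    v-nonNeg : ∀ n → 1 ℕ.≤ n → n ℕ.≤ M → 0ℚ ≤ v n
    v-nonNeg n a b = *-cancelˡ-≤ (ℚ.positive⁻¹ 2ℚ) (ℚ.≤-trans (ℚ.≤-reflexive (ℚ.*-zeroʳ 2ℚ)) (ℚ.≤-trans 0≤1 (v-lower n a b)))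

    w : ℕ → ℚ
    w n = v n * rcp n

    v≡ : ∀ {n} → 1 ℕ.≤ n → v n ≡ ι n * w n
    v≡ {n} h = trans (sym (ℚ.*-identityʳ (v n))) (trans (cong (v n *_) (sym (rcp-inv h))) (lem (v n) (rcp n) (ι n)))
      where
      lem : ∀ v r n → v * (r * n) ≡ n * (v * r)
      lem = solve-∀ ring

    dyadic : ∀ j → j ℕ.≤ J → v (2 ℕ.^ j) ≤ 1ℚ + η + 2ℚ * ι j * ε
    dyadic zero    _  = subst (λ t → v 1 ≤ 1ℚ + η + 2ℚ * t * ε) (sym ι0) (lem (v 1) one₁)
      where
      lem : ∀ o → o - 1ℚ ≤ η → o ≤ 1ℚ + η + 2ℚ * 0ℚ * ε
      lem o h = ≤-by h (solve (o ∷ η ∷ ε ∷ []) ring)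
    dyadic (suc j) le = subst (λ t → v (2 ℕ.* a) ≤ 1ℚ + η + 2ℚ * t * ε) (sym (ι-suc j))
        (lem (ι a) (v a) (v (2 ℕ.* a)) (ι j) (1≤ι (1≤2^ j)) (ι-nonNeg j) (ℚ.≤-trans ((*-nonNeg 0≤4 0≤ε) ⊛ ι-mono {j} {J} (ℕ.≤-trans (ℕ.n≤1+n j) le)) small′)
          (subst (λ t → ι a * v (2 ℕ.* a) ≤ (ι a + ε * (t - ι a)) * v a + η) (trans (ι-* 2 a) (cong (_* ι a) ι2)) (bern a (2 ℕ.* a) (1≤2^ j) (1≤2^ (suc j)) (ℕ.≤-trans (ℕ.m≤m+n a (a ℕ.+ 0)) a2≤M) a2≤M))
          (dyadic j (ℕ.≤-trans (ℕ.n≤1+n j) le)))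
      where
      a = 2 ℕ.^ j
      ι2 : ι 2 ≡ 2ℚ
      ι2 = trans (ι-suc 1) (cong (1ℚ +_) ι1)
      a2≤M : 2 ℕ.* a ℕ.≤ M
      a2≤M = ℕ.≤-trans (ℕ.^-monoʳ-≤ 2 le) X≤M
      small′ : 4ℚ * ε * ι J ≤ 1ℚ
      small′ = subst (_≤ 1ℚ) (lem₀ (ι J) ε) small
        where
        lem₀ : ∀ j e → 4ℚ * j * e ≡ 4ℚ * e * j
        lem₀ = solve-∀ ring
      lem : ∀ a w w₂ j → 1ℚ ≤ a → 0ℚ ≤ j → 4ℚ * ε * j ≤ 1ℚ → a * w₂ ≤ (a + ε * (2ℚ * a - a)) * w + η → w ≤ 1ℚ + η + 2ℚ * j * ε → w₂ ≤ 1ℚ + η + 2ℚ * (1ℚ + j) * ε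
      lem a w w₂ j p q r s t = *-cancelˡ-≤ (ℚ.<-≤-trans 0<1 p) (*-cancelˡ-≤ (ℚ.positive⁻¹ 2ℚ)
          (≤-by ((0≤2 ⊛ s) ⊕ (0≤2 ⊛ (*-nonNeg 0≤a (+-nonNeg 0≤1 0≤ε) ⊛ t)) ⊕ (0≤2 ⊛ (0≤η ⊛ p)) ⊕ (*-nonNeg 0≤a 0≤ε ⊛ r) ⊕ (0≤a ⊛ 4η≤ε) ⊕ (0≤2 ⊛ (*-nonNeg 0≤a 0≤η ⊛ ε≤1)))
            (solve (a ∷ w ∷ w₂ ∷ j ∷ ε ∷ η ∷ []) ring)))
        where
        0≤a = ℚ.≤-trans 0≤1 p

    1≤X = 1≤2^ J

    v-upper : ∀ n → 1 ℕ.≤ n → n ℕ.≤ X → v n ≤ 2ℚ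
    v-upper n 1≤n n≤X = lem (ι X) (ι n) (v X) (v n) (ι J) (1≤ι 1≤X) (ι-mono n≤X) (v-nonNeg X 1≤X X≤M) (bern X n 1≤X 1≤n X≤M (ℕ.≤-trans n≤X X≤M)) (dyadic J ℕ.≤-refl) small
      where
      lem : ∀ x n u w j → 1ℚ ≤ x → n ≤ x → 0ℚ ≤ u → x * w ≤ (x + ε * (n - x)) * u + η → u ≤ 1ℚ + η + 2ℚ * j * ε → 4ℚ * j * ε ≤ 1ℚ → w ≤ 2ℚ
      lem x n u w j p q r s t k = *-cancelˡ-≤ (ℚ.<-≤-trans 0<1 p) (*-cancelˡ-≤ (ℚ.positive⁻¹ 2ℚ)
          (≤-by ((0≤2 ⊛ s) ⊕ (0≤2 ⊛ (*-nonNeg 0≤ε r ⊛ q)) ⊕ (0≤2 ⊛ (0≤x ⊛ t)) ⊕ (0≤x ⊛ k) ⊕ (0≤2 ⊛ (0≤η ⊛ p)) ⊕ (0≤x ⊛ 4η≤1)) (solve (x ∷ n ∷ u ∷ w ∷ j ∷ ε ∷ η ∷ []) ring)))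
        where
        0≤x = ℚ.≤-trans 0≤1 p

    rr-mono : ∀ n → 1 ℕ.≤ n → suc n ℕ.≤ M → rM * rM ≤ rcp n * rcp (suc n)
    rr-mono n 1≤n le = *-mono-≤ (rcp-nonNeg M) (rcp-nonNeg M) (rcp-antitone 1≤n (ℕ.≤-trans (ℕ.n≤1+n n) le)) (rcp-antitone {suc n} (s≤s z≤n) le)

    bern-up : ∀ n → 1 ℕ.≤ n → suc n ℕ.≤ M → ι n * v (suc n) ≤ (ι n + ε) * v n + η
    bern-up n 1≤n le = subst (λ t → ι n * v (suc n) ≤ t * v n + η) (trans (cong (λ s → ι n + ε * (s - ι n)) (ι-suc n)) (lem (ι n) ε)) (bern n (suc n) 1≤n (s≤s z≤n) (ℕ.≤-trans (ℕ.n≤1+n n) le) le)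
      where
      lem : ∀ n e → n + e * (1ℚ + n - n) ≡ n + e
      lem = solve-∀ ring

    bern-down : ∀ n → 1 ℕ.≤ n → suc n ℕ.≤ M → (1ℚ + ι n) * v n ≤ (1ℚ + ι n - ε) * v (suc n) + η
    bern-down n 1≤n le = subst (λ t → (1ℚ + ι n) * v n ≤ t * v (suc n) + η) (lem (ι n) ε) (subst (λ s → s * v n ≤ (s + ε * (ι n - s)) * v (suc n) + η) (ι-suc n) (bern (suc n) n (s≤s z≤n) 1≤n le (ℕ.≤-trans (ℕ.n≤1+n n) le)))
      where
      lem : ∀ n e → 1ℚ + n + e * (n - (1ℚ + n)) ≡ 1ℚ + n - e
      lem = solve-∀ ring

    gap : ∀ n → 1 ℕ.≤ n → suc n ℕ.≤ M → (1ℚ - ε) * (rM * rM) ≤ 4ℚ * (w n - w (suc n))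
    gap n 1≤n le = ℚ.≤-trans (0≤β ⊛ rr-mono n 1≤n le)
        (subst (λ t → (1ℚ - ε) * (rcp n * rcp (suc n)) ≤ 4ℚ * t) (sym weq) (lem (rcp n * rcp (suc n)) (ι n) (v n) (v (suc n)) (*-nonNeg (rcp-nonNeg n) (rcp-nonNeg (suc n))) (v-lower n 1≤n (ℕ.≤-trans (ℕ.n≤1+n n) le)) (bern-up n 1≤n le)))
      where
      weq : w n - w (suc n) ≡ rcp n * rcp (suc n) * ((1ℚ + ι n) * v n - ι n * v (suc n))
      weq = trans (e₀ (w n) (w (suc n))) (trans (cong₂ (λ a b → v n * rcp n * a - v (suc n) * rcp (suc n) * b) (sym r₂) (sym (rcp-inv 1≤n))) (lem₀ (v n) (v (suc n)) (rcp n) (rcp (suc n)) (ι n)))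
        where
        e₀ : ∀ a b → a - b ≡ a * 1ℚ - b * 1ℚ
        e₀ = solve-∀ ring
        r₂ : rcp (suc n) * (1ℚ + ι n) ≡ 1ℚ
        r₂ = trans (cong (rcp (suc n) *_) (sym (ι-suc n))) (rcp-inv {suc n} (s≤s z≤n))
        lem₀ : ∀ v v′ r r′ n → v * r * (r′ * (1ℚ + n)) + - (v′ * r′ * (r * n)) ≡ r * r′ * ((1ℚ + n) * v - n * v′)
        lem₀ = solve-∀ ring
      0≤β : 0ℚ ≤ 1ℚ - ε
      0≤β = ≤⇒0≤ ε≤1
      lem : ∀ R n u u′ → 0ℚ ≤ R → 1ℚ ≤ 2ℚ * u → n * u′ ≤ (n + ε) * u + η → (1ℚ - ε) * R ≤ 4ℚ * (R * ((1ℚ + n) * u - n * u′))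
      lem R n u u′ p q r = ≤-by ((0≤4 ⊛ (p ⊛ r)) ⊕ (0≤2 ⊛ (*-nonNeg 0≤β p ⊛ q)) ⊕ (p ⊛ 4η≤β)) (solve (R ∷ n ∷ u ∷ u′ ∷ ε ∷ η ∷ []) ring)

    w-step : ∀ n → 1 ℕ.≤ n → suc n ℕ.≤ M → w (suc n) ≤ w n
    w-step n 1≤n le = *-cancelˡ-≤ (ℚ.positive⁻¹ 4ℚ) (lem (w n) (w (suc n)) (ℚ.≤-trans (*-nonNeg (≤⇒0≤ ε≤1) 0≤rr) (gap n 1≤n le)))
      where
      lem : ∀ a b → 0ℚ ≤ 4ℚ * (a - b) → 4ℚ * b ≤ 4ℚ * a
      lem a b h = ≤-by h (solve (a ∷ b ∷ []) ring)

    w-anti : ∀ m n → 1 ℕ.≤ m → m ℕ.≤ n → n ℕ.≤ M → w n ≤ w m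
    w-anti m n 1≤m m≤n n≤M with t , refl ← ℕ.m≤n⇒∃[o]m+o≡n m≤n = go t n≤M
      where
      go : ∀ t → m ℕ.+ t ℕ.≤ M → w (m ℕ.+ t) ≤ w m
      go zero    _  = ℚ.≤-reflexive (cong w (ℕ.+-identityʳ m))
      go (suc t) le = subst (λ s → w s ≤ w m) (sym (ℕ.+-suc m t)) (ℚ.≤-trans (w-step (m ℕ.+ t) (ℕ.≤-trans 1≤m (ℕ.m≤m+n m t)) le′) (go t (ℕ.≤-trans (ℕ.n≤1+n _) le′)))
        where le′ = subst (ℕ._≤ M) (ℕ.+-suc m t) le

    slope : ∀ n → 1 ℕ.≤ n → suc n ℕ.≤ X → ∣ (v (suc n) - v n) - ε * w (suc n) ∣ ≤ 2ℚ * ε * (w n - w (suc n))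
    slope n 1≤n le = ∣∣-least (lem₁ (ι n) (v n) (v (suc n)) (w n) (w (suc n)) (1≤ι 1≤n) η≤ (v≡ 1≤n) (bern-up n 1≤n le′))
        (lem₂ (ι n) (v n) (v (suc n)) (w n) (w (suc n)) (1≤ι 1≤n) η≤ (trans (v≡ {suc n} (s≤s z≤n)) (cong (_* w (suc n)) (ι-suc n))) (≤⇒0≤ (w-step n 1≤n le′)) (bern-down n 1≤n le′))
      where
      le′ = ℕ.≤-trans le X≤M
      η≤ : η ≤ ε * (w n - w (suc n))
      η≤ = *-cancelˡ-≤ (ℚ.positive⁻¹ 4ℚ) (ℚ.≤-trans 4η≤εβ (ℚ.≤-trans (0≤ε ⊛ gap n 1≤n le′) (ℚ.≤-reflexive (lem₀ ε (w n - w (suc n))))))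
        where
        lem₀ : ∀ e d → e * (4ℚ * d) ≡ 4ℚ * (e * d)
        lem₀ = solve-∀ ring
      lem₁ : ∀ n u u′ a b → 1ℚ ≤ n → η ≤ ε * (a - b) → u ≡ n * a → n * u′ ≤ (n + ε) * u + η → u′ - u - ε * b ≤ 2ℚ * ε * (a - b)
      lem₁ n u u′ a b p q refl r = *-cancelˡ-≤ (ℚ.<-≤-trans 0<1 p) (≤-by (r ⊕ (0≤η ⊛ p) ⊕ (ℚ.≤-trans 0≤1 p ⊛ q)) (solve (n ∷ u′ ∷ a ∷ b ∷ ε ∷ η ∷ []) ring))
      lem₂ : ∀ n u u′ a b → 1ℚ ≤ n → η ≤ ε * (a - b) → u′ ≡ (1ℚ + n) * b → 0ℚ ≤ a - b → (1ℚ + n) * u ≤ (1ℚ + n - ε) * u′ + η → - (u′ - u - ε * b) ≤ 2ℚ * ε * (a - b)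
      lem₂ n u u′ a b p q refl d r = *-cancelˡ-≤ {1ℚ + n} (ℚ.<-≤-trans 0<1 (≤-by 0≤n (solve (n ∷ []) ring))) (≤-by (r ⊕ q ⊕ *-nonNeg (*-nonNeg 0≤ε d) 1+2n) (solve (n ∷ u ∷ a ∷ b ∷ ε ∷ η ∷ []) ring))
        where
        0≤n = ℚ.≤-trans 0≤1 p
        1+2n : 0ℚ ≤ 1ℚ + n + n
        1+2n = +-nonNeg (+-nonNeg 0≤1 0≤n) 0≤n

    near : ∀ a b → 1 ℕ.≤ a → a ℕ.≤ b → b ℕ.≤ X → ∣ v b - v a ∣ ≤ 4ℚ * ε * ((ι b - ι a) * rcp a)
    near a b 1≤a a≤b b≤X with ℕ.m≤n⇒m<n∨m≡n a≤b
    ... | inj₂ refl = ℚ.≤-reflexive (trans (cong ∣_∣ (e₁ (v a))) (e₂ ε (ι a) (rcp a)))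
      where
      e₁ : ∀ x → x - x ≡ 0ℚ
      e₁ = solve-∀ ring
      e₂ : ∀ e a r → 0ℚ ≡ 4ℚ * e * ((a - a) * r)
      e₂ = solve-∀ ring
    ... | inj₁ a<b = ∣∣-least (lem₁ (ι a) (ι b) (rcp a) (v a) (v b) (rcp-inv 1≤a) (rcp-nonNeg a) (v-upper a 1≤a a≤X) b-a (bern a b 1≤a 1≤b a≤M b≤M))
        (lem₂ (ι a) (ι b) (rcp a) (rcp b) (v a) (v b) (rcp-inv 1≤b) (rcp-nonNeg b) (rcp-antitone 1≤a a≤b) (v-nonNeg b 1≤b b≤M) b-a (bern b a 1≤b 1≤a b≤M a≤M))
      where
      a≤X = ℕ.≤-trans a≤b b≤X
      1≤b = ℕ.≤-trans 1≤a a≤b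
      b≤M = ℕ.≤-trans b≤X X≤M
      a≤M = ℕ.≤-trans a≤b b≤M
      b-a : 1ℚ ≤ ι b - ι a
      b-a = lem (ι a) (ι b) (subst (_≤ ι b) (ι-suc a) (ι-mono a<b))
        where
        lem : ∀ a b → 1ℚ + a ≤ b → 1ℚ ≤ b - a
        lem a b h = ≤-by h (solve (a ∷ b ∷ []) ring)
      lem₁ : ∀ a b r u u′ → r * a ≡ 1ℚ → 0ℚ ≤ r → u ≤ 2ℚ → 1ℚ ≤ b - a → a * u′ ≤ (a + ε * (b - a)) * u + η → u′ - u ≤ 4ℚ * ε * ((b - a) * r)
      lem₁ a b r u u′ e p q d s = subst (_≤ 4ℚ * ε * ((b - a) * r)) (trans (lem₀ r a (u′ - u)) (trans (cong (_* (u′ - u)) e) (ℚ.*-identityˡ (u′ - u))))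
          (≤-by ((p ⊛ s) ⊕ (*-nonNeg p (*-nonNeg 0≤ε (ℚ.≤-trans 0≤1 d)) ⊛ q) ⊕ (p ⊛ 4η≤ε) ⊕ (*-nonNeg p 0≤ε ⊛ d) ⊕ *-nonNeg p (*-nonNeg 3≥0 0≤η) ⊕ *-nonNeg p (*-nonNeg 0≤ε (ℚ.≤-trans 0≤1 d))) (solve (a ∷ b ∷ r ∷ u ∷ u′ ∷ ε ∷ η ∷ []) ring))
        where
        3≥0 : 0ℚ ≤ 1ℚ + 2ℚ
        3≥0 = ℚ.<⇒≤ (ℚ.positive⁻¹ (1ℚ + 2ℚ))
        lem₀ : ∀ r a d → r * (a * d) ≡ r * a * d
        lem₀ = solve-∀ ring
      lem₂ : ∀ a b r s u u′ → s * b ≡ 1ℚ → 0ℚ ≤ s → s ≤ r → 0ℚ ≤ u′ → 1ℚ ≤ b - a → b * u ≤ (b + ε * (a - b)) * u′ + η → - (u′ - u) ≤ 4ℚ * ε * ((b - a) * r)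
      lem₂ a b r s u u′ e p q o d t = subst (_≤ 4ℚ * ε * ((b - a) * r)) (trans (lem₀ s b (u′ - u)) (trans (cong (λ z → - (z * (u′ - u))) e) (cong -_ (ℚ.*-identityˡ (u′ - u)))))
          (≤-by ((p ⊛ t) ⊕ *-nonNeg p (*-nonNeg (*-nonNeg 0≤ε (ℚ.≤-trans 0≤1 d)) o) ⊕ (p ⊛ 4η≤ε) ⊕ (*-nonNeg p 0≤ε ⊛ d) ⊕ (*-nonNeg 0≤ε (ℚ.≤-trans 0≤1 d) ⊛ q) ⊕ *-nonNeg p (*-nonNeg 3≥0 0≤η) ⊕ *-nonNeg (*-nonNeg 3≥0 (*-nonNeg 0≤ε (ℚ.≤-trans 0≤1 d))) (ℚ.≤-trans p q)) (solve (a ∷ b ∷ r ∷ s ∷ u ∷ u′ ∷ ε ∷ η ∷ []) ring))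
        where
        3≥0 : 0ℚ ≤ 1ℚ + 2ℚ
        3≥0 = ℚ.<⇒≤ (ℚ.positive⁻¹ (1ℚ + 2ℚ))
        lem₀ : ∀ s b d → s * (b * (- d)) ≡ - (s * b * d)
        lem₀ = solve-∀ ring

    powerLike : PowerLike v ε τ X M
    powerLike = record
      { 0<ε = 0<ε ; ε≤1 = ε≤1 ; 0≤τ = 0≤τ ; X≤M = X≤M
      ; lower = λ n a b → v-lower n a (ℕ.≤-trans b X≤M)
      ; upper = v-upper
      ; w≥0 = λ n a b → *-nonNeg (v-nonNeg n a b) (rcp-nonNeg n)
      ; w-anti = w-anti
      ; slope = slope
      ; mult = λ d e a b le → ℚ.≤-trans (mul d e a b (ℕ.≤-trans le X≤M)) η≤ετ
      ; near = near
      }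

    increase-nonNeg : ∀ Y → 1 ℕ.≤ Y → Y ℕ.< X → 0ℚ ≤ v X - v Y
    increase-nonNeg Y 1≤Y Y<X = lem (ι X) (ι Y) (v X) (v Y) (1≤ι 1≤X) (subst (_≤ ι X) (ι-suc Y) (ι-mono Y<X)) (v-lower X 1≤X X≤M) (bern X Y 1≤X 1≤Y X≤M (ℕ.≤-trans (ℕ.<⇒≤ Y<X) X≤M))
      where
      lem : ∀ x y u w → 1ℚ ≤ x → 1ℚ + y ≤ x → 1ℚ ≤ 2ℚ * u → x * w ≤ (x + ε * (y - x)) * u + η → 0ℚ ≤ u - w
      lem x y u w p q r s = *-cancelˡ-≤ (ℚ.<-≤-trans 0<1 p) (*-cancelˡ-≤ (ℚ.positive⁻¹ 2ℚ) (≤-by ((0≤2 ⊛ s) ⊕ (0≤ε ⊛ r) ⊕ (0≤2 ⊛ (*-nonNeg 0≤ε 0≤u ⊛ q)) ⊕ 4η≤ε ⊕ (0≤2 ⊛ 0≤η)) (solve (x ∷ y ∷ u ∷ w ∷ ε ∷ η ∷ []) ring)))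
        where
        0≤u : 0ℚ ≤ u
        0≤u = *-cancelˡ-≤ (ℚ.positive⁻¹ 2ℚ) (ℚ.≤-trans (ℚ.≤-reflexive (ℚ.*-zeroʳ 2ℚ)) (ℚ.≤-trans 0≤1 r))

    increase-bound : ∀ Y → 1 ℕ.≤ Y → Y ℕ.≤ X → v X - v Y ≤ (2ℚ * ι J + 1ℚ) * ε
    increase-bound Y 1≤Y Y≤X = lem (ι Y) (v X) (v Y) (v 1) (ι J) (1≤ι 1≤Y) (v-nonNeg Y 1≤Y Y≤M) one₂ (bern-1 Y 1≤Y Y≤M) (dyadic J ℕ.≤-refl)
      where
      Y≤M = ℕ.≤-trans Y≤X X≤M
      lem : ∀ y u w o j → 1ℚ ≤ y → 0ℚ ≤ w → 1ℚ - o ≤ η → y * o ≤ (y + ε * (1ℚ - y)) * w + η → u ≤ 1ℚ + η + 2ℚ * j * ε → u - w ≤ (2ℚ * j + 1ℚ) * ε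
      lem y u w o j p q r s t = *-cancelˡ-≤ (ℚ.<-≤-trans 0<1 p) (≤-by (s ⊕ (0≤y ⊛ r) ⊕ (*-nonNeg 0≤ε q ⊛ p) ⊕ (0≤y ⊛ t) ⊕ (0≤y ⊛ 4η≤ε) ⊕ (0≤η ⊛ p) ⊕ *-nonNeg 0≤y 0≤η) (solve (y ∷ u ∷ w ∷ o ∷ j ∷ ε ∷ η ∷ []) ring))
        where
        0≤y = ℚ.≤-trans 0≤1 p

module RealZero where

  open import Data.Rational using (_≤_)
  open Rationals
  open Limits
  open ExponentialSeries
  open Logarithm
  open RealPowers
  open Growth
  open PowerApproximation

  opaque
    unfolding recip

    div-recip : ∀ (x y : Seq) i → (x /ᴿ y) i ≡ x i * recip (y i)
    div-recip x y i with y i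
    ... | mkℚ (ℤ.+ 0) _ _ = refl
    ... | p@(mkℚ +[1+ _ ] _ _) = cong (x i *_) (sym (ℚ.*-identityˡ (ℚ.1/ p)))
    ... | p@(mkℚ -[1+ _ ] _ _) = cong (x i *_) (sym (ℚ.*-identityˡ (ℚ.1/ p)))

  opaque
    unfolding ι ιℤ

    fromℕ-ι : ∀ n i → fromℕ n i ≡ ι n
    fromℕ-ι n i = refl

    fromℤ-ι : ∀ z i → fromℤ z i ≡ ιℤ z
    fromℤ-ι z i = refl

  ∑<-∑₀ : ∀ N (f : ℕ → Seq) i → ∑< N f i ≡ ∑₀ N (λ k → f k i)
  ∑<-∑₀ zero    f i = refl
  ∑<-∑₀ (suc N) f i = cong₂ _+_ (∑<-∑₀ N f i) refl

  ^ᴿ-pow : ∀ x k i → (x ^ᴿ k) i ≡ pow (x i) k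
  ^ᴿ-pow x zero    i = refl
  ^ᴿ-pow x (suc k) i = cong (x i *_) (^ᴿ-pow x k i)

  log-Lg : ∀ n i → log (fromℕ n) i ≡ Lg i (ι n)
  log-Lg n i = cong₂ _*_ (fromℕ-ι 2 i) (trans (∑<-∑₀ i _ i) (∑₀-cong i (λ k →
      trans (div-recip (y ^ᴿ suc (2 ℕ.* k)) (fromℕ (suc (2 ℕ.* k))) i)
        (cong₂ _*_ (trans (^ᴿ-pow y (suc (2 ℕ.* k)) i) (cong (λ t → pow t (suc (2 ℕ.* k))) y≡)) (cong recip (fromℕ-ι (suc (2 ℕ.* k)) i))))))
    where
    y : Seq
    y = (fromℕ n -ᴿ fromℕ 1) /ᴿ (fromℕ n +ᴿ fromℕ 1)
    y≡ : y i ≡ cayley (ι n)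
    y≡ = trans (div-recip (fromℕ n -ᴿ fromℕ 1) (fromℕ n +ᴿ fromℕ 1) i) (cong (λ t → (t - 1ℚ) * recip (t + 1ℚ)) (fromℕ-ι n i))

  factorial-pos : ∀ k → 1 ℕ.≤ k !
  factorial-pos zero    = ℕ.≤-refl
  factorial-pos (suc k) = ℕ.*-mono-≤ {1} {suc k} (s≤s z≤n) (factorial-pos k)

  pow-term : ∀ a k → pow a k * rcp (k !) ≡ term a k
  pow-term a zero    = trans (ℚ.*-identityˡ (rcp 1)) (trans (sym (ℚ.*-identityʳ (rcp 1))) (trans (cong (rcp 1 *_) (sym ι1)) (rcp-inv {1} ℕ.≤-refl)))
  pow-term a (suc k) = trans (cong (a * pow a k *_) (rcp-* {suc k} (s≤s z≤n) (factorial-pos k))) (trans (lem a (pow a k) (rcp (suc k)) (rcp (k !))) (cong (λ t → a * t * rcp (suc k)) (pow-term a k)))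
    where
    lem : ∀ a p r s → a * p * (r * s) ≡ a * (p * s) * r
    lem = solve-∀ ring

  module _ (z : ℂ) (i : ℕ) (im0 : im z i ≡ 0ℚ) where
    ^ᶜ-im : ∀ k → im (z ^ᶜ k) i ≡ 0ℚ
    ^ᶜ-im zero    = refl
    ^ᶜ-im (suc k) = trans (cong₂ (λ a b → re z i * a + b * re (z ^ᶜ k) i) (^ᶜ-im k) im0) (lem (re z i) (re (z ^ᶜ k) i))
      where
      lem : ∀ a b → a * 0ℚ + 0ℚ * b ≡ 0ℚ
      lem = solve-∀ ring

    ^ᶜ-re : ∀ k → re (z ^ᶜ k) i ≡ pow (re z i) k
    ^ᶜ-re zero    = refl
    ^ᶜ-re (suc k) = trans (cong₂ (λ a b → re z i * a - b * im (z ^ᶜ k) i) (^ᶜ-re k) im0) (lem (re z i) (pow (re z i) k) (im (z ^ᶜ k) i))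
      where
      lem : ∀ a b c → a * b - 0ℚ * c ≡ a * b
      lem = solve-∀ ring

    exp-Ex : re (exp z) i ≡ Ex i (re z i)
    exp-Ex = trans (∑<-∑₀ i _ i) (∑₀-cong i (λ k → trans (cong₂ (λ a b → a * (fromℕ 1 /ᴿ fromℕ (k !)) i - b * 0ℚ) (^ᶜ-re k) (^ᶜ-im k))
        (trans (cong (λ t → pow (re z i) k * t - 0ℚ * 0ℚ) (trans (div-recip (fromℕ 1) (fromℕ (k !)) i) (cong (λ t → 1ℚ * recip t) (fromℕ-ι (k !) i))))
          (trans (lem (pow (re z i) k) (rcp (k !))) (pow-term (re z i) k)))))
      where
      lem : ∀ a b → a * (1ℚ * b) - 0ℚ * 0ℚ ≡ a * b
      lem = solve-∀ ring

  power-Ex : ∀ n (β : Seq) i → re (power n (0ᶜ -ᶜ fromᴿ β)) i ≡ Ex i (- (β i * Lg i (ι n)))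
  power-Ex n β i = trans (exp-Ex z i (lem₀ (β i) (log (fromℕ n) i))) (cong (Ex i) (trans (lem₁ (β i) (log (fromℕ n) i)) (cong (λ t → - (β i * t)) (log-Lg n i))))
    where
    z = (0ᶜ -ᶜ fromᴿ β) *ᶜ fromᴿ (log (fromℕ n))
    lem₀ : ∀ b l → (0ℚ - b) * 0ℚ + (0ℚ - 0ℚ) * l ≡ 0ℚ
    lem₀ = solve-∀ ring
    lem₁ : ∀ b l → (0ℚ - b) * l - (0ℚ - 0ℚ) * 0ℚ ≡ - (b * l)
    lem₁ = solve-∀ ring

  ∑₀-∑ : ∀ N (f : ℕ → ℚ) → ∑₀ N (λ k → f (suc k)) ≡ ∑ N f
  ∑₀-∑ zero    f = refl
  ∑₀-∑ (suc N) f = cong (_+ f (suc N)) (∑₀-∑ N f)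

  LPartial-re : ∀ {q} (χ : RealCharacter q) (β : Seq) → ∑ q (λ n → ιℤ (RealCharacter.χ χ n)) ≡ 0ℚ → ∀ N i →
    re (LPartial χ (fromᴿ β) N) i ≡ ∑ N (λ n → ιℤ (RealCharacter.χ χ n) * Ex i (- (β i * Lg i (ι n))))
  LPartial-re {q} χ β mean0 N i = trans (cong₂ (λ a m → a - (m * re u i - 0ℚ * im u i)) (trans (∑<-∑₀ N _ i) (trans (∑₀-cong N (λ k →
        trans (cong₂ (λ a b → a * b - 0ℚ * im (power (suc k) (0ᶜ -ᶜ fromᴿ β)) i) (fromℤ-ι (c (suc k)) i) (power-Ex (suc k) β i)) (lem (ιℤ (c (suc k))) (Ex i (- (β i * Lg i (ι (suc k))))) (im (power (suc k) (0ᶜ -ᶜ fromᴿ β)) i))))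
      (∑₀-∑ N (λ n → ιℤ (c n) * Ex i (- (β i * Lg i (ι n))))))) mean≡) (lem₁ _ (re u i) (im u i))
    where
    c = RealCharacter.χ χ
    u = power N (1ᶜ -ᶜ fromᴿ β) /ᶜ (1ᶜ -ᶜ fromᴿ β)
    lem : ∀ a b c → a * b - 0ℚ * c ≡ a * b
    lem = solve-∀ ring
    lem₁ : ∀ a b c → a - (0ℚ * b - 0ℚ * c) ≡ a
    lem₁ = solve-∀ ring
    mean≡ : mean χ i ≡ 0ℚ
    mean≡ = trans (div-recip (∑< q (λ a → fromℤ (c (suc a)))) (fromℕ q) i) (trans (cong (_* recip (fromℕ q i)) (trans (∑<-∑₀ q _ i) (trans (∑₀-cong q (λ k → fromℤ-ι (c (suc k)) i)) (trans (∑₀-∑ q (λ n → ιℤ (c n))) mean0)))) (ℚ.*-zeroˡ (recip (fromℕ q i))))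

  Cauchy-Bd : (x : ℝ) → Bd (seq x)
  Cauchy-Bd x = proj₁ arch , ev-from N λ i N≤i → ℚ.≤-trans (ℚ.≤-reflexive (cong ∣_∣ (lem (seq x i) (seq x N)))) (ℚ.≤-trans (∣∣-+-≤ (proj₂ c i N N≤i ℕ.≤-refl) ℚ.≤-refl) (proj₂ arch))
    where
    c = cauchy x 1ℚ 0<1
    N = proj₁ c
    arch = archimedean (1ℚ + ∣ seq x N ∣)
    lem : ∀ a b → a ≡ a - b + b
    lem = solve-∀ ring

  _⊓1 : ∀ {ε} → 0ℚ < ε → ∃ λ ε′ → 0ℚ < ε′ × ε′ ≤ ε × ε′ ≤ 1ℚ
  _⊓1 {ε} 0<ε with ℚ.≤-total ε 1ℚ
  ... | inj₁ le = ε , 0<ε , ℚ.≤-refl , le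
  ... | inj₂ le = 1ℚ , 0<1 , le , ℚ.≤-refl

  module FromZero {q} (χ : RealCharacter q) (β : ℝ) (isZero : LZero χ (fromᴿ (seq β))) (β<1 : seq β <ᴿ fromℕ 1)
    (mean0 : ∑ q (λ n → ιℤ (RealCharacter.χ χ n)) ≡ 0ℚ) where

    private
      b = seq β
      c : ℕ → ℚ
      c n = ιℤ (RealCharacter.χ χ n)
      dom = LValue.domain isZero
      bound₁ = proj₁ (proj₂ dom) ⊓1
      bound₂ = proj₁ (proj₂ β<1) ⊓1
      β₀ = proj₁ bound₁
      ε₀ = proj₁ bound₂
      0<β₀ = proj₁ (proj₂ bound₁)
      0<ε₀ = proj₁ (proj₂ bound₂)
      β≥ : Ev (λ i → β₀ ≤ b i)
      β≥ = ev-map (λ i h → ℚ.≤-trans (proj₁ (proj₂ (proj₂ bound₁))) (lem (proj₁ dom) (b i) h)) (proj₂ (proj₂ dom))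
        where
        lem : ∀ e x → 0ℚ + e ≤ x → e ≤ x
        lem e x h = ≤-by h (solve (e ∷ x ∷ []) ring)
      ε≥ : Ev (λ i → ε₀ ≤ 1ℚ - b i)
      ε≥ = ev-map (λ i h → ℚ.≤-trans (proj₁ (proj₂ (proj₂ bound₂))) (lem (proj₁ β<1) (b i) h)) (proj₂ (proj₂ β<1))
        where
        lem : ∀ e x → x + e ≤ 1ℚ → e ≤ 1ℚ - x
        lem e x h = ≤-by h (solve (e ∷ x ∷ []) ring)
      bβ = Cauchy-Bd β
      open Powers b bβ (Nn-ev (ev-map (λ i → ℚ.≤-trans (ℚ.<⇒≤ 0<β₀)) β≥)) (Nn-ev (ev-map (λ i → ℚ.≤-trans (ℚ.<⇒≤ 0<ε₀)) ε≥))

    value : ℕ → ℕ → ℚ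
    value i n = v n i

    vanishing : ∀ τ₁ → 0ℚ < τ₁ → ∀ M₀ → ∃ λ M → M₀ ℕ.≤ M × Ev (λ i → ∣ ∑ M (λ n → c n * (value i n * rcp n)) ∣ ≤ τ₁)
    vanishing τ₁ 0<τ₁ M₀ = M , ℕ.m≤n+m M₀ N₀ , ev-map (λ i h → subst₂ _≤_ (cong ∣_∣ (trans (lem (re (LPartial χ (fromᴿ b) M) i)) (trans (LPartial-re χ b mean0 M i)
          (∑-cong M (λ n 1≤n _ → cong (c n *_) (trans (sym (ℚ.*-identityˡ _)) (trans (cong (_* Ex i (arg n i)) (sym (rcp-inv 1≤n))) (lem₂ (rcp n) (ι n) (Ex i (arg n i)))))))))) (lem₃ τ₁) h) (proj₂ limit M (ℕ.m≤m+n N₀ M₀) (½ * τ₁) (half-pos 0<τ₁))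
      where
      limit = LValue.real isZero (½ * τ₁) (half-pos 0<τ₁)
      N₀ = proj₁ limit
      M = N₀ ℕ.+ M₀
      lem : ∀ a → a - 0ℚ ≡ a
      lem = solve-∀ ring
      lem₂ : ∀ r n e → r * n * e ≡ n * e * r
      lem₂ = solve-∀ ring
      lem₃ : ∀ t → ½ * t + ½ * t ≡ t
      lem₃ = solve-∀ ring

    -- the approximate identities hold simultaneously for all arguments up to M
    module _ (M : ℕ) (η : ℚ) (0<η : 0ℚ < η) where
      approx-one : Ev (λ i → (v 1 i - 1ℚ ≤ η) × (1ℚ - v 1 i ≤ η))
      approx-one = ev-zip (λ i p q → lem (v 1 i) q , lem₂ (v 1 i) p) (proj₁ v-1 .nn η 0<η) (proj₂ v-1 .nn η 0<η)
        where
        lem : ∀ a → - η ≤ 1ℚ - a → a - 1ℚ ≤ η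
        lem a h = ≤-by h (solve (a ∷ η ∷ []) ring)
        lem₂ : ∀ a → - η ≤ a - 1ℚ → 1ℚ - a ≤ η
        lem₂ a h = ≤-by h (solve (a ∷ η ∷ []) ring)

      approx-mul : Ev (λ i → ∀ m → m ℕ.≤ M → ∀ n → n ℕ.≤ M → 1 ℕ.≤ m → 1 ℕ.≤ n → ∣ v (m ℕ.* n) i - v m i * v n i ∣ ≤ η)
      approx-mul = ev-bounded M (λ m _ → ev-bounded M (λ n _ → pair m n))
        where
        lem : ∀ a b → - η ≤ a - b → b - a ≤ η
        lem a b h = ≤-by h (solve (a ∷ b ∷ η ∷ []) ring)
        lem₂ : ∀ a b → - η ≤ a - b → - (a - b) ≤ η
        lem₂ a b h = ≤-by h (solve (a ∷ b ∷ η ∷ []) ring)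
        pair : ∀ m n → Ev (λ i → 1 ℕ.≤ m → 1 ℕ.≤ n → ∣ v (m ℕ.* n) i - v m i * v n i ∣ ≤ η)
        pair zero    n       = ev-now λ i ()
        pair (suc m) zero    = ev-now λ i _ ()
        pair m@(suc _) n@(suc _) = ev-zip (λ i p q _ _ → ∣∣-least (lem (v m i * v n i) (v (m ℕ.* n) i) p) (lem₂ (v (m ℕ.* n) i) (v m i * v n i) q))
          (v-*-≤ m n (s≤s z≤n) (s≤s z≤n) .nn η 0<η) (v-*-≥ m n (s≤s z≤n) (s≤s z≤n) .nn η 0<η)

      approx-bernoulli : Ev (λ i → ∀ a → a ℕ.≤ M → ∀ b′ → b′ ℕ.≤ M → 1 ℕ.≤ a → 1 ℕ.≤ b′ → ι a * v b′ i ≤ (ι a + (1ℚ - b i) * (ι b′ - ι a)) * v a i + η)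
      approx-bernoulli = ev-bounded M (λ a _ → ev-bounded M (λ b′ _ → pair a b′))
        where
        lem : ∀ a b → - η ≤ a - b → b ≤ a + η
        lem a b h = ≤-by h (solve (a ∷ b ∷ η ∷ []) ring)
        pair : ∀ a b′ → Ev (λ i → 1 ℕ.≤ a → 1 ℕ.≤ b′ → ι a * v b′ i ≤ (ι a + (1ℚ - b i) * (ι b′ - ι a)) * v a i + η)
        pair zero    b′       = ev-now λ i ()
        pair (suc a) zero    = ev-now λ i _ ()
        pair a@(suc _) b′@(suc _) = ev-map (λ i p _ _ → lem ((ι a + (1ℚ - b i) * (ι b′ - ι a)) * v a i) (ι a * v b′ i) p) (bernoulli a b′ (s≤s z≤n) (s≤s z≤n) .nn η 0<η)

    record Data (τ τ₁ : ℚ) (J Y M i : ℕ) : Set where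
      field
        isPowerLike : PowerLike (value i) (1ℚ - b i) τ (2 ℕ.^ J) M
        increase≥0  : 0ℚ ≤ value i (2 ℕ.^ J) - value i Y
        increase≤   : value i (2 ℕ.^ J) - value i Y ≤ (2ℚ * ι J + 1ℚ) * (1ℚ - b i)
        vanishes    : ∣ ∑ M (λ n → c n * (value i n * rcp n)) ∣ ≤ τ₁

    powerLikeData : ∀ τ τ₁ J Y → 0ℚ < τ → τ ≤ 1ℚ → 0ℚ < τ₁ → 1 ℕ.≤ Y → Y ℕ.< 2 ℕ.^ J →
      ∃ λ M → Ev (λ i → 4ℚ * ι J * (1ℚ - b i) ≤ 1ℚ → Data τ τ₁ J Y M i)
    powerLikeData τ τ₁ J Y 0<τ τ≤1 0<τ₁ 1≤Y Y<X = M , ev-zip (λ { i ((e≥ , b≥) , van) ((one₁ , one₂) , mul , bern) small →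
        let open Exact (value i) (1ℚ - b i) ε₀ β₀ τ η J M 0<ε₀ 0<β₀ 0<τ (proj₂ (proj₂ (proj₂ bound₂))) (proj₂ (proj₂ (proj₂ bound₁))) τ≤1
                  e≥ (subst (β₀ ≤_) (dbl (b i)) b≥) 1≤M X≤M η≡ small one₁ one₂
                  (λ m n 1≤m 1≤n le → mul m (ℕ.≤-trans (ℕ.m≤m*n m n {{ℕ.>-nonZero 1≤n}}) le) n (ℕ.≤-trans (ℕ.m≤n*m n m {{ℕ.>-nonZero 1≤m}}) le) 1≤m 1≤n)
                  (λ a b′ 1≤a 1≤b a≤M b≤M → bern a a≤M b′ b≤M 1≤a 1≤b)
        in record { isPowerLike = powerLike ; increase≥0 = increase-nonNeg Y 1≤Y Y<X ; increase≤ = increase-bound Y 1≤Y (ℕ.<⇒≤ Y<X) ; vanishes = van } })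
      (ev-× (ev-× ε≥ β≥) (proj₂ (proj₂ van₀))) (ev-× (approx-one M η 0<η) (ev-× (approx-mul M η 0<η) (approx-bernoulli M η 0<η)))
      where
      van₀ = vanishing τ₁ 0<τ₁ (2 ℕ.^ J)
      M = proj₁ van₀
      X≤M = proj₁ (proj₂ van₀)
      1≤M : 1 ℕ.≤ M
      1≤M = ℕ.≤-trans (ℕ.m^n>0 2 J) X≤M
      θ = ε₀ * (β₀ * (τ * (rcp M * rcp M)))
      0<θ : 0ℚ < θ
      0<θ = *-pos 0<ε₀ (*-pos 0<β₀ (*-pos 0<τ (*-pos (rcp-pos 1≤M) (rcp-pos 1≤M))))
      η = ½ * (½ * θ)
      0<η : 0ℚ < η
      0<η = half-pos (half-pos 0<θ)
      η≡ : 4ℚ * η ≡ θ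
      η≡ = lem θ
        where
        lem : ∀ t → 4ℚ * (½ * (½ * t)) ≡ t
        lem = solve-∀ ring
      dbl : ∀ x → x ≡ 1ℚ - (1ℚ - x)
      dbl = solve-∀ ring

module Characters where

  open import Data.Rational using (_≤_)
  open Rationals
  open ExponentialSeries using (∑₀; ∑₀-head; ∑₀-cong)
  open Summation
  open DivisorSums
  open RealZero using (∑₀-∑)

  Cong : ℕ → ℕ → ℕ → Set
  Cong q m n = ∃₂ λ a b → m ℕ.+ a ℕ.* q ≡ n ℕ.+ b ℕ.* q

  Cong-≡ : ∀ {q m n} → m ≡ n → Cong q m n
  Cong-≡ refl = 0 , 0 , refl

  Cong-sym : ∀ {q m n} → Cong q m n → Cong q n m
  Cong-sym (a , b , e) = b , a , sym e

  Cong-trans : ∀ {q l m n} → Cong q l m → Cong q m n → Cong q l n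
  Cong-trans {q} {l} {m} {n} (a , b , e) (c , d , f) = a ℕ.+ c , b ℕ.+ d ,
    trans (lem l a c q) (trans (cong (ℕ._+ c ℕ.* q) e) (trans (lem₂ m b c q) (trans (cong (ℕ._+ b ℕ.* q) f) (lem₃ n b d q))))
    where
    lem : ∀ l a c q → l ℕ.+ (a ℕ.+ c) ℕ.* q ≡ l ℕ.+ a ℕ.* q ℕ.+ c ℕ.* q
    lem = solveℕ-∀
    lem₂ : ∀ m b c q → m ℕ.+ b ℕ.* q ℕ.+ c ℕ.* q ≡ m ℕ.+ c ℕ.* q ℕ.+ b ℕ.* q
    lem₂ = solveℕ-∀
    lem₃ : ∀ n b d q → n ℕ.+ d ℕ.* q ℕ.+ b ℕ.* q ≡ n ℕ.+ (b ℕ.+ d) ℕ.* q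
    lem₃ = solveℕ-∀

  Cong-+ : ∀ {q m n m′ n′} → Cong q m n → Cong q m′ n′ → Cong q (m ℕ.+ m′) (n ℕ.+ n′)
  Cong-+ {q} {m} {n} {m′} {n′} (a , b , e) (c , d , f) = a ℕ.+ c , b ℕ.+ d , trans (lem m m′ a c q) (trans (cong₂ ℕ._+_ e f) (sym (lem n n′ b d q)))
    where
    lem : ∀ m m′ a c q → m ℕ.+ m′ ℕ.+ (a ℕ.+ c) ℕ.* q ≡ m ℕ.+ a ℕ.* q ℕ.+ (m′ ℕ.+ c ℕ.* q)
    lem = solveℕ-∀

  Cong-* : ∀ {q m n m′ n′} → Cong q m n → Cong q m′ n′ → Cong q (m ℕ.* m′) (n ℕ.* n′)
  Cong-* {q} {m} {n} {m′} {n′} (a , b , e) (c , d , f) =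
    m ℕ.* c ℕ.+ a ℕ.* m′ ℕ.+ a ℕ.* c ℕ.* q , n ℕ.* d ℕ.+ b ℕ.* n′ ℕ.+ b ℕ.* d ℕ.* q , trans (lem m m′ a c q) (trans (cong₂ ℕ._*_ e f) (sym (lem n n′ b d q)))
    where
    lem : ∀ m m′ a c q → m ℕ.* m′ ℕ.+ (m ℕ.* c ℕ.+ a ℕ.* m′ ℕ.+ a ℕ.* c ℕ.* q) ℕ.* q ≡ (m ℕ.+ a ℕ.* q) ℕ.* (m′ ℕ.+ c ℕ.* q)
    lem = solveℕ-∀

  Cong-∣ : ∀ {q} n {k} → q ∣ k → Cong q (n ℕ.+ k) n
  Cong-∣ {q} n (divides j refl) = 0 , j , ℕ.+-identityʳ (n ℕ.+ j ℕ.* q)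

  Cong-0 : ∀ {q k} → q ∣ k → Cong q k 0
  Cong-0 = Cong-∣ 0

  ∣-Cong : ∀ {q} n k → Cong q (n ℕ.+ k) n → q ∣ k
  ∣-Cong {q} n k (a , b , e) = ∣m+n∣m⇒∣n {m = a ℕ.* q} (divides b (ℕ.+-cancelˡ-≡ n _ _ (trans (lem n a k q) e))) (n∣m*n a)
    where
    lem : ∀ n a k q → n ℕ.+ (a ℕ.* q ℕ.+ k) ≡ n ℕ.+ k ℕ.+ a ℕ.* q
    lem = solveℕ-∀

  0-Cong : ∀ {q k} → Cong q k 0 → q ∣ k
  0-Cong = ∣-Cong 0 _

  Cong-weaken : ∀ {d q m n} → d ∣ q → Cong q m n → Cong d m n
  Cong-weaken {d} {_} {m} {n} (divides j refl) (a , b , e) = a ℕ.* j , b ℕ.* j , trans (cong (m ℕ.+_) (ℕ.*-assoc a j d)) (trans e (cong (n ℕ.+_) (sym (ℕ.*-assoc b j d))))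

  Cong-coprime : ∀ {m p a b} → Coprime m p → Cong m a b → Cong p a b → Cong (m ℕ.* p) a b
  Cong-coprime {m} {p} {a} {b} c f g with ℕ.≤-total a b
  ... | inj₁ a≤b with k , refl ← ℕ.m≤n⇒∃[o]m+o≡n a≤b = Cong-sym (Cong-∣ a (product (∣-Cong a k (Cong-sym f)) (∣-Cong a k (Cong-sym g))))
    where
    product : m ∣ k → p ∣ k → m ℕ.* p ∣ k
    product (divides j refl) pk with coprime-divisor {n = m} (Coprimality.sym c) (subst (p ∣_) (ℕ.*-comm j m) pk)
    ... | divides i refl = divides i (trans (ℕ.*-assoc i p m) (cong (i ℕ.*_) (ℕ.*-comm p m)))
  ... | inj₂ b≤a with k , refl ← ℕ.m≤n⇒∃[o]m+o≡n b≤a = Cong-∣ b (product (∣-Cong b k f) (∣-Cong b k g))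
    where
    product : m ∣ k → p ∣ k → m ℕ.* p ∣ k
    product (divides j refl) pk with coprime-divisor {n = m} (Coprimality.sym c) (subst (p ∣_) (ℕ.*-comm j m) pk)
    ... | divides i refl = divides i (trans (ℕ.*-assoc i p m) (cong (i ℕ.*_) (ℕ.*-comm p m)))

  Cong-% : ∀ {q m n} → .{{_ : ℕ.NonZero q}} → Cong q m n → m % q ≡ n % q
  Cong-% {q} {m} {n} (a , b , e) = trans (sym ([m+kn]%n≡m%n m a q)) (trans (cong (_% q) e) ([m+kn]%n≡m%n n b q))

  %-Cong : ∀ q n → .{{_ : ℕ.NonZero q}} → Cong q n (n % q)
  %-Cong q n = 0 , n ℕ./ q , trans (ℕ.+-identityʳ n) (m≡m%n+[m/n]*n n q)

  inverse : ∀ {n q} → Coprime n q → ∃ λ u → Cong q (n ℕ.* u) 1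
  inverse {n} {q} c with coprime-Bézout c
  ... | Bézout.+- x y eq = x , 0 , y , trans (ℕ.+-identityʳ (n ℕ.* x)) (trans (ℕ.*-comm n x) (sym eq))
  ... | Bézout.-+ x y eq = x ℕ.* (x ℕ.* n) , y , x ℕ.* n ℕ.* y , trans (cong (λ t → n ℕ.* (x ℕ.* (x ℕ.* n)) ℕ.+ t) (sym eq)) (trans (lem n x) (trans (cong (λ t → 1 ℕ.+ x ℕ.* n ℕ.* t) eq) (cong suc (sym (ℕ.*-assoc (x ℕ.* n) y q)))))
    where
    lem : ∀ n x → n ℕ.* (x ℕ.* (x ℕ.* n)) ℕ.+ (1 ℕ.+ x ℕ.* n) ≡ 1 ℕ.+ x ℕ.* n ℕ.* (1 ℕ.+ x ℕ.* n)
    lem = solveℕ-∀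

  coprime-Cong : ∀ {q m n} → Cong q m n → Coprime m q → Coprime n q
  coprime-Cong {q} {m} {n} (a , b , e) c {d} (dn , dq) = c (d∣m , dq)
    where
    d∣m : d ∣ m
    d∣m = ∣m+n∣m⇒∣n {m = a ℕ.* q} (subst (d ∣_) (trans (sym e) (ℕ.+-comm m (a ℕ.* q))) (∣m∣n⇒∣m+n dn (∣-trans dq (n∣m*n b)))) (∣-trans dq (n∣m*n a))

  coprime-unit : ∀ {q n u} → Cong q (n ℕ.* u) 1 → Coprime n q
  coprime-unit {q} {n} {u} e {d} (dn , dq) = coprime-Cong {q} {1} {n ℕ.* u} (Cong-sym e) (λ (x , _) → ∣1⇒≡1 x) (∣-trans dn (m∣m*n u) , dq)

  module Values {q} (X : RealCharacter q) where

    c : ℕ → ℚ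
    c n = ιℤ (χ X n)

    χ-shift : ∀ n k → χ X (n ℕ.+ k ℕ.* q) ≡ χ X n
    χ-shift n zero    = cong (χ X) (ℕ.+-identityʳ n)
    χ-shift n (suc k) = trans (cong (χ X) (lem n (k ℕ.* q) q)) (trans (periodic X (n ℕ.+ k ℕ.* q)) (χ-shift n k))
      where
      lem : ∀ n k q → n ℕ.+ (q ℕ.+ k) ≡ n ℕ.+ k ℕ.+ q
      lem = solveℕ-∀

    χ-cong : ∀ {m n} → Cong q m n → χ X m ≡ χ X n
    χ-cong {m} {n} (a , b , e) = trans (sym (χ-shift m a)) (trans (cong (χ X) e) (χ-shift n b))

    coprime⇒≢0 : ∀ n → Coprime n q → χ X n ≢ ℤ.0ℤ
    coprime⇒≢0 n = Equivalence.from (nonzero X n)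

    ≢0⇒coprime : ∀ n → χ X n ≢ ℤ.0ℤ → Coprime n q
    ≢0⇒coprime n = Equivalence.to (nonzero X n)

    ¬coprime⇒0 : ∀ n → ¬ Coprime n q → χ X n ≡ ℤ.0ℤ
    ¬coprime⇒0 n h with χ X n ℤ.≟ ℤ.0ℤ
    ... | yes e = e
    ... | no ne = ⊥-elim (h (≢0⇒coprime n ne))

    coprime-1 : Coprime 1 q
    coprime-1 (d1 , _) = ∣1⇒≡1 d1

    χ-1 : χ X 1 ≡ ℤ.1ℤ
    χ-1 = idem (χ X 1) (coprime⇒≢0 1 coprime-1) (sym (multiplicative X 1 1))
      where
      idem : ∀ z → z ≢ ℤ.0ℤ → z ℤ.* z ≡ z → z ≡ ℤ.1ℤ
      idem z ne e = ℤ.*-cancelˡ-≡ z z ℤ.1ℤ {{ℤ.≢-nonZero ne}} (trans e (sym (ℤ.*-identityʳ z)))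

    χ-unit : ∀ n → Coprime n q → χ X n ≡ ℤ.1ℤ ⊎ χ X n ≡ ℤ.-1ℤ
    χ-unit n cop = cases (χ X n) (χ X (proj₁ inv)) (trans (sym (multiplicative X n (proj₁ inv))) (trans (χ-cong (proj₂ inv)) χ-1))
      where
      inv = inverse cop
      cases : ∀ a b → a ℤ.* b ≡ ℤ.1ℤ → a ≡ ℤ.1ℤ ⊎ a ≡ ℤ.-1ℤ
      cases a b e with ℤ.+∣i∣≡i⊎+∣i∣≡-i a
      ... | inj₁ f = inj₁ (trans (sym f) (cong (λ t → ℤ.+ t) abs))
        where
        abs : ℤ.∣ a ∣ ≡ 1
        abs = ℕ.m*n≡1⇒m≡1 ℤ.∣ a ∣ ℤ.∣ b ∣ (trans (sym (ℤ.abs-* a b)) (cong ℤ.∣_∣ e))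
      ... | inj₂ f = inj₂ (trans (sym (ℤ.neg-involutive a)) (cong ℤ.-_ (trans (sym f) (cong (λ t → ℤ.+ t) abs))))
        where
        abs : ℤ.∣ a ∣ ≡ 1
        abs = ℕ.m*n≡1⇒m≡1 ℤ.∣ a ∣ ℤ.∣ b ∣ (trans (sym (ℤ.abs-* a b)) (cong ℤ.∣_∣ e))

    χ-cases : ∀ n → χ X n ≡ ℤ.0ℤ ⊎ χ X n ≡ ℤ.1ℤ ⊎ χ X n ≡ ℤ.-1ℤ
    χ-cases n with χ X n ℤ.≟ ℤ.0ℤ
    ... | yes e = inj₁ e
    ... | no ne = inj₂ (χ-unit n (≢0⇒coprime n ne))

    opaque
      unfolding ιℤ
      ιℤ0 : ιℤ ℤ.0ℤ ≡ 0ℚ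
      ιℤ0 = refl
      ιℤ1 : ιℤ ℤ.1ℤ ≡ 1ℚ
      ιℤ1 = refl
      ιℤ-1 : ιℤ ℤ.-1ℤ ≡ - 1ℚ
      ιℤ-1 = refl

    sign : Sign c
    sign = record
      { c-one = trans (cong ιℤ χ-1) ιℤ1
      ; c-* = λ m n → trans (cong ιℤ (multiplicative X m n)) (ιℤ-* (χ X m) (χ X n))
      ; c-cases = λ n → cases n (χ-cases n)
      }
      where
      cases : ∀ n → χ X n ≡ ℤ.0ℤ ⊎ χ X n ≡ ℤ.1ℤ ⊎ χ X n ≡ ℤ.-1ℤ → c n ≡ 0ℚ ⊎ c n ≡ 1ℚ ⊎ c n ≡ - 1ℚ
      cases n (inj₁ e)        = inj₁ (trans (cong ιℤ e) ιℤ0)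
      cases n (inj₂ (inj₁ e)) = inj₂ (inj₁ (trans (cong ιℤ e) ιℤ1))
      cases n (inj₂ (inj₂ e)) = inj₂ (inj₂ (trans (cong ιℤ e) ιℤ-1))

    c-bounded : ∀ n → ∣ c n ∣ ≤ 1ℚ
    c-bounded n with Sign.c-cases sign n
    ... | inj₁ e        = ℚ.≤-trans (ℚ.≤-reflexive (cong ∣_∣ e)) 0≤1
    ... | inj₂ (inj₁ e) = ℚ.≤-reflexive (cong ∣_∣ e)
    ... | inj₂ (inj₂ e) = ℚ.≤-reflexive (cong ∣_∣ e)

    c-periodic : ∀ n → c (n ℕ.+ q) ≡ c n
    c-periodic n = cong ιℤ (periodic X n)

    -- Multiplication by a unit u permutes the residues, so ∑ c = c u ∑ c.
    module _ .{{q≢0 : ℕ.NonZero q}} (u : ℕ) (χu : χ X u ≡ ℤ.-1ℤ) where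
      private
        cu : c u ≡ - 1ℚ
        cu = trans (cong ιℤ χu) ιℤ-1
        cop : Coprime u q
        cop = ≢0⇒coprime u (λ e → case (trans (sym χu) e))
          where
          case : ℤ.-1ℤ ≡ ℤ.0ℤ → ⊥
          case ()
        u′ = proj₁ (inverse cop)
        uu′ = proj₂ (inverse cop)
        c₀ : ℕ → ℚ
        c₀ n = c (ℕ.pred n)
        σ τ : ℕ → ℕ
        σ a = suc ((u ℕ.* ℕ.pred a) % q)
        τ b = suc ((u′ ℕ.* ℕ.pred b) % q)
        σ≤ : ∀ a → σ a ℕ.≤ q
        σ≤ a = m%n<n (u ℕ.* ℕ.pred a) q
        back : ∀ v w → Cong q (v ℕ.* w) 1 → ∀ x y → x ℕ.< q → y ≡ (w ℕ.* x) % q → x ≡ (v ℕ.* y) % q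
        back v w vw x y x<q refl = trans (sym (m<n⇒m%n≡m x<q)) (Cong-% {q} {x} {v ℕ.* ((w ℕ.* x) % q)} (Cong-trans (Cong-sym step) (Cong-* (Cong-≡ {m = v} refl) (%-Cong q (w ℕ.* x)))))
          where
          step : Cong q (v ℕ.* (w ℕ.* x)) x
          step = Cong-trans (Cong-≡ (sym (ℕ.*-assoc v w x))) (Cong-trans (Cong-* vw (Cong-≡ {m = x} refl)) (Cong-≡ (ℕ.*-identityˡ x)))
        sum : ℚ
        sum = ∑ q c₀
        permuted : ∑ q (λ a → c (u ℕ.* ℕ.pred a)) ≡ sum
        permuted = begin
          ∑ q (λ a → c (u ℕ.* ℕ.pred a))
            ≡⟨ ∑-cong q (λ a _ _ → trans (cong ιℤ (χ-cong (%-Cong q (u ℕ.* ℕ.pred a)))) (trans (sym (ℚ.*-identityˡ (c₀ (σ a)))) (trans (cong (_* c₀ (σ a)) (sym (𝟙-yes (σ a ℕ.≤? q) (σ≤ a)))) (sym (∑-pick q (σ a) c₀ (s≤s z≤n)))))) ⟩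
          ∑ q (λ a → ∑ q (λ b → 𝟙 (b ℕ.≟ σ a) * c₀ b))
            ≡⟨ ∑-swap q q _ ⟩
          ∑ q (λ b → ∑ q (λ a → 𝟙 (b ℕ.≟ σ a) * c₀ b))
            ≡⟨ ∑-cong q (λ b 1≤b b≤q → trans (∑-cong q (λ a 1≤a a≤q → cong (_* c₀ b) (𝟙-cong (b ℕ.≟ σ a) (a ℕ.≟ τ b) (to a b 1≤a a≤q) (from a b 1≤b b≤q)))) (∑-single q (τ b) (c₀ b) (s≤s z≤n) (m%n<n (u′ ℕ.* ℕ.pred b) q))) ⟩
          sum ∎
          where
          open ≡-Reasoning
          pred< : ∀ {a} → 1 ℕ.≤ a → a ℕ.≤ q → ℕ.pred a ℕ.< q
          pred< {suc a} _ le = le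
          suc-pred : ∀ {a} → 1 ℕ.≤ a → suc (ℕ.pred a) ≡ a
          suc-pred {suc a} _ = refl
          to : ∀ a b → 1 ℕ.≤ a → a ℕ.≤ q → b ≡ σ a → a ≡ τ b
          to a b 1≤a a≤q refl = trans (sym (suc-pred 1≤a)) (cong suc (back u′ u (Cong-trans (Cong-≡ (ℕ.*-comm u′ u)) uu′) (ℕ.pred a) _ (pred< 1≤a a≤q) refl))
          from : ∀ a b → 1 ℕ.≤ b → b ℕ.≤ q → a ≡ τ b → b ≡ σ a
          from a b 1≤b b≤q refl = trans (sym (suc-pred 1≤b)) (cong suc (back u u′ uu′ (ℕ.pred b) _ (pred< 1≤b b≤q) refl))
        sum≡0 : sum ≡ 0ℚ
        sum≡0 = lem sum (trans (sym permuted) (trans (∑-cong q (λ a _ _ → trans (Sign.c-* sign u (ℕ.pred a)) (cong (_* c₀ a) cu))) (∑-* q (- 1ℚ) c₀)))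
          where
          lem : ∀ s → s ≡ - 1ℚ * s → s ≡ 0ℚ
          lem s e = *-cancel (trans (cong (s +_) e) (lem′ s))
            where
            lem′ : ∀ s → s + - 1ℚ * s ≡ 0ℚ
            lem′ = solve-∀ ring
            *-cancel : s + s ≡ 0ℚ → s ≡ 0ℚ
            *-cancel f = trans (lem″ s) (trans (cong (½ *_) f) (ℚ.*-zeroʳ ½))
              where
              lem″ : ∀ s → s ≡ ½ * (s + s)
              lem″ = solve-∀ ring

      sum-period : ∑ q c ≡ 0ℚ
      sum-period = trans (sym (∑₀-∑ q c)) (lem (c 0) (∑₀ q (λ k → c (suc k))) (trans (sym (∑₀-head q c)) (cong₂ _+_ (trans (∑₀-∑ q c₀) sum≡0) (c-periodic 0))))
        where
        lem : ∀ a b → a + b ≡ 0ℚ + a → b ≡ 0ℚ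
        lem a b e = trans (lem₁ a b) (trans (cong (λ t → t - a) e) (lem₂ a))
          where
          lem₁ : ∀ a b → b ≡ a + b - a
          lem₁ = solve-∀ ring
          lem₂ : ∀ a → 0ℚ + a - a ≡ 0ℚ
          lem₂ = solve-∀ ring

      partial-sums : ∀ N → ∣ ∑ N c ∣ ≤ ι q
      partial-sums N = subst (λ t → ∣ t ∣ ≤ ι q) (sym (trans (cong (λ t → ∑ t c) (trans (m≡m%n+[m/n]*n N q) (ℕ.+-comm (N % q) (N ℕ./ q ℕ.* q)))) (reduce-period (N ℕ./ q) (N % q))))
          (ℚ.≤-trans (∑-abs (N % q) c) (ℚ.≤-trans (∑-mono (N % q) (λ k _ _ → c-bounded k)) (ℚ.≤-trans (ℚ.≤-reflexive (trans (∑-const (N % q) 1ℚ) (ℚ.*-identityʳ (ι (N % q))))) (ι-mono (ℕ.<⇒≤ (m%n<n N q))))))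
        where
        reduce-period : ∀ k r → ∑ (k ℕ.* q ℕ.+ r) c ≡ ∑ r c
        reduce-period zero    r = refl
        reduce-period (suc k) r = trans (cong (λ t → ∑ t c) (ℕ.+-assoc q (k ℕ.* q) r)) (trans (∑-split q (k ℕ.* q ℕ.+ r) c) (trans (cong₂ _+_ sum-period (∑-cong (k ℕ.* q ℕ.+ r) (λ j _ _ → trans (cong c (ℕ.+-comm q j)) (c-periodic j)))) (trans (ℚ.+-identityˡ _) (reduce-period k r))))

module OppositeValues where

  open import Data.Rational using (_≤_)
  open Rationals
  open DivisorSums
  open Characters

  even-or-odd : ∀ n → (∃ λ j → n ≡ 2 ℕ.* j) ⊎ (∃ λ j → n ≡ suc (2 ℕ.* j))
  even-or-odd zero = inj₁ (0 , refl)
  even-or-odd (suc n) with even-or-odd n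
  ... | inj₁ (j , refl) = inj₂ (j , refl)
  ... | inj₂ (j , refl) = inj₁ (suc j , cong suc (sym (ℕ.+-suc j (j ℕ.+ 0))))

  even≢odd : ∀ {i j} → 2 ℕ.* i ≢ suc (2 ℕ.* j)
  even≢odd {i} {j} e with 2 ∣? 1
  ... | yes d = ℕ.<⇒≱ (s≤s (s≤s z≤n)) (∣⇒≤ d)
  ... | no ¬d = ¬d (∣m+n∣m⇒∣n {m = 2 ℕ.* j} (subst (2 ∣_) (trans e (ℕ.+-comm 1 (2 ℕ.* j))) (m∣m*n i)) (m∣m*n j))

  Cong-cancel : ∀ {q m n} t → Cong q (m ℕ.+ t) (n ℕ.+ t) → Cong q m n
  Cong-cancel {q} {m} {n} t (a , b , e) = a , b , ℕ.+-cancelʳ-≡ t _ _ (trans (lem m a q t) (trans e (sym (lem n b q t))))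
    where
    lem : ∀ m a q t → m ℕ.+ a ℕ.* q ℕ.+ t ≡ m ℕ.+ t ℕ.+ a ℕ.* q
    lem = solveℕ-∀

  ∑-reverse : ∀ k (f : ℕ → ℚ) → ∑ k (λ j → f (suc k ℕ.∸ j)) ≡ ∑ k f
  ∑-reverse zero    f = refl
  ∑-reverse (suc k) f = trans (∑-split 1 k (λ j → f (2 ℕ.+ k ℕ.∸ j))) (trans (cong₂ _+_ (ℚ.+-identityˡ (f (suc k))) (∑-reverse k f)) (ℚ.+-comm (f (suc k)) (∑ k f)))

  sum-of-signs : ∀ k (c : ℕ → ℚ) → (∀ a → 1 ℕ.≤ a → a ℕ.≤ k → c a ≡ 1ℚ ⊎ c a ≡ - 1ℚ) → ∃ λ n → ∑ k c + ι k ≡ ι (2 ℕ.* n)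
  sum-of-signs zero    c h = 0 , ℚ.+-identityˡ (ι 0)
  sum-of-signs (suc k) c h with sum-of-signs k c (λ a p q → h a p (ℕ.m≤n⇒m≤1+n q)) | h (suc k) (s≤s z≤n) ℕ.≤-refl
  ... | n , e | inj₁ f = suc n , trans (cong₂ (λ a b → ∑ k c + a + b) f (ι-suc k)) (trans (lem (∑ k c) (ι k)) (trans (cong₂ (λ a b → a + (b + b)) e (sym ι1)) (sym (trans (cong ι (lem₂ n)) (trans (ι-+ (2 ℕ.* n) 2) (cong (ι (2 ℕ.* n) +_) (ι-+ 1 1)))))))
    where
    lem : ∀ s k → s + 1ℚ + (1ℚ + k) ≡ s + k + (1ℚ + 1ℚ)
    lem = solve-∀ ring
    lem₂ : ∀ n → 2 ℕ.* suc n ≡ 2 ℕ.* n ℕ.+ 2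
    lem₂ = solveℕ-∀
  ... | n , e | inj₂ f = n , trans (cong₂ (λ a b → ∑ k c + a + b) f (ι-suc k)) (trans (lem (∑ k c) (ι k)) e)
    where
    lem : ∀ s k → s + (- 1ℚ) + (1ℚ + k) ≡ s + k
    lem = solve-∀ ring

  ι-injective : ∀ {m n} → ι m ≡ ι n → m ≡ n
  ι-injective e = ℕ.≤-antisym (ι-cancel-≤ (ℚ.≤-reflexive e)) (ι-cancel-≤ (ℚ.≤-reflexive (sym e)))

  count : ∀ k {P : ℕ → Set} (P? : ∀ a → Dec (P a)) → ∃ λ n → ∑ k (λ a → 𝟙 (P? a)) ≡ ι n
  count zero    P? = 0 , sym ι0
  count (suc k) P? with count k P? | P? (suc k)
  ... | n , e | yes _ = suc n , trans (cong (_+ 1ℚ) e) (trans (ℚ.+-comm (ι n) 1ℚ) (sym (ι-suc n)))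
  ... | n , e | no _  = n , trans (cong (_+ 0ℚ) e) (ℚ.+-identityʳ (ι n))

  symmetric-sum : ∀ k {P : ℕ → ℕ → Set} (P? : ∀ a b → Dec (P a b)) → (∀ {a b} → P a b → P b a) →
    ∃ λ n → ∑ k (λ a → ∑ k (λ b → 𝟙 (P? a b))) ≡ ∑ k (λ a → 𝟙 (P? a a)) + ι (2 ℕ.* n)
  symmetric-sum zero    P? s = 0 , sym (trans (ℚ.+-identityˡ (ι 0)) ι0)
  symmetric-sum (suc k) P? s with symmetric-sum k P? s | count k (λ a → P? a (suc k))
  ... | n , e | m , f = n ℕ.+ m , trans (cong₂ _+_ (trans (∑-+ k _ _) (cong₂ _+_ e f)) (cong (_+ 𝟙 (P? (suc k) (suc k))) (trans (∑-cong k (λ b _ _ → 𝟙-cong (P? (suc k) b) (P? b (suc k)) s s)) f)))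
      (trans (lem (∑ k (λ a → 𝟙 (P? a a))) (ι (2 ℕ.* n)) (ι m) (𝟙 (P? (suc k) (suc k)))) (cong (∑ k (λ a → 𝟙 (P? a a)) + 𝟙 (P? (suc k) (suc k)) +_) (sym (trans (cong ι (lem₂ n m)) (trans (ι-+ (2 ℕ.* n) (m ℕ.+ m)) (cong (ι (2 ℕ.* n) +_) (ι-+ m m)))))))
    where
    lem : ∀ t n m d → t + n + m + (m + d) ≡ t + d + (n + (m + m))
    lem = solve-∀ ring
    lem₂ : ∀ n m → 2 ℕ.* (n ℕ.+ m) ≡ 2 ℕ.* n ℕ.+ (m ℕ.+ m)
    lem₂ = solveℕ-∀

  -- Among 1, …, k with l = 2 k + 1 the relation a b ≡ ± 1 pairs the elements
  -- other than 1, unless a² ≡ - 1 for some a.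
  sqrt-of-minus-one : ∀ {l} → Prime l → l % 4 ≡ 1 → ∃ λ a → l ∣ suc (a ℕ.* a)
  sqrt-of-minus-one {l} pr l%4 with ℕ.anyUpTo? (λ a → l ∣? suc (a ℕ.* a)) l
  ... | yes (a , _ , d) = a , d
  ... | no none = ⊥-elim (even≢odd {j} {n} (ι-injective (trans (sym total) (trans e (trans (cong (_+ ι (2 ℕ.* n)) trace) (sym (ι-suc (2 ℕ.* n))))))))
    where
    instance
      l≢0 : ℕ.NonZero l
      l≢0 = prime⇒nonZero pr
    j = l ℕ./ 4
    k = 2 ℕ.* j
    l≡ : l ≡ suc (2 ℕ.* k)
    l≡ = trans (m≡m%n+[m/n]*n l 4) (trans (cong (ℕ._+ j ℕ.* 4) l%4) (lem j))
      where
      lem : ∀ j → 1 ℕ.+ j ℕ.* 4 ≡ suc (2 ℕ.* (2 ℕ.* j))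
      lem = solveℕ-∀
    2k : k ℕ.+ k ≡ 2 ℕ.* k
    2k = cong (k ℕ.+_) (sym (ℕ.+-identityʳ k))
    k+k<l : k ℕ.+ k ℕ.< l
    k+k<l = ℕ.≤-reflexive (trans (cong suc 2k) (sym l≡))
    k<l : k ℕ.< l
    k<l = ℕ.≤-<-trans (ℕ.m≤m+n k k) k+k<l
    1≤k : 1 ℕ.≤ k
    1≤k = ℕ.n≢0⇒n>0 (λ k≡0 → ℕ.<-irrefl (sym (trans l≡ (cong (λ t → suc (2 ℕ.* t)) k≡0))) (prime>1 pr))
    P : ℕ → ℕ → Set
    P a b = (a ℕ.* b) % l ≡ 1 ⊎ l ∣ suc (a ℕ.* b)
    P? : ∀ a b → Dec (P a b)
    P? a b = ((a ℕ.* b) % l ℕ.≟ 1) ⊎-dec (l ∣? suc (a ℕ.* b))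
    P-sym : ∀ {a b} → P a b → P b a
    P-sym {a} {b} = subst (λ t → t % l ≡ 1 ⊎ l ∣ suc t) (ℕ.*-comm a b)
    1%l : 1 % l ≡ 1
    1%l = m<n⇒m%n≡m (prime>1 pr)
    to-Cong : ∀ {x} → x % l ≡ 1 → Cong l x 1
    to-Cong {x} f = subst (Cong l x) f (%-Cong l x)
    row : ∀ a → 1 ℕ.≤ a → a ℕ.≤ k → ∑ k (λ b → 𝟙 (P? a b)) ≡ 1ℚ
    row a 1≤a a≤k = by-cases (x ℕ.≤? k)
      where
      a<l = ℕ.≤-<-trans a≤k k<l
      cop : Coprime a l
      cop = Coprimality.sym (prime⇒coprime pr {{ℕ.>-nonZero 1≤a}} a<l)
      inv = inverse cop
      x = proj₁ inv % l
      x<l : x ℕ.< l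
      x<l = m%n<n (proj₁ inv) l
      ax : Cong l (a ℕ.* x) 1
      ax = Cong-trans (Cong-* (Cong-≡ {m = a} refl) (Cong-sym (%-Cong l (proj₁ inv)))) (proj₂ inv)
      1≤x : 1 ℕ.≤ x
      1≤x = ℕ.n≢0⇒n>0 (λ x≡0 → ℕ.<⇒≱ (prime>1 pr) (∣⇒≤ (0-Cong (Cong-trans (Cong-sym ax) (Cong-≡ (trans (cong (a ℕ.*_) x≡0) (ℕ.*-zeroʳ a)))))))
      plus : ∀ {b} → b ℕ.≤ k → (a ℕ.* b) % l ≡ 1 → b ≡ x
      plus {b} b≤k f = trans (sym (m<n⇒m%n≡m (ℕ.≤-<-trans b≤k k<l))) (trans (Cong-% {l} {b} {x} b~x) (m<n⇒m%n≡m x<l))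
        where
        b~x : Cong l b x
        b~x = Cong-trans (Cong-≡ (sym (ℕ.*-identityˡ b))) (Cong-trans (Cong-* (Cong-sym ax) (Cong-≡ {m = b} refl)) (Cong-trans (Cong-≡ (lem a x b)) (Cong-trans (Cong-* (Cong-≡ {m = x} refl) (to-Cong f)) (Cong-≡ (ℕ.*-identityʳ x)))))
          where
          lem : ∀ a x b → a ℕ.* x ℕ.* b ≡ x ℕ.* (a ℕ.* b)
          lem = solveℕ-∀
      minus : ∀ {b} → l ∣ suc (a ℕ.* b) → l ∣ b ℕ.+ x
      minus {b} d = 0-Cong (Cong-trans (Cong-+ (Cong-trans (Cong-≡ (sym (ℕ.*-identityˡ b))) (Cong-* (Cong-sym ax) (Cong-≡ {m = b} refl))) (Cong-≡ {m = x} refl)) (Cong-trans (Cong-≡ (lem a x b)) (Cong-0 (∣-trans d (n∣m*n x)))))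
        where
        lem : ∀ a x b → a ℕ.* x ℕ.* b ℕ.+ x ≡ x ℕ.* suc (a ℕ.* b)
        lem = solveℕ-∀
      single : ∀ b₀ → 1 ℕ.≤ b₀ → b₀ ℕ.≤ k → (∀ b → 1 ℕ.≤ b → b ℕ.≤ k → P a b → b ≡ b₀) → P a b₀ → ∑ k (λ b → 𝟙 (P? a b)) ≡ 1ℚ
      single b₀ p q f g = trans (∑-cong k (λ b 1≤b b≤k → trans (𝟙-cong (P? a b) (b ℕ.≟ b₀) (f b 1≤b b≤k) (λ { refl → g })) (sym (ℚ.*-identityʳ _)))) (∑-single k b₀ 1ℚ p q)
      by-cases : Dec (x ℕ.≤ k) → ∑ k (λ b → 𝟙 (P? a b)) ≡ 1ℚ
      by-cases (yes x≤k) = single x 1≤x x≤k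
        (λ { b _ b≤k (inj₁ f) → plus b≤k f
           ; b 1≤b b≤k (inj₂ d) → ⊥-elim (ℕ.<⇒≱ (ℕ.≤-<-trans (ℕ.+-mono-≤ b≤k x≤k) k+k<l) (∣⇒≤ {{ℕ.>-nonZero (ℕ.≤-trans 1≤b (ℕ.m≤m+n b x))}} (minus d))) })
        (inj₁ (trans (Cong-% ax) 1%l))
      by-cases (no x≰k) = single b₀ (ℕ.m<n⇒0<n∸m x<l) b₀≤k
        (λ { b _ b≤k (inj₁ f) → ⊥-elim (x≰k (subst (ℕ._≤ k) (plus b≤k f) b≤k))
           ; b 1≤b b≤k (inj₂ d) → complement b 1≤b b≤k (minus d) })
        (inj₂ (0-Cong (Cong-trans (Cong-≡ (ℕ.+-comm 1 (a ℕ.* b₀))) (Cong-trans (Cong-+ (Cong-≡ {m = a ℕ.* b₀} refl) (Cong-sym ax)) (Cong-trans (Cong-≡ (trans (sym (ℕ.*-distribˡ-+ a b₀ x)) (cong (a ℕ.*_) b₀+x))) (Cong-0 (n∣m*n a)))))))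
        where
        b₀ = l ℕ.∸ x
        b₀+x : b₀ ℕ.+ x ≡ l
        b₀+x = ℕ.m∸n+n≡m (ℕ.<⇒≤ x<l)
        b₀≤k : b₀ ℕ.≤ k
        b₀≤k = ℕ.+-cancelʳ-≤ x b₀ k (ℕ.≤-trans (ℕ.≤-reflexive b₀+x) (ℕ.≤-trans (ℕ.≤-reflexive (trans l≡ (cong suc (sym 2k)))) (ℕ.≤-trans (ℕ.≤-reflexive (sym (ℕ.+-suc k k))) (ℕ.+-monoʳ-≤ k (ℕ.≰⇒> x≰k)))))
        complement : ∀ b → 1 ℕ.≤ b → b ℕ.≤ k → l ∣ b ℕ.+ x → b ≡ b₀
        complement b 1≤b b≤k (divides zero f) = ⊥-elim (ℕ.<⇒≱ (ℕ.≤-trans 1≤b (ℕ.m≤m+n b x)) (ℕ.≤-reflexive f))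
        complement b 1≤b b≤k (divides (suc zero) f) = ℕ.+-cancelʳ-≡ x b b₀ (trans f (trans (ℕ.+-identityʳ l) (sym b₀+x)))
        complement b 1≤b b≤k (divides (suc (suc i)) f) = ⊥-elim (ℕ.<⇒≱ (ℕ.+-mono-< (ℕ.≤-<-trans b≤k k<l) x<l) (ℕ.≤-trans (ℕ.+-monoʳ-≤ l (ℕ.m≤m+n l (i ℕ.* l))) (ℕ.≤-reflexive (sym f))))
    total : ∑ k (λ a → ∑ k (λ b → 𝟙 (P? a b))) ≡ ι k
    total = trans (∑-cong k row) (trans (∑-const k 1ℚ) (ℚ.*-identityʳ (ι k)))
    trace : ∑ k (λ a → 𝟙 (P? a a)) ≡ 1ℚ
    trace = trans (∑-cong k (λ a 1≤a a≤k → trans (𝟙-cong (P? a a) (a ℕ.≟ 1) (to a 1≤a a≤k) (λ { refl → inj₁ 1%l })) (sym (ℚ.*-identityʳ _)))) (∑-single k 1 1ℚ ℕ.≤-refl 1≤k)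
      where
      lem : ∀ a → 1 ℕ.+ a ℕ.* (2 ℕ.+ a) ≡ suc a ℕ.* suc a
      lem = solveℕ-∀
      factor : ∀ a → suc a ℕ.≤ k → (l ∣ a) ⊎ (l ∣ 2 ℕ.+ a) → suc a ≡ 1
      factor zero    _  _        = refl
      factor (suc a) le (inj₁ d) = ⊥-elim (ℕ.<⇒≱ (ℕ.<-trans (ℕ.n<1+n (suc a)) (ℕ.≤-<-trans le k<l)) (∣⇒≤ d))
      factor a@(suc _) le (inj₂ d) = ⊥-elim (ℕ.<⇒≱ (ℕ.≤-<-trans (subst (ℕ._≤ k ℕ.+ k) (ℕ.+-comm (suc a) 1) (ℕ.+-mono-≤ le 1≤k)) k+k<l) (∣⇒≤ d))
      to : ∀ a → 1 ℕ.≤ a → a ℕ.≤ k → P a a → a ≡ 1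
      to a _ a≤k (inj₂ d) = ⊥-elim (none (a , ℕ.≤-<-trans a≤k k<l , d))
      to (suc a) _ a≤k (inj₁ f) = factor a a≤k (euclidsLemma a (2 ℕ.+ a) pr (∣-Cong 1 (a ℕ.* (2 ℕ.+ a)) (Cong-trans (Cong-≡ (lem a)) (to-Cong f))))
    n = proj₁ (symmetric-sum k P? (λ {a} {b} → P-sym {a} {b}))
    e = proj₂ (symmetric-sum k P? (λ {a} {b} → P-sym {a} {b}))

  record Idempotent (m p : ℕ) : Set where
    field
      s   : ℕ
      s≡1 : Cong m s 1
      s≡0 : Cong p s 0

  idempotent : ∀ {m p} → Coprime m p → Idempotent m p
  idempotent {m} {p} c = record { s = p ℕ.* u ; s≡1 = proj₂ (inverse (Coprimality.sym c)) ; s≡0 = Cong-0 (m∣m*n u) }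
    where u = proj₁ (inverse (Coprimality.sym c))

  module CRT {m p} (cop : Coprime m p) where
    open Idempotent (idempotent cop) public
    open Idempotent (idempotent (Coprimality.sym cop)) public renaming (s to r; s≡1 to r≡1; s≡0 to r≡0)

    glue : ℕ → ℕ → ℕ
    glue a b = a ℕ.* s ℕ.+ b ℕ.* r

    glue-m : ∀ a b → Cong m (glue a b) a
    glue-m a b = Cong-trans (Cong-+ (Cong-* (Cong-≡ {m = a} refl) s≡1) (Cong-* (Cong-≡ {m = b} refl) r≡0)) (Cong-≡ (lem a b))
      where
      lem : ∀ a b → a ℕ.* 1 ℕ.+ b ℕ.* 0 ≡ a
      lem = solveℕ-∀

    glue-p : ∀ a b → Cong p (glue a b) b
    glue-p a b = Cong-trans (Cong-+ (Cong-* (Cong-≡ {m = a} refl) s≡0) (Cong-* (Cong-≡ {m = b} refl) r≡1)) (Cong-≡ (lem a b))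
      where
      lem : ∀ a b → a ℕ.* 0 ℕ.+ b ℕ.* 1 ≡ b
      lem = solveℕ-∀

  prime-coprime : ∀ {l m} → Prime l → ¬ l ∣ m → Coprime l m
  prime-coprime pr ¬lm {d} (dl , dm) with prime⇒irreducible pr dl
  ... | inj₁ e = e
  ... | inj₂ refl = ⊥-elim (¬lm dm)

  sqrt-squarefree : ∀ m → 1 ℕ.≤ m → (∀ l → Prime l → l ∣ m → (l ≡ 2 ⊎ l % 4 ≡ 1) × ¬ l ℕ.* l ∣ m) → ∃ λ a → m ∣ suc (a ℕ.* a)
  sqrt-squarefree = <-rec _ go
    where
    go : ∀ m → (∀ {m′} → m′ ℕ.< m → 1 ℕ.≤ m′ → (∀ l → Prime l → l ∣ m′ → (l ≡ 2 ⊎ l % 4 ≡ 1) × ¬ l ℕ.* l ∣ m′) → ∃ λ a → m′ ∣ suc (a ℕ.* a)) →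
      1 ℕ.≤ m → (∀ l → Prime l → l ∣ m → (l ≡ 2 ⊎ l % 4 ≡ 1) × ¬ l ℕ.* l ∣ m) → ∃ λ a → m ∣ suc (a ℕ.* a)
    go m rec 1≤m h with ℕ.m≤n⇒m<n∨m≡n 1≤m
    ... | inj₂ refl = 0 , divides 1 refl
    ... | inj₁ 1<m with prime-divisor m 1<m
    ...   | l , pr , divides zero refl = ⊥-elim (ℕ.<⇒≱ 1≤m z≤n)
    ...   | l , pr , divides m′@(suc _) refl = glue a′ aₗ , 0-Cong (Cong-coprime (Coprimality.sym cop)
              (Cong-trans (square (glue-m a′ aₗ)) (Cong-0 (proj₂ sub))) (Cong-trans (square (glue-p a′ aₗ)) (Cong-0 (proj₂ rootₗ))))
      where
      ¬lm′ : ¬ l ∣ m′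
      ¬lm′ d = proj₂ (h l pr (n∣m*n m′)) (*-monoˡ-∣ l d)
      cop : Coprime l m′
      cop = prime-coprime pr ¬lm′
      sub = rec {m′} (ℕ.m<m*n m′ l (prime>1 pr)) (s≤s z≤n) (λ l′ pr′ d → proj₁ (h l′ pr′ (∣-trans d (m∣m*n l))) , λ dd → proj₂ (h l′ pr′ (∣-trans d (m∣m*n l))) (∣-trans dd (m∣m*n l)))
      a′ = proj₁ sub
      rootₗ : ∃ λ a → l ∣ suc (a ℕ.* a)
      rootₗ with proj₁ (h l pr (n∣m*n m′))
      ... | inj₁ refl = 1 , divides 1 refl
      ... | inj₂ e = sqrt-of-minus-one pr e
      aₗ = proj₁ rootₗ
      open CRT (Coprimality.sym cop)
      square : ∀ {q x y} → Cong q x y → Cong q (suc (x ℕ.* x)) (suc (y ℕ.* y))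
      square f = Cong-+ (Cong-≡ {m = 1} refl) (Cong-* f f)

  -- restricting a character mod m p to the residues that are 1 mod p
  component : ∀ {q m p} → RealCharacter q → q ≡ m ℕ.* p → Coprime m p → RealCharacter m
  component {q} {m} {p} X q≡ cop = record
    { χ = λ n → χ X (glue n 1)
    ; periodic = λ n → χ-cong (both (Cong-trans (glue-m (n ℕ.+ m) 1) (Cong-trans (Cong-∣ n ∣-refl) (Cong-sym (glue-m n 1)))) (Cong-trans (glue-p (n ℕ.+ m) 1) (Cong-sym (glue-p n 1))))
    ; multiplicative = λ a b → trans (χ-cong (both (Cong-trans (glue-m (a ℕ.* b) 1) (Cong-sym (Cong-* (glue-m a 1) (glue-m b 1)))) (Cong-trans (glue-p (a ℕ.* b) 1) (Cong-sym (Cong-* (glue-p a 1) (glue-p b 1))))))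
        (multiplicative X (glue a 1) (glue b 1))
    ; nonzero = λ n → mk⇔ (to n) (from n)
    }
    where
    open CRT cop
    open Values X
    both : ∀ {a b} → Cong m a b → Cong p a b → Cong q a b
    both {a} {b} x y = subst (λ t → Cong t a b) (sym q≡) (Cong-coprime cop x y)
    to : ∀ n → χ X (glue n 1) ≢ ℤ.0ℤ → Coprime n m
    to n ne = coprime-Cong (glue-m n 1) (λ (d₁ , d₂) → ≢0⇒coprime (glue n 1) ne (d₁ , ∣-trans d₂ (subst (m ∣_) (sym q≡) (m∣m*n p))))
    from : ∀ n → Coprime n m → χ X (glue n 1) ≢ ℤ.0ℤ
    from n c = coprime⇒≢0 (glue n 1) (coprime-unit {q} {glue n 1} {glue u 1} (both (Cong-trans (Cong-* (glue-m n 1) (glue-m u 1)) (proj₂ (inverse c))) (Cong-* (glue-p n 1) (glue-p u 1))))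
      where u = proj₁ (inverse c)

  -- An even real character modulo p = 2 k + 1 with k odd has no value - 1:
  -- otherwise its values on 1, …, k would add up to 0.
  even-character-trivial : ∀ {p} k (Y : RealCharacter p) → Prime p → p ≡ suc (2 ℕ.* k) → (∃ λ j → k ≡ suc (2 ℕ.* j)) →
    χ Y (ℕ.pred p) ≡ ℤ.1ℤ → ∀ u → χ Y u ≢ ℤ.-1ℤ
  even-character-trivial {p} k Y pr p≡ (j , refl) even u χu = even≢odd {proj₁ parity} {j} (ι-injective (trans (sym (proj₂ parity)) (trans (cong (_+ ι k) half) (ℚ.+-identityˡ (ι k)))))
    where
    open Values Y
    instance
      p≢0 : ℕ.NonZero p
      p≢0 = prime⇒nonZero pr
    k<p : k ℕ.< p
    k<p = subst (k ℕ.<_) (sym p≡) (s≤s (ℕ.m≤m+n k (k ℕ.+ 0)))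
    values : ∀ a → 1 ℕ.≤ a → a ℕ.≤ k → c a ≡ 1ℚ ⊎ c a ≡ - 1ℚ
    values a 1≤a a≤k with χ-unit a (Coprimality.sym (prime⇒coprime pr {{ℕ.>-nonZero 1≤a}} (ℕ.≤-<-trans a≤k k<p)))
    ... | inj₁ e = inj₁ (trans (cong ιℤ e) ιℤ1)
    ... | inj₂ e = inj₂ (trans (cong ιℤ e) ιℤ-1)
    parity = sum-of-signs k c values
    c-p : c p ≡ 0ℚ
    c-p = trans (cong ιℤ (¬coprime⇒0 p (λ cop → ℕ.<-irrefl (sym (cop (∣-refl , ∣-refl))) (prime>1 pr)))) ιℤ0
    c-neg : ∀ a b → a ℕ.+ b ≡ p → c a ≡ c b
    c-neg a b e = trans (cong ιℤ (trans (χ-cong (1 ℕ.* b , 1 , eq)) (trans (multiplicative Y (ℕ.pred p) b) (trans (cong (ℤ._* χ Y b) even) (ℤ.*-identityˡ (χ Y b)))))) refl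
      where
      eq : a ℕ.+ 1 ℕ.* b ℕ.* p ≡ ℕ.pred p ℕ.* b ℕ.+ 1 ℕ.* p
      eq = trans (lem a b) (trans (cong (ℕ.pred p ℕ.* b ℕ.+_) (trans e (sym (ℕ.+-identityʳ p)))) refl)
        where
        lem : ∀ a b → a ℕ.+ 1 ℕ.* b ℕ.* p ≡ ℕ.pred p ℕ.* b ℕ.+ (a ℕ.+ b)
        lem a b = trans (cong (λ t → a ℕ.+ 1 ℕ.* b ℕ.* t) (sym (ℕ.suc-pred p))) (lem″ a b (ℕ.pred p))
          where
          lem″ : ∀ a b p′ → a ℕ.+ 1 ℕ.* b ℕ.* suc p′ ≡ p′ ℕ.* b ℕ.+ (a ℕ.+ b)
          lem″ = solveℕ-∀
    double : ∑ k c + ∑ k c ≡ 0ℚ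
    double = trans (sym (ℚ.+-identityʳ _)) (trans (cong₂ _+_ (trans (cong (∑ k c +_) (sym mirrored)) (sym (∑-split k k c))) (sym (trans (cong c (sym (trans p≡ (cong suc 2k≡)))) c-p)))
        (trans (cong (λ t → ∑ t c) (sym (trans p≡ (cong suc 2k≡)))) (sum-period u χu)))
      where
      2k≡ : 2 ℕ.* k ≡ k ℕ.+ k
      2k≡ = cong (k ℕ.+_) (ℕ.+-identityʳ k)
      mirrored : ∑ k (λ i → c (k ℕ.+ i)) ≡ ∑ k c
      mirrored = trans (∑-cong k (λ i _ i≤k → c-neg (k ℕ.+ i) (suc k ℕ.∸ i) (trans (ℕ.+-assoc k i _) (trans (cong (k ℕ.+_) (ℕ.m+[n∸m]≡n (ℕ.m≤n⇒m≤1+n i≤k))) (trans (ℕ.+-suc k k) (sym (trans p≡ (cong suc 2k≡)))))))) (∑-reverse k c)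
    half : ∑ k c ≡ 0ℚ
    half = trans (lem (∑ k c)) (trans (cong (½ *_) double) (ℚ.*-zeroʳ ½))
      where
      lem : ∀ s → s ≡ ½ * (s + s)
      lem = solve-∀ ring

  -- If q = l d with l ∣ d and χ (1 + d) = 1, then χ has period d.
  module Descent {q} (X : RealCharacter q) (l d : ℕ) (q≡ : q ≡ l ℕ.* d) (l∣d : l ∣ d) where
    open Values X

    f : ℕ → ℤ
    f j = χ X (1 ℕ.+ j ℕ.* d)

    f-suc : ∀ j → f (suc j) ≡ f j ℤ.* f 1
    f-suc j = trans (χ-cong {1 ℕ.+ suc j ℕ.* d} {(1 ℕ.+ j ℕ.* d) ℕ.* (1 ℕ.+ 1 ℕ.* d)} (Cong-sym (Cong-trans (Cong-≡ (lem j d)) (Cong-∣ (1 ℕ.+ suc j ℕ.* d) q∣)))) (multiplicative X (1 ℕ.+ j ℕ.* d) (1 ℕ.+ 1 ℕ.* d))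
      where
      lem : ∀ j d → (1 ℕ.+ j ℕ.* d) ℕ.* (1 ℕ.+ 1 ℕ.* d) ≡ 1 ℕ.+ suc j ℕ.* d ℕ.+ j ℕ.* (d ℕ.* d)
      lem = solveℕ-∀
      q∣ : q ∣ j ℕ.* (d ℕ.* d)
      q∣ = subst (_∣ j ℕ.* (d ℕ.* d)) (sym q≡) (∣-trans (*-monoˡ-∣ d l∣d) (n∣m*n j))

    f-0 : f 0 ≡ ℤ.1ℤ
    f-0 = χ-1

    f-l : f l ≡ ℤ.1ℤ
    f-l = trans (χ-cong (Cong-∣ 1 (subst (q ∣_) q≡ ∣-refl))) χ-1

    module _ (f-1 : f 1 ≡ ℤ.1ℤ) (1<l : 1 ℕ.< l) (1≤q : 1 ℕ.≤ q) where
      f-all : ∀ j → f j ≡ ℤ.1ℤ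
      f-all zero    = f-0
      f-all (suc j) = trans (f-suc j) (cong₂ ℤ._*_ (f-all j) f-1)

      d∣q : d ∣ q
      d∣q = subst (d ∣_) (sym q≡) (n∣m*n l)

      coprime-up : ∀ {n} → Coprime n d → Coprime n q
      coprime-up {n} c {e} (en , eq) = c (en , ∣-trans (coprime-divisor {e} {d} {l} (λ (x , y) → c (∣-trans x en , y)) (subst (e ∣_) (trans q≡ (ℕ.*-comm l d)) eq)) l∣d)

      coprime-down : ∀ {n} → Coprime n q → Coprime n d
      coprime-down {n} c {e} (en , ed) = c (en , ∣-trans ed d∣q)

      shift-coprime : ∀ n → ¬ Coprime n q → ¬ Coprime (n ℕ.+ d) q
      shift-coprime n ¬c c = ¬c λ {e} → coprime-up {n} (λ {e} → shifted {e}) {e}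
        where
        shifted : Coprime n d
        shifted = coprime-Cong {d} {n ℕ.+ d} {n} (Cong-∣ n ∣-refl) (λ {e} → coprime-down {n ℕ.+ d} c {e})

      period : ∀ n → χ X (n ℕ.+ d) ≡ χ X n
      period n with Coprimality.coprime? n q
      ... | yes c = trans (χ-cong step) (trans (multiplicative X n (1 ℕ.+ u ℕ.* d)) (trans (cong (χ X n ℤ.*_) (f-all u)) (ℤ.*-identityʳ (χ X n))))
        where
        u = proj₁ (inverse c)
        step : Cong q (n ℕ.+ d) (n ℕ.* (1 ℕ.+ u ℕ.* d))
        step = Cong-trans (Cong-+ (Cong-≡ {m = n} refl) (Cong-trans (Cong-≡ (sym (ℕ.*-identityˡ d))) (Cong-* (Cong-sym (proj₂ (inverse c))) (Cong-≡ {m = d} refl)))) (Cong-≡ (lem n u d))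
          where
          lem : ∀ n u d → n ℕ.+ n ℕ.* u ℕ.* d ≡ n ℕ.* (1 ℕ.+ u ℕ.* d)
          lem = solveℕ-∀
      ... | no ¬c = trans (¬coprime⇒0 (n ℕ.+ d) (shift-coprime n ¬c)) (sym (¬coprime⇒0 n ¬c))

      imprimitive : ¬ Primitive X
      imprimitive prim = prim d d∣q d<q Y (λ n _ → refl)
        where
        down : ∀ n → χ X n ≢ ℤ.0ℤ → Coprime n d
        down n ne = coprime-down {n} (≢0⇒coprime n ne)
        up : ∀ n → Coprime n d → χ X n ≢ ℤ.0ℤ
        up n c = coprime⇒≢0 n (coprime-up {n} (λ {e} → c {e}))
        Y : RealCharacter d
        Y = record { χ = χ X ; periodic = period ; multiplicative = multiplicative X ; nonzero = λ n → mk⇔ (down n) (up n) }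
        d<q : d ℕ.< q
        d<q = subst (d ℕ.<_) (trans (ℕ.*-comm d l) (sym q≡)) (ℕ.m<m*n d l {{ℕ.>-nonZero 1≤d}} 1<l)
          where
          1≤d : 1 ℕ.≤ d
          1≤d = ℕ.n≢0⇒n>0 (λ { refl → ℕ.<⇒≱ 1≤q (ℕ.≤-reflexive (trans q≡ (ℕ.*-zeroʳ l))) })

  odd-squarefree : ∀ {q} (X : RealCharacter q) → Primitive X → 1 ℕ.≤ q → ∀ {l} j → l ≡ suc (2 ℕ.* j) → 1 ℕ.< l → ¬ l ℕ.* l ∣ q
  odd-squarefree {q} X prim 1≤q {l} j l≡ 1<l (divides k q≡) = cases (χ-cases (1 ℕ.+ 1 ℕ.* d))
    where
    d = k ℕ.* l
    open Values X
    lem : ∀ k l → k ℕ.* (l ℕ.* l) ≡ l ℕ.* (k ℕ.* l)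
    lem = solveℕ-∀
    open Descent X l d (trans q≡ (lem k l)) (n∣m*n k)
    alternate : f 1 ≡ ℤ.-1ℤ → ∀ i → f (2 ℕ.* i) ≡ ℤ.1ℤ
    alternate e zero    = f-0
    alternate e (suc i) = trans (cong f (cong suc (ℕ.+-suc i (i ℕ.+ 0)))) (trans (f-suc (suc (2 ℕ.* i))) (trans (cong (ℤ._* f 1) (f-suc (2 ℕ.* i))) (cong₂ (λ a b → a ℤ.* b ℤ.* b) (alternate e i) e)))
    last : f l ≡ f (2 ℕ.* j) ℤ.* f 1
    last = trans (cong f l≡) (f-suc (2 ℕ.* j))
    cases : f 1 ≡ ℤ.0ℤ ⊎ f 1 ≡ ℤ.1ℤ ⊎ f 1 ≡ ℤ.-1ℤ → ⊥
    cases (inj₁ e)        = 1≢0 (trans (sym f-l) (trans last (trans (cong (f (2 ℕ.* j) ℤ.*_) e) (ℤ.*-zeroʳ (f (2 ℕ.* j))))))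
      where
      1≢0 : ℤ.1ℤ ≢ ℤ.0ℤ
      1≢0 ()
    cases (inj₂ (inj₁ e)) = imprimitive e 1<l 1≤q prim
    cases (inj₂ (inj₂ e)) = 1≢-1 (trans (sym f-l) (trans last (cong₂ ℤ._*_ (alternate e j) e)))
      where
      1≢-1 : ℤ.1ℤ ≢ ℤ.-1ℤ
      1≢-1 ()

  -- The residue classes in which p₁ + p₂ = n forces χ p₁ and χ p₂ to be opposite.
  data Opposite {q : ℕ} (X : RealCharacter q) : Set where
    odd  : (∀ a b → Coprime a q → Coprime b q → q ∣ a ℕ.+ b → χ X a ℤ.* χ X b ≡ ℤ.-1ℤ) → Opposite X
    even : ∀ h → q ≡ 2 ℕ.* h → 2 ∣ h →
      (∀ a b → Coprime a q → Coprime b q → Cong q (a ℕ.+ b) h → χ X a ℤ.* χ X b ≡ ℤ.-1ℤ) → Opposite X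

  module _ {q} (X : RealCharacter q) (1≤q : 1 ℕ.≤ q) where
    open Values X
    private
      ν = ℕ.pred q
      instance
        q≢0 : ℕ.NonZero q
        q≢0 = ℕ.>-nonZero 1≤q
      sν : suc ν ≡ q
      sν = ℕ.suc-pred q

    ν-square : Cong q (ν ℕ.* ν) 1
    ν-square = 2 , q , trans (cong (λ t → ν ℕ.* ν ℕ.+ 2 ℕ.* t) (sym sν)) (trans (lem ν) (cong (λ t → 1 ℕ.+ t ℕ.* t) sν))
      where
      lem : ∀ ν → ν ℕ.* ν ℕ.+ 2 ℕ.* suc ν ≡ 1 ℕ.+ suc ν ℕ.* suc ν
      lem = solveℕ-∀

    ν-unit : χ X ν ≡ ℤ.1ℤ ⊎ χ X ν ≡ ℤ.-1ℤ
    ν-unit = χ-unit ν (coprime-unit {q} {ν} {ν} ν-square)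

    unit-square : ∀ {a} → Coprime a q → χ X a ℤ.* χ X a ≡ ℤ.1ℤ
    unit-square {a} c with χ-unit a c
    ... | inj₁ e = cong (λ t → t ℤ.* t) e
    ... | inj₂ e = cong (λ t → t ℤ.* t) e

    negated : ∀ a b t → Cong q (b ℕ.+ t ℕ.* a) 0 → Coprime a q → χ X a ℤ.* χ X b ≡ χ X ν ℤ.* χ X t
    negated a b t e ca = trans (cong (χ X a ℤ.*_) (trans (χ-cong b~) (trans (multiplicative X (ν ℕ.* t) a) (cong (ℤ._* χ X a) (multiplicative X ν t)))))
        (trans (cong (χ X a ℤ.*_) (ℤ.*-comm (χ X ν ℤ.* χ X t) (χ X a))) (trans (sym (ℤ.*-assoc (χ X a) (χ X a) _)) (trans (cong (ℤ._* (χ X ν ℤ.* χ X t)) (unit-square ca)) (ℤ.*-identityˡ _))))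
      where
      b~ : Cong q b (ν ℕ.* t ℕ.* a)
      b~ = Cong-cancel (t ℕ.* a) (Cong-trans e (Cong-sym (Cong-trans (Cong-≡ (trans (lem ν t a) (cong (ℕ._* (t ℕ.* a)) sν))) (Cong-0 (m∣m*n (t ℕ.* a))))))
        where
        lem : ∀ ν t a → ν ℕ.* t ℕ.* a ℕ.+ t ℕ.* a ≡ suc ν ℕ.* (t ℕ.* a)
        lem = solveℕ-∀

    odd-opposite : χ X ν ≡ ℤ.-1ℤ → Opposite X
    odd-opposite e = odd (λ a b ca _ d → trans (negated a b 1 (Cong-trans (Cong-≡ (trans (cong (b ℕ.+_) (ℕ.*-identityˡ a)) (ℕ.+-comm b a))) (Cong-0 d)) ca) (trans (cong₂ ℤ._*_ e χ-1) refl))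

    opposite-4 : Primitive X → 4 ∣ q → Opposite X
    opposite-4 prim (divides k q≡) =
      [ (λ e → even h q≡2h (m∣m*n k) (λ a b ca _ s → trans (negated a b (1 ℕ.+ h) (sum-zero a b ca s) ca) (cong₂ ℤ._*_ e χh))) , odd-opposite ]′ ν-unit
      where
      h = 2 ℕ.* k
      q≡2h : q ≡ 2 ℕ.* h
      q≡2h = trans q≡ (lem k)
        where
        lem : ∀ k → k ℕ.* 4 ≡ 2 ℕ.* (2 ℕ.* k)
        lem = solveℕ-∀
      open Descent X 2 h q≡2h (m∣m*n k)
      h-square : Cong q ((1 ℕ.+ h) ℕ.* (1 ℕ.+ h)) 1
      h-square = 0 , 1 ℕ.+ k , trans (lem k) (cong (λ t → 1 ℕ.+ (1 ℕ.+ k) ℕ.* t) (sym q≡))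
        where
        lem : ∀ k → (1 ℕ.+ 2 ℕ.* k) ℕ.* (1 ℕ.+ 2 ℕ.* k) ℕ.+ 0 ≡ 1 ℕ.+ (1 ℕ.+ k) ℕ.* (k ℕ.* 4)
        lem = solveℕ-∀
      χh : χ X (1 ℕ.+ h) ≡ ℤ.-1ℤ
      χh = [ (λ e → ⊥-elim (imprimitive (trans (cong (λ t → χ X (1 ℕ.+ t)) (ℕ.*-identityˡ h)) e) (s≤s (s≤s z≤n)) 1≤q prim)) , (λ e → e) ]′
        (χ-unit (1 ℕ.+ h) (coprime-unit {q} {1 ℕ.+ h} {1 ℕ.+ h} h-square))
      sum-zero : ∀ a b → Coprime a q → Cong q (a ℕ.+ b) h → Cong q (b ℕ.+ (1 ℕ.+ h) ℕ.* a) 0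
      sum-zero a b ca s with even-or-odd a
      ... | inj₁ (j , refl) = ⊥-elim (ℕ.<-irrefl (sym (ca {2} (m∣m*n j , subst (2 ∣_) (sym q≡2h) (m∣m*n h)))) (s≤s (s≤s z≤n)))
      ... | inj₂ (j , refl) = Cong-trans (Cong-≡ (lem b h j)) (Cong-trans (Cong-+ s (Cong-≡ {m = h ℕ.* suc (2 ℕ.* j)} refl)) (Cong-trans (Cong-≡ (trans (lem₂ h j) (cong (ℕ._* suc j) (sym q≡2h)))) (Cong-0 (m∣m*n (suc j)))))
        where
        lem : ∀ b h j → b ℕ.+ (1 ℕ.+ h) ℕ.* suc (2 ℕ.* j) ≡ suc (2 ℕ.* j) ℕ.+ b ℕ.+ h ℕ.* suc (2 ℕ.* j)
        lem = solveℕ-∀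
        lem₂ : ∀ h j → h ℕ.+ h ℕ.* suc (2 ℕ.* j) ≡ 2 ℕ.* h ℕ.* suc j
        lem₂ = solveℕ-∀

    opposite-prime : Primitive X → ¬ 4 ∣ q → ∀ p → Prime p → p ∣ q → p % 4 ≡ 3 → (∀ l → Prime l → l ∣ q → l % 4 ≡ 3 → p ≡ l) → Opposite X
    opposite-prime prim ¬4 p pr (divides m q≡) p%4 unique =
      [ (λ e → ⊥-elim (prim m (subst (m ∣_) (sym q≡) (m∣m*n p)) (subst (m ℕ.<_) (sym q≡) (ℕ.m<m*n m p {{ℕ.>-nonZero 1≤m}} (prime>1 pr))) Y′ (induced e))) , odd-opposite ]′ ν-unit
      where
      j = p ℕ./ 4
      p≡ : p ≡ suc (2 ℕ.* suc (2 ℕ.* j))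
      p≡ = trans (m≡m%n+[m/n]*n p 4) (trans (cong (ℕ._+ j ℕ.* 4) p%4) (lem j))
        where
        lem : ∀ j → 3 ℕ.+ j ℕ.* 4 ≡ suc (2 ℕ.* suc (2 ℕ.* j))
        lem = solveℕ-∀
      1≤m : 1 ℕ.≤ m
      1≤m = ℕ.n≢0⇒n>0 (λ { refl → ℕ.<⇒≱ 1≤q (ℕ.≤-reflexive q≡) })
      m∣q : m ∣ q
      m∣q = subst (m ∣_) (sym q≡) (m∣m*n p)
      p∣q : p ∣ q
      p∣q = subst (p ∣_) (sym q≡) (n∣m*n m)
      ¬pm : ¬ p ∣ m
      ¬pm d = odd-squarefree X prim 1≤q (suc (2 ℕ.* j)) p≡ (prime>1 pr) (subst (p ℕ.* p ∣_) (sym q≡) (*-monoˡ-∣ p d))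
      cop : Coprime m p
      cop = Coprimality.sym (prime-coprime pr ¬pm)
      primes : ∀ l → Prime l → l ∣ m → (l ≡ 2 ⊎ l % 4 ≡ 1) × ¬ l ℕ.* l ∣ m
      primes l prₗ l∣m with even-or-odd l
      ... | inj₁ (i , l≡) with prime∣prime prime[2] prₗ (subst (2 ∣_) (sym l≡) (m∣m*n i))
      ...   | refl = inj₁ refl , λ d → ¬4 (∣-trans d m∣q)
      primes l prₗ l∣m | inj₂ (i , l≡) with even-or-odd i
      ...   | inj₁ (i′ , refl) = inj₂ (trans (cong (_% 4) (trans l≡ (lem i′))) (ℕ.[m+kn]%n≡m%n 1 i′ 4)) , λ d → odd-squarefree X prim 1≤q i l≡ (prime>1 prₗ) (∣-trans d m∣q)
        where
        lem : ∀ i → suc (2 ℕ.* (2 ℕ.* i)) ≡ 1 ℕ.+ i ℕ.* 4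
        lem = solveℕ-∀
      ...   | inj₂ (i′ , refl) = ⊥-elim (¬pm (subst (_∣ m) (sym (unique l prₗ (∣-trans l∣m m∣q) (trans (cong (_% 4) (trans l≡ (lem i′))) (ℕ.[m+kn]%n≡m%n 3 i′ 4)))) l∣m))
        where
        lem : ∀ i → suc (2 ℕ.* suc (2 ℕ.* i)) ≡ 3 ℕ.+ i ℕ.* 4
        lem = solveℕ-∀
      root = sqrt-squarefree m 1≤m primes
      a = proj₁ root
      copₐ : Coprime a m
      copₐ {d} (da , dm) = ∣1⇒≡1 (∣m+n∣m⇒∣n {m = a ℕ.* a} (subst (d ∣_) (ℕ.+-comm 1 (a ℕ.* a)) (∣-trans dm (proj₂ root))) (∣-trans da (m∣m*n a)))
      open CRT cop
      Y′ : RealCharacter m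
      Y′ = component X q≡ cop
      q≡′ : q ≡ p ℕ.* m
      q≡′ = trans q≡ (ℕ.*-comm m p)
      Y : RealCharacter p
      Y = component X q≡′ (Coprimality.sym cop)
      module CRT′ = CRT (Coprimality.sym cop)
      both : ∀ {a b} → Cong m a b → Cong p a b → Cong q a b
      both {a} {b} x y = subst (λ t → Cong t a b) (sym q≡) (Cong-coprime cop x y)
      minus-one : ∀ {d x y} → d ∣ suc x → d ∣ suc y → Cong d x y
      minus-one {d} {x} {y} dx dy = Cong-cancel 1 (Cong-trans (Cong-≡ (ℕ.+-comm x 1)) (Cong-trans (Cong-0 dx) (Cong-sym (Cong-trans (Cong-≡ (ℕ.+-comm y 1)) (Cong-0 dy)))))
      u = glue a 1
      copᵤ : Coprime u q
      copᵤ = ≢0⇒coprime u (Values.coprime⇒≢0 Y′ a copₐ)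
      f = CRT′.glue (ℕ.pred p) 1
      f~ : Cong q f (ν ℕ.* (u ℕ.* u))
      f~ = both
        (Cong-trans (CRT′.glue-p (ℕ.pred p) 1) (Cong-sym (Cong-trans (Cong-* (Cong-≡ {m = ν} refl) (Cong-trans (Cong-* (glue-m a 1) (glue-m a 1)) (minus-one (proj₂ root) (subst (m ∣_) (sym sν) m∣q)))) (Cong-weaken m∣q ν-square))))
        (Cong-trans (CRT′.glue-m (ℕ.pred p) 1) (Cong-sym (Cong-trans (Cong-* (Cong-≡ {m = ν} refl) (Cong-* (glue-p a 1) (glue-p a 1))) (Cong-trans (Cong-≡ (ℕ.*-identityʳ ν)) (minus-one (subst (p ∣_) (sym sν) p∣q) (subst (p ∣_) (sym (ℕ.suc-pred p {{prime⇒nonZero pr}})) ∣-refl))))))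
      Y-even : χ X ν ≡ ℤ.1ℤ → χ Y (ℕ.pred p) ≡ ℤ.1ℤ
      Y-even e = trans (χ-cong f~) (trans (multiplicative X ν (u ℕ.* u)) (cong₂ ℤ._*_ e (trans (multiplicative X u u) (unit-square copᵤ))))
      Y-trivial : χ X ν ≡ ℤ.1ℤ → ∀ n → Coprime n p → χ Y n ≡ ℤ.1ℤ
      Y-trivial ν-even n c = cases (Values.χ-unit Y n c)
        where
        cases : χ Y n ≡ ℤ.1ℤ ⊎ χ Y n ≡ ℤ.-1ℤ → χ Y n ≡ ℤ.1ℤ
        cases (inj₁ e) = e
        cases (inj₂ e) = ⊥-elim (even-character-trivial (suc (2 ℕ.* j)) Y pr p≡ (j , refl) (Y-even ν-even) n e)
      induced : χ X ν ≡ ℤ.1ℤ → InducedBy X Y′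
      induced e n c = trans (χ-cong n~) (trans (multiplicative X (glue n 1) (CRT′.glue n 1)) (trans (cong (χ Y′ n ℤ.*_) (Y-trivial e n (λ (x , y) → c (x , ∣-trans y p∣q)))) (ℤ.*-identityʳ (χ Y′ n))))
        where
        n~ : Cong q n (glue n 1 ℕ.* CRT′.glue n 1)
        n~ = both (Cong-sym (Cong-trans (Cong-* (glue-m n 1) (CRT′.glue-p n 1)) (Cong-≡ (ℕ.*-identityʳ n)))) (Cong-sym (Cong-trans (Cong-* (glue-p n 1) (CRT′.glue-m n 1)) (Cong-≡ (ℕ.*-identityˡ n))))

    opposite : Primitive X → ∃! _≡_ (λ t → t ∣ q × 4OrPrime≡3mod4 t) → Opposite X
    opposite prim (t , (t∣q , t∈) , unique) with 4 ∣? q | t∈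
    ... | yes 4∣q | _ = opposite-4 prim 4∣q
    ... | no ¬4   | inj₁ refl = ⊥-elim (¬4 t∣q)
    ... | no ¬4   | inj₂ (pr , t%4) = opposite-prime prim ¬4 t pr t∣q t%4 (λ l prₗ l∣q l%4 → unique (l∣q , inj₂ (prₗ , l%4)))

module Goldbach where

  open import Data.Rational using (_≤_)
  open Rationals
  open Limits
  open ExponentialSeries using (∑₀; ∑₀-head; ∑₀-cong; ∑₀-grow)
  open Logarithm
  open RealPowers
  open RealZero using (∑₀-∑; log-Lg; div-recip; fromℕ-ι; Cauchy-Bd)
  open DivisorSums
  open Characters
  open OppositeValues

  Lg-pos : ∀ {x} → 1ℚ < x → ∀ i → 1 ℕ.≤ i → 0ℚ < Lg i x
  Lg-pos {x} 1<x i 1≤i = *-pos (ι-pos {2} (s≤s z≤n)) (ℚ.<-≤-trans first (∑₀-grow (λ k → *-nonNeg (pow-nonNeg (cayley-nonNeg 1≤x) (suc (2 ℕ.* k))) (rcp-nonNeg (suc (2 ℕ.* k)))) 1≤i))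
    where
    1≤x = ℚ.<⇒≤ 1<x
    0<x-1 : 0ℚ < x - 1ℚ
    0<x-1 = <-by 1<x (lem x)
      where
      lem : ∀ x → 1ℚ + (x - 1ℚ) ≡ x + 0ℚ
      lem = solve-∀ ring
    first : 0ℚ < 0ℚ + cayley x * 1ℚ * rcp 1
    first = subst (0ℚ <_) (lem (cayley x * rcp 1) (cayley x) (rcp 1) refl) (*-pos (*-pos 0<x-1 (recip-pos (x+1-pos 1≤x))) (rcp-pos {1} ℕ.≤-refl))
      where
      lem : ∀ z a b → z ≡ a * b → z ≡ 0ℚ + a * 1ℚ * b
      lem _ a b refl = lem′ a b
        where
        lem′ : ∀ a b → a * b ≡ 0ℚ + a * 1ℚ * b
        lem′ = solve-∀ ring

  ι-2* : ∀ n → ι (2 ℕ.* n) ≡ ι n + ι n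
  ι-2* n = trans (ι-+ n (n ℕ.+ 0)) (cong (λ t → ι n + ι t) (ℕ.+-identityʳ n))

  1≤2^ : ∀ s → 1 ℕ.≤ 2 ℕ.^ s
  1≤2^ s = ℕ.m^n>0 2 s

  Lg-2^-upper : ∀ i s → Lg i (ι (2 ℕ.^ s)) ≤ ι s
  Lg-2^-upper i zero    = ℚ.≤-reflexive (trans (cong (Lg i) ι1) (trans (Lg-1 i) (sym ι0)))
  Lg-2^-upper i (suc s) = subst (Lg i (ι (2 ℕ.* 2 ℕ.^ s)) ≤_) (sym (ι-suc s)) (lem (Lg i x′) (Lg i x) (ι s)
      (step x x′ (Lg i x′ - Lg i x) (1≤ι (1≤2^ s)) (ι-2* (2 ℕ.^ s)) (Lg-diff-upper (1≤ι (1≤2^ s)) (ι-mono (ℕ.m≤m+n (2 ℕ.^ s) (2 ℕ.^ s ℕ.+ 0))) i)) (Lg-2^-upper i s))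
    where
    x = ι (2 ℕ.^ s)
    x′ = ι (2 ℕ.* 2 ℕ.^ s)
    lem : ∀ a b c → a - b ≤ 1ℚ → b ≤ c → a ≤ 1ℚ + c
    lem a b c p q = ≤-by (p ⊕ q) (solve (a ∷ b ∷ c ∷ []) ring)
    step : ∀ x x′ Δ → 1ℚ ≤ x → x′ ≡ x + x → x′ * (x + 1ℚ) * Δ ≤ (x′ - x) * (x′ + 1ℚ) → Δ ≤ 1ℚ
    step x _ Δ p refl h = *-cancelˡ-≤ {(x + x) * (x + 1ℚ)} (*-pos 0<x+x (x+1-pos p))
        (≤-by (h ⊕ 0≤x) (solve (x ∷ Δ ∷ []) ring))
      where
      0<x = ℚ.<-≤-trans 0<1 p
      0≤x = ℚ.<⇒≤ 0<x
      x≤x+x : x ≤ x + x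
      x≤x+x = ≤-by 0≤x (solve (x ∷ []) ring)
      0<x+x = ℚ.<-≤-trans 0<x x≤x+x

  Lg-2^-lower : ∀ s → Ev (λ i → ι s ≤ ι 4 * Lg i (ι (2 ℕ.^ s)))
  Lg-2^-lower zero    = ev-now λ i → ℚ.≤-trans (ℚ.≤-reflexive ι0) (*-nonNeg (ι-nonNeg 4) (Lg-nonNeg (1≤ι (1≤2^ 0)) i))
  Lg-2^-lower (suc s) = ev-zip (λ i h p → subst (_≤ ι 4 * Lg i x′) (sym (ι-suc s)) (lem (ι 4) (Lg i x′) (Lg i x) (ι s)
      (step (ι 4) x x′ (Lg i x′ - Lg i x) (pow (cayley x) (2 ℕ.* i)) 1≤x ι4 (ι-2* (2 ℕ.^ s)) p (≤⇒0≤ (Lg-mono 1≤x x≤x′ i)) (Lg-diff-lower 1≤x x≤x′ i)) h))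
      (Lg-2^-lower s) (pow-vanishes (cayley-nonNeg 1≤x) (1-cayley-pos 1≤x) .nn ½ (ℚ.positive⁻¹ ½))
    where
    x = ι (2 ℕ.^ s)
    x′ = ι (2 ℕ.* 2 ℕ.^ s)
    1≤x = 1≤ι (1≤2^ s)
    x≤x′ : x ≤ x′
    x≤x′ = ι-mono (ℕ.m≤m+n (2 ℕ.^ s) (2 ℕ.^ s ℕ.+ 0))
    ι4 : ι 4 ≡ 1ℚ + 1ℚ + (1ℚ + 1ℚ)
    ι4 = trans (ι-+ 2 2) (cong (λ t → t + t) (trans (ι-+ 1 1) (cong (λ t → t + t) ι1)))
    lem : ∀ f a b c → 1ℚ ≤ f * (a - b) → c ≤ f * b → 1ℚ + c ≤ f * a
    lem f a b c p q = ≤-by (p ⊕ q) (solve (f ∷ a ∷ b ∷ c ∷ []) ring)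
    step : ∀ f x x′ Δ P → 1ℚ ≤ x → f ≡ 1ℚ + 1ℚ + (1ℚ + 1ℚ) → x′ ≡ x + x → - ½ ≤ - P → 0ℚ ≤ Δ → (x′ - x) * (x + 1ℚ) * (1ℚ - P) ≤ x * (x′ + 1ℚ) * Δ → 1ℚ ≤ f * Δ
    step _ x _ Δ P p refl refl q d h = *-cancelˡ-≤ {x * (x + 1ℚ)} (*-pos 0<x (x+1-pos p))
        (≤-by (h ⊕ h ⊕ (*-nonNeg 0≤x 0≤x1 ⊛ (q ⊕ q)) ⊕ *-nonNeg (+-nonNeg 0≤x 0≤x) d) (solve (x ∷ Δ ∷ P ∷ []) ring))
      where
      0<x = ℚ.<-≤-trans 0<1 p
      0≤x = ℚ.<⇒≤ 0<x
      0≤x1 : 0ℚ ≤ x + 1ℚ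
      0≤x1 = ℚ.<⇒≤ (x+1-pos p)

  ≤-all-ε : ∀ {a b} → (∀ ε → 0ℚ < ε → a ≤ b + ε) → a ≤ b
  ≤-all-ε {a} {b} h with a ℚ.≤? b
  ... | yes p = p
  ... | no ¬p = ⊥-elim (ℚ.<-irrefl refl (ℚ.<-≤-trans (ℚ.≰⇒> ¬p) (lem a b (h (½ * (a - b)) (half-pos 0<)))))
    where
    0< : 0ℚ < a - b
    0< = <-by (ℚ.≰⇒> ¬p) (lem′ a b)
      where
      lem′ : ∀ a b → b + (a - b) ≡ a + 0ℚ
      lem′ = solve-∀ ring
    lem : ∀ a b → a ≤ b + ½ * (a - b) → a ≤ b
    lem a b p = ≤-by (p ⊕ p) (solve (a ∷ b ∷ []) ring)

  length-filter : ∀ {P : ℕ → Set} (P? : ∀ n → Dec (P n)) (f : ℕ → ℕ) N → ι (length (filter P? (applyUpTo f N))) ≡ ∑₀ N (λ k → 𝟙 (P? (f k)))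
  length-filter P? f zero    = ι0
  length-filter P? f (suc N) with P? (f 0) in e
  ... | yes _ = trans (ι-suc _) (trans (cong (1ℚ +_) (length-filter P? (λ k → f (suc k)) N)) (trans (cong (_+ ∑₀ N (λ k → 𝟙 (P? (f (suc k))))) (sym (cong 𝟙 e))) (sym (∑₀-head N (λ k → 𝟙 (P? (f k)))))))
  ... | no _  = trans (length-filter P? (λ k → f (suc k)) N) (trans (sym (ℚ.+-identityˡ _)) (trans (cong (_+ ∑₀ N (λ k → 𝟙 (P? (f (suc k))))) (sym (cong 𝟙 e))) (sym (∑₀-head N (λ k → 𝟙 (P? (f k)))))))

  -- All that is used about n: primes p₁ + p₂ = n have opposite characters.
  module _ {q} (X : RealCharacter q) (1≤q : 1 ℕ.≤ q) where
    open Values X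

    Good : ℕ → Set
    Good p = Prime p × c p ≡ 1ℚ

    good? : ∀ p → Dec (Good p)
    good? p = prime? p ×-dec (c p ℚ.≟ 1ℚ)

    primeCount : ℕ → ℚ
    primeCount N = ∑ N (λ p → 𝟙 (good? p))

    record Separating (n : ℕ) : Set where
      field
        opposed : ∀ a b → Coprime a q → Coprime b q → a ℕ.+ b ≡ n → χ X a ℤ.* χ X b ≡ ℤ.-1ℤ
        radical : ∀ p → Prime p → p ∣ q → p ∣ n
        large   : 2 ℕ.* q ℕ.< n

    module _ {n} (sep : Separating n) where
      open Separating sep

      one-good : ∀ a b → a ℕ.+ b ≡ n → Prime a → Prime b → Good a ⊎ Good b
      one-good a b e pa pb with a ∣? q | b ∣? q
      ... | yes aq | _ = ⊥-elim (ℕ.<⇒≱ large (ℕ.≤-trans (ℕ.≤-reflexive (trans (sym e) (cong (a ℕ.+_) (trans (sym a≡b) (sym (ℕ.+-identityʳ a)))))) (ℕ.*-monoʳ-≤ 2 (∣⇒≤ {{ℕ.>-nonZero 1≤q}} aq))))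
        where
        a≡b : a ≡ b
        a≡b = prime∣prime pa pb (∣m+n∣m⇒∣n {m = a} (subst (a ∣_) (sym e) (radical a pa aq)) ∣-refl)
      ... | no _ | yes bq = ⊥-elim (ℕ.<⇒≱ large (ℕ.≤-trans (ℕ.≤-reflexive (trans (sym e) (trans (cong (ℕ._+ b) (sym b≡a)) (cong (b ℕ.+_) (sym (ℕ.+-identityʳ b)))))) (ℕ.*-monoʳ-≤ 2 (∣⇒≤ {{ℕ.>-nonZero 1≤q}} bq))))
        where
        b≡a : b ≡ a
        b≡a = prime∣prime pb pa (∣m+n∣m⇒∣n {m = b} (subst (b ∣_) (trans (sym e) (ℕ.+-comm a b)) (radical b pb bq)) ∣-refl)
      ... | no ¬aq | no ¬bq with χ-unit a (prime-coprime pa ¬aq) | χ-unit b (prime-coprime pb ¬bq)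
      ...   | inj₁ f | _ = inj₁ (pa , trans (cong ιℤ f) ιℤ1)
      ...   | inj₂ _ | inj₁ f = inj₂ (pb , trans (cong ιℤ f) ιℤ1)
      ...   | inj₂ f | inj₂ f′ = ⊥-elim (absurd (trans (sym (cong₂ ℤ._*_ f f′)) (opposed a b (prime-coprime pa ¬aq) (prime-coprime pb ¬bq) e)))
        where
        absurd : ℤ.1ℤ ≡ ℤ.-1ℤ → ⊥
        absurd ()

      g-bound : ι (g n) ≤ primeCount n + primeCount n
      g-bound = ℚ.≤-trans (ℚ.≤-reflexive g≡) (ℚ.≤-trans (∑-mono n pointwise) (ℚ.≤-trans (ℚ.≤-reflexive (∑-+ n (λ p → 𝟙 (good? p)) (λ p → 𝟙 (good? (n ℕ.∸ p))))) (ℚ.≤-refl {primeCount n} ⊕ mirrored n)))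
        where
        pair? : ∀ p → Dec (Prime p × Prime (n ℕ.∸ p))
        pair? p = prime? p ×-dec prime? (n ℕ.∸ p)
        g≡ : ι (g n) ≡ ∑ n (λ p → 𝟙 (pair? p))
        g≡ = trans (length-filter pair? (λ k → k) (suc n)) (trans (∑₀-head n (λ p → 𝟙 (pair? p))) (trans (cong₂ _+_ (𝟙-no (pair? 0) (λ (p0 , _) → ℕ.<⇒≱ (prime>1 p0) z≤n)) (∑₀-∑ n (λ p → 𝟙 (pair? p)))) (ℚ.+-identityˡ _)))
        pointwise : ∀ p → 1 ℕ.≤ p → p ℕ.≤ n → 𝟙 (pair? p) ≤ 𝟙 (good? p) + 𝟙 (good? (n ℕ.∸ p))
        pointwise p _ p≤n with pair? p
        ... | no _ = +-nonNeg (𝟙-nonNeg (good? p)) (𝟙-nonNeg (good? (n ℕ.∸ p)))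
        ... | yes (pa , pb) with one-good p (n ℕ.∸ p) (ℕ.m+[n∸m]≡n p≤n) pa pb
        ...   | inj₁ ga = lem _ _ (𝟙-yes (good? p) ga) (𝟙-nonNeg (good? (n ℕ.∸ p)))
          where
          lem : ∀ a b → a ≡ 1ℚ → 0ℚ ≤ b → 1ℚ ≤ a + b
          lem _ b refl h = ≤-by h (solve (b ∷ []) ring)
        ...   | inj₂ gb = lem _ _ (𝟙-yes (good? (n ℕ.∸ p)) gb) (𝟙-nonNeg (good? p))
          where
          lem : ∀ a b → a ≡ 1ℚ → 0ℚ ≤ b → 1ℚ ≤ b + a
          lem _ b refl h = ≤-by h (solve (b ∷ []) ring)
        mirrored : ∀ n → ∑ n (λ p → 𝟙 (good? (n ℕ.∸ p))) ≤ primeCount n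
        mirrored zero    = ℚ.≤-refl
        mirrored (suc k) = ∑-reverse k (λ p → 𝟙 (good? p)) `≤` (ℚ.≤-trans (ℚ.≤-reflexive (trans (cong (λ t → 𝟙 (good? t)) (ℕ.n∸n≡0 k)) (𝟙-no (good? 0) (λ (p0 , _) → ℕ.<⇒≱ (prime>1 p0) z≤n)))) (𝟙-nonNeg (good? (suc k))))
          where
          _`≤`_ : ∀ {a b c d} → a ≡ b → c ≤ d → a + c ≤ b + d
          e `≤` h = ℚ.≤-reflexive e ⊕ h

  odds-between : ∀ M → 2 ℕ.≤ M → ∃ λ o → ∃ λ i → 1 ℕ.≤ i × suc M ℕ.≤ suc (2 ℕ.* o) × o ℕ.+ i ℕ.≤ M × suc M ℕ.≤ 4 ℕ.* i
  odds-between M 2≤M with even-or-odd M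
  ... | inj₁ (zero , e) = ⊥-elim (ℕ.<⇒≱ 2≤M (ℕ.≤-trans (ℕ.≤-reflexive e) z≤n))
  ... | inj₁ (suc i , e) = suc i , suc i , s≤s z≤n , ℕ.≤-reflexive (cong suc e) , ℕ.≤-reflexive (trans (cong (suc i ℕ.+_) (sym (ℕ.+-identityʳ (suc i)))) (sym e)) ,
         ℕ.≤-trans (ℕ.≤-reflexive (trans (cong suc e) (lem i))) (ℕ.≤-trans (ℕ.m≤m+n (3 ℕ.+ 2 ℕ.* i) (1 ℕ.+ 2 ℕ.* i)) (ℕ.≤-reflexive (lem₂ i)))
    where
    lem : ∀ i → suc (2 ℕ.* suc i) ≡ 3 ℕ.+ 2 ℕ.* i
    lem = solveℕ-∀
    lem₂ : ∀ i → 3 ℕ.+ 2 ℕ.* i ℕ.+ (1 ℕ.+ 2 ℕ.* i) ≡ 4 ℕ.* suc i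
    lem₂ = solveℕ-∀
  ... | inj₂ (zero , e) = ⊥-elim (ℕ.<⇒≱ 2≤M (ℕ.≤-reflexive e))
  ... | inj₂ (suc i , e) = suc (suc i) , suc i , s≤s z≤n , ℕ.≤-trans (ℕ.≤-reflexive (trans (cong suc e) (lem i))) (ℕ.≤-trans (ℕ.n≤1+n _) (ℕ.≤-reflexive (lem₃ i))) ,
         ℕ.≤-reflexive (trans (lem₄ i) (sym e)) ,
         ℕ.≤-trans (ℕ.≤-reflexive (trans (cong suc e) (lem i))) (ℕ.≤-trans (ℕ.m≤m+n (4 ℕ.+ 2 ℕ.* i) (2 ℕ.* i)) (ℕ.≤-reflexive (lem₂ i)))
    where
    lem : ∀ i → suc (suc (2 ℕ.* suc i)) ≡ 4 ℕ.+ 2 ℕ.* i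
    lem = solveℕ-∀
    lem₂ : ∀ i → 4 ℕ.+ 2 ℕ.* i ℕ.+ 2 ℕ.* i ≡ 4 ℕ.* suc i
    lem₂ = solveℕ-∀
    lem₃ : ∀ i → suc (4 ℕ.+ 2 ℕ.* i) ≡ suc (2 ℕ.* suc (suc i))
    lem₃ = solveℕ-∀
    lem₄ : ∀ i → suc (suc i) ℕ.+ suc i ≡ suc (2 ℕ.* suc i)
    lem₄ = solveℕ-∀

  -- If the conjecture failed at every term of a progression, there would be too many exceptions.
  module _ (em : ExcludedMiddle 0ℓ) (δ x₀ : ℝ) (whle : WHLE δ x₀) where

    Bound : ℕ → Set
    Bound n = seq δ *ᴿ (fromℕ n /ᴿ log (fromℕ n) ^ᴿ 2) ≤ᴿ fromℕ (g n)

    pow2 : ℕ → ℝ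
    pow2 s = record { seq = fromℕ (2 ℕ.^ s) ; cauchy = λ ε 0<ε → 0 , λ i j _ _ → ℚ.≤-trans (ℚ.≤-reflexive (cong ∣_∣ (ℚ.+-inverseʳ (fromℕ (2 ℕ.^ s) 0)))) (ℚ.<⇒≤ 0<ε) }

    progression : ∀ s q′ a b L → 1 ℕ.≤ q′ → 1 ℕ.≤ b → bound (Cauchy-Bd x₀) ℕ.≤ 2 ℕ.^ suc s → 4 ℕ.* q′ ℕ.≤ 2 ℕ.^ suc s →
      (∀ j → j ℕ.< L → (2 ∣ a ℕ.+ b ℕ.* j) × (q′ ∣ a ℕ.+ b ℕ.* j) × 2 ℕ.^ s ℕ.< a ℕ.+ b ℕ.* j × a ℕ.+ b ℕ.* j ℕ.≤ 2 ℕ.^ suc s) →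
      2 ℕ.^ suc s ℕ.< 8 ℕ.* q′ ℕ.* L → ∃ λ j → j ℕ.< L × Bound (a ℕ.+ b ℕ.* j)
    progression s q′ a b L 1≤q′ 1≤b C≤ 4q′≤ terms many = cases em
     where
     cases : Dec (∃ λ j → j ℕ.< L × Bound (a ℕ.+ b ℕ.* j)) → ∃ λ j → j ℕ.< L × Bound (a ℕ.+ b ℕ.* j)
     cases (yes p) = p
     cases (no ¬p) = ⊥-elim (ℕ.<⇒≱ many (ι-cancel-≤ (≤-all-ε few)))
      where
      x = 2 ℕ.^ suc s
      f = λ j → a ℕ.+ b ℕ.* j
      exceptions = applyUpTo f L
      unique : Unique exceptions
      unique = Unique.applyUpTo⁺₁ f L (λ {i} {j} i<j _ e → ℕ.<⇒≢ i<j (ℕ.*-cancelˡ-≡ i j b {{ℕ.>-nonZero 1≤b}} (ℕ.+-cancelˡ-≡ a _ _ e)))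
      recip2 : ι x * recip (ι 2) ≡ ι (2 ℕ.^ s)
      recip2 = trans (cong (_* recip (ι 2)) (ι-* 2 (2 ℕ.^ s))) (trans (lem (ι 2) (ι (2 ℕ.^ s)) (recip (ι 2))) (trans (cong (_* ι (2 ℕ.^ s)) (recip-inv (ι-pos {2} (s≤s z≤n)))) (ℚ.*-identityˡ _)))
        where
        lem : ∀ a b r → a * b * r ≡ r * a * b
        lem = solve-∀ ring
      all : All (WHLEException δ (pow2 (suc s)) q′) exceptions
      all = All.applyUpTo⁺₁ f L (λ {j} j<L → let (ev , mul , low , up) = terms j j<L in record
        { even = ev ; multiple = mul
        ; lower = 1ℚ , 0<1 , 0 , λ i _ → subst₂ _≤_ (trans (cong (_+ 1ℚ) (sym recip2)) (cong (_+ 1ℚ) (trans (cong₂ (λ u v → u * recip v) (sym (fromℕ-ι x i)) (sym (fromℕ-ι 2 i))) (sym (div-recip (fromℕ x) (fromℕ 2) i)))))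
              (sym (fromℕ-ι (f j) i)) (ℚ.≤-trans (ℚ.≤-reflexive (trans (ℚ.+-comm (ι (2 ℕ.^ s)) 1ℚ) (sym (ι-suc (2 ℕ.^ s))))) (ι-mono low))
        ; upper = λ ε 0<ε → 0 , λ i _ → subst₂ (λ u v → u ≤ v + ε) (sym (fromℕ-ι (f j) i)) (sym (fromℕ-ι x i)) (ℚ.≤-trans (ι-mono up) (lem (ι x) ε 0<ε))
        ; fails = λ h → ¬p (j , j<L , h) })
        where
        lem : ∀ a ε → 0ℚ < ε → a ≤ a + ε
        lem a ε h = ≤-by (ℚ.<⇒≤ h) (solve (a ∷ ε ∷ []) ring)
      x₀≤ : seq x₀ ≤ᴿ fromℕ x
      x₀≤ ε 0<ε = ev-map (λ i h → subst (λ u → seq x₀ i ≤ u + ε) (sym (fromℕ-ι x i)) (lem (seq x₀ i) (ι x) ε 0<ε (ℚ.≤-trans (∣∣≤⇒≤ h) (ι-mono C≤)))) (isBounded (Cauchy-Bd x₀))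
        where
        lem : ∀ a b ε → 0ℚ < ε → a ≤ b → a ≤ b + ε
        lem a b ε h p = ≤-by (p ⊕ ℚ.<⇒≤ h) (solve (a ∷ b ∷ ε ∷ []) ring)
      q′≤ : fromℕ q′ ≤ᴿ fromℕ x /ᴿ fromℕ 4
      q′≤ ε 0<ε = 0 , λ i _ → subst₂ (λ u v → u ≤ v + ε) (sym (fromℕ-ι q′ i)) (trans (cong₂ (λ u v → u * recip v) (sym (fromℕ-ι x i)) (sym (fromℕ-ι 4 i))) (sym (div-recip (fromℕ x) (fromℕ 4) i)))
          (lem (ι q′) (ι x) (ι 4) (recip (ι 4)) ε 0<ε (recip-inv (ι-pos {4} (s≤s z≤n))) (ℚ.<⇒≤ (recip-pos (ι-pos {4} (s≤s z≤n)))) (subst (_≤ ι x) (ι-* 4 q′) (ι-mono 4q′≤)))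
        where
        lem : ∀ q x f r ε → 0ℚ < ε → r * f ≡ 1ℚ → 0ℚ ≤ r → f * q ≤ x → q ≤ x * r + ε
        lem q x f r ε 0<ε e p h = subst (_≤ x * r + ε) (trans (lem′ r f q) (trans (cong (_* q) e) (ℚ.*-identityˡ q))) (≤-by ((p ⊛ h) ⊕ ℚ.<⇒≤ 0<ε) (solve (q ∷ x ∷ f ∷ r ∷ ε ∷ []) ring))
          where
          lem′ : ∀ r f q → r * (f * q) ≡ r * f * q
          lem′ = solve-∀ ring
      few : ∀ ε → 0ℚ < ε → ι (8 ℕ.* q′ ℕ.* L) ≤ ι x + ε
      few ε 0<ε = result
        where
        e8 = 8 ℕ.* q′
        1≤e8 : 1 ℕ.≤ e8
        1≤e8 = ℕ.*-mono-≤ {1} {8} (s≤s z≤n) 1≤q′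
        η = ε * rcp e8
        0<η = *-pos 0<ε (rcp-pos 1≤e8)
        at = whle (pow2 (suc s)) q′ x₀≤ 1≤q′ q′≤ exceptions unique all η 0<η
        i = proj₁ at
        h : ι L ≤ ι x * rcp e8 + η
        h = subst₂ (λ u v → u ≤ v + η) (trans (fromℕ-ι _ i) (cong ι (List.length-applyUpTo f L))) (trans (div-recip (fromℕ x) (fromℕ e8) i) (cong₂ (λ u v → u * recip v) (fromℕ-ι x i) (fromℕ-ι e8 i))) (proj₂ at i ℕ.≤-refl)
        result : ι (e8 ℕ.* L) ≤ ι x + ε
        result = subst₂ _≤_ (sym (ι-* e8 L)) (lem (ι e8) (ι x) (rcp e8) ε (rcp-inv 1≤e8)) (ι-nonNeg e8 ⊛ h)
          where
          lem : ∀ e x r ε → r * e ≡ 1ℚ → e * (x * r + ε * r) ≡ x + ε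
          lem e x r ε eq = trans (lem′ e x r ε) (trans (cong (_* (x + ε)) eq) (ℚ.*-identityˡ (x + ε)))
            where
            lem′ : ∀ e x r ε → e * (x * r + ε * r) ≡ r * e * (x + ε)
            lem′ = solve-∀ ring

    module _ {q} (X : RealCharacter q) (1≤q : 1 ℕ.≤ q) where

      good-number : Opposite X → ∀ s → bound (Cauchy-Bd x₀) ℕ.≤ 2 ℕ.^ suc s → 4 ℕ.* q ℕ.≤ 2 ℕ.^ s →
        ∃ λ n → Separating X 1≤q n × 2 ℕ.^ s ℕ.< n × n ℕ.≤ 2 ℕ.^ suc s × Bound n
      good-number (odd opp) s C≤ 4q≤ = n , sep , low , up , proj₂ (proj₂ found)
        where
        N = 2 ℕ.^ s
        d = 2 ℕ.* q
        1≤d : 1 ℕ.≤ d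
        1≤d = ℕ.*-mono-≤ {1} {2} (s≤s z≤n) 1≤q
        instance
          d≢0 : ℕ.NonZero d
          d≢0 = ℕ.>-nonZero 1≤d
        J = N ℕ./ d
        Jd≤N : J ℕ.* d ℕ.≤ N
        Jd≤N = ℕ.m/n*n≤m N d
        N<Jd+d : N ℕ.< d ℕ.+ J ℕ.* d
        N<Jd+d = ℕ.≤-trans (ℕ.≤-reflexive (cong suc (m≡m%n+[m/n]*n N d))) (ℕ.+-monoˡ-≤ (J ℕ.* d) (m%n<n N d))
        1≤J : 1 ℕ.≤ J
        1≤J = ℕ.m≥n⇒m/n>0 (ℕ.≤-trans (ℕ.*-monoˡ-≤ q {2} {4} (s≤s (s≤s z≤n))) 4q≤)
        a = d ℕ.* suc J
        a≡ : ∀ d J → d ℕ.* suc J ≡ d ℕ.+ J ℕ.* d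
        a≡ = solveℕ-∀
        term≡ : ∀ j → a ℕ.+ d ℕ.* j ≡ d ℕ.* (suc J ℕ.+ j)
        term≡ j = sym (ℕ.*-distribˡ-+ d (suc J) j)
        N<term : ∀ j → N ℕ.< a ℕ.+ d ℕ.* j
        N<term j = ℕ.≤-trans (ℕ.≤-trans N<Jd+d (ℕ.≤-reflexive (sym (a≡ d J)))) (ℕ.m≤m+n a (d ℕ.* j))
        term≤ : ∀ j → j ℕ.< J → a ℕ.+ d ℕ.* j ℕ.≤ 2 ℕ.* N
        term≤ j j<J = ℕ.≤-trans (ℕ.≤-reflexive (trans (term≡ j) (cong (d ℕ.*_) (sym (ℕ.+-suc J j))))) (ℕ.≤-trans (ℕ.*-monoʳ-≤ d (ℕ.+-monoʳ-≤ J j<J)) (ℕ.≤-trans (ℕ.≤-reflexive (lem d J)) (ℕ.*-monoʳ-≤ 2 Jd≤N)))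
          where
          lem : ∀ d J → d ℕ.* (J ℕ.+ J) ≡ 2 ℕ.* (J ℕ.* d)
          lem = solveℕ-∀
        d∣ : ∀ j → d ∣ a ℕ.+ d ℕ.* j
        d∣ j = subst (d ∣_) (sym (term≡ j)) (m∣m*n (suc J ℕ.+ j))
        many : 2 ℕ.* N ℕ.< 8 ℕ.* q ℕ.* J
        many = ℕ.<-≤-trans (ℕ.*-monoʳ-< 2 N<Jd+d) (ℕ.≤-trans (ℕ.*-monoʳ-≤ 2 (ℕ.+-monoˡ-≤ (J ℕ.* d) (ℕ.≤-trans (ℕ.≤-reflexive (sym (ℕ.*-identityˡ d))) (ℕ.*-monoˡ-≤ d 1≤J)))) (ℕ.≤-reflexive (lem q J)))
          where
          lem : ∀ q J → 2 ℕ.* (J ℕ.* (2 ℕ.* q) ℕ.+ J ℕ.* (2 ℕ.* q)) ≡ 8 ℕ.* q ℕ.* J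
          lem = solveℕ-∀
        found = progression s q a d J 1≤q 1≤d C≤ (ℕ.≤-trans 4q≤ (ℕ.m≤m+n N (N ℕ.+ 0))) (λ j j<J → ∣-trans (m∣m*n q) (d∣ j) , ∣-trans (n∣m*n 2) (d∣ j) , N<term j , term≤ j j<J) many
        j = proj₁ found
        n = a ℕ.+ d ℕ.* j
        low = N<term j
        up = term≤ j (proj₁ (proj₂ found))
        q∣n = ∣-trans (n∣m*n 2) (d∣ j)
        sep : Separating X 1≤q n
        sep = record { opposed = λ x y cx cy e → opp x y cx cy (subst (q ∣_) (sym e) q∣n)
                     ; radical = λ p _ pq → ∣-trans pq q∣n
                     ; large = ℕ.≤-<-trans (ℕ.≤-trans (ℕ.*-monoˡ-≤ q {2} {4} (s≤s (s≤s z≤n))) 4q≤) low }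
      good-number (even h q≡ 2∣h opp) s C≤ 4q≤ = n , sep , low , up , proj₂ (proj₂ found)
        where
        N = 2 ℕ.^ s
        1≤h : 1 ℕ.≤ h
        1≤h = ℕ.n≢0⇒n>0 (λ { refl → ℕ.<⇒≱ 1≤q (ℕ.≤-reflexive q≡) })
        instance
          h≢0 : ℕ.NonZero h
          h≢0 = ℕ.>-nonZero 1≤h
        M = N ℕ./ h
        Mh≤N : M ℕ.* h ℕ.≤ N
        Mh≤N = ℕ.m/n*n≤m N h
        N<Mh+h : N ℕ.< h ℕ.+ M ℕ.* h
        N<Mh+h = ℕ.≤-trans (ℕ.≤-reflexive (cong suc (m≡m%n+[m/n]*n N h))) (ℕ.+-monoˡ-≤ (M ℕ.* h) (m%n<n N h))
        h≤q : h ℕ.≤ q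
        h≤q = ℕ.≤-trans (ℕ.m≤m+n h (h ℕ.+ 0)) (ℕ.≤-reflexive (sym q≡))
        2≤M : 2 ℕ.≤ M
        2≤M = ℕ.≤-trans (ℕ.≤-reflexive (sym (ℕ.m*n/n≡m 2 h))) (ℕ./-monoˡ-≤ h (ℕ.≤-trans (ℕ.*-monoˡ-≤ h {2} {4} (s≤s (s≤s z≤n))) (ℕ.≤-trans (ℕ.*-monoʳ-≤ 4 h≤q) 4q≤)))
        odds = odds-between M 2≤M
        o = proj₁ odds
        L = proj₁ (proj₂ odds)
        M<2o+1 = proj₁ (proj₂ (proj₂ (proj₂ odds)))
        o+L≤M = proj₁ (proj₂ (proj₂ (proj₂ (proj₂ odds))))
        M<4L = proj₂ (proj₂ (proj₂ (proj₂ (proj₂ odds))))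
        a = h ℕ.* suc (2 ℕ.* o)
        b = 2 ℕ.* h
        term≡ : ∀ j → a ℕ.+ b ℕ.* j ≡ h ℕ.* suc (2 ℕ.* (o ℕ.+ j))
        term≡ j = lem h o j
          where
          lem : ∀ h o j → h ℕ.* suc (2 ℕ.* o) ℕ.+ 2 ℕ.* h ℕ.* j ≡ h ℕ.* suc (2 ℕ.* (o ℕ.+ j))
          lem = solveℕ-∀
        N<term : ∀ j → N ℕ.< a ℕ.+ b ℕ.* j
        N<term j = ℕ.≤-trans N<Mh+h (ℕ.≤-trans (ℕ.≤-reflexive (ℕ.*-comm (suc M) h)) (ℕ.≤-trans (ℕ.*-monoʳ-≤ h M<2o+1) (ℕ.m≤m+n a (b ℕ.* j))))
        term≤ : ∀ j → j ℕ.< L → a ℕ.+ b ℕ.* j ℕ.≤ 2 ℕ.* N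
        term≤ j j<L = ℕ.≤-trans (ℕ.≤-reflexive (term≡ j)) (ℕ.≤-trans (ℕ.*-monoʳ-≤ h (ℕ.≤-trans (ℕ.n≤1+n _) (ℕ.≤-trans (ℕ.≤-reflexive (lem o j)) (ℕ.*-monoʳ-≤ 2 (ℕ.≤-trans (ℕ.+-monoʳ-≤ o j<L) o+L≤M))))) (ℕ.≤-trans (ℕ.≤-reflexive (lem₂ h M)) (ℕ.*-monoʳ-≤ 2 Mh≤N)))
          where
          lem : ∀ o j → suc (suc (2 ℕ.* (o ℕ.+ j))) ≡ 2 ℕ.* (o ℕ.+ suc j)
          lem = solveℕ-∀
          lem₂ : ∀ h M → h ℕ.* (2 ℕ.* M) ≡ 2 ℕ.* (M ℕ.* h)
          lem₂ = solveℕ-∀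
        h∣ : ∀ j → h ∣ a ℕ.+ b ℕ.* j
        h∣ j = subst (h ∣_) (sym (term≡ j)) (m∣m*n _)
        many : 2 ℕ.* N ℕ.< 8 ℕ.* h ℕ.* L
        many = ℕ.<-≤-trans (ℕ.*-monoʳ-< 2 N<Mh+h) (ℕ.≤-trans (ℕ.≤-reflexive (cong (2 ℕ.*_) (ℕ.*-comm (suc M) h))) (ℕ.≤-trans (ℕ.*-monoʳ-≤ 2 (ℕ.*-monoʳ-≤ h M<4L)) (ℕ.≤-reflexive (lem h L))))
          where
          lem : ∀ h L → 2 ℕ.* (h ℕ.* (4 ℕ.* L)) ≡ 8 ℕ.* h ℕ.* L
          lem = solveℕ-∀
        found = progression s h a b L 1≤h (ℕ.*-mono-≤ {1} {2} (s≤s z≤n) 1≤h) C≤ (ℕ.≤-trans (ℕ.*-monoʳ-≤ 4 h≤q) (ℕ.≤-trans 4q≤ (ℕ.m≤m+n N (N ℕ.+ 0)))) (λ j j<L → ∣-trans 2∣h (h∣ j) , h∣ j , N<term j , term≤ j j<L) many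
        j = proj₁ found
        n = a ℕ.+ b ℕ.* j
        low = N<term j
        up = term≤ j (proj₁ (proj₂ found))
        sep : Separating X 1≤q n
        sep = record { opposed = λ x y cx cy e → opp x y cx cy (Cong-trans (Cong-≡ (trans e (trans (term≡ j) (lem h (o ℕ.+ j))))) (Cong-∣ h (subst (_∣ (o ℕ.+ j) ℕ.* (2 ℕ.* h)) (sym q≡) (n∣m*n (o ℕ.+ j)))))
                     ; radical = rad
                     ; large = ℕ.≤-<-trans (ℕ.≤-trans (ℕ.*-monoˡ-≤ q {2} {4} (s≤s (s≤s z≤n))) 4q≤) low }
          where
          lem : ∀ h i → h ℕ.* suc (2 ℕ.* i) ≡ h ℕ.+ i ℕ.* (2 ℕ.* h)
          lem = solveℕ-∀
          rad : ∀ p → Prime p → p ∣ q → p ∣ n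
          rad p pr pq = cases (euclidsLemma 2 h pr (subst (p ∣_) q≡ pq))
            where
            cases : (p ∣ 2) ⊎ (p ∣ h) → p ∣ n
            cases (inj₁ p2) = ∣-trans p2 (∣-trans 2∣h (h∣ j))
            cases (inj₂ ph) = ∣-trans ph (h∣ j)

      prime-lower : Opposite X → ∀ δ₀ → 0ℚ < δ₀ → Ev (λ i → δ₀ ≤ seq δ i) → ∀ s → bound (Cauchy-Bd x₀) ℕ.≤ 2 ℕ.^ suc s → 4 ℕ.* q ℕ.≤ 2 ℕ.^ s →
        δ₀ * ι (2 ℕ.^ s) * rcp (suc s ℕ.* suc s) ≤ primeCount X 1≤q (2 ℕ.^ suc s) + primeCount X 1≤q (2 ℕ.^ suc s)
      prime-lower opp δ₀ 0<δ₀ δ≥ s C≤ 4q≤ = ℚ.≤-trans (≤-all-ε main) (ℚ.≤-trans (g-bound X 1≤q sep) (mono ⊕ mono))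
        where
        gn = good-number opp s C≤ 4q≤
        n = proj₁ gn
        sep = proj₁ (proj₂ gn)
        N<n = proj₁ (proj₂ (proj₂ gn))
        n≤2N = proj₁ (proj₂ (proj₂ (proj₂ gn)))
        bnd = proj₂ (proj₂ (proj₂ (proj₂ gn)))
        1<n : 1 ℕ.< n
        1<n = ℕ.≤-<-trans (1≤2^ s) N<n
        mono : primeCount X 1≤q n ≤ primeCount X 1≤q (2 ℕ.^ suc s)
        mono = ∑-prefix-mono n≤2N (λ p → 𝟙-nonNeg (good? X 1≤q p))
        1<ιn : 1ℚ < ι n
        1<ιn = subst (_< ι n) ι1 (ι-mono-< 1<n)
        S = suc s
        main : ∀ ε → 0ℚ < ε → δ₀ * ι (2 ℕ.^ s) * rcp (S ℕ.* S) ≤ ι (g n) + ε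
        main ε 0<ε = proj₂ at (proj₁ at) ℕ.≤-refl
          where
          at : Ev (λ i → δ₀ * ι (2 ℕ.^ s) * rcp (S ℕ.* S) ≤ ι (g n) + ε)
          at = ev-zip (λ i h (d , 1≤i) → ℚ.≤-trans (lower i d 1≤i) (subst₂ (λ u v → u ≤ v + ε) (value i) (fromℕ-ι (g n) i) h)) (bnd ε 0<ε) (ev-× δ≥ (ev-from 1 λ _ le → le))
            where
            value : ∀ i → (seq δ *ᴿ (fromℕ n /ᴿ log (fromℕ n) ^ᴿ 2)) i ≡ seq δ i * (ι n * recip (Lg i (ι n) * (Lg i (ι n) * 1ℚ)))
            value i = cong (seq δ i *_) (trans (div-recip (fromℕ n) (log (fromℕ n) ^ᴿ 2) i) (cong₂ (λ u v → u * recip (v * (v * 1ℚ))) (fromℕ-ι n i) (log-Lg n i)))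
            lower : ∀ i → δ₀ ≤ seq δ i → 1 ℕ.≤ i → δ₀ * ι (2 ℕ.^ s) * rcp (S ℕ.* S) ≤ seq δ i * (ι n * recip (Lg i (ι n) * (Lg i (ι n) * 1ℚ)))
            lower i d 1≤i = ℚ.≤-trans (ℚ.≤-reflexive (ℚ.*-assoc δ₀ _ _)) (*-mono-≤ (ℚ.<⇒≤ 0<δ₀) (*-nonNeg (ι-nonNeg (2 ℕ.^ s)) (rcp-nonNeg (S ℕ.* S))) d
                (*-mono-≤ (ι-nonNeg (2 ℕ.^ s)) (rcp-nonNeg (S ℕ.* S)) (ι-mono (ℕ.<⇒≤ N<n)) (recip-antitone (*-pos l>0 (*-pos l>0 0<1)) l²≤)))
              where
              l = Lg i (ι n)
              l>0 = Lg-pos 1<ιn i 1≤i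
              l≤ : l ≤ ι S
              l≤ = ℚ.≤-trans (Lg-mono (ℚ.<⇒≤ 1<ιn) (ι-mono n≤2N) i) (Lg-2^-upper i S)
              l²≤ : l * (l * 1ℚ) ≤ ι (S ℕ.* S)
              l²≤ = subst₂ _≤_ (cong (l *_) (sym (ℚ.*-identityʳ l))) (sym (ι-* S S)) (*-mono-≤ (ℚ.<⇒≤ l>0) (ℚ.<⇒≤ l>0) l≤ l≤)

module ZeroFreeRegion where

  open import Data.Rational using (_≤_)
  open Rationals
  open Limits
  open Logarithm
  open RealPowers
  open Summation
  open Growth
  open RealZero
  open DivisorSums
  open Characters
  open OppositeValues
  open Goldbach

  shift : ∀ a b → ι (2 ℕ.^ a) * rcp (2 ℕ.^ (a ℕ.+ b)) ≡ rcp (2 ℕ.^ b)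
  shift a b = trans (cong (λ t → ι (2 ℕ.^ a) * rcp t) (ℕ.^-distribˡ-+-* 2 a b)) (trans (cong (ι (2 ℕ.^ a) *_) (rcp-* (1≤2^ a) (1≤2^ b)))
    (trans (lem (ι (2 ℕ.^ a)) (rcp (2 ℕ.^ a)) (rcp (2 ℕ.^ b))) (trans (cong (_* rcp (2 ℕ.^ b)) (rcp-inv (1≤2^ a))) (ℚ.*-identityˡ _))))
    where
    lem : ∀ a r s → a * (r * s) ≡ r * a * s
    lem = solve-∀ ring

  harmonic-2^ : ∀ m → harmonic (2 ℕ.^ m) ≤ 1ℚ + ι m
  harmonic-2^ zero    = ℚ.≤-trans (ℚ.≤-reflexive (ℚ.+-identityˡ (rcp 1))) (ℚ.≤-trans (rcp≤1 1) (ℚ.≤-reflexive (trans (sym (ℚ.+-identityʳ 1ℚ)) (cong (1ℚ +_) (sym ι0)))))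
  harmonic-2^ (suc m) = subst (_≤ 1ℚ + ι (suc m)) (sym (trans (cong (λ t → harmonic (N ℕ.+ t)) (ℕ.+-identityʳ N)) (∑-split N N rcp)))
      (ℚ.≤-trans (harmonic-2^ m ⊕ block) (ℚ.≤-reflexive (trans (lem (ι m)) (cong (1ℚ +_) (sym (ι-suc m))))))
    where
    N = 2 ℕ.^ m
    lem : ∀ a → 1ℚ + a + 1ℚ ≡ 1ℚ + (1ℚ + a)
    lem = solve-∀ ring
    block : ∑ N (λ k → rcp (N ℕ.+ k)) ≤ 1ℚ
    block = ℚ.≤-trans (∑-mono N (λ k _ _ → rcp-antitone (1≤2^ m) (ℕ.m≤m+n N k))) (ℚ.≤-reflexive (trans (∑-const N (rcp N)) (trans (ℚ.*-comm (ι N) (rcp N)) (rcp-inv (1≤2^ m)))))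

  harmonic-mono : ∀ {M N} → M ℕ.≤ N → harmonic M ≤ harmonic N
  harmonic-mono le = ∑-prefix-mono le rcp-nonNeg

  n<2^n : ∀ n → n ℕ.< 2 ℕ.^ n
  n<2^n zero    = s≤s z≤n
  n<2^n (suc n) = ℕ.≤-trans (s≤s (n<2^n n)) (ℕ.≤-trans (ℕ.+-monoˡ-≤ (2 ℕ.^ n) (1≤2^ n)) (ℕ.≤-reflexive (cong (2 ℕ.^ n ℕ.+_) (sym (ℕ.+-identityʳ (2 ℕ.^ n))))))

  k⁴≤ : ∀ k → k ℕ.* k ℕ.* (k ℕ.* k) ℕ.≤ 256 ℕ.* 2 ℕ.^ k
  k⁴≤ k = ℕ.≤-trans (ℕ.*-mono-≤ (ℕ.*-mono-≤ k≤ k≤) (ℕ.*-mono-≤ k≤ k≤)) (ℕ.≤-trans (ℕ.≤-reflexive (lem (2 ℕ.^ m)))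
      (ℕ.*-monoʳ-≤ 256 (ℕ.≤-trans (ℕ.≤-reflexive (trans (cong₂ ℕ._*_ (sym (ℕ.^-distribˡ-+-* 2 m m)) (sym (ℕ.^-distribˡ-+-* 2 m m))) (sym (ℕ.^-distribˡ-+-* 2 (m ℕ.+ m) (m ℕ.+ m))))) (ℕ.^-monoʳ-≤ 2 4m≤))))
    where
    m = k ℕ./ 4
    k≡ = m≡m%n+[m/n]*n k 4
    lem : ∀ a → 4 ℕ.* a ℕ.* (4 ℕ.* a) ℕ.* (4 ℕ.* a ℕ.* (4 ℕ.* a)) ≡ 256 ℕ.* (a ℕ.* a ℕ.* (a ℕ.* a))
    lem = solveℕ-∀
    lem₂ : ∀ m → m ℕ.+ m ℕ.+ (m ℕ.+ m) ≡ m ℕ.* 4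
    lem₂ = solveℕ-∀
    4m≤ : m ℕ.+ m ℕ.+ (m ℕ.+ m) ℕ.≤ k
    4m≤ = ℕ.≤-trans (ℕ.≤-reflexive (lem₂ m)) (ℕ.≤-trans (ℕ.m≤n+m (m ℕ.* 4) _) (ℕ.≤-reflexive (sym k≡)))
    k≤ : k ℕ.≤ 4 ℕ.* 2 ℕ.^ m
    k≤ = ℕ.≤-trans (ℕ.≤-reflexive k≡) (ℕ.≤-trans (ℕ.+-monoˡ-≤ (m ℕ.* 4) (ℕ.<⇒≤ (m%n<n k 4))) (ℕ.≤-trans (ℕ.≤-reflexive (ℕ.*-comm (suc m) 4)) (ℕ.*-monoʳ-≤ 4 (n<2^n m))))

  binary-length : ∀ q → 1 ℕ.≤ q → ∃ λ k → 2 ℕ.^ k ℕ.≤ q × q ℕ.< 2 ℕ.^ suc k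
  binary-length (suc zero)    _ = 0 , ℕ.≤-refl , s≤s (s≤s z≤n)
  binary-length (suc q@(suc _)) _ with binary-length q (s≤s z≤n)
  ... | k , lo , hi with suc q ℕ.<? 2 ℕ.^ suc k
  ...   | yes lt = k , ℕ.m≤n⇒m≤1+n lo , lt
  ...   | no ¬lt = suc k , ℕ.≮⇒≥ ¬lt , ℕ.≤-<-trans hi (ℕ.^-monoʳ-< 2 (s≤s (s≤s z≤n)) (ℕ.n<1+n (suc k)))

  dyadic-sum : ∀ a p k → 1 ℕ.≤ p → ∑ k (λ j → 𝟙 (p ℕ.≤? 2 ℕ.^ (a ℕ.+ j)) * rcp (2 ℕ.^ (a ℕ.+ j))) ≤ rcp p + rcp p
  dyadic-sum a p k 1≤p = lem₀ (∑ k t) (t k) (rcp p + rcp p) (t-nonNeg k) (go k)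
    where
    t : ℕ → ℚ
    t j = 𝟙 (p ℕ.≤? 2 ℕ.^ (a ℕ.+ j)) * rcp (2 ℕ.^ (a ℕ.+ j))
    t-nonNeg : ∀ j → 0ℚ ≤ t j
    t-nonNeg j = *-nonNeg (𝟙-nonNeg (p ℕ.≤? 2 ℕ.^ (a ℕ.+ j))) (rcp-nonNeg (2 ℕ.^ (a ℕ.+ j)))
    lem₀ : ∀ x y z → 0ℚ ≤ y → x + y ≤ z → x ≤ z
    lem₀ x y z p h = ≤-by (h ⊕ p) (solve (x ∷ y ∷ z ∷ []) ring)
    t-yes : ∀ j → p ℕ.≤ 2 ℕ.^ (a ℕ.+ j) → t j ≡ rcp (2 ℕ.^ (a ℕ.+ j))
    t-yes j h = trans (cong (_* rcp (2 ℕ.^ (a ℕ.+ j))) (𝟙-yes (p ℕ.≤? 2 ℕ.^ (a ℕ.+ j)) h)) (ℚ.*-identityˡ _)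
    t-no : ∀ j → ¬ p ℕ.≤ 2 ℕ.^ (a ℕ.+ j) → t j ≡ 0ℚ
    t-no j h = trans (cong (_* rcp (2 ℕ.^ (a ℕ.+ j))) (𝟙-no (p ℕ.≤? 2 ℕ.^ (a ℕ.+ j)) h)) (ℚ.*-zeroˡ (rcp (2 ℕ.^ (a ℕ.+ j))))
    t≤ : ∀ j → t j ≤ rcp p
    t≤ j with p ℕ.≤? 2 ℕ.^ (a ℕ.+ j)
    ... | yes h = ℚ.≤-trans (ℚ.≤-reflexive (ℚ.*-identityˡ (rcp (2 ℕ.^ (a ℕ.+ j))))) (rcp-antitone 1≤p h)
    ... | no _ = ℚ.≤-trans (ℚ.≤-reflexive (ℚ.*-zeroˡ (rcp (2 ℕ.^ (a ℕ.+ j))))) (rcp-nonNeg p)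
    doubling : ∀ j → rcp (2 ℕ.^ (a ℕ.+ suc j)) + rcp (2 ℕ.^ (a ℕ.+ suc j)) ≡ rcp (2 ℕ.^ (a ℕ.+ j))
    doubling j = trans (cong (λ e → rcp (2 ℕ.^ e) + rcp (2 ℕ.^ e)) (ℕ.+-suc a j)) (trans (lem (rcp (2 ℕ.^ suc (a ℕ.+ j)))) (trans (cong (_* rcp (2 ℕ.^ suc (a ℕ.+ j))) (sym (trans (ι-+ 1 1) (cong (λ t → t + t) ι1)))) (shift 1 (a ℕ.+ j))))
      where
      lem : ∀ x → x + x ≡ (1ℚ + 1ℚ) * x
      lem = solve-∀ ring
    go : ∀ k → ∑ k t + t k ≤ rcp p + rcp p
    go zero    = ℚ.≤-trans (ℚ.≤-reflexive (ℚ.+-identityˡ (t 0))) (ℚ.≤-trans (t≤ 0) (lem (rcp p) (rcp-nonNeg p)))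
      where
      lem : ∀ x → 0ℚ ≤ x → x ≤ x + x
      lem x h = ≤-by h (solve (x ∷ []) ring)
    go (suc k) = by-cases (p ℕ.≤? 2 ℕ.^ (a ℕ.+ k))
      where
      mono : ∀ {i j} → i ℕ.≤ j → 2 ℕ.^ (a ℕ.+ i) ℕ.≤ 2 ℕ.^ (a ℕ.+ j)
      mono le = ℕ.^-monoʳ-≤ 2 (ℕ.+-monoʳ-≤ a le)
      by-cases : Dec (p ℕ.≤ 2 ℕ.^ (a ℕ.+ k)) → ∑ k t + t (suc k) + t (suc k) ≤ rcp p + rcp p
      by-cases (yes h) = ℚ.≤-trans (ℚ.≤-reflexive (trans (ℚ.+-assoc (∑ k t) (t (suc k)) (t (suc k))) (cong (∑ k t +_)
          (trans (cong (λ x → x + x) (t-yes (suc k) (ℕ.≤-trans h (mono (ℕ.n≤1+n k))))) (trans (doubling k) (sym (t-yes k h))))))) (go k)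
      by-cases (no ¬h) = ℚ.≤-trans (ℚ.≤-reflexive (cong (λ x → x + t (suc k) + t (suc k)) (∑-zero k (λ j _ j≤k → t-no j (λ h → ¬h (ℕ.≤-trans h (mono j≤k)))))))
          (ℚ.≤-trans (ℚ.≤-reflexive (cong (_+ t (suc k)) (ℚ.+-identityˡ (t (suc k))))) (t≤ (suc k) ⊕ t≤ (suc k)))

  12k≡ : ∀ k → k ℕ.+ (k ℕ.+ k) ℕ.+ (k ℕ.+ k) ℕ.+ (k ℕ.+ k) ℕ.+ (k ℕ.+ (k ℕ.+ k) ℕ.+ (k ℕ.+ k)) ≡ 12 ℕ.* k
  12k≡ = solveℕ-∀

  count-bound : ∀ d r r′ N R Π y l m → N * R ≡ ½ → 0ℚ ≤ R → 0ℚ ≤ d → r ≤ r′ → d * N * r′ ≤ Π + Π → Π ≤ y + l → y * R ≤ m → d * r ≤ # 4 * m + # 4 * (R * l)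
  count-bound d r r′ N R Π y l m e hR hd h₁ h₂ h₃ h₄ = subst (_≤ # 4 * m + # 4 * (R * l)) (trans (cong (λ t → 2ℚ * t * (d * r)) e) (lem′ d r))
      (≤-by ((*-nonNeg 0≤2 hR ⊛ h₂) ⊕ (*-nonNeg (#-nonNeg 4) hR ⊛ h₃) ⊕ (#-nonNeg 4 ⊛ h₄) ⊕ (*-nonNeg 0≤2 (*-nonNeg (subst (0ℚ ≤_) (sym e) (ℚ.<⇒≤ (ℚ.positive⁻¹ ½))) hd) ⊛ h₁)) (solve (d ∷ r ∷ r′ ∷ N ∷ R ∷ Π ∷ y ∷ l ∷ m ∷ []) ring))
    where
    0≤2 : 0ℚ ≤ 2ℚ
    0≤2 = ℚ.<⇒≤ (ℚ.positive⁻¹ 2ℚ)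
    lem′ : ∀ d r → 2ℚ * ½ * (d * r) ≡ d * r
    lem′ = solve-∀ ring

  P-lower-arithmetic : ∀ d r κ n R P → r * n ≡ 1ℚ → n ≡ # 49 * (κ * κ) → 0ℚ ≤ κ → κ * (d * r) ≤ κ * (# 4 * R) + # 4 * (P + P) → d ≤ # 196 * (κ * κ) * R + # 392 * κ * P
  P-lower-arithmetic d r κ n R P e refl hκ h = *-cancelκ
    where
    a : # 49 * κ * (κ * (d * r)) ≡ d
    a = trans (lem′ κ d r) (trans (cong (d *_) e) (ℚ.*-identityʳ d))
      where
      lem′ : ∀ κ d r → # 49 * κ * (κ * (d * r)) ≡ d * (r * (# 49 * (κ * κ)))
      lem′ = solve-∀ ring
    *-cancelκ : d ≤ # 196 * (κ * κ) * R + # 392 * κ * P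
    *-cancelκ = subst₂ _≤_ a (lem″ κ R P) (*-nonNeg (#-nonNeg 49) hκ ⊛ h)
      where
      lem″ : ∀ κ R P → # 49 * κ * (κ * (# 4 * R) + # 4 * (P + P)) ≡ # 196 * (κ * κ) * R + # 392 * κ * P
      lem″ = solve-∀ ring

  error-arithmetic : ∀ d z t Q s H κ ρ → d * z ≤ ρ → d * t ≡ ρ → Q * s ≤ ρ → H ≤ 1ℚ + # 12 * κ → 0ℚ ≤ H → 1ℚ ≤ κ → 0ℚ ≤ ρ → d * (8ℚ * (1ℚ + 2ℚ) * z + t) + 4ℚ * Q * s * H ≤ # 77 * κ * ρ
  error-arithmetic d z t Q s H κ ρ h₁ h₂ h₃ h₄ h₅ h₆ h₇ = ≤-by ((#-nonNeg 24 ⊛ h₁) ⊕ ℚ.≤-reflexive h₂ ⊕ (*-nonNeg (#-nonNeg 4) h₅ ⊛ h₃) ⊕ (*-nonNeg (#-nonNeg 4) h₇ ⊛ h₄) ⊕ (*-nonNeg (#-nonNeg 29) h₇ ⊛ h₆)) (solve (d ∷ z ∷ t ∷ Q ∷ s ∷ H ∷ κ ∷ ρ ∷ []) ring)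

  P-upper-arithmetic : ∀ P S S′ SX SY κ ε ρ → P * S ≤ S′ - S → S′ - S ≤ 2ℚ * (SX - SY) →
    SX - SY ≤ 2ℚ * (2ℚ * (# 12 * κ) + 1ℚ) * ε * SY + (8ℚ * 2ℚ * (2ℚ * (# 12 * κ) + 1ℚ) * (# 5 * ρ) + 2ℚ * (2ℚ * (# 12 * κ) + 1ℚ) * (# 77 * κ * ρ) + 8ℚ * (# 77 * κ * ρ)) →
    SY ≤ 2ℚ * S → 1ℚ ≤ S → 1ℚ ≤ κ → 0ℚ ≤ ε → 0ℚ ≤ ρ → S * P ≤ S * (# 200 * κ * ε + # 13000 * (κ * κ) * ρ)
  P-upper-arithmetic P S S′ SX SY κ ε ρ h₁ h₂ h₃ h₄ h₅ h₆ h₇ h₈ =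
    ≤-by (h₁ ⊕ h₂ ⊕ (0≤2 ⊛ h₃) ⊕ (*-nonNeg (*-nonNeg (#-nonNeg 4) 0≤g) h₇ ⊛ h₄) ⊕ (*-nonNeg (*-nonNeg (#-nonNeg 8) h₇) 0≤S ⊛ h₆) ⊕ (0≤E ⊛ h₅) ⊕ (*-nonNeg 0≤S (*-nonNeg (#-nonNeg 5380) (*-nonNeg 0≤κ′ h₈)) ⊛ h₆) ⊕ (*-nonNeg 0≤S (*-nonNeg (#-nonNeg 160) h₈) ⊛ square) ⊕ rest)
      (solve (P ∷ S ∷ S′ ∷ SX ∷ SY ∷ κ ∷ ε ∷ ρ ∷ []) ring)
    where
    0≤2 : 0ℚ ≤ 2ℚ
    0≤2 = ℚ.<⇒≤ (ℚ.positive⁻¹ 2ℚ)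
    0≤S = ℚ.≤-trans 0≤1 h₅
    0≤κ′ = ℚ.≤-trans 0≤1 h₆
    0≤g : 0ℚ ≤ 2ℚ * (# 12 * κ) + 1ℚ
    0≤g = +-nonNeg (*-nonNeg 0≤2 (*-nonNeg (#-nonNeg 12) 0≤κ′)) 0≤1
    square : 1ℚ ≤ κ * κ
    square = ℚ.≤-trans (ℚ.≤-reflexive (sym (ℚ.*-identityˡ 1ℚ))) (*-mono-≤ 0≤1 0≤1 h₆ h₆)
    0≤E : 0ℚ ≤ # 2 * (8ℚ * 2ℚ * (2ℚ * (# 12 * κ) + 1ℚ) * (# 5 * ρ) + 2ℚ * (2ℚ * (# 12 * κ) + 1ℚ) * (# 77 * κ * ρ) + 8ℚ * (# 77 * κ * ρ))
    0≤E = *-nonNeg (#-nonNeg 2) (+-nonNeg (+-nonNeg (*-nonNeg (*-nonNeg (#-nonNeg 16) 0≤g) (*-nonNeg (#-nonNeg 5) h₈)) (*-nonNeg (*-nonNeg 0≤2 0≤g) e≥0)) (*-nonNeg (#-nonNeg 8) e≥0))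
      where
      e≥0 : 0ℚ ≤ # 77 * κ * ρ
      e≥0 = *-nonNeg (*-nonNeg (#-nonNeg 77) 0≤κ′) h₈
    rest : 0ℚ ≤ # 68 * (S * (κ * κ * ρ))
    rest = *-nonNeg (#-nonNeg 68) (*-nonNeg 0≤S (*-nonNeg (*-nonNeg 0≤κ′ 0≤κ′) h₈))

  conclusion-arithmetic : ∀ d κ ε ρ R P → d ≤ # 196 * (κ * κ) * R + # 392 * κ * P → P ≤ # 200 * κ * ε + # 13000 * (κ * κ) * ρ → ρ ≤ R → κ * κ * (κ * κ) * R ≤ # 256 → 1ℚ ≤ κ → 0ℚ ≤ κ → 0ℚ ≤ R → # 10192392 * # 256 ≤ κ * d → d ≤ # 156800 * (κ * κ) * ε
  conclusion-arithmetic d κ ε ρ R P h₁ h₂ h₃ h₄ h₅ h₆ h₇ h₈ = *-cancelˡ-≤ (ℚ.<-≤-trans 0<1 h₅)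
      (≤-by ((h₆ ⊛ h₁) ⊕ (h₆ ⊛ h₁) ⊕ (*-nonNeg (#-nonNeg 784) κ²≥0 ⊛ h₂) ⊕ (*-nonNeg (#-nonNeg 10192000) κ⁴≥0 ⊛ h₃) ⊕ (*-nonNeg (#-nonNeg 392) (*-nonNeg (*-nonNeg κ²≥0 h₆) h₇) ⊛ h₅) ⊕ (#-nonNeg 10192392 ⊛ h₄) ⊕ h₈)
        (solve (d ∷ κ ∷ ε ∷ ρ ∷ R ∷ P ∷ []) ring))
    where
    κ²≥0 : 0ℚ ≤ κ * κ
    κ²≥0 = *-nonNeg h₆ h₆
    κ⁴≥0 : 0ℚ ≤ κ * κ * (κ * κ)
    κ⁴≥0 = *-nonNeg κ²≥0 κ²≥0

  small-ε : ∀ ε κ d → 0ℚ ≤ κ → 1ℚ ≤ κ → # 156800 * (κ * κ) * ε ≤ d → d ≤ 1ℚ → 0ℚ ≤ ε ⊎ ε ≤ 0ℚ → 4ℚ * (# 12 * κ) * ε ≤ 1ℚ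
  small-ε ε κ d p p′ s t (inj₁ q) = ≤-by (s ⊕ t ⊕ (*-nonNeg (#-nonNeg 48) (*-nonNeg p q) ⊛ p′) ⊕ *-nonNeg (#-nonNeg 156752) (*-nonNeg (*-nonNeg p p) q)) (solve (ε ∷ κ ∷ d ∷ []) ring)
  small-ε ε κ d p _ _ _ (inj₂ q) = ≤-by ((*-nonNeg (#-nonNeg 48) p ⊛ q) ⊕ 0≤1) (solve (ε ∷ κ ∷ []) ring)

  module Main {q} (X : RealCharacter q) (β : ℝ) (1≤q : 1 ℕ.≤ q) (isZero : LZero X (fromᴿ (seq β))) (β<1 : seq β <ᴿ fromℕ 1)
    (u : ℕ) (χu : χ X u ≡ ℤ.-1ℤ) (em : ExcludedMiddle 0ℓ) (δ x₀ : ℝ) (whle : WHLE δ x₀) (opp : Opposite X)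
    (δ₀ : ℚ) (0<δ₀ : 0ℚ < δ₀) (δ₀≤1 : δ₀ ≤ 1ℚ) (δ≥ : Ev (λ i → δ₀ ≤ seq δ i))
    (k : ℕ) (1≤k : 1 ℕ.≤ k) (q<2^k : q ℕ.< 2 ℕ.^ k) (C≤q : bound (Cauchy-Bd x₀) ℕ.≤ q)
    (k-large : # 10192392 * # 256 ≤ ι k * δ₀)
    where

    private
      instance
        q≢0 : ℕ.NonZero q
        q≢0 = ℕ.>-nonZero 1≤q
    open Values X
    open FromZero X β isZero β<1 (sum-period u χu)

    e₂ e₃ e₅ e₇ J : ℕ
    e₂ = k ℕ.+ k
    e₃ = k ℕ.+ e₂
    e₅ = e₃ ℕ.+ e₂
    e₇ = e₅ ℕ.+ e₂
    J = e₇ ℕ.+ e₅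

    D Y Zₚ : ℕ
    D = 2 ℕ.^ e₃
    Y = 2 ℕ.^ e₅
    Zₚ = 2 ℕ.^ e₇

    ρ : ℚ
    ρ = rcp (2 ℕ.^ e₂)
    0≤ρ = rcp-nonNeg (2 ℕ.^ e₂)

    X≡ : 2 ℕ.^ J ≡ Zₚ ℕ.* Y
    X≡ = ℕ.^-distribˡ-+-* 2 e₇ e₅

    0<e₇ : 0 ℕ.< e₇
    0<e₇ = ℕ.≤-trans 1≤k (ℕ.≤-trans (ℕ.m≤m+n k k) (ℕ.m≤n+m e₂ e₅))

    Y<X : Y ℕ.< 2 ℕ.^ J
    Y<X = ℕ.^-monoʳ-< 2 (s≤s (s≤s z≤n)) (ℕ.m<n+m e₅ 0<e₇)

    open PrimeSum c sign Y

    κ = ι k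
    1≤κ : 1ℚ ≤ κ
    1≤κ = 1≤ι 1≤k
    0≤κ = ι-nonNeg k

    P₀ : ℚ
    P₀ = P Zₚ

    largeCount : ℕ → ℚ
    largeCount N = ∑ N (λ p → 𝟙 (large? p))

    count-split : ∀ N → Y ℕ.≤ N → primeCount X 1≤q N ≤ ι Y + largeCount N
    count-split N Y≤N = ℚ.≤-trans (∑-mono N pointwise) (ℚ.≤-trans (ℚ.≤-reflexive (∑-+ N _ _)) (small ⊕ ℚ.≤-refl))
      where
      small : ∑ N (λ p → 𝟙 (p ℕ.≤? Y)) ≤ ι Y
      small = ℚ.≤-trans (ℚ.≤-reflexive (∑-extend Y≤N (λ p Y<p _ → 𝟙-no (p ℕ.≤? Y) (ℕ.<⇒≱ Y<p)))) (ℚ.≤-trans (∑-mono Y (λ p _ p≤Y → ℚ.≤-reflexive (𝟙-yes (p ℕ.≤? Y) p≤Y))) (ℚ.≤-reflexive (trans (∑-const Y 1ℚ) (ℚ.*-identityʳ (ι Y)))))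
      pointwise : ∀ p → 1 ℕ.≤ p → p ℕ.≤ N → 𝟙 (good? X 1≤q p) ≤ 𝟙 (p ℕ.≤? Y) + 𝟙 (large? p)
      pointwise p _ _ = aux (good? X 1≤q p) (p ℕ.≤? Y)
        where
        l₁ : ∀ b → 0ℚ ≤ b → 1ℚ ≤ 1ℚ + b
        l₁ b h = ≤-by h (solve (b ∷ []) ring)
        aux : (d : Dec (Good X 1≤q p)) (d′ : Dec (p ℕ.≤ Y)) → 𝟙 d ≤ 𝟙 d′ + 𝟙 (large? p)
        aux (no _)  d′      = +-nonNeg (𝟙-nonNeg d′) (𝟙-nonNeg (large? p))
        aux (yes _) (yes _) = l₁ (𝟙 (large? p)) (𝟙-nonNeg (large? p))
        aux (yes g) (no ¬h) = ℚ.≤-reflexive (sym (trans (cong (0ℚ +_) (𝟙-yes (large? p) (ℕ.≰⇒> ¬h , g))) (ℚ.+-identityˡ 1ℚ)))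

    scale : ℕ → ℕ
    scale j = (e₅ ℕ.+ k) ℕ.+ j

    at-scale : ∀ j → 1 ℕ.≤ j → j ℕ.≤ k → δ₀ * rcp (49 ℕ.* (k ℕ.* k)) ≤ # 4 * rcp (2 ℕ.^ k) + # 4 * (rcp (2 ℕ.^ scale j) * largeCount (2 ℕ.^ scale j))
    at-scale (suc j) _ j≤k = count-bound δ₀ (rcp (49 ℕ.* (k ℕ.* k))) (rcp (S ℕ.* S)) (ι (2 ℕ.^ s)) (rcp (2 ℕ.^ S)) (primeCount X 1≤q (2 ℕ.^ S)) (ι Y) (largeCount (2 ℕ.^ S)) (rcp (2 ℕ.^ k))
        half (rcp-nonNeg (2 ℕ.^ S)) (ℚ.<⇒≤ 0<δ₀) S²≤ lower (count-split (2 ℕ.^ S) (ℕ.^-monoʳ-≤ 2 (ℕ.≤-trans (ℕ.m≤m+n e₅ k) (ℕ.m≤m+n (e₅ ℕ.+ k) (suc j))))) Y-small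
      where
      S = scale (suc j)
      s = scale j
      S≡ : S ≡ suc s
      S≡ = ℕ.+-suc (e₅ ℕ.+ k) j
      lower : δ₀ * ι (2 ℕ.^ s) * rcp (S ℕ.* S) ≤ primeCount X 1≤q (2 ℕ.^ S) + primeCount X 1≤q (2 ℕ.^ S)
      lower = subst (λ t → δ₀ * ι (2 ℕ.^ s) * rcp (t ℕ.* t) ≤ primeCount X 1≤q (2 ℕ.^ t) + primeCount X 1≤q (2 ℕ.^ t)) (sym S≡)
        (prime-lower em δ x₀ whle X 1≤q opp δ₀ 0<δ₀ δ≥ s
          (ℕ.≤-trans C≤q (ℕ.≤-trans (ℕ.<⇒≤ q<2^k) (ℕ.^-monoʳ-≤ 2 (ℕ.≤-trans (ℕ.≤-trans (ℕ.m≤n+m k e₅) (ℕ.m≤m+n (e₅ ℕ.+ k) j)) (ℕ.n≤1+n s)))))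
          (ℕ.≤-trans (ℕ.*-monoʳ-≤ 4 (ℕ.<⇒≤ q<2^k)) (ℕ.≤-trans (ℕ.≤-reflexive (lem₄ (2 ℕ.^ k))) (ℕ.^-monoʳ-≤ 2 {suc (suc k)} (ℕ.≤-trans (ℕ.≤-trans (ℕ.+-monoˡ-≤ k 2≤e₅) (ℕ.m≤m+n (e₅ ℕ.+ k) j)) ℕ.≤-refl)))))
        where
        lem₄ : ∀ a → 4 ℕ.* a ≡ 2 ℕ.* (2 ℕ.* a)
        lem₄ = solveℕ-∀
        2≤e₅ : 2 ℕ.≤ e₅
        2≤e₅ = ℕ.≤-trans (ℕ.+-mono-≤ 1≤k 1≤k) (ℕ.m≤n+m e₂ e₃)
      half : ι (2 ℕ.^ s) * rcp (2 ℕ.^ S) ≡ ½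
      half = trans (cong (λ t → ι (2 ℕ.^ s) * rcp (2 ℕ.^ t)) (trans S≡ (ℕ.+-comm 1 s))) (trans (shift s 1) (recip-unique (rcp-inv {2} (s≤s z≤n)) (trans (cong (½ *_) (trans (ι-+ 1 1) (cong (λ t → t + t) ι1))) refl)))
      Y-small : ι Y * rcp (2 ℕ.^ S) ≤ rcp (2 ℕ.^ k)
      Y-small = ℚ.≤-trans (ℚ.≤-reflexive (trans (cong (λ t → ι Y * rcp (2 ℕ.^ t)) (ℕ.+-assoc e₅ k (suc j))) (shift e₅ (k ℕ.+ suc j)))) (rcp-antitone (1≤2^ k) (ℕ.^-monoʳ-≤ 2 (ℕ.m≤m+n k (suc j))))
      S≤7k : S ℕ.≤ 7 ℕ.* k
      S≤7k = ℕ.≤-trans (ℕ.+-monoʳ-≤ (e₅ ℕ.+ k) j≤k) (ℕ.≤-reflexive (lem₇ k))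
        where
        lem₇ : ∀ k → k ℕ.+ (k ℕ.+ k) ℕ.+ (k ℕ.+ k) ℕ.+ k ℕ.+ k ≡ 7 ℕ.* k
        lem₇ = solveℕ-∀
      S²≤ : rcp (49 ℕ.* (k ℕ.* k)) ≤ rcp (S ℕ.* S)
      S²≤ = rcp-antitone (ℕ.*-mono-≤ 1≤S 1≤S) (ℕ.≤-trans (ℕ.*-mono-≤ S≤7k S≤7k) (ℕ.≤-reflexive (lem₄₉ k)))
        where
        1≤S : 1 ℕ.≤ S
        1≤S = subst (1 ℕ.≤_) (sym S≡) (s≤s z≤n)
        lem₄₉ : ∀ k → 7 ℕ.* k ℕ.* (7 ℕ.* k) ≡ 49 ℕ.* (k ℕ.* k)
        lem₄₉ = solveℕ-∀

    double-count : ∑ k (λ j → rcp (2 ℕ.^ scale j) * largeCount (2 ℕ.^ scale j)) ≤ P₀ + P₀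
    double-count = ℚ.≤-trans (ℚ.≤-reflexive expand) (ℚ.≤-trans (∑-mono Zₚ (λ p 1≤p _ → 𝟙-nonNeg (large? p) ⊛ dyadic-sum (e₅ ℕ.+ k) p k 1≤p))
        (ℚ.≤-reflexive (trans (∑-cong Zₚ (λ p _ _ → ℚ.*-distribˡ-+ (𝟙 (large? p)) (rcp p) (rcp p))) (∑-+ Zₚ _ _))))
      where
      open ≡-Reasoning
      lem : ∀ R a b → R * (a * b) ≡ b * (a * R)
      lem = solve-∀ ring
      cut : ∀ j → j ℕ.≤ k → largeCount (2 ℕ.^ scale j) ≡ ∑ Zₚ (λ p → 𝟙 (p ℕ.≤? 2 ℕ.^ scale j) * 𝟙 (large? p))
      cut j j≤k = sym (trans (∑-extend (ℕ.^-monoʳ-≤ 2 (ℕ.≤-trans (ℕ.+-monoʳ-≤ (e₅ ℕ.+ k) j≤k) (ℕ.≤-reflexive (ℕ.+-assoc e₅ k k))))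
            (λ p lt _ → trans (cong (_* 𝟙 (large? p)) (𝟙-no (p ℕ.≤? 2 ℕ.^ scale j) (ℕ.<⇒≱ lt))) (ℚ.*-zeroˡ (𝟙 (large? p)))))
          (∑-cong (2 ℕ.^ scale j) (λ p _ le → trans (cong (_* 𝟙 (large? p)) (𝟙-yes (p ℕ.≤? 2 ℕ.^ scale j) le)) (ℚ.*-identityˡ (𝟙 (large? p))))))
      expand : ∑ k (λ j → rcp (2 ℕ.^ scale j) * largeCount (2 ℕ.^ scale j)) ≡ ∑ Zₚ (λ p → 𝟙 (large? p) * ∑ k (λ j → 𝟙 (p ℕ.≤? 2 ℕ.^ scale j) * rcp (2 ℕ.^ scale j)))
      expand = begin
        ∑ k (λ j → rcp (2 ℕ.^ scale j) * largeCount (2 ℕ.^ scale j))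
          ≡⟨ ∑-cong k (λ j _ j≤k → trans (cong (rcp (2 ℕ.^ scale j) *_) (cut j j≤k)) (sym (∑-* Zₚ (rcp (2 ℕ.^ scale j)) _))) ⟩
        ∑ k (λ j → ∑ Zₚ (λ p → rcp (2 ℕ.^ scale j) * (𝟙 (p ℕ.≤? 2 ℕ.^ scale j) * 𝟙 (large? p))))
          ≡⟨ ∑-swap k Zₚ _ ⟩
        ∑ Zₚ (λ p → ∑ k (λ j → rcp (2 ℕ.^ scale j) * (𝟙 (p ℕ.≤? 2 ℕ.^ scale j) * 𝟙 (large? p))))
          ≡⟨ ∑-cong Zₚ (λ p _ _ → trans (∑-cong k (λ j _ _ → lem (rcp (2 ℕ.^ scale j)) (𝟙 (p ℕ.≤? 2 ℕ.^ scale j)) (𝟙 (large? p)))) (∑-* k (𝟙 (large? p)) _)) ⟩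
        ∑ Zₚ (λ p → 𝟙 (large? p) * ∑ k (λ j → 𝟙 (p ℕ.≤? 2 ℕ.^ scale j) * rcp (2 ℕ.^ scale j))) ∎

    P-lower : δ₀ ≤ # 196 * (κ * κ) * rcp (2 ℕ.^ k) + # 392 * κ * P₀
    P-lower = P-lower-arithmetic δ₀ (rcp (49 ℕ.* (k ℕ.* k))) κ (ι (49 ℕ.* (k ℕ.* k))) (rcp (2 ℕ.^ k)) P₀ (rcp-inv 1≤49k²) 49k² 0≤κ
        (ℚ.≤-trans summed (ℚ.≤-refl {κ * (# 4 * rcp (2 ℕ.^ k))} ⊕ (#-nonNeg 4 ⊛ double-count)))
      where
      1≤49k² : 1 ℕ.≤ 49 ℕ.* (k ℕ.* k)
      1≤49k² = ℕ.*-mono-≤ {1} {49} (s≤s z≤n) (ℕ.*-mono-≤ 1≤k 1≤k)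
      49k² : ι (49 ℕ.* (k ℕ.* k)) ≡ # 49 * (κ * κ)
      49k² = trans (ι-* 49 (k ℕ.* k)) (cong₂ _*_ (ι-# 49) (ι-* k k))
      summed : κ * (δ₀ * rcp (49 ℕ.* (k ℕ.* k))) ≤ κ * (# 4 * rcp (2 ℕ.^ k)) + # 4 * ∑ k (λ j → rcp (2 ℕ.^ scale j) * largeCount (2 ℕ.^ scale j))
      summed = subst₂ _≤_ (∑-const k _) (trans (∑-+ k _ _) (cong₂ _+_ (∑-const k _) (∑-* k (# 4) _))) (∑-mono k at-scale)

    J≡ : ι J ≡ # 12 * κ
    J≡ = trans (cong ι (12k≡ k)) (trans (ι-* 12 k) (cong (_* κ) (ι-# 12)))

    S₁-≥1 : 1ℚ ≤ S₁ Y
    S₁-≥1 = ℚ.≤-trans (ℚ.≤-reflexive (sym (trans (ℚ.+-identityˡ (r 1 * rcp 1)) (cong₂ _*_ (divisorSum-1 sign) rcp1)))) (∑-prefix-mono {1} {Y} (1≤2^ e₅) nonneg)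
      where
      rcp1 : rcp 1 ≡ 1ℚ
      rcp1 = trans (sym (ℚ.*-identityʳ (rcp 1))) (trans (cong (rcp 1 *_) (sym ι1)) (rcp-inv {1} ℕ.≤-refl))
      nonneg : ∀ n → 0ℚ ≤ r n * rcp n
      nonneg zero    = ℚ.≤-reflexive (sym (ℚ.*-zeroˡ (rcp 0)))
      nonneg (suc n) = *-nonNeg (divisorSum-nonNeg (suc n) (s≤s z≤n) sign) (rcp-nonNeg (suc n))

    τ τ₁ : ℚ
    τ = rcp (D ℕ.* (2 ℕ.^ e₂ ℕ.* suc (2 ℕ.^ J)))
    τ₁ = ρ

    1≤τden : 1 ℕ.≤ D ℕ.* (2 ℕ.^ e₂ ℕ.* suc (2 ℕ.^ J))
    1≤τden = ℕ.*-mono-≤ (1≤2^ e₃) (ℕ.*-mono-≤ (1≤2^ e₂) (s≤s z≤n))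

    module AtIndex (i M : ℕ) (data′ : Data τ τ₁ J Y M i) where
      open Data data′
      ε = 1ℚ - seq β i
      vᵢ = value i
      open Core isPowerLike c c-bounded (ι q) (ι-nonNeg q) (partial-sums u χu) D (1≤2^ e₃) using (τ′; error; C; C-bound; growth)
      open PowerLike isPowerLike

      X₀ = 2 ℕ.^ J
      γ e : ℚ
      γ = # 5 * ρ
      e = # 77 * κ * ρ

      Qr : ι q * rcp (suc D) ≤ ρ
      Qr = ℚ.≤-trans (*-mono-≤ (ι-nonNeg q) (rcp-nonNeg (suc D)) (ι-mono (ℕ.<⇒≤ q<2^k)) (rcp-antitone (1≤2^ e₃) (ℕ.n≤1+n D))) (ℚ.≤-reflexive (shift k e₂))

      e₃≤e₅ : e₃ ℕ.≤ e₅
      e₃≤e₅ = ℕ.m≤m+n e₃ e₂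

      D≤Y : D ℕ.≤ Y
      D≤Y = ℕ.^-monoʳ-≤ 2 e₃≤e₅

      τ′≡ : ι D * (τ * (1ℚ + ι X₀)) ≡ ρ
      τ′≡ = trans (cong₂ (λ a b → ι D * (a * b)) (trans (rcp-* (1≤2^ e₃) (ℕ.*-mono-≤ (1≤2^ e₂) (s≤s z≤n))) (cong (rcp D *_) (rcp-* {2 ℕ.^ e₂} {suc X₀} (1≤2^ e₂) (s≤s z≤n)))) (sym (ι-suc X₀)))
        (trans (lem (ι D) (rcp D) ρ (rcp (suc X₀)) (ι (suc X₀))) (trans (cong₂ (λ a b → a * ρ * b) (rcp-inv (1≤2^ e₃)) (rcp-inv {suc X₀} (s≤s z≤n))) (lem₂ ρ)))
        where
        lem : ∀ d rd p rx x → d * (rd * (p * rx) * x) ≡ rd * d * p * (rx * x)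
        lem = solve-∀ ring
        lem₂ : ∀ p → 1ℚ * p * 1ℚ ≡ p
        lem₂ = solve-∀ ring

      error-bound : ∀ Z → Y ℕ.≤ Z → Z ℕ.≤ X₀ → error Z ≤ e
      error-bound Z Y≤Z Z≤X₀ = error-arithmetic (ι D) (rcp Z) τ′ (ι q) (rcp (suc D)) (harmonic Z) κ ρ DZ τ′≡ Qr (ℚ.≤-trans (harmonic-mono Z≤X₀) (ℚ.≤-trans (harmonic-2^ J) (ℚ.≤-reflexive (cong (1ℚ +_) J≡)))) (∑-nonNeg Z (λ n _ _ → rcp-nonNeg n)) 1≤κ 0≤ρ
        where
        DZ : ι D * rcp Z ≤ ρ
        DZ = ℚ.≤-trans (ι-nonNeg D ⊛ rcp-antitone (1≤2^ e₅) Y≤Z) (ℚ.≤-reflexive (shift e₃ e₂))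

      SX = Hyperbola.S c w X₀
      SY = Hyperbola.S c w Y

      r-nonNeg : ∀ n → 1 ℕ.≤ n → 0ℚ ≤ r n
      r-nonNeg n h = divisorSum-nonNeg n h sign

      comparable : ∀ n → 1 ℕ.≤ n → n ℕ.≤ X₀ → r n * rcp n ≤ 2ℚ * (r n * w n)
      comparable n 1≤n n≤X = lem (r n) (rcp n) (vᵢ n) (*-nonNeg (r-nonNeg n 1≤n) (rcp-nonNeg n)) (lower n 1≤n n≤X)
        where
        lem : ∀ r i v → 0ℚ ≤ r * i → 1ℚ ≤ 2ℚ * v → r * i ≤ 2ℚ * (r * (v * i))
        lem r i v p q = ≤-by (p ⊛ q) (solve (r ∷ i ∷ v ∷ []) ring)

      comparable′ : ∀ n → 1 ℕ.≤ n → n ℕ.≤ X₀ → r n * w n ≤ 2ℚ * (r n * rcp n)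
      comparable′ n 1≤n n≤X = lem (r n) (rcp n) (vᵢ n) (*-nonNeg (r-nonNeg n 1≤n) (rcp-nonNeg n)) (upper n 1≤n n≤X)
        where
        lem : ∀ r i v → 0ℚ ≤ r * i → v ≤ 2ℚ → r * (v * i) ≤ 2ℚ * (r * i)
        lem r i v p q = ≤-by (p ⊛ q) (solve (r ∷ i ∷ v ∷ []) ring)

      SY≤ : SY ≤ 2ℚ * S₁ Y
      SY≤ = ℚ.≤-trans (∑-mono Y (λ n a b → comparable′ n a (ℕ.≤-trans b (ℕ.<⇒≤ Y<X)))) (ℚ.≤-reflexive (∑-* Y 2ℚ _))

      SY≥0 : 0ℚ ≤ SY
      SY≥0 = ∑-nonNeg Y (λ n a b → *-nonNeg (r-nonNeg n a) (w≥0 n a (ℕ.≤-trans (ℕ.≤-trans b (ℕ.<⇒≤ Y<X)) X≤M)))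

      private
        K = proj₁ (ℕ.m≤n⇒∃[o]m+o≡n (ℕ.<⇒≤ Y<X))
        YK = proj₂ (ℕ.m≤n⇒∃[o]m+o≡n (ℕ.<⇒≤ Y<X))
        difference : ∀ f → ∑ X₀ f - ∑ Y f ≡ ∑ K (λ j → f (Y ℕ.+ j))
        difference f = trans (cong (λ t → ∑ t f - ∑ Y f) (sym YK)) (trans (cong (λ t → t - ∑ Y f) (∑-split Y K f)) (lem (∑ Y f) _))
          where
          lem : ∀ a b → a + b - a ≡ b
          lem = solve-∀ ring
        inside : ∀ j → j ℕ.≤ K → Y ℕ.+ j ℕ.≤ X₀
        inside j le = subst (Y ℕ.+ j ℕ.≤_) YK (ℕ.+-monoʳ-≤ Y le)
        above : ∀ j → 1 ℕ.≤ Y ℕ.+ j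
        above j = ℕ.≤-trans (1≤2^ e₅) (ℕ.m≤m+n Y j)

      dS≥0 : 0ℚ ≤ SX - SY
      dS≥0 = subst (0ℚ ≤_) (sym (difference (λ n → r n * w n))) (∑-nonNeg K (λ j _ le → *-nonNeg (r-nonNeg (Y ℕ.+ j) (above j)) (w≥0 (Y ℕ.+ j) (above j) (ℕ.≤-trans (inside j le) X≤M))))

      dS₁≤ : S₁ X₀ - S₁ Y ≤ 2ℚ * (SX - SY)
      dS₁≤ = subst₂ _≤_ (sym (difference (λ n → r n * rcp n))) (trans (∑-* K 2ℚ _) (cong (2ℚ *_) (sym (difference (λ n → r n * w n))))) (∑-mono K (λ j _ le → comparable (Y ℕ.+ j) (above j) (inside j le)))

      P-upper : P₀ ≤ # 200 * κ * ε + # 13000 * (κ * κ) * ρ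
      P-upper = *-cancelˡ-≤ (ℚ.<-≤-trans 0<1 S₁-≥1) (P-upper-arithmetic P₀ (S₁ Y) (S₁ X₀) SX SY κ ε ρ
          (subst (λ t → P₀ * S₁ Y ≤ S₁ t - S₁ Y) (sym X≡) (prime-sum Zₚ (subst (Y ℕ.≤_) X≡ (ℕ.<⇒≤ Y<X)))) dS₁≤
          (subst (λ t → SX - SY ≤ 2ℚ * (2ℚ * t + 1ℚ) * ε * SY + (8ℚ * 2ℚ * (2ℚ * t + 1ℚ) * γ + 2ℚ * (2ℚ * t + 1ℚ) * e + 8ℚ * e)) J≡
            (growth Y (2ℚ * ι J + 1ℚ) γ e (1≤2^ e₅) (ℕ.<⇒≤ Y<X) D≤Y (+-nonNeg (*-nonNeg (ℚ.<⇒≤ (ℚ.positive⁻¹ 2ℚ)) (ι-nonNeg J)) 0≤1) (*-nonNeg (#-nonNeg 5) 0≤ρ)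
              increase≥0 increase≤ C≤ (error-bound X₀ (ℕ.<⇒≤ Y<X) ℕ.≤-refl) (error-bound Y ℕ.≤-refl (ℕ.<⇒≤ Y<X)) dS≥0 SY≥0))
          SY≤ S₁-≥1 1≤κ (ℚ.<⇒≤ 0<ε) 0≤ρ)
        where
        C≤ : ∣ C D ∣ ≤ γ
        C≤ = ℚ.≤-trans (C-bound (ℕ.≤-<-trans D≤Y Y<X) vanishes) (lem₅ (ι q) (rcp (suc D)) ρ Qr)
          where
          lem₅ : ∀ Q s ρ → Q * s ≤ ρ → ρ + 4ℚ * Q * s ≤ # 5 * ρ
          lem₅ Q s ρ h = ≤-by (#-nonNeg 4 ⊛ h) (solve (Q ∷ s ∷ ρ ∷ []) ring)

      conclusion : δ₀ ≤ # 156800 * (κ * κ) * ε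
      conclusion = conclusion-arithmetic δ₀ κ ε ρ (rcp (2 ℕ.^ k)) P₀ P-lower P-upper (rcp-antitone (1≤2^ k) (ℕ.^-monoʳ-≤ 2 (ℕ.m≤m+n k k))) k³ 1≤κ 0≤κ 0≤R k-large
        where
        R = rcp (2 ℕ.^ k)
        0≤R = rcp-nonNeg (2 ℕ.^ k)
        k³ : κ * κ * (κ * κ) * R ≤ # 256
        k³ = subst₂ _≤_ (ℚ.*-comm R _) (trans (lem₀ (# 256) (ι (2 ℕ.^ k)) R) (trans (cong (# 256 *_) (rcp-inv (1≤2^ k))) (ℚ.*-identityʳ (# 256))))
            (0≤R ⊛ subst₂ _≤_ (trans (ι-* (k ℕ.* k) (k ℕ.* k)) (cong (λ t → t * t) (ι-* k k))) (trans (ι-* 256 (2 ℕ.^ k)) (cong (_* ι (2 ℕ.^ k)) (ι-# 256))) (ι-mono (k⁴≤ k)))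
          where
          lem₀ : ∀ a b r → r * (a * b) ≡ a * (r * b)
          lem₀ = solve-∀ ring

    zero-free : Ev (λ i → δ₀ ≤ # 156800 * (κ * κ) * (1ℚ - seq β i))
    zero-free = ev-map step (proj₂ pld)
      where
      pld = powerLikeData τ τ₁ J Y (rcp-pos 1≤τden) (rcp≤1 (D ℕ.* (2 ℕ.^ e₂ ℕ.* suc (2 ℕ.^ J)))) (rcp-pos (1≤2^ e₂)) (1≤2^ e₅) Y<X
      step : ∀ i → (4ℚ * ι J * (1ℚ - seq β i) ≤ 1ℚ → Data τ τ₁ J Y (proj₁ pld) i) → δ₀ ≤ # 156800 * (κ * κ) * (1ℚ - seq β i)
      step i f = reduce (map₂ (λ h → AtIndex.conclusion i (proj₁ pld) (f (subst (λ t → 4ℚ * t * (1ℚ - seq β i) ≤ 1ℚ) (sym J≡)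
          (small-ε (1ℚ - seq β i) κ δ₀ 0≤κ 1≤κ h δ₀≤1 (ℚ.≤-total 0ℚ (1ℚ - seq β i))))))
        (ℚ.≤-total δ₀ (# 156800 * (κ * κ) * (1ℚ - seq β i))))

  φ≤ : ∀ q → φ q ℕ.≤ q
  φ≤ q = ℕ.≤-trans (List.length-filter (λ a → coprime? a q) (applyUpTo suc q)) (ℕ.≤-reflexive (List.length-applyUpTo suc q))

  constℝ : ℚ → ℝ
  constℝ p = record { seq = constᴿ p ; cauchy = λ ε 0<ε → 0 , λ i j _ _ → ℚ.≤-trans (ℚ.≤-reflexive (cong ∣_∣ (ℚ.+-inverseʳ p))) (ℚ.<⇒≤ 0<ε) }

open Rationals
open Limits
open Logarithm
open RealPowers
open Summation
open Growth
open RealZero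
open DivisorSums
open Characters
open OppositeValues
open Goldbach
open ZeroFreeRegion
open import Data.Nat using (_≤_)

corollary1 : ∀ (c₀ : ℝ) → fromℕ 0 <ᴿ seq c₀ →
    ∀ (δ x₀ : ℝ) → fromℕ 0 <ᴿ seq δ →
    ∃ λ (c : ℝ) → fromℕ 0 <ᴿ seq c ×
    (ExcludedMiddle 0ℓ → LandauPage c₀ → WHLE δ x₀ →
    ∃ λ (q₀ : ℕ) → ∀ (q : ℕ) → q₀ ≤ q →
    ∃! _≡_ (λ t → t ∣ q × 4OrPrime≡3mod4 t) →
    ∀ (χ : RealCharacter q) (β : ℝ) → ExceptionalZero c₀ χ β →
    seq c *ᴿ fromℕ (φ q) /ᴿ (fromℕ q *ᴿ log (fromℕ q) ^ᴿ 2) ≤ᴿ fromℕ 1 -ᴿ seq β)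
corollary1 c₀ _ δ x₀ (δ₁ , 0<δ₁ , N , δ-lower) = constℝ γ , (γ , 0<γ , 0 , λ i _ → ℚ.≤-reflexive (ℚ.+-identityˡ γ)) , λ em _ whle → q₀ , bound-at em whle
  where
  δ₀ = proj₁ (0<δ₁ ⊓1)
  0<δ₀ = proj₁ (proj₂ (0<δ₁ ⊓1))
  δ≥ : Ev (λ i → δ₀ ℚ.≤ seq δ i)
  δ≥ = N , λ i le → ℚ.≤-trans (proj₁ (proj₂ (proj₂ (0<δ₁ ⊓1)))) (subst (ℚ._≤ seq δ i) (ℚ.+-identityˡ δ₁) (δ-lower i le))
  C₀ = 10035200
  0<C₀ : 0ℚ < ι C₀
  0<C₀ = ι-pos {C₀} (s≤s z≤n)
  γ = δ₀ * recip (ι C₀)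
  0<γ : 0ℚ < γ
  0<γ = *-pos 0<δ₀ (recip-pos 0<C₀)
  arch = archimedean (# 10192392 * # 256 * recip δ₀)
  k₀ = proj₁ arch
  q₀ = 2 ℕ.^ suc k₀ ℕ.+ bound (Cauchy-Bd x₀)
  bound-at : ExcludedMiddle 0ℓ → WHLE δ x₀ → ∀ q → q₀ ≤ q → ∃! _≡_ (λ t → t ∣ q × 4OrPrime≡3mod4 t) →
    ∀ (χ : RealCharacter q) (β : ℝ) → ExceptionalZero c₀ χ β →
    constᴿ γ *ᴿ fromℕ (φ q) /ᴿ (fromℕ q *ᴿ log (fromℕ q) ^ᴿ 2) ≤ᴿ fromℕ 1 -ᴿ seq β
  bound-at em whle q q₀≤q unique X β ez ε 0<ε = ev-zip (λ i h (l≥ , 1≤i) → final i h l≥ 1≤i) zero-free (ev-× (Lg-2^-lower k′) (ev-from 1 λ _ le → le))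
    where
    open ExceptionalZero ez
    2^k₀≤q : 2 ℕ.^ suc k₀ ℕ.≤ q
    2^k₀≤q = ℕ.≤-trans (ℕ.m≤m+n _ _) q₀≤q
    1≤q : 1 ℕ.≤ q
    1≤q = ℕ.≤-trans (1≤2^ (suc k₀)) 2^k₀≤q
    1<q : 1 ℕ.< q
    1<q = ℕ.≤-trans (ℕ.^-monoʳ-≤ 2 {1} {suc k₀} (s≤s z≤n)) 2^k₀≤q
    digits = binary-length q 1≤q
    k′ = proj₁ digits
    k = suc k′
    q<2^k = proj₂ (proj₂ digits)
    k₀≤k′ : suc k₀ ℕ.≤ k′
    k₀≤k′ = ℕ.≤-pred (ℕ.≰⇒> (λ k≤ → ℕ.<⇒≱ q<2^k (ℕ.≤-trans (ℕ.^-monoʳ-≤ 2 k≤) 2^k₀≤q)))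
    k-large : # 10192392 * # 256 ℚ.≤ ι k * δ₀
    k-large = subst₂ ℚ._≤_ (trans (ℚ.*-assoc (# 10192392 * # 256) (recip δ₀) δ₀) (trans (cong (# 10192392 * # 256 *_) (recip-inv 0<δ₀)) (ℚ.*-identityʳ (# 10192392 * # 256)))) refl
      (subst₂ ℚ._≤_ (ℚ.*-comm δ₀ (# 10192392 * # 256 * recip δ₀)) (ℚ.*-comm δ₀ (ι k)) (ℚ.<⇒≤ 0<δ₀ ⊛ ℚ.≤-trans (proj₂ arch) (ι-mono (ℕ.≤-trans (ℕ.n≤1+n k₀) (ℕ.≤-trans k₀≤k′ (ℕ.n≤1+n k′))))))
    open Main X β 1≤q isZero β<1 (proj₁ quadratic) (proj₂ quadratic) em δ x₀ whle (opposite X 1≤q isPrimitive unique) δ₀ 0<δ₀ (proj₂ (proj₂ (proj₂ (0<δ₁ ⊓1)))) δ≥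
      k (s≤s z≤n) q<2^k (ℕ.≤-trans (ℕ.m≤n+m _ _) q₀≤q) k-large using (zero-free)
    final : ∀ i → δ₀ ℚ.≤ # 156800 * (ι k * ι k) * (1ℚ - seq β i) → ι k′ ℚ.≤ ι 4 * Lg i (ι (2 ℕ.^ k′)) → 1 ℕ.≤ i →
      (constᴿ γ *ᴿ fromℕ (φ q) /ᴿ (fromℕ q *ᴿ log (fromℕ q) ^ᴿ 2)) i ℚ.≤ (fromℕ 1 -ᴿ seq β) i + ε
    final i h l≥ 1≤i = ℚ.≤-trans (ℚ.≤-reflexive value) (ℚ.≤-trans quotient (lem₁ (1ℚ - seq β i) ε 0<ε))
      where
      η = 1ℚ - seq β i
      l = Lg i (ι q)
      lem₁ : ∀ a e → 0ℚ < e → a ℚ.≤ a + e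
      lem₁ a e p = ≤-by (ℚ.<⇒≤ p) (solve (a ∷ e ∷ []) ring)
      1<ιq : 1ℚ < ι q
      1<ιq = subst (_< ι q) ι1 (ι-mono-< 1<q)
      0<l : 0ℚ < l
      0<l = Lg-pos 1<ιq i 1≤i
      y = ι q * (l * (l * 1ℚ))
      0<y : 0ℚ < y
      0<y = *-pos (ι-pos 1≤q) (*-pos 0<l (*-pos 0<l 0<1))
      value : (constᴿ γ *ᴿ fromℕ (φ q) /ᴿ (fromℕ q *ᴿ log (fromℕ q) ^ᴿ 2)) i ≡ γ * ι (φ q) * recip y
      value = trans (div-recip (constᴿ γ *ᴿ fromℕ (φ q)) (fromℕ q *ᴿ log (fromℕ q) ^ᴿ 2) i) (cong₂ (λ a b → γ * a * recip b) (fromℕ-ι (φ q) i) (cong₂ (λ a b → a * (b * (b * 1ℚ))) (fromℕ-ι q i) (log-Lg q i)))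
      k≤8l : ι k ℚ.≤ # 8 * l
      k≤8l = lem (ι k) (ι k′) l (Lg i (ι (2 ℕ.^ k′))) (ι-suc k′) (1≤ι (ℕ.≤-trans (s≤s z≤n) k₀≤k′)) (subst (λ t → ι k′ ℚ.≤ t * Lg i (ι (2 ℕ.^ k′))) (ι-# 4) l≥) (Lg-mono (1≤ι (1≤2^ k′)) (ι-mono (proj₁ (proj₂ digits))) i)
        where
        lem : ∀ a b l l′ → a ≡ 1ℚ + b → 1ℚ ℚ.≤ b → b ℚ.≤ # 4 * l′ → l′ ℚ.≤ l → a ℚ.≤ # 8 * l
        lem _ b l l′ refl p q r = ≤-by (p ⊕ q ⊕ q ⊕ (#-nonNeg 8 ⊛ r)) (solve (b ∷ l ∷ l′ ∷ []) ring)
      0≤η : 0ℚ ℚ.≤ η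
      0≤η = *-cancelˡ-≤ {# 156800 * (ι k * ι k)} (*-pos (ℚ.positive⁻¹ (# 156800)) (*-pos (ι-pos {k} (s≤s z≤n)) (ι-pos {k} (s≤s z≤n)))) (ℚ.≤-trans (ℚ.≤-reflexive (ℚ.*-zeroʳ (# 156800 * (ι k * ι k)))) (ℚ.≤-trans (ℚ.<⇒≤ 0<δ₀) h))
      γ≤ : γ ℚ.≤ η * (l * l)
      γ≤ = *-cancelˡ-≤ 0<C₀ (subst₂ ℚ._≤_ (sym (trans (lem₂ (ι C₀) δ₀ (recip (ι C₀))) (trans (cong (_* δ₀) (recip-inv 0<C₀)) (ℚ.*-identityˡ δ₀)))) (cong (_* (η * (l * l))) (sym (ι-# C₀)))
          (lem δ₀ (ι k) η l (ι-nonNeg k) (ℚ.<⇒≤ 0<l) 0≤η h k≤8l))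
        where
        lem₂ : ∀ C d r → C * (d * r) ≡ r * C * d
        lem₂ = solve-∀ ring
        lem : ∀ d κ η l → 0ℚ ℚ.≤ κ → 0ℚ ℚ.≤ l → 0ℚ ℚ.≤ η → d ℚ.≤ # 156800 * (κ * κ) * η → κ ℚ.≤ # 8 * l → d ℚ.≤ # 10035200 * (η * (l * l))
        lem d κ η l p q r s t = ≤-by (s ⊕ (*-nonNeg (#-nonNeg 156800) r ⊛ *-mono-≤ p p t t)) (solve (d ∷ κ ∷ η ∷ l ∷ []) ring)
      quotient : γ * ι (φ q) * recip y ℚ.≤ η
      quotient = *-cancelˡ-≤ 0<y (subst (ℚ._≤ y * η) (sym (trans (lem₂ y (γ * ι (φ q)) (recip y)) (trans (cong (_* (γ * ι (φ q))) (recip-inv 0<y)) (ℚ.*-identityˡ _))))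
          (ℚ.≤-trans (ℚ.<⇒≤ 0<γ ⊛ ι-mono (φ≤ q)) (ℚ.≤-trans (ℚ.≤-reflexive (ℚ.*-comm γ (ι q))) (ℚ.≤-trans (ι-nonNeg q ⊛ γ≤) (ℚ.≤-reflexive (lem₃ (ι q) η l))))))
        where
        lem₂ : ∀ y g r → y * (g * r) ≡ r * y * g
        lem₂ = solve-∀ ring
        lem₃ : ∀ q η l → q * (η * (l * l)) ≡ q * (l * (l * 1ℚ)) * η
        lem₃ = solve-∀ ring
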